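{- There is an algorithm which, given any trim $\epsilon$-cycle free finite automaton $A$ that is polynomially ambiguous, computes the degree of polynomial ambiguity $\mathrm{dpa}(A)$ in time $O(|A|_E^3)$.
   Context: A finite automaton is a tuple $A=(\Sigma,Q,E,I,F)$ with $\Sigma$ a finite alphabet, $Q$ a finite set of states, $I\subseteq Q$ initial states, $F\subseteq Q$ final states, and $E\subseteq Q\times(\Sigma\cup\{\epsilon\})\times Q$ a finite set of transitions, where $\epsilon$ is the empty string. $|A|_E$ is the number of transitions. A successful path is a path from an initial state to a final state; its label is the concatenation of the labels of its transitions (an element of $\Sigma^*$). $A$ is trim if every state lies on a successful path. $A$ is $\epsilon$-cycle free if it has no cycle (of positive length) all of whose transitions are labeled $\epsilon$. For $x\in\Sigma^*$, $\mathrm{da}(A,x)$ is the number of successful paths of $A$ labeled $x$. $A$ is polynomially ambiguous if there is a polynomial $h\in\mathbb{N}[X]$ with $\mathrm{da}(A,x)\le h(|x|)$ for all $x\in\Sigma^*$; the minimal degree of such a polynomial is the degree of polynomial ambiguity $\mathrm{dpa}(A)$. In particular $\mathrm{dpa}(A)=0$ iff $\sup_x \mathrm{da}(A,x)<\infty$. Running times are worst-case times in the usual RAM model. -}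

module Defs where

open import Data.Bool using (if_then_else_)
open import Data.Fin using (Fin; toℕ)
open import Data.Fin.Subset using (Subset; _∈_)
open import Data.List using (List; []; _∷_; _++_; map; concatMap; length; catMaybes; head; drop)
open import Data.List.Membership.Propositional using () renaming (_∈_ to _∈ₗ_)
open import Data.List.Relation.Unary.All using (All; all?)
open import Data.List.Relation.Unary.Unique.Propositional using (Unique)
open import Data.Maybe using (Maybe; just; nothing; maybe′)
open import Data.Nat using (ℕ; zero; suc; _+_; _*_; _∸_; _≤_; _<_; _≟_)
open import Data.Product using (Σ; ∃-syntax; ∃₂; _×_; _,_)
open import Data.Vec using (toList)
open import Function using (_∘_)
open import Function.Bundles using (_↔_)
open import Relation.Binary.Construct.Closure.ReflexiveTransitive using (Star; ε; _◅_)
open import Relation.Binary.PropositionalEquality using (_≡_)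
open import Relation.Nullary using (¬_; does)

-- The alphabet is Fin ∣Σ∣ and the state set Fin ∣Q∣; the transition label
-- `nothing` is the empty string.  The set E is a duplicate-free list.
record Automaton : Set where
  field
    ∣Σ∣ ∣Q∣ : ℕ

  Letter : Set
  Letter = Fin ∣Σ∣

  State : Set
  State = Fin ∣Q∣

  Label : Set
  Label = Maybe Letter

  Transition : Set
  Transition = State × Label × State

  field
    E        : List Transition
    E-unique : Unique E
    I F      : Subset ∣Q∣

∣_∣E : Automaton → ℕ
∣ A ∣E = length (Automaton.E A)

module _ (A : Automaton) where
  open Automaton A

  Step : State → State → Set
  Step p q = ∃[ l ] (p , l , q) ∈ₗ E

  Path : State → State → Set
  Path = Star Step

  labels : ∀ {p q} → Path p q → List Label
  labels ε             = []
  labels ((l , _) ◅ π) = l ∷ labels π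

  pathLabel : ∀ {p q} → Path p q → List Letter
  pathLabel π = catMaybes (labels π)

  states : ∀ {p q} → Path p q → List State
  states {p} ε       = p ∷ []
  states {p} (_ ◅ π) = p ∷ states π

  SuccessfulPath : Set
  SuccessfulPath = ∃₂ λ p q → p ∈ I × q ∈ F × Path p q

  SuccessfulPathLabelled : List Letter → Set
  SuccessfulPathLabelled x =
    Σ SuccessfulPath λ (_ , _ , _ , _ , π) → pathLabel π ≡ x

  Trim : Set
  Trim = ∀ s → Σ SuccessfulPath λ (_ , _ , _ , _ , π) → s ∈ₗ states π

  ε-CycleFree : Set
  ε-CycleFree =
    ¬ (∃₂ λ p (π : Path p p) → 0 < length (labels π) × All (_≡ nothing) (labels π))

  -- Da A x m says da(A,x) = m.  It is a relation because da(A,x) may be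
  -- infinite when A has ε-cycles.  Membership proofs in I, F and the
  -- duplicate-free E are unique, so SuccessfulPathLabelled x has exactly one
  -- element per successful path labelled x.
  Da : List Letter → ℕ → Set
  Da x m = SuccessfulPathLabelled x ↔ Fin m

-- Coefficients, constant term first; trailing zeros are allowed.
Polynomial : Set
Polynomial = List ℕ

eval : Polynomial → ℕ → ℕ
eval []      x = 0
eval (a ∷ h) x = a + x * eval h x

-- Trailing zeros are ignored, and the zero polynomial has degree 0.
degree : Polynomial → ℕ
degree []      = 0
degree (a ∷ h) = if does (all? (_≟ 0) h) then 0 else suc (degree h)

module _ (A : Automaton) where
  open Automaton A

  AmbiguityBoundedBy : Polynomial → Set
  AmbiguityBoundedBy h =
    ∀ (x : List Letter) → ∃[ m ] Da A x m × m ≤ eval h (length x)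

  PolynomiallyAmbiguous : Set
  PolynomiallyAmbiguous = ∃[ h ] AmbiguityBoundedBy h

  Dpa : ℕ → Set
  Dpa d = (∃[ h ] AmbiguityBoundedBy h × degree h ≡ d)
        × (∀ h → AmbiguityBoundedBy h → d ≤ degree h)

-- Random access machine with the Cook–Reckhow instruction set at unit cost,
-- over natural-number registers: no multiplication, truncated subtraction, and
-- a sequential read-only input that yields 0 once exhausted.

Register Address : Set
Register = ℕ
Address  = ℕ

data Instruction : Set where
  const : Register → ℕ → Instruction
  add   : Register → Register → Register → Instruction
  sub   : Register → Register → Register → Instruction
  load  : Register → Register → Instruction
  store : Register → Register → Instruction
  jump  : Register → Address → Instruction
  read  : Register → Instruction

Program : Set
Program = List Instruction

Memory : Set
Memory = ℕ → ℕ

_[_]≔_ : Memory → ℕ → ℕ → Memory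
(X [ i ]≔ v) j = if does (j ≟ i) then v else X j

record Config : Set where
  constructor ⟨_,_,_⟩
  field
    pc     : Address
    memory : Memory
    input  : List ℕ

exec : Instruction → Config → Config
exec (const i c) ⟨ pc , X , inp ⟩   = ⟨ suc pc , X [ i ]≔ c , inp ⟩
exec (add i j k) ⟨ pc , X , inp ⟩   = ⟨ suc pc , X [ i ]≔ (X j + X k) , inp ⟩
exec (sub i j k) ⟨ pc , X , inp ⟩   = ⟨ suc pc , X [ i ]≔ (X j ∸ X k) , inp ⟩
exec (load i j)  ⟨ pc , X , inp ⟩   = ⟨ suc pc , X [ i ]≔ X (X j) , inp ⟩
exec (store i j) ⟨ pc , X , inp ⟩   = ⟨ suc pc , X [ X i ]≔ X j , inp ⟩
exec (jump j m)  ⟨ pc , X , inp ⟩ with X j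
... | zero                          = ⟨ suc pc , X , inp ⟩
... | suc _                         = ⟨ m , X , inp ⟩
exec (read i) ⟨ pc , X , [] ⟩       = ⟨ suc pc , X [ i ]≔ 0 , [] ⟩
exec (read i) ⟨ pc , X , v ∷ inp ⟩  = ⟨ suc pc , X [ i ]≔ v , inp ⟩

fetch : Program → Address → Maybe Instruction
fetch P a = head (drop a P)

-- P ⊢ c ⇓[ t ] c′ : started in c, P executes exactly t instructions and
-- halts in c′, by leaving the program text.
data _⊢_⇓[_]_ (P : Program) : Config → ℕ → Config → Set where
  halt : ∀ {c} → fetch P (Config.pc c) ≡ nothing → P ⊢ c ⇓[ 0 ] c
  step : ∀ {c c′ t i} → fetch P (Config.pc c) ≡ just i →
         P ⊢ exec i c ⇓[ t ] c′ → P ⊢ c ⇓[ suc t ] c′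

-- On the given input, with memory initially zero, P halts after t steps with
-- the given output in X₀.
Computes : Program → (input : List ℕ) → (output time : ℕ) → Set
Computes P inp out t =
  ∃[ c ] P ⊢ ⟨ 0 , (λ _ → 0) , inp ⟩ ⇓[ t ] c × Config.memory c 0 ≡ out

-- The tuple (Σ,Q,E,I,F) in this order: |Σ|, |Q|, |E|, three numbers per
-- transition, and the characteristic vectors of I and F.
module _ (A : Automaton) where
  open Automaton A

  -- ε is 0 and the letter a is 1 + a.
  encodeLabel : Label → ℕ
  encodeLabel = maybe′ (suc ∘ toℕ) 0

  encodeTransition : Transition → List ℕ
  encodeTransition (p , l , q) = toℕ p ∷ encodeLabel l ∷ toℕ q ∷ []

  encodeSubset : ∀ {n} → Subset n → List ℕ
  encodeSubset S = map (λ b → if b then 1 else 0) (toList S)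

  encode : List ℕ
  encode = ∣Σ∣ ∷ ∣Q∣ ∷ ∣ A ∣E ∷ concatMap encodeTransition E
           ++ encodeSubset I ++ encodeSubset F

{-# OPTIONS --safe #-}
-- Call (p,q), p ≠ q, a flag if for some word v starting with a letter that p and
-- q both read at once there are v-paths p → p, p → q and q → q.  In a
-- polynomially ambiguous automaton two states of one strong component are joined
-- by at most one path per word, so q cannot reach p back.  Hence the level of a
-- state, the largest number of flags on a chain of paths and flags starting
-- there, is finite, and dpa(A) is the maximal level d:
-- * a chain of d flags yields n^d paths on words of length O(n), told apart by
--   the positions at which they leave the components of the p's;
-- * a path drops in level at most d times, and between two drops it changes its
--   component at boundedly many positions: if the sets of states reachable from
--   the start and coreachable from the end agreed at two of these positions, the
--   word between them would yield a flag within one level.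
-- Flags are found in the graph of triples of states, with moves reading the same
-- label in all three components and "reset" edges that read a letter and send
-- (p,q,q) to (p′,p′,q′): (p,q) is a flag iff this edge lies on a cycle.  The graph
-- has O(|E|³) edges, so its strong components are found within the time bound
-- (Kosaraju); levels are then longest paths, computed by relaxation in O(|E|)
-- rounds of O(|E|²) steps.  The program is written in a small language of arrays
-- and counted loops, compiled to the RAM with exact cost.
module Submission where

-- The time bound involves |E| alone, while a trim automaton may have arbitrarily many isolated
-- states that are both initial and final. Hence no loop runs over the states: they are numbered
-- through their occurrences as end points of transitions, in the range from 1 to 2|E|, and a triple
-- is a three-digit number in base N = 2|E| + 1. The machine cannot multiply, so N t and N² t are
-- tabulated by repeated addition.
--
-- A cycle through a reset edge may contain further reset edges. They do no harm: at a reset the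
-- second component stands where the third one does, so instead of jumping it can be taken to follow
-- the third from there on, and at the end of the cycle both stand at q.
--
-- Flags never lie on cycles of the automaton, so a walk of largest weight may be assumed to repeat
-- no state; that is why O(|E|) relaxation rounds suffice.
--
-- The counting arguments of the upper bound ask whether certain paths exist. Only finitely many
-- such questions occur in each of them, and the inequality to be proved is stable under double
-- negation, so the answers may be assumed without being computed.

-- Compilation of array programs with counted loops to the RAM

module LoopLanguage where

  open import Defs hiding (eval)
  open import Data.Bool using (Bool; true; T; _∧_; if_then_else_)
  open import Data.Bool.Properties using (T-∧)
  open import Data.List using (List; []; _∷_; _++_; length; drop; head; replicate)
  open import Data.List.Properties using (++-assoc; ++-identityʳ; length-++; drop-drop)
  open import Data.Maybe using (nothing)
  open import Data.Nat
  open import Data.Nat.DivMod using (m<n⇒m%n≡m; [m+kn]%n≡m%n; _%_)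
  open import Data.Nat.Properties
  open import Data.Product using (_×_; _,_; proj₁; proj₂)
  open import Function using (_∘_; id)
  open import Function.Bundles using (Equivalence)
  open import Relation.Binary.PropositionalEquality
  open import Relation.Nullary using (yes; no; does)
  open import Relation.Nullary.Decidable using (dec-true; dec-false)

  infix  40 _⟪_⟫
  infixl 30 _⊕_ _⊖_
  infix  20 _⟪_⟫≔_
  infixr 10 _∙_

  data Exp : Set where
    lit     : ℕ → Exp
    _⟪_⟫    : ℕ → Exp → Exp
    _⊕_ _⊖_ : Exp → Exp → Exp

  data Cmd : Set where
    _⟪_⟫≔_ : ℕ → Exp → Exp → Cmd
    input  : ℕ → Exp → Cmd
    _∙_    : Cmd → Cmd → Cmd
    loop   : Exp → Cmd → Cmd

  Store : Set
  Store = ℕ → ℕ → ℕ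

  record Env : Set where
    constructor _▹_
    field
      arrays : Store
      inputs : List ℕ
  open Env public

  _[_,_↦_] : Store → ℕ → ℕ → ℕ → Store
  (σ [ a , i ↦ v ]) b = if does (b ≟ a) then (σ b) [ i ]≔ v else σ b

  ≔-same : ∀ (X : Memory) i v → (X [ i ]≔ v) i ≡ v
  ≔-same X i v rewrite dec-true (i ≟ i) refl = refl

  ≔-other : ∀ (X : Memory) {i j} v → j ≢ i → (X [ i ]≔ v) j ≡ X j
  ≔-other X {i} {j} v j≢i rewrite dec-false (j ≟ i) j≢i = refl

  ⟦_⟧ : Exp → Store → ℕ
  ⟦ lit n ⟧ σ   = n
  ⟦ a ⟪ e ⟫ ⟧ σ = σ a (⟦ e ⟧ σ)
  ⟦ e ⊕ f ⟧ σ   = ⟦ e ⟧ σ + ⟦ f ⟧ σ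
  ⟦ e ⊖ f ⟧ σ   = ⟦ e ⟧ σ ∸ ⟦ f ⟧ σ

  first : List ℕ → ℕ
  first []      = 0
  first (v ∷ _) = v

  rest : List ℕ → List ℕ
  rest []        = []
  rest (_ ∷ inp) = inp

  iter : {A : Set} → ℕ → (A → A) → A → A
  iter zero    f s = s
  iter (suc n) f s = iter n f (f s)

  eval : Cmd → Env → Env
  eval (a ⟪ e ⟫≔ f) (σ ▹ inp) = (σ [ a , ⟦ e ⟧ σ ↦ ⟦ f ⟧ σ ]) ▹ inp
  eval (input a e) (σ ▹ inp)  = (σ [ a , ⟦ e ⟧ σ ↦ first inp ]) ▹ rest inp
  eval (c ∙ d)     s          = eval d (eval c s)
  eval (loop e c)  s          = iter (⟦ e ⟧ (arrays s)) (eval c) s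

  -- Column a < 63 of the memory, viewed as a matrix with 64 columns, holds the
  -- array a; column 63 holds the temporaries of the compiled code.
  opaque
    address : ℕ → ℕ → ℕ
    address a i = i * 64 + a

    address-injectiveˡ : ∀ {a b} i j → a < 64 → b < 64 → address a i ≡ address b j → a ≡ b
    address-injectiveˡ {a} {b} i j a<64 b<64 eq =
      trans (sym (column i a<64)) (trans (cong (_% 64) eq) (column j b<64))
      where
      column : ∀ {a} i → a < 64 → (i * 64 + a) % 64 ≡ a
      column {a} i a<64 = trans (cong (_% 64) (+-comm (i * 64) a)) (trans ([m+kn]%n≡m%n a i 64) (m<n⇒m%n≡m a<64))

    address-injectiveʳ : ∀ a {i j} → address a i ≡ address a j → i ≡ j
    address-injectiveʳ a {i} {j} eq = *-cancelʳ-≡ i j 64 (+-cancelʳ-≡ a _ _ eq)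

    address-origin : address 0 0 ≡ 0
    address-origin = refl

    address-sum : ∀ a i → i * 64 + a ≡ address a i
    address-sum a i = refl

  temp : ℕ → ℕ
  temp = address 63

  -- Six doublings multiply the index by 64, the number of columns, without a multiplication
  -- instruction.
  locate : ℕ → ℕ → Program
  locate d a =
    replicate 6 (add (temp d) (temp d) (temp d))
    ++ const (temp (suc d)) a ∷ add (temp d) (temp d) (temp (suc d)) ∷ []

  compileExp : ℕ → Exp → Program
  compileExp d (lit n)   = const (temp d) n ∷ []
  compileExp d (a ⟪ e ⟫) = compileExp d e ++ locate d a ++ load (temp d) (temp d) ∷ []
  compileExp d (e ⊕ f)   = compileExp d e ++ compileExp (suc d) f ++ add (temp d) (temp d) (temp (suc d)) ∷ []
  compileExp d (e ⊖ f)   = compileExp d e ++ compileExp (suc d) f ++ sub (temp d) (temp d) (temp (suc d)) ∷ []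

  -- `b` is the address of the code, needed because jumps are absolute, and `d` the first free
  -- temporary. A loop keeps the number of remaining rounds in `temp d`, so its body starts at
  -- `suc d`. Control enters at the test behind the body, by a jump on the constant 1, so that a
  -- loop with bound 0 runs no round.
  compile : Address → ℕ → Cmd → Program
  compile b d (a ⟪ e ⟫≔ f) =
    compileExp d e ++ locate d a ++ compileExp (suc d) f ++ store (temp d) (temp (suc d)) ∷ []
  compile b d (input a e) =
    compileExp d e ++ locate d a ++ read (temp (suc d)) ∷ store (temp d) (temp (suc d)) ∷ []
  compile b d (c ∙ c′) =
    let code = compile b d c in code ++ compile (b + length code) d c′
  compile b d (loop e c) =
    let bound = compileExp d e
        entry = b + length bound + 2
        body  = compile entry (suc d) c
    in bound
       ++ const (temp (suc d)) 1 ∷ jump (temp (suc d)) (entry + length body + 2)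
       ∷ body
       ++ const (temp (suc d)) 1 ∷ sub (temp d) (temp d) (temp (suc d))
       ∷ jump (temp d) entry ∷ []

  sizeExp : Exp → ℕ
  sizeExp (lit n)   = 1
  sizeExp (a ⟪ e ⟫) = sizeExp e + 9
  sizeExp (e ⊕ f)   = sizeExp e + (sizeExp f + 1)
  sizeExp (e ⊖ f)   = sizeExp e + (sizeExp f + 1)

  -- The 3 instructions of a round outside the body are the successful test and the two that
  -- decrement the counter; the final failing test is counted in `cost`.
  iterCost : {A : Set} → ℕ → (A → A) → (A → ℕ) → A → ℕ
  iterCost zero    f k s = 0
  iterCost (suc n) f k s = (k s + 3) + iterCost n f k (f s)

  cost : Cmd → Env → ℕ
  cost (a ⟪ e ⟫≔ f) s = sizeExp e + (8 + (sizeExp f + 1))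
  cost (input a e)  s = sizeExp e + 10
  cost (c ∙ d)      s = cost c s + cost d (eval c s)
  cost (loop e c)   s = sizeExp e + (2 + (iterCost (⟦ e ⟧ (arrays s)) (eval c) (cost c) s + 1))

  -- Array names must stay below the column of temporaries. The condition is Boolean so that a
  -- closed program satisfies it by evaluation.
  boundedExp : Exp → Bool
  boundedExp (lit n)   = true
  boundedExp (a ⟪ e ⟫) = (a <ᵇ 63) ∧ boundedExp e
  boundedExp (e ⊕ f)   = boundedExp e ∧ boundedExp f
  boundedExp (e ⊖ f)   = boundedExp e ∧ boundedExp f

  bounded : Cmd → Bool
  bounded (a ⟪ e ⟫≔ f) = (a <ᵇ 63) ∧ (boundedExp e ∧ boundedExp f)
  bounded (input a e)  = (a <ᵇ 63) ∧ boundedExp e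
  bounded (c ∙ d)      = bounded c ∧ bounded d
  bounded (loop e c)   = boundedExp e ∧ bounded c

  <63⇒<64 : ∀ {a} → a < 63 → a < 64
  <63⇒<64 a<63 = ≤-trans a<63 (n≤1+n 63)

  private
    63<64 : 63 < 64
    63<64 = ≤-refl

  address≢temp : ∀ {a} i d → a < 63 → address a i ≢ temp d
  address≢temp i d a<63 eq =
    <-irrefl (address-injectiveˡ i d (<63⇒<64 a<63) 63<64 eq) a<63

  temp-injective : ∀ {d e} → temp d ≡ temp e → d ≡ e
  temp-injective = address-injectiveʳ 63

  record Represents (X : Memory) (σ : Store) : Set where
    constructor represents
    field contents : ∀ a i → a < 63 → X (address a i) ≡ σ a i
  open Represents

  -- A frame condition for code that may overwrite the temporaries from `d` on: array columns and
  -- lower temporaries keep their contents.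
  record AgreeBelow (d : ℕ) (X Y : Memory) : Set where
    constructor agreeing
    field agree : ∀ y → (∀ e → d ≤ e → y ≢ temp e) → Y y ≡ X y
  open AgreeBelow

  represents-agree : ∀ {d X Y σ} → Represents X σ → AgreeBelow d X Y → Represents Y σ
  represents-agree rep X~Y = represents λ a i a<63 →
    trans (agree X~Y (address a i) λ e _ → address≢temp i e a<63) (contents rep a i a<63)

  agree-temp : ∀ {d X Y e} → AgreeBelow d X Y → e < d → Y (temp e) ≡ X (temp e)
  agree-temp {e = e} X~Y e<d =
    agree X~Y (temp e) λ e′ d≤e′ eq → <-irrefl (temp-injective eq) (<-≤-trans e<d d≤e′)

  agree-weaken : ∀ {d X Y} → AgreeBelow (suc d) X Y → AgreeBelow d X Y
  agree-weaken X~Y = agreeing λ y away → agree X~Y y λ e d<e → away e (<⇒≤ d<e)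

  agree-refl : ∀ {d X} → AgreeBelow d X X
  agree-refl = agreeing λ _ _ → refl

  agree-trans : ∀ {d X Y Z} → AgreeBelow d X Y → AgreeBelow d Y Z → AgreeBelow d X Z
  agree-trans X~Y Y~Z = agreeing λ y away → trans (agree Y~Z y away) (agree X~Y y away)

  agree-≔ : ∀ d X v → AgreeBelow d X (X [ temp d ]≔ v)
  agree-≔ d X v = agreeing λ y away → ≔-other X v (away d ≤-refl)

  T-split : ∀ {x y} → T (x ∧ y) → T x × T y
  T-split = Equivalence.to T-∧

  compileExp-length : ∀ d e → length (compileExp d e) ≡ sizeExp e
  compileExp-length d (lit n)   = refl
  compileExp-length d (a ⟪ e ⟫) =
    trans (length-++ (compileExp d e)) (cong (_+ 9) (compileExp-length d e))
  compileExp-length d (e ⊕ f) =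
    trans (length-++ (compileExp d e))
      (cong₂ _+_ (compileExp-length d e)
        (trans (length-++ (compileExp (suc d) f)) (cong (_+ 1) (compileExp-length (suc d) f))))
  compileExp-length d (e ⊖ f) =
    trans (length-++ (compileExp d e))
      (cong₂ _+_ (compileExp-length d e)
        (trans (length-++ (compileExp (suc d) f)) (cong (_+ 1) (compileExp-length (suc d) f))))

  module _ (P : Program) where

    -- Executions in continuation-passing style, so that they compose.
    record Steps (c : Config) (t : ℕ) (c′ : Config) : Set where
      constructor steps
      field run : ∀ {t′ c″} → P ⊢ c′ ⇓[ t′ ] c″ → P ⊢ c ⇓[ t + t′ ] c″
    open Steps public

    steps-refl : ∀ {c} → Steps c 0 c
    steps-refl = steps id

    steps-trans : ∀ {c c′ c″ t t′} → Steps c t c′ → Steps c′ t′ c″ → Steps c (t + t′) c″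
    steps-trans {c} {t = t} {t′} p q = steps λ {u} {e} r →
      subst (λ k → P ⊢ c ⇓[ k ] e) (sym (+-assoc t t′ u)) (run p (run q r))

    steps-cast : ∀ {c t t′ a a′ Y inp} → t ≡ t′ → a ≡ a′ →
      Steps c t ⟨ a , Y , inp ⟩ → Steps c t′ ⟨ a′ , Y , inp ⟩
    steps-cast refl refl p = p

    steps-from : ∀ {a a′ X inp t c} → a ≡ a′ → Steps ⟨ a , X , inp ⟩ t c → Steps ⟨ a′ , X , inp ⟩ t c
    steps-from refl p = p

    record At (a : Address) (is : Program) : Set where
      constructor at
      field
        {after} : Program
        located : drop a P ≡ is ++ after
    open At

    at-++ˡ : ∀ {a} is {js} → At a (is ++ js) → At a is
    at-++ˡ is {js} (at {ks} eq) = at (trans eq (++-assoc is js ks))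

    drop-length-++ : ∀ (is js : Program) → drop (length is) (is ++ js) ≡ js
    drop-length-++ []       js = refl
    drop-length-++ (_ ∷ is) js = drop-length-++ is js

    at-++ʳ : ∀ {a n} is {js} → length is ≡ n → At a (is ++ js) → At (a + n) js
    at-++ʳ {a} is {js} refl (at {ks} eq) = at (begin
      drop (a + length is) P            ≡⟨ drop-drop a (length is) P ⟨
      drop (length is) (drop a P)       ≡⟨ cong (drop (length is)) (trans eq (++-assoc is js ks)) ⟩
      drop (length is) (is ++ js ++ ks) ≡⟨ drop-length-++ is (js ++ ks) ⟩
      js ++ ks                          ∎)
      where open ≡-Reasoning

    at-next : ∀ {a i is} → At a (i ∷ is) → At (a + 1) is
    at-next {i = i} = at-++ʳ (i ∷ []) refl

    execute : ∀ {a i is X inp c} → At a (i ∷ is) → exec i ⟨ a , X , inp ⟩ ≡ c → Steps ⟨ a , X , inp ⟩ 1 c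
    execute p refl = steps (step (cong head (located p)))

    Block : Address → List ℕ → Memory → ℕ → Memory → Set
    Block a inp X t Y = Steps ⟨ a , X , inp ⟩ t ⟨ a + t , Y , inp ⟩

    single : ∀ {a i is X inp Y} → At a (i ∷ is) → exec i ⟨ a , X , inp ⟩ ≡ ⟨ suc a , Y , inp ⟩ → Block a inp X 1 Y
    single {a} p eq = steps-cast refl (+-comm 1 a) (execute p eq)

    block-trans : ∀ {a inp X Y Z s t} → Block a inp X s Y → Block (a + s) inp Y t Z → Block a inp X (s + t) Z
    block-trans {a} {s = s} {t} p q = steps-cast refl (+-assoc a s t) (steps-trans p q)

    record Effect (a : Address) (inp : List ℕ) (d : ℕ) (X : Memory) (t v : ℕ) : Set where
      constructor effect
      field
        memory′ : Memory
        block   : Block a inp X t memory′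
        value   : memory′ (temp d) ≡ v
        frame   : AgreeBelow d X memory′
    open Effect

    doubles-correct : ∀ {a X inp} d v n k → At a (replicate k (add (temp d) (temp d) (temp d))) →
      X (temp d) ≡ v * n → Effect a inp d X k (v * (2 ^ k * n))
    doubles-correct {a} {X} {inp} d v n zero p eq =
      effect X (steps-cast refl (sym (+-identityʳ a)) steps-refl)
        (trans eq (cong (v *_) (sym (*-identityˡ n)))) agree-refl
    doubles-correct {a} {X} {inp} d v n (suc k) p eq =
      effect (memory′ ih) (block-trans (single p refl) (block ih))
        (trans (value ih) (cong (v *_) (trans (sym (*-assoc (2 ^ k) 2 n)) (cong (_* n) (*-comm (2 ^ k) 2)))))
        (agree-trans (agree-≔ d X _) (frame ih))
      where
      ih : Effect (a + 1) inp d (X [ temp d ]≔ (X (temp d) + X (temp d))) k (v * (2 ^ k * (2 * n)))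
      ih = doubles-correct d v (2 * n) k (at-next p) (trans (≔-same X (temp d) _)
        (trans (cong₂ _+_ eq eq) (trans (sym (*-distribˡ-+ v n n)) (cong (λ k → v * (n + k)) (sym (+-identityʳ n))))))

    locate-correct : ∀ {a X inp} d b v → At a (locate d b) → X (temp d) ≡ v →
      Effect a inp d X 8 (address b v)
    locate-correct {a} {X} {inp} d b v p X≡v =
      effect (Y₁ [ temp d ]≔ (Y₁ (temp d) + Y₁ (temp (suc d))))
        (block-trans (block E) (block-trans (single p₆ refl) (single (at-next p₆) refl)))
        (trans (≔-same Y₁ (temp d) _)
           (trans (cong₂ _+_ (trans (≔-other Y b t≢t⁺) (value E)) (≔-same Y (temp (suc d)) b)) (address-sum b v)))
        (agree-trans (frame E) (agree-trans (agree-weaken (agree-≔ (suc d) Y b)) (agree-≔ d Y₁ _)))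
      where
      doubles : Program
      doubles = replicate 6 (add (temp d) (temp d) (temp d))
      E : Effect a inp d X 6 (v * 64)
      E = doubles-correct d v 1 6 (at-++ˡ doubles p) (trans X≡v (sym (*-identityʳ v)))
      p₆ : At (a + 6) (const (temp (suc d)) b ∷ add (temp d) (temp d) (temp (suc d)) ∷ [])
      p₆ = at-++ʳ doubles refl p
      Y Y₁ : Memory
      Y  = memory′ E
      Y₁ = Y [ temp (suc d) ]≔ b
      t≢t⁺ : temp d ≢ temp (suc d)
      t≢t⁺ eq = 1+n≢n (sym (temp-injective eq))

    ExpCorrect : ℕ → Exp → Set
    ExpCorrect d e = ∀ {a X inp σ} → At a (compileExp d e) → Represents X σ →
      Effect a inp d X (sizeExp e) (⟦ e ⟧ σ)

    binary-correct : ∀ d e f (op : Register → Register → Register → Instruction) (_⊛_ : ℕ → ℕ → ℕ) →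
      (∀ i j k a X inp → exec (op i j k) ⟨ a , X , inp ⟩ ≡ ⟨ suc a , X [ i ]≔ (X j ⊛ X k) , inp ⟩) →
      ExpCorrect d e → ExpCorrect (suc d) f → ∀ {a X inp σ} →
      At a (compileExp d e ++ compileExp (suc d) f ++ op (temp d) (temp d) (temp (suc d)) ∷ []) →
      Represents X σ → Effect a inp d X (sizeExp e + (sizeExp f + 1)) (⟦ e ⟧ σ ⊛ ⟦ f ⟧ σ)
    binary-correct d e f op _⊛_ op-exec e-correct f-correct {a} {X} {inp} {σ} p rep =
      effect (Y [ temp d ]≔ (Y (temp d) ⊛ Y (temp (suc d))))
        (block-trans (block E) (block-trans (block F) (single p₂ (op-exec _ _ _ _ _ _))))
        (trans (≔-same Y (temp d) _) (cong₂ _⊛_ (trans (agree-temp (frame F) ≤-refl) (value E)) (value F)))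
        (agree-trans (frame E) (agree-trans (agree-weaken (frame F)) (agree-≔ d Y _)))
      where
      E : Effect a inp d X (sizeExp e) (⟦ e ⟧ σ)
      E = e-correct (at-++ˡ (compileExp d e) p) rep
      p₁ = at-++ʳ (compileExp d e) (compileExp-length d e) p
      F : Effect (a + sizeExp e) inp (suc d) (memory′ E) (sizeExp f) (⟦ f ⟧ σ)
      F = f-correct (at-++ˡ (compileExp (suc d) f) p₁) (represents-agree rep (frame E))
      p₂ = at-++ʳ (compileExp (suc d) f) (compileExp-length (suc d) f) p₁
      Y : Memory
      Y = memory′ F

    compileExp-correct : ∀ d e → T (boundedExp e) → ExpCorrect d e

    element-correct : ∀ d b e → T (boundedExp e) → ∀ {a X inp σ is} →
      At a (compileExp d e ++ locate d b ++ is) → Represents X σ →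
      Effect a inp d X (sizeExp e + 8) (address b (⟦ e ⟧ σ)) × At (a + (sizeExp e + 8)) is
    element-correct d b e ok {a} {X} {inp} {σ} {is} p rep =
        effect (memory′ L) (block-trans (block E) (block L)) (value L) (agree-trans (frame E) (frame L))
      , subst (λ k → At k is) (+-assoc a (sizeExp e) 8) (at-++ʳ (locate d b) refl p₁)
      where
      E : Effect a inp d X (sizeExp e) (⟦ e ⟧ σ)
      E = compileExp-correct d e ok (at-++ˡ (compileExp d e) p) rep
      p₁ : At (a + sizeExp e) (locate d b ++ is)
      p₁ = at-++ʳ (compileExp d e) (compileExp-length d e) p
      L : Effect (a + sizeExp e) inp d (memory′ E) 8 (address b (⟦ e ⟧ σ))
      L = locate-correct d b _ (at-++ˡ (locate d b) p₁) (value E)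

    compileExp-correct d (lit n) ok {X = X} p rep =
      effect (X [ temp d ]≔ n) (single p refl) (≔-same X (temp d) n) (agree-≔ d X n)
    compileExp-correct d (b ⟪ e ⟫) ok {a} {X} {inp} {σ} p rep =
      effect (Y [ temp d ]≔ Y (Y (temp d)))
        (steps-cast (+-assoc (sizeExp e) 8 1) (cong (a +_) (+-assoc (sizeExp e) 8 1))
          (block-trans (block E) (single (proj₂ Ep) refl)))
        (trans (≔-same Y (temp d) _) (trans (cong Y (value E))
          (contents (represents-agree rep (frame E)) b _ (<ᵇ⇒< b 63 (proj₁ oks)))))
        (agree-trans (frame E) (agree-≔ d Y _))
      where
      oks = T-split {b <ᵇ 63} ok
      Ep : Effect a inp d X (sizeExp e + 8) (address b (⟦ e ⟧ σ)) × At (a + (sizeExp e + 8)) (load (temp d) (temp d) ∷ [])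
      Ep = element-correct d b e (proj₂ oks) p rep
      E = proj₁ Ep
      Y : Memory
      Y = memory′ E
    compileExp-correct d (e ⊕ f) ok =
      binary-correct d e f add _+_ (λ _ _ _ _ _ _ → refl)
        (compileExp-correct d e (proj₁ (T-split {boundedExp e} ok)))
        (compileExp-correct (suc d) f (proj₂ (T-split {boundedExp e} ok)))
    compileExp-correct d (e ⊖ f) ok =
      binary-correct d e f sub _∸_ (λ _ _ _ _ _ _ → refl)
        (compileExp-correct d e (proj₁ (T-split {boundedExp e} ok)))
        (compileExp-correct (suc d) f (proj₂ (T-split {boundedExp e} ok)))

    AgreeTemps : ℕ → Memory → Memory → Set
    AgreeTemps d X Y = ∀ e → e < d → Y (temp e) ≡ X (temp e)

    represents-≔ : ∀ {X σ a l i v v′} → a < 63 → l ≡ address a i → v ≡ v′ → Represents X σ →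
      Represents (X [ l ]≔ v) (σ [ a , i ↦ v′ ])
    represents-≔ {X} {σ} {a} {i = i} {v} a<63 refl refl rep = represents go
      where
      go : ∀ b j → b < 63 → (X [ address a i ]≔ v) (address b j) ≡ (σ [ a , i ↦ v ]) b j
      go b j b<63 with b ≟ a
      ... | no  b≢a  rewrite dec-false (b ≟ a) b≢a =
        trans (≔-other X v λ eq → b≢a (address-injectiveˡ j i (<63⇒<64 b<63) (<63⇒<64 a<63) eq)) (contents rep b j b<63)
      ... | yes refl rewrite dec-true (a ≟ a) refl with j ≟ i
      ...   | yes refl = trans (≔-same X (address a i) v) (sym (≔-same (σ a) i v))
      ...   | no  j≢i  = trans (≔-other X v (j≢i ∘ address-injectiveʳ a))
                           (trans (contents rep b j b<63) (sym (≔-other (σ a) v j≢i)))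

    agreeTemps-≔ : ∀ {d X Y a i l v} → a < 63 → l ≡ address a i → AgreeBelow d X Y → AgreeTemps d X (Y [ l ]≔ v)
    agreeTemps-≔ {Y = Y} {i = i} {v = v} a<63 refl X~Y e e<d =
      trans (≔-other Y v λ eq → address≢temp i e a<63 (sym eq)) (agree-temp X~Y e<d)

    record Outcome (d : ℕ) (a : Address) (X : Memory) (inp : List ℕ) (t : ℕ) (a′ : Address) (s : Env) : Set where
      constructor outcome
      field
        final   : Memory
        reached : Steps ⟨ a , X , inp ⟩ t ⟨ a′ , final , inputs s ⟩
        holds   : Represents final (arrays s)
        kept    : AgreeTemps d X final
    open Outcome

    CmdCorrect : ℕ → Address → Cmd → Set
    CmdCorrect d a c = ∀ {X} s → Represents X (arrays s) →
      Outcome d a X (inputs s) (cost c s) (a + length (compile a d c)) (eval c s)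

    jump-taken : ∀ {a j m Y inp n is} → At a (jump j m ∷ is) → Y j ≡ suc n →
      Steps ⟨ a , Y , inp ⟩ 1 ⟨ m , Y , inp ⟩
    jump-taken {a} {j} {m} {Y} {inp} p eq = execute p lemma
      where
      lemma : exec (jump j m) ⟨ a , Y , inp ⟩ ≡ ⟨ m , Y , inp ⟩
      lemma rewrite eq = refl

    jump-skipped : ∀ {a j m Y inp is} → At a (jump j m ∷ is) → Y j ≡ 0 →
      Steps ⟨ a , Y , inp ⟩ 1 ⟨ suc a , Y , inp ⟩
    jump-skipped {a} {j} {m} {Y} {inp} p eq = execute p lemma
      where
      lemma : exec (jump j m) ⟨ a , Y , inp ⟩ ≡ ⟨ suc a , Y , inp ⟩
      lemma rewrite eq = refl

    module Loop (d : ℕ) (c : Cmd) (entry exit : Address)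
        (body-correct : CmdCorrect (suc d) entry c)
        (exit≡ : entry + length (compile entry (suc d) c) ≡ exit)
        (p : At exit (const (temp (suc d)) 1 ∷ sub (temp d) (temp d) (temp (suc d)) ∷ jump (temp d) entry ∷ [])) where

      test : Address
      test = exit + 1 + 1

      scratch : Memory → Memory
      scratch Y = Y [ temp (suc d) ]≔ 1

      -- The induction is anchored at the test behind the body, the one address that every round
      -- passes; the counter in `temp d` is the number of rounds left.
      iterate : ∀ n s {Y} → Represents Y (arrays s) → Y (temp d) ≡ n →
        Outcome d test Y (inputs s) (iterCost n (eval c) (cost c) s + 1) (suc test) (iter n (eval c) s)
      iterate zero    s {Y} rep eq = outcome Y (jump-skipped (at-next (at-next p)) eq) rep λ _ _ → refl
      iterate (suc n) s {Y} rep eq =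
        outcome (final rest′)
          (steps-cast (timing (cost c s) (iterCost n (eval c) (cost c) (eval c s))) refl
            (steps-trans (jump-taken (at-next (at-next p)) eq) (steps-trans (steps-cast refl exit≡ (reached once))
              (steps-trans (block-trans (single p refl) (single (at-next p) refl))
                (steps-from (+-assoc exit 1 1) (reached rest′))))))
          (holds rest′)
          (λ i i<d → trans (kept rest′ i i<d) (trans (agree-temp Y₁~Y₂ i<d) (kept once i (m<n⇒m<1+n i<d))))
        where
        once : Outcome (suc d) entry Y (inputs s) (cost c s) (entry + length (compile entry (suc d) c)) (eval c s)
        once = body-correct s rep
        Y₁ Y₂ : Memory
        Y₁ = final once
        Y₂ = scratch Y₁ [ temp d ]≔ (scratch Y₁ (temp d) ∸ scratch Y₁ (temp (suc d)))
        Y₁~Y₂ : AgreeBelow d Y₁ Y₂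
        Y₁~Y₂ = agree-trans (agree-weaken (agree-≔ (suc d) Y₁ 1)) (agree-≔ d (scratch Y₁) _)
        counter : Y₂ (temp d) ≡ n
        counter = trans (≔-same (scratch Y₁) (temp d) _)
          (cong₂ _∸_ (trans (agree-temp (agree-≔ (suc d) Y₁ 1) ≤-refl) (trans (kept once d ≤-refl) eq))
                     (≔-same Y₁ (temp (suc d)) 1))
        rest′ : Outcome d test Y₂ (inputs (eval c s)) (iterCost n (eval c) (cost c) (eval c s) + 1) (suc test) (iter n (eval c) (eval c s))
        rest′ = iterate n (eval c s) (represents-agree (holds once) Y₁~Y₂) counter
        timing : ∀ a b → 1 + (a + (2 + (b + 1))) ≡ a + 3 + b + 1
        timing a b = trans (sym (+-suc a (2 + (b + 1)))) (trans (sym (+-assoc a 3 (b + 1))) (sym (+-assoc (a + 3) b 1)))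

    compile-correct : ∀ d a c → T (bounded c) → At a (compile a d c) → CmdCorrect d a c
    compile-correct d a (b ⟪ e ⟫≔ f) ok p {X} (σ ▹ inp) rep =
      outcome (Y [ Y (temp d) ]≔ Y (temp (suc d)))
        (steps-cast time (cong (a +_) (trans time (sym len)))
          (block-trans (block E) (block-trans (block F) (single p₂ refl))))
        (represents-≔ {σ = σ} b<63 loc (value F) (represents-agree (represents-agree rep (frame E)) (frame F)))
        (agreeTemps-≔ b<63 loc (agree-trans (frame E) (agree-weaken (frame F))))
      where
      ok₁ = proj₁ (T-split {b <ᵇ 63} ok)
      ok₂ = T-split {boundedExp e} (proj₂ (T-split {b <ᵇ 63} ok))
      b<63 = <ᵇ⇒< b 63 ok₁
      tail : Program
      tail = compileExp (suc d) f ++ store (temp d) (temp (suc d)) ∷ []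
      Ep : Effect a inp d X (sizeExp e + 8) (address b (⟦ e ⟧ σ)) × At (a + (sizeExp e + 8)) tail
      Ep = element-correct d b e (proj₁ ok₂) p rep
      E = proj₁ Ep
      F : Effect (a + (sizeExp e + 8)) inp (suc d) (memory′ E) (sizeExp f) (⟦ f ⟧ σ)
      F = compileExp-correct (suc d) f (proj₂ ok₂) (at-++ˡ (compileExp (suc d) f) (proj₂ Ep)) (represents-agree rep (frame E))
      p₂ = at-++ʳ (compileExp (suc d) f) (compileExp-length (suc d) f) (proj₂ Ep)
      Y : Memory
      Y = memory′ F
      loc : Y (temp d) ≡ address b (⟦ e ⟧ σ)
      loc = trans (agree-temp (frame F) ≤-refl) (value E)
      time : sizeExp e + 8 + (sizeExp f + 1) ≡ sizeExp e + (8 + (sizeExp f + 1))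
      time = +-assoc (sizeExp e) 8 (sizeExp f + 1)
      len : length (compile a d (b ⟪ e ⟫≔ f)) ≡ sizeExp e + (8 + (sizeExp f + 1))
      len = trans (length-++ (compileExp d e)) (cong₂ _+_ (compileExp-length d e)
              (cong (8 +_) (trans (length-++ (compileExp (suc d) f)) (cong (_+ 1) (compileExp-length (suc d) f)))))
    compile-correct d a (input b e) ok p {X} (σ ▹ inp) rep =
      outcome (Y [ Y (temp d) ]≔ Y (temp (suc d)))
        (steps-cast time (trans (+-assoc (a + (sizeExp e + 8)) 1 1) (trans (+-assoc a (sizeExp e + 8) 2) (cong (a +_) (trans time (sym len)))))
          (steps-trans (block E) (steps-trans (reads inp p₁) (single (at-next p₁) refl))))
        (represents-≔ {σ = σ} b<63 loc (≔-same (memory′ E) (temp (suc d)) (first inp))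
          (represents-agree (represents-agree rep (frame E)) E~Y))
        (agreeTemps-≔ b<63 loc (agree-trans (frame E) (agree-weaken E~Y)))
      where
      oks = T-split {b <ᵇ 63} ok
      b<63 = <ᵇ⇒< b 63 (proj₁ oks)
      Ep : Effect a inp d X (sizeExp e + 8) (address b (⟦ e ⟧ σ))
         × At (a + (sizeExp e + 8)) (read (temp (suc d)) ∷ store (temp d) (temp (suc d)) ∷ [])
      Ep = element-correct d b e (proj₂ oks) p rep
      E = proj₁ Ep
      p₁ = proj₂ Ep
      Y : Memory
      Y = memory′ E [ temp (suc d) ]≔ first inp
      E~Y : AgreeBelow (suc d) (memory′ E) Y
      E~Y = agree-≔ (suc d) (memory′ E) (first inp)
      loc : Y (temp d) ≡ address b (⟦ e ⟧ σ)
      loc = trans (agree-temp E~Y ≤-refl) (value E)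
      reads : ∀ {a i is X} inp → At a (read i ∷ is) →
        Steps ⟨ a , X , inp ⟩ 1 ⟨ a + 1 , X [ i ]≔ first inp , rest inp ⟩
      reads {a} []      p = steps-cast refl (+-comm 1 a) (execute p refl)
      reads {a} (_ ∷ _) p = steps-cast refl (+-comm 1 a) (execute p refl)
      time : sizeExp e + 8 + 2 ≡ sizeExp e + 10
      time = +-assoc (sizeExp e) 8 2
      len : length (compile a d (input b e)) ≡ sizeExp e + 10
      len = trans (length-++ (compileExp d e)) (cong (_+ 10) (compileExp-length d e))
    compile-correct d a (c ∙ c′) ok p {X} s rep =
      outcome (final O′)
        (steps-cast refl (trans (+-assoc a _ _) (cong (a +_) (sym (length-++ (compile a d c)))))
          (steps-trans (reached O) (reached O′)))
        (holds O′)
        (λ i i<d → trans (kept O′ i i<d) (kept O i i<d))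
      where
      oks = T-split {bounded c} ok
      O = compile-correct d a c (proj₁ oks) (at-++ˡ (compile a d c) p) s rep
      O′ = compile-correct d _ c′ (proj₂ oks) (at-++ʳ (compile a d c) refl p) (eval c s) (holds O)
    compile-correct d a (loop e c) ok p {X} s@(σ ▹ inp) rep =
      outcome (final O)
        (steps-cast refl end (steps-trans (block E) (steps-trans enter
          (steps-from (+-assoc exit 1 1) (reached O)))))
        (holds O)
        (λ i i<d → trans (kept O i i<d) (trans (agree-temp E~Y (m<n⇒m<1+n i<d)) (agree-temp (frame E) i<d)))
      where
      oks = T-split {boundedExp e} ok
      bound : Program
      bound = compileExp d e
      entry exit : Address
      entry = a + length bound + 2
      body : Program
      body = compile entry (suc d) c
      exit = entry + length body
      trailer : Program
      trailer = const (temp (suc d)) 1 ∷ sub (temp d) (temp d) (temp (suc d)) ∷ jump (temp d) entry ∷ []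
      E : Effect a inp d X (sizeExp e) (⟦ e ⟧ σ)
      E = compileExp-correct d e (proj₁ oks) (at-++ˡ bound p) rep
      p₀ : At (a + length bound) (const (temp (suc d)) 1 ∷ jump (temp (suc d)) (exit + 2) ∷ body ++ trailer)
      p₀ = at-++ʳ bound refl p
      p₁ : At entry (body ++ trailer)
      p₁ = subst (λ k → At k (body ++ trailer)) (+-assoc (a + length bound) 1 1) (at-next (at-next p₀))
      Y : Memory
      Y = memory′ E [ temp (suc d) ]≔ 1
      E~Y : AgreeBelow (suc d) (memory′ E) Y
      E~Y = agree-≔ (suc d) (memory′ E) 1
      open Loop d c entry exit (compile-correct (suc d) entry c (proj₂ oks) (at-++ˡ body p₁)) refl (at-++ʳ body refl p₁)
      enter : Steps ⟨ a + sizeExp e , memory′ E , inp ⟩ 2 ⟨ exit + 2 , Y , inp ⟩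
      enter = subst (λ k → Steps ⟨ a + k , memory′ E , inp ⟩ 2 ⟨ exit + 2 , Y , inp ⟩) (compileExp-length d e)
        (steps-trans (single p₀ refl) (jump-taken (at-next p₀) (≔-same (memory′ E) (temp (suc d)) 1)))
      O : Outcome d test Y inp (iterCost (⟦ e ⟧ σ) (eval c) (cost c) s + 1) (suc test) (eval (loop e c) s)
      O = iterate (⟦ e ⟧ σ) s (represents-agree (represents-agree rep (frame E)) E~Y)
            (trans (agree-temp E~Y ≤-refl) (value E))
      end : suc test ≡ a + length (compile a d (loop e c))
      end = begin
        1 + (exit + 1 + 1)                     ≡⟨ cong suc (+-assoc exit 1 1) ⟩
        1 + (exit + 2)                         ≡⟨ +-suc exit 2 ⟨
        entry + length body + 3                ≡⟨ +-assoc entry (length body) 3 ⟩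
        entry + (length body + 3)              ≡⟨ +-assoc (a + length bound) 2 (length body + 3) ⟩
        a + length bound + (2 + (length body + 3)) ≡⟨ +-assoc a (length bound) _ ⟩
        a + (length bound + (2 + (length body + 3)))
          ≡⟨ cong (λ k → a + (length bound + (2 + k))) (length-++ body) ⟨
        a + (length bound + _)                 ≡⟨ cong (a +_) (length-++ bound) ⟨
        a + length (compile a d (loop e c))    ∎
        where open ≡-Reasoning

  program : Cmd → Program
  program = compile 0 0

  initial : List ℕ → Env
  initial inp = (λ _ _ → 0) ▹ inp

  program-computes : ∀ c inp → T (bounded c) →
    Computes (program c) inp (arrays (eval c (initial inp)) 0 0) (cost c (initial inp))
  program-computes c inp ok =
      end
    , subst (λ t → program c ⊢ ⟨ 0 , (λ _ → 0) , inp ⟩ ⇓[ t ] end) (+-identityʳ (cost c (initial inp)))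
        (run (Outcome.reached O) (halt (beyond (program c))))
    , subst (λ k → Y k ≡ arrays (eval c (initial inp)) 0 0) address-origin
        (contents (Outcome.holds O) 0 0 (s≤s z≤n))
    where
    beyond : ∀ (is : Program) → fetch is (length is) ≡ nothing
    beyond []       = refl
    beyond (_ ∷ is) = beyond is
    O = compile-correct (program c) 0 0 c ok (at (sym (++-identityʳ (program c)))) (initial inp) (represents λ _ _ _ → refl)
    Y : Memory
    Y = Outcome.final O
    end : Config
    end = ⟨ length (program c) , Y , inputs (eval c (initial inp)) ⟩

-- Frame conditions and an invariant rule with costs

module LoopLogic where

  open import Defs using (Memory; _[_]≔_)
  open LoopLanguage
  open import Data.Bool using (Bool; true; false; T; not; _∧_)
  open import Data.List using (List; []; _∷_; length)
  open import Data.List.Membership.Propositional using (_∈_)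
  open import Data.List.Relation.Unary.Any using (here; there)
  open import Data.Nat
  open import Data.Nat.Properties
  open import Data.Product using (∃-syntax; _×_; _,_)
  open import Data.Sum using (inj₁; inj₂)
  open import Data.Unit using (⊤; tt)
  open import Relation.Binary.PropositionalEquality

  -- A syntactic test that an array is never assigned. On closed commands it evaluates, so that `tt`
  -- proves their frame conditions.
  keeps : Cmd → ℕ → Bool
  keeps (a ⟪ _ ⟫≔ _) b = not (b ≡ᵇ a)
  keeps (input a _)  b = not (b ≡ᵇ a)
  keeps (c ∙ d)      b = keeps c b ∧ keeps d b
  keeps (loop _ c)   b = keeps c b

  iter-frame : ∀ {A : Set} (P : Env → A) {f : Env → Env} → (∀ s → P (f s) ≡ P s) → ∀ n s → P (iter n f s) ≡ P s
  iter-frame P same zero    s = refl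
  iter-frame P same (suc n) s = trans (iter-frame P same n _) (same s)

  frame : ∀ c b → T (keeps c b) → ∀ s → arrays (eval c s) b ≡ arrays s b
  frame (a ⟪ _ ⟫≔ _) b ok (σ ▹ inp) with b ≡ᵇ a
  ... | false = refl
  frame (input a _) b ok (σ ▹ inp) with b ≡ᵇ a
  ... | false = refl
  frame (c ∙ d) b ok s =
    let ok₁ , ok₂ = T-split {keeps c b} ok in trans (frame d b ok₂ (eval c s)) (frame c b ok₁ s)
  frame (loop e c) b ok s = iter-frame (λ s → arrays s b) (frame c b ok) (⟦ e ⟧ (arrays s)) s

  silent : Cmd → Bool
  silent (_ ⟪ _ ⟫≔ _) = true
  silent (input _ _)  = false
  silent (c ∙ d)      = silent c ∧ silent d
  silent (loop _ c)   = silent c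

  frame-inputs : ∀ c → T (silent c) → ∀ s → inputs (eval c s) ≡ inputs s
  frame-inputs (a ⟪ _ ⟫≔ _) ok s = refl
  frame-inputs (c ∙ d) ok s =
    let ok₁ , ok₂ = T-split {silent c} ok in trans (frame-inputs d ok₂ (eval c s)) (frame-inputs c ok₁ s)
  frame-inputs (loop e c) ok s = iter-frame inputs (frame-inputs c ok) (⟦ e ⟧ (arrays s)) s

  loop-skip : ∀ e c s → ⟦ e ⟧ (arrays s) ≡ 0 → eval (loop e c) s ≡ s
  loop-skip e c s eq rewrite eq = refl

  loop-once : ∀ e c s → ⟦ e ⟧ (arrays s) ≡ 1 → eval (loop e c) s ≡ eval c s
  loop-once e c s eq rewrite eq = refl

  cost-skip : ∀ e c s → ⟦ e ⟧ (arrays s) ≡ 0 → cost (loop e c) s ≡ sizeExp e + 3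
  cost-skip e c s eq rewrite eq = refl

  cost-once : ∀ e c s → ⟦ e ⟧ (arrays s) ≡ 1 → cost (loop e c) s ≡ sizeExp e + (6 + cost c s)
  cost-once e c s eq rewrite eq = cong (sizeExp e +_) (cong (2 +_) (begin
    cost c s + 3 + 0 + 1 ≡⟨ cong (_+ 1) (+-identityʳ (cost c s + 3)) ⟩
    cost c s + 3 + 1     ≡⟨ +-assoc (cost c s) 3 1 ⟩
    cost c s + 4         ≡⟨ +-comm (cost c s) 4 ⟩
    4 + cost c s         ∎))
    where open ≡-Reasoning

  cost-∙ : ∀ c d s {m n} → cost c s ≤ m → cost d (eval c s) ≤ n → cost (c ∙ d) s ≤ m + n
  cost-∙ c d s = +-mono-≤

  -- An identity, stated as a lemma so that its two sides are never compared by
  -- running the programs symbolically.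
  eval-∙ : ∀ (P : Env → Set) c d s → P (eval d (eval c s)) → P (eval (c ∙ d) s)
  eval-∙ P c d s p = p

  module _ {A : Set} (f : A → A) (k : A → ℕ) (Inv : ℕ → A → Set) where

    iter-rule : ∀ n B i s → (∀ j s → j < n + i → Inv j s → Inv (suc j) (f s) × k s ≤ B) → Inv i s →
      Inv (n + i) (iter n f s) × iterCost n f k s ≤ n * (B + 3)
    iter-rule zero    B i s step inv = inv , z≤n
    iter-rule (suc n) B i s step inv =
      let inv₁ , cost₁ = step i s (s≤s (m≤n+m i n)) inv
          inv₂ , cost₂ = iter-rule n B (suc i) (f s)
                           (λ j s j<n → step j s (≤-trans j<n (≤-reflexive (+-suc n i)))) inv₁
      in subst (λ j → Inv j (iter n f (f s))) (+-suc n i) inv₂ , +-mono-≤ (+-monoˡ-≤ 3 cost₁) cost₂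

  -- Result and cost share one invariant, because the bound on a round may depend on what the
  -- invariant says about the state.
  loop-rule : ∀ e c (Inv : ℕ → Env → Set) n B s → ⟦ e ⟧ (arrays s) ≡ n →
    (∀ j s → j < n → Inv j s → Inv (suc j) (eval c s) × cost c s ≤ B) → Inv 0 s →
    Inv n (eval (loop e c) s) × cost (loop e c) s ≤ sizeExp e + (3 + n * (B + 3))
  loop-rule e c Inv n B s refl step inv =
    let inv′ , bound = iter-rule (eval c) (cost c) Inv n B 0 s
                         (λ j s j<n → step j s (≤-trans j<n (≤-reflexive (+-identityʳ n)))) inv
    in subst (λ j → Inv j (eval (loop e c) s)) (+-identityʳ n) inv′
     , +-monoʳ-≤ (sizeExp e) (≤-trans (+-monoʳ-≤ 2 (≤-trans (≤-reflexive (+-comm _ 1)) (s≤s bound))) ≤-refl)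

  -- The array f holds the list l, the last element at index 0.
  Holds : {A : Set} → (ℕ → A) → List A → Set
  Holds f []      = ⊤
  Holds f (x ∷ l) = f (length l) ≡ x × Holds f l

  holds-cong : ∀ {A : Set} {f g : ℕ → A} l → (∀ i → i < length l → g i ≡ f i) → Holds f l → Holds g l
  holds-cong []      eq h       = tt
  holds-cong (x ∷ l) eq (p , h) =
    trans (eq (length l) ≤-refl) p , holds-cong l (λ i i<l → eq i (m<n⇒m<1+n i<l)) h

  holds-index : ∀ {A : Set} {f : ℕ → A} l → Holds f l → ∀ i → i < length l → f i ∈ l
  holds-index (x ∷ l) (p , h) i i<l with m≤n⇒m<n∨m≡n (s≤s⁻¹ i<l)
  ... | inj₁ i<l′ = there (holds-index l h i i<l′)
  ... | inj₂ refl = here p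

  holds-find : ∀ {A : Set} {f : ℕ → A} l → Holds f l → ∀ {x} → x ∈ l → ∃[ i ] i < length l × f i ≡ x
  holds-find (x ∷ l) (p , h) (here refl) = length l , ≤-refl , p
  holds-find (x ∷ l) (p , h) (there x∈)  = let i , i<l , eq = holds-find l h x∈ in i , m<n⇒m<1+n i<l , eq

  ≔-below : ∀ (f : Memory) {n i} v → i < n → (f [ n ]≔ v) i ≡ f i
  ≔-below f v i<n = ≔-other f v (<⇒≢ i<n)

  ≔-at : ∀ (f : Memory) {n i} v → n ≡ i → (f [ n ]≔ v) i ≡ v
  ≔-at f {n} v refl = ≔-same f n v

  holds-push : ∀ {f : Memory} l {n x} → n ≡ length l → Holds f l → Holds (f [ n ]≔ x) (x ∷ l)
  holds-push {f} l {x = x} refl h = ≔-same f (length l) x , holds-cong l (λ i i<l → ≔-below f x i<l) h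

-- Depth-first search and Kosaraju's theorem

module DepthFirstSearch where

  open import Defs using (_[_]≔_)
  open LoopLanguage using (≔-same; ≔-other; iter)
  open import Data.Bool using (if_then_else_)
  open import Data.List using (List; []; _∷_; _++_; _∷ʳ_; length; map; _ʳ++_)
  open import Data.List.Membership.Propositional using (_∈_)
  open import Data.List.Membership.Propositional.Properties using (∈-++⁻; ∈-map⁻; ∈-map⁺)
  open import Data.List.Properties using (++-assoc; ++-identityʳ; ∷-injectiveˡ; ∷-injectiveʳ)
  open import Data.List.Relation.Unary.All as All using (All; []; _∷_)
  open import Data.List.Relation.Unary.AllPairs using (AllPairs; []; _∷_)
  open import Data.List.Relation.Unary.Any using (here; there)
  open import Data.Nat
  open import Data.Nat.Properties
  open import Data.Nat.Tactic.RingSolver using (solve-∀)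
  open import Data.Product using (∃-syntax; _×_; _,_; proj₂)
  open import Data.Sum using (_⊎_; inj₁; inj₂)
  open import Function using (_∘_)
  open import Relation.Binary.Construct.Closure.ReflexiveTransitive using (Star; ε; _◅_; _◅◅_; gmap; return)
  open import Relation.Binary.PropositionalEquality
  open import Relation.Nullary using (¬_; yes; no; does; contradiction)
  open import Relation.Nullary.Decidable using (dec-true; dec-false)

  data Item : Set where
    visit finish : ℕ → Item

  node : Item → ℕ
  node (visit v)  = v
  node (finish v) = v

  -- One search from each element of todo in turn.  A visited node v has
  -- vis v = 1 + the root of its search tree; ord lists the finished nodes, the
  -- last one first.
  record Search : Set where
    constructor search
    field
      work : List Item
      todo : List ℕ
      vis  : ℕ → ℕ
      cur  : ℕ
      ord  : List ℕ
  open Search public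

  -- The graph with the edges U i → V i for i < L.
  module Graph (U V : ℕ → ℕ) where

    successors : ℕ → ℕ → List ℕ
    successors zero    v = []
    successors (suc i) v = if does (U i ≟ v) then V i ∷ successors i v else successors i v

    -- The edges not yet charged. Those of a node are pushed only when it is first visited, so each
    -- edge pays for one push in the whole search.
    unscanned : ℕ → (ℕ → ℕ) → ℕ
    unscanned zero    vis = 0
    unscanned (suc i) vis = (if does (vis (U i) ≟ 0) then 1 else 0) + unscanned i vis

    Edge : ℕ → ℕ → ℕ → Set
    Edge L u w = ∃[ i ] i < L × U i ≡ u × V i ≡ w

    ∈-successors⁺ : ∀ L {u w} → Edge L u w → w ∈ successors L u
    ∈-successors⁺ (suc L) {u} (i , i<1+L , Ui≡u , Vi≡w) with m≤n⇒m<n∨m≡n (s≤s⁻¹ i<1+L)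
    ... | inj₂ refl rewrite dec-true (U i ≟ u) Ui≡u = here (sym Vi≡w)
    ... | inj₁ i<L with U L ≟ u
    ...   | yes p rewrite dec-true (U L ≟ u) p = there (∈-successors⁺ L (i , i<L , Ui≡u , Vi≡w))
    ...   | no ¬p rewrite dec-false (U L ≟ u) ¬p = ∈-successors⁺ L (i , i<L , Ui≡u , Vi≡w)

    ∈-successors⁻ : ∀ L {u w} → w ∈ successors L u → Edge L u w
    ∈-successors⁻ (suc L) {u} w∈ with U L ≟ u
    ∈-successors⁻ (suc L) {u} w∈ | no ¬p rewrite dec-false (U L ≟ u) ¬p =
      let i , i<L , rest = ∈-successors⁻ L w∈ in i , m<n⇒m<1+n i<L , rest
    ∈-successors⁻ (suc L) {u} w∈ | yes p rewrite dec-true (U L ≟ u) p with w∈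
    ... | here w≡   = L , ≤-refl , p , sym w≡
    ... | there w∈′ = let i , i<L , rest = ∈-successors⁻ L w∈′ in i , m<n⇒m<1+n i<L , rest

    unscanned-mark : ∀ L vis v c → vis v ≡ 0 →
      unscanned L vis ≡ length (successors L v) + unscanned L (vis [ v ]≔ suc c)
    unscanned-mark zero    vis v c eq = refl
    unscanned-mark (suc L) vis v c eq with U L ≟ v
    ... | yes refl rewrite dec-true (U L ≟ U L) refl | eq = cong suc (unscanned-mark L vis v c eq)
    ... | no  ¬p   rewrite dec-false (U L ≟ v) ¬p
      = trans (cong (new +_) (unscanned-mark L vis v c eq)) (x+[y+z]≡y+[x+z] new (length (successors L v)) _)
      where
      new = if does (vis (U L) ≟ 0) then 1 else 0
      x+[y+z]≡y+[x+z] : ∀ x y z → x + (y + z) ≡ y + (x + z)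
      x+[y+z]≡y+[x+z] x y z = trans (sym (+-assoc x y z)) (trans (cong (_+ z) (+-comm x y)) (+-assoc y x z))

    unscanned≤ : ∀ L vis → unscanned L vis ≤ L
    unscanned≤ zero    vis = z≤n
    unscanned≤ (suc L) vis with vis (U L) ≟ 0
    ... | yes p rewrite dec-true (vis (U L) ≟ 0) p = s≤s (unscanned≤ L vis)
    ... | no ¬p rewrite dec-false (vis (U L) ≟ 0) ¬p = m≤n⇒m≤1+n (unscanned≤ L vis)

    module DepthFirst (L : ℕ) where

      infix 4 _⟶_ _⟶*_
      _⟶_ _⟶*_ : ℕ → ℕ → Set
      _⟶_  = Edge L
      _⟶*_ = Star _⟶_

      -- Successors are pushed whether visited or not, so a node can be pending several times and
      -- all but its first `visit` are dropped. `finish v` stays below the successors of `v` and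
      -- makes `v` gray until it is popped.
      next : Search → Search
      next (search (finish v ∷ work) todo vis cur ord) = search work todo vis cur (v ∷ ord)
      next (search (visit v ∷ work) todo vis cur ord) with vis v
      ... | zero  = search (map visit (successors L v) ʳ++ finish v ∷ work) todo (vis [ v ]≔ suc cur) cur ord
      ... | suc _ = search work todo vis cur ord
      next (search [] (r ∷ todo) vis cur ord) = search (visit r ∷ []) todo vis r ord
      next (search [] [] vis cur ord)         = search [] [] vis cur ord

      weight : List Item → ℕ
      weight []             = 0
      weight (visit _ ∷ w)  = 2 + weight w
      weight (finish _ ∷ w) = 1 + weight w

      -- The weights make every step lower the potential: a root (3) becomes a visit (2), opening a
      -- node replaces a visit (2) by its finish (1), and the 2 for each pushed successor come out
      -- of its unscanned edge.
      potential : Search → ℕ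
      potential s = weight (work s) + (3 * length (todo s) + 2 * unscanned L (vis s))

      Finished : Search → Set
      Finished s = work s ≡ [] × todo s ≡ []

      weight-visits : ∀ vs w → weight (map visit vs ʳ++ w) ≡ 2 * length vs + weight w
      weight-visits []       w = refl
      weight-visits (v ∷ vs) w = begin
        weight (map visit vs ʳ++ visit v ∷ w)   ≡⟨ weight-visits vs (visit v ∷ w) ⟩
        2 * length vs + (2 + weight w)          ≡⟨ lemma (length vs) (weight w) ⟩
        2 * length (v ∷ vs) + weight w          ∎
        where
        open ≡-Reasoning
        lemma : ∀ a b → 2 * a + (2 + b) ≡ 2 * suc a + b
        lemma = solve-∀

      -- A finish step trades one unit of potential for one finished node. So
      -- `length (ord s) + potential s` never grows, which bounds the length of the final order
      -- without a proof that it has no repetitions.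
      next-potential : ∀ s → Finished s ⊎ length (ord (next s)) + potential (next s) ≡ length (ord s) + potential s
                                        × potential (next s) < potential s
                                     ⊎ ord (next s) ≡ ord s × potential (next s) < potential s
      next-potential (search (finish v ∷ work) todo vis cur ord) = inj₂ (inj₁ (sym (+-suc (length ord) _) , ≤-refl))
      next-potential (search (visit v ∷ work) todo vis cur ord) with vis v in eq
      ... | suc _ = inj₂ (inj₂ (refl , n≤1+n _))
      ... | zero  = inj₂ (inj₂ (refl , ≤-reflexive (cong suc (begin
        weight (map visit ws ʳ++ finish v ∷ work) + (t + 2 * u′)
          ≡⟨ cong (_+ (t + 2 * u′)) (weight-visits ws (finish v ∷ work)) ⟩
        2 * length ws + (1 + weight work) + (t + 2 * u′)
          ≡⟨ lemma (length ws) (weight work) t u′ ⟩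
        1 + (weight work + (t + 2 * (length ws + u′)))
          ≡⟨ cong (λ k → 1 + (weight work + (t + 2 * k))) (unscanned-mark L vis v cur eq) ⟨
        1 + (weight work + (t + 2 * unscanned L vis)) ∎))))
        where
        open ≡-Reasoning
        ws = successors L v
        t  = 3 * length todo
        u′ = unscanned L (vis [ v ]≔ suc cur)
        lemma : ∀ a b c d → 2 * a + (1 + b) + (c + 2 * d) ≡ 1 + (b + (c + 2 * (a + d)))
        lemma = solve-∀
      next-potential (search [] (r ∷ todo) vis cur ord) =
        inj₂ (inj₂ (refl , ≤-reflexive (lemma (length todo) (2 * unscanned L vis))))
        where
        lemma : ∀ a b → 3 + (3 * a + b) ≡ 3 * suc a + b
        lemma = solve-∀
      next-potential (search [] [] vis cur ord) = inj₁ (refl , refl)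

      Visited : Search → ℕ → Set
      Visited s v = vis s v ≢ 0

      Gray : List Item → ℕ → Set
      Gray w v = finish v ∈ w

      _via_⟶*_ : ℕ → List ℕ → ℕ → Set
      u via black ⟶* w = Star (λ x y → x ∈ black × x ⟶ y) u w

      -- What is above a pending finish g on the stack was put there while g was
      -- being searched.
      Above : Item → Item → Set
      Above y x = ∀ g → x ≡ finish g → g ⟶* node y

      -- A search tree collects the nodes for which its root comes first among the roots reaching
      -- them. In the second search of Kosaraju's method these trees are the strong components, so
      -- `vis` serves as component number.
      FirstRoot : List ℕ → ℕ → ℕ → Set
      FirstRoot done v r = ∃[ a ] ∃[ b ] done ≡ a ++ r ∷ b × r ⟶* v × (∀ {r′} → r′ ∈ a → ¬ r′ ⟶* v)

      -- `ordered` is the theorem on finishing times in a form that holds during the search: if `u`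
      -- finished before `v` and reaches `v`, then `u` is equivalent to a node that finishes no
      -- earlier than `v`, perhaps one still gray. `back` supplies the equivalence: a gray node
      -- reached from a finished one through finished nodes also reaches it back.
      record Invariant (done : List ℕ) (s : Search) : Set where
        field
          visited-split : ∀ {v} → Visited s v → v ∈ ord s ⊎ Gray (work s) v
          black-visited : ∀ {v} → v ∈ ord s → Visited s v
          gray-visited  : ∀ {v} → Gray (work s) v → Visited s v
          above         : AllPairs Above (work s)
          from-cur      : ∀ {y} → y ∈ work s → cur s ⟶* node y
          black-closed  : ∀ {u w} → u ∈ ord s → u ⟶ w → Visited s w
          gray-closed   : ∀ a g b → work s ≡ a ++ finish g ∷ b → ∀ {w} → g ⟶ w → Visited s w ⊎ visit w ∈ a
          back          : ∀ {u g} → u ∈ ord s → Gray (work s) g → u via ord s ⟶* g → g ⟶* u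
          ordered       : ∀ a v b → ord s ≡ a ++ v ∷ b → ∀ {u} → u ∈ b → u ⟶* v →
                          ∃[ u′ ] u ⟶* u′ × u′ ⟶* u × (u′ ∈ a ⊎ u′ ≡ v ⊎ Gray (work s) u′)
          roots-visited : ∀ {r} → r ∈ done → Visited s r ⊎ (visit r ∈ work s)
          tagged        : ∀ {v} → Visited s v → ∃[ r ] vis s v ≡ suc r × FirstRoot done v r
          current       : (done ≡ [] × work s ≡ []) ⊎
                          (∃[ earlier ] done ≡ earlier ∷ʳ cur s × (∀ {r v} → r ∈ earlier → r ⟶* v → Visited s v))
      open Invariant public

      module _ {done : List ℕ} where

        via⇒⟶* : ∀ {black u w} → u via black ⟶* w → u ⟶* w
        via⇒⟶* = gmap (λ x → x) proj₂

        via-visited : ∀ {s} → Invariant done s → ∀ {u w} → Visited s u → u via ord s ⟶* w → Visited s w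
        via-visited inv u-vis ε                      = u-vis
        via-visited inv u-vis ((u∈ord , u⟶x) ◅ path) = via-visited inv (black-closed inv u∈ord u⟶x) path

        via-first : ∀ {black v u g} → u via (v ∷ black) ⟶* g → u via black ⟶* g ⊎ u via black ⟶* v
        via-first ε = inj₁ ε
        via-first ((here refl , _) ◅ path) = inj₂ ε
        via-first ((there u∈ , e) ◅ path) with via-first path
        ... | inj₁ p = inj₁ ((u∈ , e) ◅ p)
        ... | inj₂ p = inj₂ ((u∈ , e) ◅ p)

        first-gray : ∀ {s} → Invariant done s → ∀ {u v} → u ∈ ord s → Gray (work s) v → u ⟶* v →
          ∃[ g ] Gray (work s) g × u via ord s ⟶* g
        first-gray inv u∈ v-gray ε = _ , v-gray , ε
        first-gray inv u∈ v-gray (e ◅ path) with visited-split inv (black-closed inv u∈ e)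
        ... | inj₂ gray = _ , gray , (u∈ , e) ◅ ε
        ... | inj₁ w∈   = let g , gray , p = first-gray inv w∈ v-gray path in g , gray , (u∈ , e) ◅ p

        finish-preserves : ∀ {v w todo vis cur ord} → Invariant done (search (finish v ∷ w) todo vis cur ord) →
          Invariant done (search w todo vis cur (v ∷ ord))
        finish-preserves {v} {w} {todo} {vis} {cur} {ord} inv = record
          { visited-split = λ x-vis → case-split (visited-split inv x-vis)
          ; black-visited = λ { (here refl) → gray-visited inv (here refl) ; (there x∈) → black-visited inv x∈ }
          ; gray-visited  = gray-visited inv ∘ there
          ; above         = above-tail (above inv)
          ; from-cur      = from-cur inv ∘ there
          ; black-closed  = λ { (here refl) e → gray-done (gray-closed inv [] v w refl e) ; (there u∈) e → black-closed inv u∈ e }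
          ; gray-closed   = λ a g b eq e → strip (gray-closed inv (finish v ∷ a) g b (cong (finish v ∷_) eq) e)
          ; back          = back′
          ; ordered       = ordered′
          ; roots-visited = λ r∈ → strip (roots-visited inv r∈)
          ; tagged        = tagged inv
          ; current       = drop-empty (current inv)
          }
          where
          case-split : ∀ {x} → x ∈ ord ⊎ Gray (finish v ∷ w) x → x ∈ v ∷ ord ⊎ Gray w x
          case-split (inj₁ x∈)          = inj₁ (there x∈)
          case-split (inj₂ (here refl)) = inj₁ (here refl)
          case-split (inj₂ (there g))   = inj₂ g
          above-tail : AllPairs Above (finish v ∷ w) → AllPairs Above w
          above-tail (_ ∷ p) = p
          gray-done : ∀ {x : ℕ} {A : Set} → A ⊎ visit x ∈ [] → A
          gray-done (inj₁ a) = a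
          strip : ∀ {x l} {A : Set} → A ⊎ visit x ∈ finish v ∷ l → A ⊎ visit x ∈ l
          strip (inj₁ a)         = inj₁ a
          strip (inj₂ (there p)) = inj₂ p
          drop-empty : ∀ {A B : Set} → A × finish v ∷ w ≡ [] ⊎ B → A × w ≡ [] ⊎ B
          drop-empty (inj₂ b) = inj₂ b
          reaches-v : ∀ {g} → Gray w g → g ⟶* v
          reaches-v gray with p ∷ _ ← above inv = All.lookup p gray _ refl
          back′ : ∀ {u g} → u ∈ v ∷ ord → Gray w g → u via (v ∷ ord) ⟶* g → g ⟶* u
          back′ (here refl) gray path = reaches-v gray
          -- If the path uses `v`, then `g` reaches `v`, which lies above it on the stack, and `v`,
          -- gray until now, reaches `u` by the old invariant.
          back′ (there u∈)  gray path with via-first path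
          ... | inj₁ p = back inv u∈ (there gray) p
          ... | inj₂ p = reaches-v gray ◅◅ back inv u∈ (here refl) p
          ordered′ : ∀ a x b → v ∷ ord ≡ a ++ x ∷ b → ∀ {u} → u ∈ b → u ⟶* x →
                     ∃[ u′ ] u ⟶* u′ × u′ ⟶* u × (u′ ∈ a ⊎ u′ ≡ x ⊎ Gray w u′)
          -- Here `v` is the node just finished. The first gray node on the path from `u` to it is
          -- reached through finished nodes only, so `back` makes it equivalent to `u`.
          ordered′ [] x b refl u∈ u⟶*v with first-gray inv u∈ (here refl) u⟶*v
          ... | g , here refl  , p = g , via⇒⟶* p , back inv u∈ (here refl) p , inj₂ (inj₁ refl)
          ... | g , there gray , p = g , via⇒⟶* p , back inv u∈ (there gray) p , inj₂ (inj₂ gray)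
          ordered′ (y ∷ a) x b refl u∈ u⟶*x with ordered inv a x b refl u∈ u⟶*x
          ... | u′ , p , q , inj₁ u′∈               = u′ , p , q , inj₁ (there u′∈)
          ... | u′ , p , q , inj₂ (inj₁ eq)         = u′ , p , q , inj₂ (inj₁ eq)
          ... | u′ , p , q , inj₂ (inj₂ (here refl)) = u′ , p , q , inj₁ (here refl)
          ... | u′ , p , q , inj₂ (inj₂ (there g))  = u′ , p , q , inj₂ (inj₂ g)

        skip-preserves : ∀ {v w todo vis cur ord} → vis v ≢ 0 → Invariant done (search (visit v ∷ w) todo vis cur ord) →
          Invariant done (search w todo vis cur ord)
        skip-preserves {v} {w} {todo} {vis} {cur} {ord} v-vis inv = record
          { visited-split = λ x-vis → case-split (visited-split inv x-vis)
          ; black-visited = black-visited inv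
          ; gray-visited  = gray-visited inv ∘ there
          ; above         = above-tail (above inv)
          ; from-cur      = from-cur inv ∘ there
          ; black-closed  = black-closed inv
          ; gray-closed   = λ a g b eq e → strip (gray-closed inv (visit v ∷ a) g b (cong (visit v ∷_) eq) e)
          ; back          = λ u∈ gray → back inv u∈ (there gray)
          ; ordered       = λ a x b eq u∈ p → let u′ , q , r , rest = ordered inv a x b eq u∈ p in u′ , q , r , last rest
          ; roots-visited = λ r∈ → strip (roots-visited inv r∈)
          ; tagged        = tagged inv
          ; current       = drop-empty (current inv)
          }
          where
          case-split : ∀ {x} → x ∈ ord ⊎ Gray (visit v ∷ w) x → x ∈ ord ⊎ Gray w x
          case-split (inj₁ x∈)        = inj₁ x∈
          case-split (inj₂ (there g)) = inj₂ g
          above-tail : AllPairs Above (visit v ∷ w) → AllPairs Above w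
          above-tail (_ ∷ p) = p
          strip : ∀ {x l} → vis x ≢ 0 ⊎ visit x ∈ visit v ∷ l → vis x ≢ 0 ⊎ visit x ∈ l
          strip (inj₁ a)           = inj₁ a
          strip (inj₂ (here refl)) = inj₁ v-vis
          strip (inj₂ (there p))   = inj₂ p
          drop-empty : ∀ {A B : Set} → A × visit v ∷ w ≡ [] ⊎ B → A × w ≡ [] ⊎ B
          drop-empty (inj₂ b) = inj₂ b
          last : ∀ {A B : Set} {x} → A ⊎ B ⊎ Gray (visit v ∷ w) x → A ⊎ B ⊎ Gray w x
          last (inj₁ a)                = inj₁ a
          last (inj₂ (inj₁ b))         = inj₂ (inj₁ b)
          last (inj₂ (inj₂ (there g))) = inj₂ (inj₂ g)

        ∈-ʳ++⁻ : ∀ {A : Set} {y : A} xs {ys} → y ∈ xs ʳ++ ys → y ∈ xs ⊎ y ∈ ys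
        ∈-ʳ++⁻ []       y∈ = inj₂ y∈
        ∈-ʳ++⁻ (x ∷ xs) y∈ with ∈-ʳ++⁻ xs y∈
        ... | inj₁ p         = inj₁ (there p)
        ... | inj₂ (here p)  = inj₁ (here p)
        ... | inj₂ (there p) = inj₂ p

        ∈-ʳ++⁺ʳ : ∀ {A : Set} {y : A} xs {ys} → y ∈ ys → y ∈ xs ʳ++ ys
        ∈-ʳ++⁺ʳ []       y∈ = y∈
        ∈-ʳ++⁺ʳ (x ∷ xs) y∈ = ∈-ʳ++⁺ʳ xs (there y∈)

        ∈-ʳ++⁺ˡ : ∀ {A : Set} {y : A} xs {ys} → y ∈ xs → y ∈ xs ʳ++ ys
        ∈-ʳ++⁺ˡ (x ∷ xs) (here refl) = ∈-ʳ++⁺ʳ xs (here refl)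
        ∈-ʳ++⁺ˡ (x ∷ xs) (there y∈)  = ∈-ʳ++⁺ˡ xs y∈

        visits-split : ∀ vs {ys a g b} → map visit vs ʳ++ ys ≡ a ++ finish g ∷ b →
          ∃[ a′ ] ys ≡ a′ ++ finish g ∷ b × a ≡ map visit vs ʳ++ a′
        visits-split []       {a = a} eq = a , eq , refl
        visits-split (v ∷ vs) eq with visits-split vs eq
        ... | x ∷ a′ , refl , a≡ = a′ , refl , a≡

        visits-above : ∀ vs {ys} → AllPairs Above ys → (∀ {x} → x ∈ vs → All (Above (visit x)) ys) →
          AllPairs Above (map visit vs ʳ++ ys)
        visits-above []       p q = p
        visits-above (v ∷ vs) p q =
          visits-above vs (q (here refl) ∷ p) (λ x∈ → (λ _ ()) ∷ q (there x∈))

        open-preserves : ∀ {v w todo vis cur ord} → vis v ≡ 0 → Invariant done (search (visit v ∷ w) todo vis cur ord) →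
          Invariant done (search (map visit (successors L v) ʳ++ finish v ∷ w) todo (vis [ v ]≔ suc cur) cur ord)
        open-preserves {v} {w} {todo} {vis} {cur} {ord} v-new inv = record
          { visited-split = visited-split′
          ; black-visited = visited⁺ ∘ black-visited inv
          ; gray-visited  = gray-visited′ ∘ gray⁻
          ; above         = visits-above ws above-finish
              (λ x∈ → (λ { g refl → ∈-successors⁻ L x∈ ◅ ε }) ∷ All.map (λ f g eq → f g eq ◅◅ ∈-successors⁻ L x∈ ◅ ε) above-w)
          ; from-cur      = from-cur′
          ; black-closed  = λ u∈ e → visited⁺ (black-closed inv u∈ e)
          ; gray-closed   = gray-closed′
          ; back          = back′
          ; ordered       = λ a x b eq u∈ p → let u′ , q , r , rest = ordered inv a x b eq u∈ p in u′ , q , r , last rest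
          ; roots-visited = λ r∈ → roots (roots-visited inv r∈)
          ; tagged        = tagged′
          ; current       = current′ (current inv)
          }
          where
          ws = successors L v
          vis′ = vis [ v ]≔ suc cur
          work′ = map visit ws ʳ++ finish v ∷ w
          visited-v : vis′ v ≢ 0
          visited-v eq = contradiction (trans (sym (≔-same vis v (suc cur))) eq) λ ()
          visited⁺ : ∀ {x} → vis x ≢ 0 → vis′ x ≢ 0
          visited⁺ {x} x-vis with x ≟ v
          ... | yes refl = visited-v
          ... | no  x≢v  = x-vis ∘ trans (sym (≔-other vis (suc cur) x≢v))
          visited⁻ : ∀ {x} → vis′ x ≢ 0 → x ≡ v ⊎ (x ≢ v × vis x ≢ 0)
          visited⁻ {x} x-vis with x ≟ v
          ... | yes refl = inj₁ refl
          ... | no  x≢v  = inj₂ (x≢v , x-vis ∘ trans (≔-other vis (suc cur) x≢v))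
          gray⁺ : ∀ {x} → Gray (visit v ∷ w) x → Gray work′ x
          gray⁺ (there gray) = ∈-ʳ++⁺ʳ (map visit ws) (there gray)
          gray⁻ : ∀ {x} → Gray work′ x → x ≡ v ⊎ Gray w x
          gray⁻ gray with ∈-ʳ++⁻ (map visit ws) gray
          ... | inj₁ p with () ← proj₂ (proj₂ (∈-map⁻ visit p))
          ... | inj₂ (here refl) = inj₁ refl
          ... | inj₂ (there p)   = inj₂ p
          gray-visited′ : ∀ {x} → x ≡ v ⊎ Gray w x → vis′ x ≢ 0
          gray-visited′ (inj₁ refl) = visited-v
          gray-visited′ (inj₂ gray) = visited⁺ (gray-visited inv (there gray))
          visited-split′ : ∀ {x} → vis′ x ≢ 0 → x ∈ ord ⊎ Gray work′ x
          visited-split′ x-vis with visited⁻ x-vis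
          ... | inj₁ refl = inj₂ (∈-ʳ++⁺ʳ (map visit ws) (here refl))
          ... | inj₂ (_ , x-vis′) with visited-split inv x-vis′
          ...   | inj₁ x∈   = inj₁ x∈
          ...   | inj₂ gray = inj₂ (gray⁺ gray)
          above-w : All (Above (visit v)) w
          above-w with p ∷ _ ← above inv = p
          above-finish : AllPairs Above (finish v ∷ w)
          above-finish with p ∷ q ← above inv = p ∷ q
          from-cur′ : ∀ {y} → y ∈ work′ → cur ⟶* node y
          from-cur′ y∈ with ∈-ʳ++⁻ (map visit ws) y∈
          ... | inj₂ (here refl) = from-cur inv (here refl)
          ... | inj₂ (there p)   = from-cur inv (there p)
          ... | inj₁ p with x , x∈ , refl ← ∈-map⁻ visit p = from-cur inv (here refl) ◅◅ ∈-successors⁻ L x∈ ◅ ε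
          gray-closed′ : ∀ a g b → work′ ≡ a ++ finish g ∷ b → ∀ {x} → g ⟶ x → vis′ x ≢ 0 ⊎ visit x ∈ a
          gray-closed′ a g b eq e with visits-split ws {a = a} eq
          ... | []      , refl , refl = inj₂ (∈-ʳ++⁺ˡ (map visit ws) (∈-map⁺ visit (∈-successors⁺ L e)))
          ... | _ ∷ a′ , refl , refl with gray-closed inv (visit v ∷ a′) g b refl e
          ...   | inj₁ x-vis        = inj₁ (visited⁺ x-vis)
          ...   | inj₂ (here refl)  = inj₁ visited-v
          ...   | inj₂ (there x∈)   = inj₂ (∈-ʳ++⁺ʳ (map visit ws) (there x∈))
          back′ : ∀ {u g} → u ∈ ord → Gray work′ g → u via ord ⟶* g → g ⟶* u
          back′ u∈ gray p with gray⁻ gray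
          -- Finished nodes lead only to visited ones, and `v` was unvisited until this step.
          ... | inj₁ refl  = contradiction v-new (via-visited inv (black-visited inv u∈) p)
          ... | inj₂ gray′ = back inv u∈ (there gray′) p
          last : ∀ {A B : Set} {x} → A ⊎ B ⊎ Gray (visit v ∷ w) x → A ⊎ B ⊎ Gray work′ x
          last (inj₁ a)        = inj₁ a
          last (inj₂ (inj₁ b)) = inj₂ (inj₁ b)
          last (inj₂ (inj₂ g)) = inj₂ (inj₂ (gray⁺ g))
          roots : ∀ {r} → vis r ≢ 0 ⊎ visit r ∈ visit v ∷ w → vis′ r ≢ 0 ⊎ visit r ∈ work′
          roots (inj₁ r-vis)        = inj₁ (visited⁺ r-vis)
          roots (inj₂ (here refl))  = inj₁ visited-v
          roots (inj₂ (there p))    = inj₂ (∈-ʳ++⁺ʳ (map visit ws) (there p))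
          tagged′ : ∀ {x} → vis′ x ≢ 0 → ∃[ r ] vis′ x ≡ suc r × FirstRoot done x r
          tagged′ x-vis with visited⁻ x-vis
          ... | inj₂ (x≢v , x-vis′) =
            let r , eq , first = tagged inv x-vis′ in r , trans (≔-other vis (suc cur) x≢v) eq , first
          -- Whatever an earlier root reaches is already visited. As `v` is not, the current root is
          -- the first one to reach it.
          ... | inj₁ refl with current inv
          ...   | inj₂ (earlier , refl , closed) =
            cur , ≔-same vis v (suc cur) , earlier , [] , refl , from-cur inv (here refl)
                , λ r∈ p → closed r∈ p v-new
          current′ : (done ≡ [] × visit v ∷ w ≡ []) ⊎
              (∃[ earlier ] done ≡ earlier ∷ʳ cur × (∀ {r x} → r ∈ earlier → r ⟶* x → vis x ≢ 0)) →
            (done ≡ [] × work′ ≡ []) ⊎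
              (∃[ earlier ] done ≡ earlier ∷ʳ cur × (∀ {r x} → r ∈ earlier → r ⟶* x → vis′ x ≢ 0))
          current′ (inj₂ (earlier , eq , closed)) = inj₂ (earlier , eq , λ r∈ p → visited⁺ (closed r∈ p))

        root-preserves : ∀ {r todo vis cur ord} → Invariant done (search [] (r ∷ todo) vis cur ord) →
          Invariant (done ∷ʳ r) (search (visit r ∷ []) todo vis r ord)
        root-preserves {r} {todo} {vis} {cur} {ord} inv = record
          { visited-split = λ x-vis → inj₁ (black x-vis)
          ; black-visited = black-visited inv
          ; gray-visited  = λ { (here ()) ; (there ()) }
          ; above         = [] ∷ []
          ; from-cur      = λ { (here refl) → ε }
          ; black-closed  = black-closed inv
          ; gray-closed   = λ { [] g b () ; (_ ∷ []) g b () ; (_ ∷ _ ∷ _) g b () }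
          ; back          = λ { _ (here ()) ; _ (there ()) }
          ; ordered       = λ a x b eq u∈ p → let u′ , q , q′ , rest = ordered inv a x b eq u∈ p in u′ , q , q′ , last rest
          ; roots-visited = roots
          ; tagged        = λ x-vis → let t , eq , a , b , split , p , q = tagged inv x-vis in
                              t , eq , a , b ∷ʳ r , trans (cong (_∷ʳ r) split) (++-assoc a (t ∷ b) (r ∷ [])) , p , q
          ; current       = inj₂ (done , refl , λ r∈ p → closed (done-visited r∈) p)
          }
          where
          black : ∀ {x} → vis x ≢ 0 → x ∈ ord
          black x-vis with visited-split inv x-vis
          ... | inj₁ x∈ = x∈
          last : ∀ {A B : Set} {x} → A ⊎ B ⊎ Gray [] x → A ⊎ B ⊎ Gray (visit r ∷ []) x
          last (inj₁ a)        = inj₁ a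
          last (inj₂ (inj₁ b)) = inj₂ (inj₁ b)
          done-visited : ∀ {x} → x ∈ done → vis x ≢ 0
          done-visited x∈ with roots-visited inv x∈
          ... | inj₁ x-vis = x-vis
          roots : ∀ {x} → x ∈ done ∷ʳ r → vis x ≢ 0 ⊎ visit x ∈ visit r ∷ []
          roots x∈ with ∈-++⁻ done x∈
          ... | inj₁ p           = inj₁ (done-visited p)
          ... | inj₂ (here refl) = inj₂ (here refl)
          closed : ∀ {x y} → vis x ≢ 0 → x ⟶* y → vis y ≢ 0
          closed x-vis ε       = x-vis
          closed x-vis (e ◅ p) = closed (black-closed inv (black x-vis) e) p

      start : List ℕ → Search
      start roots = search [] roots (λ _ → 0) 0 []

      start-invariant : ∀ roots → Invariant [] (start roots)
      start-invariant roots = record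
        { visited-split = λ v-vis → contradiction refl v-vis
        ; black-visited = λ ()
        ; gray-visited  = λ ()
        ; above         = []
        ; from-cur      = λ ()
        ; black-closed  = λ ()
        ; gray-closed   = λ { [] g b () ; (_ ∷ _) g b () }
        ; back          = λ ()
        ; ordered       = λ { [] v b () ; (_ ∷ _) v b () }
        ; roots-visited = λ ()
        ; tagged        = λ v-vis → contradiction refl v-vis
        ; current       = inj₁ (refl , refl)
        }

      Reachable : List ℕ → Search → Set
      Reachable roots s = ∃[ done ] roots ≡ done ++ todo s × Invariant done s

      next-reachable : ∀ {roots} s → Reachable roots s → Reachable roots (next s)
      next-reachable (search (finish v ∷ work) todo vis cur ord) (done , eq , inv) = done , eq , finish-preserves inv
      next-reachable (search (visit v ∷ work) todo vis cur ord) (done , eq , inv) with vis v in v-vis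
      ... | zero  = done , eq , open-preserves v-vis inv
      ... | suc _ = done , eq , skip-preserves (λ v-new → contradiction (trans (sym v-vis) v-new) λ ()) inv
      next-reachable (search [] (r ∷ todo) vis cur ord) (done , eq , inv) =
        done ∷ʳ r , trans eq (sym (++-assoc done (r ∷ []) todo)) , root-preserves inv
      next-reachable (search [] [] vis cur ord) reachable = reachable

      iter-reachable : ∀ {roots} n s → Reachable roots s → Reachable roots (iter n next s)
      iter-reachable zero    s reachable = reachable
      iter-reachable (suc n) s reachable = iter-reachable n (next s) (next-reachable s reachable)

      next-finished : ∀ s → Finished s → next s ≡ s
      next-finished (search .[] .[] vis cur ord) (refl , refl) = refl

      iter-finished : ∀ n s → potential s ≤ n → Finished (iter n next s)
      iter-finished zero    s p with next-potential s
      ... | inj₁ done            = done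
      ... | inj₂ (inj₁ (_ , lt)) = contradiction (≤-trans lt p) λ ()
      ... | inj₂ (inj₂ (_ , lt)) = contradiction (≤-trans lt p) λ ()
      iter-finished (suc n) s p with next-potential s
      ... | inj₁ done            = subst Finished (sym (iter-fixed n)) done
        where
        iter-fixed : ∀ n → iter (suc n) next s ≡ s
        iter-fixed zero    = next-finished s done
        iter-fixed (suc n) = trans (cong (λ s → iter (suc n) next s) (next-finished s done)) (iter-fixed n)
      ... | inj₂ (inj₁ (_ , lt)) = iter-finished n (next s) (s≤s⁻¹ (≤-trans lt p))
      ... | inj₂ (inj₂ (_ , lt)) = iter-finished n (next s) (s≤s⁻¹ (≤-trans lt p))

      next-ord : ∀ s → length (ord (next s)) + potential (next s) ≤ length (ord s) + potential s
      next-ord s with next-potential s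
      ... | inj₁ done             = ≤-reflexive (cong (λ s → length (ord s) + potential s) (next-finished s done))
      ... | inj₂ (inj₁ (eq , _))  = ≤-reflexive eq
      ... | inj₂ (inj₂ (eq , lt)) = +-mono-≤ (≤-reflexive (cong length eq)) (<⇒≤ lt)

      iter-ord : ∀ n s → length (ord (iter n next s)) ≤ length (ord s) + potential s
      iter-ord zero    s = m≤m+n _ _
      iter-ord (suc n) s = ≤-trans (iter-ord n (next s)) (next-ord s)

      record Complete (roots : List ℕ) (vis : ℕ → ℕ) (ord : List ℕ) : Set where
        field
          roots-done   : ∀ {r} → r ∈ roots → r ∈ ord
          visited-done : ∀ {v} → vis v ≢ 0 → v ∈ ord
          closed       : ∀ {u w} → u ∈ ord → u ⟶ w → w ∈ ord
          finish-order : ∀ a v b → ord ≡ a ++ v ∷ b → ∀ {u} → u ∈ ord → u ⟶* v →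
                         ∃[ u′ ] u ⟶* u′ × u′ ⟶* u × (u′ ∈ a ⊎ u′ ≡ v)
          tree-root    : ∀ {v} → v ∈ ord → ∃[ r ] vis v ≡ suc r × FirstRoot roots v r

      finished-complete : ∀ {roots} s → Finished s → Reachable roots s → Complete roots (vis s) (ord s)
      finished-complete {roots} (search .[] .[] vis cur ord) (refl , refl) (done , eq , inv) = record
        { roots-done   = λ r∈ → root-done (subst (_ ∈_) roots≡done r∈)
        ; visited-done = black
        ; closed       = λ u∈ e → black (black-closed inv u∈ e)
        ; finish-order = finish-order
        ; tree-root    = λ v∈ → let r , p , first = tagged inv (black-visited inv v∈)
                                in r , p , subst (λ l → FirstRoot l _ r) (sym roots≡done) first
        }
        where
        roots≡done : roots ≡ done
        roots≡done = trans eq (++-identityʳ done)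
        black : ∀ {x} → vis x ≢ 0 → x ∈ ord
        black x-vis with visited-split inv x-vis
        ... | inj₁ x∈ = x∈
        root-done : ∀ {r} → r ∈ done → r ∈ ord
        root-done r∈ with roots-visited inv r∈
        ... | inj₁ r-vis = black r-vis
        finish-order : ∀ a v b → ord ≡ a ++ v ∷ b → ∀ {u} → u ∈ ord → u ⟶* v →
                       ∃[ u′ ] u ⟶* u′ × u′ ⟶* u × (u′ ∈ a ⊎ u′ ≡ v)
        finish-order a v b refl u∈ p with ∈-++⁻ a u∈
        ... | inj₁ u∈a         = _ , ε , ε , inj₁ u∈a
        ... | inj₂ (here refl) = _ , ε , ε , inj₂ refl
        ... | inj₂ (there u∈b) with ordered inv a v b refl u∈b p
        ...   | u′ , q , r , inj₁ u′∈       = u′ , q , r , inj₁ u′∈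
        ...   | u′ , q , r , inj₂ (inj₁ eq) = u′ , q , r , inj₂ eq

  module Kosaraju (U V U′ V′ : ℕ → ℕ) (L : ℕ)
      (U′≡V : ∀ {i} → i < L → U′ i ≡ V i) (V′≡U : ∀ {i} → i < L → V′ i ≡ U i) where
    private
      module G = Graph U V
      module R = Graph U′ V′
      module F = G.DepthFirst L
      module B = R.DepthFirst L
    open F using (_⟶*_)

    reverse : ∀ {u v} → u B.⟶* v → v ⟶* u
    reverse ε                        = ε
    reverse ((i , i<L , p , q) ◅ es) =
      reverse es ◅◅ return (i , i<L , trans (sym (V′≡U i<L)) q , trans (sym (U′≡V i<L)) p)

    unreverse : ∀ {u v} → u ⟶* v → v B.⟶* u
    unreverse ε                        = ε
    unreverse ((i , i<L , p , q) ◅ es) =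
      unreverse es ◅◅ return (i , i<L , trans (U′≡V i<L) q , trans (V′≡U i<L) p)

    module _ {roots vis₁ ord₁ vis₂ ord₂}
        (first : F.Complete roots vis₁ ord₁) (second : B.Complete ord₁ vis₂ ord₂) where
      open F.Complete first using (finish-order)

      -- Among the nodes in finishing order, latest first, `r` is the first one that `u` reaches. By
      -- `finish-order` some node equivalent to `u` stands at or before `r`; since `u` reaches it,
      -- it can only be `r`.
      root-equivalent : ∀ {u} → u ∈ ord₁ → ∃[ r ] vis₂ u ≡ suc r × u ⟶* r × r ⟶* u
      root-equivalent u∈ with B.Complete.tree-root second (B.Complete.roots-done second u∈)
      ... | r , eq , a , b , split , r⟶*u , none with finish-order a r b split u∈ (reverse r⟶*u)
      ...   | u′ , p , q , inj₁ u′∈a  = contradiction (unreverse p) (none u′∈a)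
      ...   | u′ , p , q , inj₂ refl = r , eq , p , q

      same-tree⇒connected : ∀ {u v} → u ∈ ord₁ → v ∈ ord₁ → vis₂ u ≡ vis₂ v → v ⟶* u
      same-tree⇒connected u∈ v∈ eq with root-equivalent u∈ | root-equivalent v∈
      ... | r , eqᵤ , _ , r⟶*u | r′ , eqᵥ , v⟶*r′ , _
        with refl ← suc-injective (trans (sym eqᵤ) (trans eq eqᵥ)) = v⟶*r′ ◅◅ r⟶*u

      connected⇒same-tree : ∀ {u v} → u ∈ ord₁ → v ∈ ord₁ → u ⟶* v → v ⟶* u → vis₂ u ≡ vis₂ v
      connected⇒same-tree {u} {v} u∈ v∈ u⟶*v v⟶*u
        with B.Complete.tree-root second (B.Complete.roots-done second u∈)
           | B.Complete.tree-root second (B.Complete.roots-done second v∈)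
      ... | r , eqᵤ , first-u | r′ , eqᵥ , first-v =
        trans eqᵤ (trans (cong suc (unique first-u first-v)) (sym eqᵥ))
        where
        unique : ∀ {r r′ l} → B.FirstRoot l u r → B.FirstRoot l v r′ → r ≡ r′
        unique ([] , b , refl , p , none) ([] , b′ , eq , p′ , none′) = ∷-injectiveˡ eq
        unique ([] , b , refl , p , none) (x ∷ a′ , b′ , eq , p′ , none′) =
          contradiction (p ◅◅ unreverse v⟶*u) (none′ (here (∷-injectiveˡ eq)))
        unique (x ∷ a , b , refl , p , none) ([] , b′ , eq , p′ , none′) =
          contradiction (p′ ◅◅ unreverse u⟶*v) (none (here (sym (∷-injectiveˡ eq))))
        unique (x ∷ a , b , refl , p , none) (x′ ∷ a′ , b′ , eq , p′ , none′) =
          unique (a , b , refl , p , none ∘ there) (a′ , b′ , ∷-injectiveʳ eq , p′ , none′ ∘ there)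

-- Array implementation of the search

module SearchProgram where

  open import Defs using (_[_]≔_)
  open LoopLanguage
  open LoopLogic
  open DepthFirstSearch
  open import Data.List using (List; []; _∷_; length; map)
  open import Data.List.Membership.Propositional using (_∈_)
  open import Data.List.Properties using (length-map)
  open import Data.Nat
  open import Data.Nat.Properties
  open import Data.Nat.Tactic.RingSolver using (solve-∀)
  open import Data.Product using (_×_; _,_; proj₁; proj₂)
  open import Data.Sum using (_⊎_; inj₁; inj₂)
  open import Data.Unit using (⊤; tt)
  open import Relation.Binary.PropositionalEquality
  open import Relation.Nullary using (yes; no)
  open import Relation.Nullary.Decidable using (dec-true; dec-false)

  -- A scalar is an array of which only the entry 0 is used, and a conditional is a
  -- loop that runs 0 or 1 times.
  infix 20 _:=_
  val : ℕ → Exp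
  val a = a ⟪ lit 0 ⟫

  _:=_ : ℕ → Exp → Cmd
  a := e = a ⟪ lit 0 ⟫≔ e

  #out #i #j #k #m #count #slot #N #p #l #q #x #y #z #L #top #cur #len #edge #node #kind : ℕ
  #out = 0
  #i = 1
  #j = 2
  #k = 3
  #m = 4
  #count = 5
  #slot = 6
  #N = 7
  #p = 8
  #l = 9
  #q = 10
  #x = 11
  #y = 12
  #z = 13
  #L = 14
  #top = 15
  #cur = 16
  #len = 17
  #edge = 18
  #node = 19
  #kind = 20

  #SRC #LAB #DST #T #T₂ #T₃ #U #V #HEAD #NEXT #DEG #SV #SK #VIS #ORD #R : ℕ
  #SRC = 21
  #LAB = 22
  #DST = 23
  #T = 24
  #T₂ = 25
  #T₃ = 26
  #U = 27
  #V = 28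
  #HEAD = 29
  #NEXT = 30
  #DEG = 31
  #SV = 32
  #SK = 33
  #VIS = 34
  #ORD = 35
  #R = 36

  scalar : Env → ℕ → ℕ
  scalar s a = arrays s a 0

  -- Adjacency lists threaded through `#NEXT`. There is no end marker, 0 being a valid edge; the
  -- length of each list is kept in `#DEG`, the form that a counted loop can use.
  linkBody : Cmd
  linkBody =
      #NEXT ⟪ val #i ⟫≔ #HEAD ⟪ #U ⟪ val #i ⟫ ⟫
    ∙ #HEAD ⟪ #U ⟪ val #i ⟫ ⟫≔ val #i
    ∙ #DEG ⟪ #U ⟪ val #i ⟫ ⟫≔ #DEG ⟪ #U ⟪ val #i ⟫ ⟫ ⊕ lit 1
    ∙ #i := val #i ⊕ lit 1

  link : Cmd
  link = #i := lit 0 ∙ loop (val #L) linkBody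

  -- `#VIS` is cleared just at the nodes listed in `#ORD`. Before the second search these include
  -- all nodes that the first one visited.
  loadBody : Cmd
  loadBody =
      #SV ⟪ val #i ⟫≔ #ORD ⟪ val #i ⟫
    ∙ #SK ⟪ val #i ⟫≔ lit 2
    ∙ #VIS ⟪ #ORD ⟪ val #i ⟫ ⟫≔ lit 0
    ∙ #i := val #i ⊕ lit 1

  load-roots : Cmd
  load-roots = #i := lit 0 ∙ loop (val #len) loadBody ∙ #top := val #len ∙ #len := lit 0 ∙ #cur := lit 0

  pop : Cmd
  pop =
      #top := val #top ⊖ lit 1
    ∙ #node := #SV ⟪ val #top ⟫
    ∙ #kind := #SK ⟪ val #top ⟫

  pushBody : Cmd
  pushBody =
      #SV ⟪ val #top ⟫≔ #V ⟪ val #edge ⟫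
    ∙ #SK ⟪ val #top ⟫≔ lit 0
    ∙ #top := val #top ⊕ lit 1
    ∙ #edge := #NEXT ⟪ val #edge ⟫

  rootBranch finishBranch openBranch visitBranch : Cmd
  rootBranch = #cur := val #node ∙ #SK ⟪ val #top ⟫≔ lit 0 ∙ #top := val #top ⊕ lit 1
  finishBranch = #ORD ⟪ val #len ⟫≔ val #node ∙ #len := val #len ⊕ lit 1
  openBranch =
    (  #VIS ⟪ val #node ⟫≔ val #cur ⊕ lit 1
     ∙ #SK ⟪ val #top ⟫≔ lit 1
     ∙ #top := val #top ⊕ lit 1
     ∙ #edge := #HEAD ⟪ val #node ⟫)
    ∙ loop (#DEG ⟪ val #node ⟫) pushBody
  visitBranch = loop (lit 1 ⊖ #VIS ⟪ val #node ⟫) openBranch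

  isRoot isFinish isVisit nonempty : Exp
  isRoot   = val #kind ⊖ lit 1
  isFinish = lit 1 ⊖ ((val #kind ⊖ lit 1) ⊕ (lit 1 ⊖ val #kind))
  isVisit  = lit 1 ⊖ val #kind
  nonempty = lit 1 ⊖ (lit 1 ⊖ val #top)

  -- An item is stored as its node in SV and its kind in SK: 0 for visit, 1 for
  -- finish, 2 for a root that has not been started.
  stepBody iteration searchLoop : Cmd
  stepBody = pop ∙ loop isRoot rootBranch ∙ loop isFinish finishBranch ∙ loop isVisit visitBranch
  iteration = loop nonempty stepBody
  searchLoop = loop (val #top ⊕ val #top ⊕ val #top ⊕ val #L ⊕ val #L) iteration

  searchAll : Cmd
  searchAll = link ∙ load-roots ∙ searchLoop

  module Linking (u v : ℕ → ℕ) where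
    open Graph u v

    -- The bound on the edges keeps a list valid when a later edge gets its own entry in `#NEXT`.
    Linked : ℕ → (ℕ → ℕ) → ℕ → List ℕ → Set
    Linked n next e []      = ⊤
    Linked n next e (x ∷ l) = e < n × v e ≡ x × Linked n next (next e) l

    linked-extend : ∀ {n n′ next next′} e l → n ≤ n′ → (∀ j → j < n → next′ j ≡ next j) →
      Linked n next e l → Linked n′ next′ e l
    linked-extend e []      n≤n′ eq h = tt
    linked-extend {n} {n′} {next} {next′} e (x ∷ l) n≤n′ eq (e<n , p , h) =
      ≤-trans e<n n≤n′ , p , subst (λ j → Linked n′ next′ j l) (sym (eq e e<n)) (linked-extend (next e) l n≤n′ eq h)

    record LinkInv (i : ℕ) (s : Env) : Set where
      field
        index  : scalar s #i ≡ i
        U-same : arrays s #U ≡ u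
        degree : ∀ w → arrays s #DEG w ≡ length (successors i w)
        linked : ∀ w → Linked i (arrays s #NEXT) (arrays s #HEAD w) (successors i w)

    link-step : ∀ i s → LinkInv i s → LinkInv (suc i) (eval linkBody s)
    link-step i s inv = record
      { index  = trans (cong (_+ 1) index) (+-comm i 1)
      ; U-same = U-same
      ; degree = degree′
      ; linked = linked′
      }
      where
      open LinkInv inv
      σ = arrays s
      target : ℕ
      target = σ #U (scalar s #i)
      target≡ : target ≡ u i
      target≡ = trans (cong (σ #U) index) (cong (λ f → f i) U-same)
      degree′ : ∀ w → (σ #DEG [ target ]≔ (σ #DEG target + 1)) w ≡ length (successors (suc i) w)
      degree′ w with u i ≟ w
      ... | yes refl rewrite dec-true (u i ≟ u i) refl =
        trans (cong (λ t → (σ #DEG [ t ]≔ (σ #DEG t + 1)) w) target≡)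
          (trans (≔-same (σ #DEG) w _) (trans (+-comm _ 1) (cong suc (degree w))))
      ... | no ui≢w rewrite dec-false (u i ≟ w) ui≢w =
        trans (≔-other (σ #DEG) _ λ w≡ → ui≢w (sym (trans w≡ target≡))) (degree w)
      next′ head′ : ℕ → ℕ
      next′ = σ #NEXT [ scalar s #i ]≔ σ #HEAD target
      head′ = σ #HEAD [ target ]≔ scalar s #i
      older : ∀ j → j < i → next′ j ≡ σ #NEXT j
      older j j<i = ≔-other (σ #NEXT) _ λ j≡ → <-irrefl (trans j≡ index) j<i
      linked′ : ∀ w → Linked (suc i) next′ (head′ w) (successors (suc i) w)
      linked′ w with u i ≟ w
      ... | no ui≢w rewrite dec-false (u i ≟ w) ui≢w =
        subst (λ e → Linked (suc i) next′ e (successors i w))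
          (sym (≔-other (σ #HEAD) _ λ w≡ → ui≢w (sym (trans w≡ target≡))))
          (linked-extend _ _ (n≤1+n i) older (linked w))
      ... | yes refl rewrite dec-true (u i ≟ u i) refl =
        subst (λ e → Linked (suc i) next′ e (v i ∷ successors i w)) (sym head≡)
          (≤-refl , refl , subst (λ e → Linked (suc i) next′ e (successors i w)) (sym next≡)
                             (linked-extend _ _ (n≤1+n i) older (linked w)))
        where
        head≡ : head′ w ≡ i
        head≡ = trans (cong (λ t → (σ #HEAD [ t ]≔ scalar s #i) w) target≡) (trans (≔-same (σ #HEAD) w _) index)
        next≡ : next′ i ≡ σ #HEAD w
        next≡ = trans (cong (λ j → (σ #NEXT [ j ]≔ σ #HEAD target) i) index)
          (trans (≔-same (σ #NEXT) i _) (cong (σ #HEAD) target≡))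

    link-correct : ∀ s {n} → arrays s #U ≡ u → scalar s #L ≡ n → (∀ w → arrays s #DEG w ≡ 0) →
      LinkInv n (eval link s) × cost link s ≤ 24 + n * (cost linkBody s + 3)
    link-correct s U≡ L≡ deg≡0 =
      let inv , bound = loop-rule (val #L) linkBody LinkInv _ (cost linkBody s) (eval (#i := lit 0) s) L≡
                          (λ j s j<n inv → link-step j s inv , ≤-refl)
                          (record { index = refl ; U-same = U≡ ; degree = deg≡0 ; linked = λ _ → tt })
      in inv , +-monoʳ-≤ 11 bound

  module Loading (roots : List ℕ) where

    record LoadInv (vis₀ : ℕ → ℕ) (i : ℕ) (s : Env) : Set where
      field
        index  : scalar s #i ≡ i
        nodes  : ∀ j → j < i → arrays s #SV j ≡ arrays s #ORD j
        kinds  : ∀ j → j < i → arrays s #SK j ≡ 2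
        held   : Holds (arrays s #ORD) roots
        reset  : ∀ j → j < i → arrays s #VIS (arrays s #ORD j) ≡ 0
        others : ∀ w → arrays s #VIS w ≡ 0 ⊎ arrays s #VIS w ≡ vis₀ w

    load-step : ∀ vis₀ i s → LoadInv vis₀ i s → LoadInv vis₀ (suc i) (eval loadBody s)
    load-step vis₀ i s inv = record
      { index  = trans (cong (_+ 1) index) (+-comm i 1)
      ; nodes  = λ j j<1+i → extend (arrays s #SV) _ (arrays s #ORD) (cong (arrays s #ORD) index) nodes j j<1+i
      ; kinds  = λ j j<1+i → extend (arrays s #SK) _ (λ _ → 2) refl kinds j j<1+i
      ; held   = held
      ; reset  = reset′
      ; others = others′
      }
      where
      open LoadInv inv
      extend : ∀ (f : ℕ → ℕ) x (g : ℕ → ℕ) → x ≡ g i → (∀ j → j < i → f j ≡ g j) →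
        ∀ j → j < suc i → (f [ scalar s #i ]≔ x) j ≡ g j
      extend f x g x≡ old j j<1+i with m≤n⇒m<n∨m≡n (s≤s⁻¹ j<1+i)
      ... | inj₁ j<i  = trans (≔-other f x λ j≡ → <-irrefl (trans j≡ index) j<i) (old j j<i)
      ... | inj₂ refl = trans (cong (λ k → (f [ k ]≔ x) j) index) (trans (≔-same f j x) x≡)
      zeroed = arrays s #ORD (scalar s #i)
      cleared : ∀ w → arrays s #VIS w ≡ 0 → (arrays s #VIS [ zeroed ]≔ 0) w ≡ 0
      cleared w w≡0 with w ≟ zeroed
      ... | yes refl = ≔-same (arrays s #VIS) w 0
      ... | no  w≢   = trans (≔-other (arrays s #VIS) 0 w≢) w≡0
      reset′ : ∀ j → j < suc i → (arrays s #VIS [ zeroed ]≔ 0) (arrays s #ORD j) ≡ 0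
      reset′ j j<1+i with m≤n⇒m<n∨m≡n (s≤s⁻¹ j<1+i)
      ... | inj₁ j<i  = cleared _ (reset j j<i)
      ... | inj₂ refl = trans (cong (λ k → (arrays s #VIS [ arrays s #ORD k ]≔ 0) (arrays s #ORD j)) index)
                          (≔-same (arrays s #VIS) _ 0)
      others′ : ∀ w → (arrays s #VIS [ zeroed ]≔ 0) w ≡ 0 ⊎ (arrays s #VIS [ zeroed ]≔ 0) w ≡ vis₀ w
      others′ w with w ≟ zeroed | others w
      ... | yes refl | _         = inj₁ (≔-same (arrays s #VIS) w 0)
      ... | no  w≢   | inj₁ eq   = inj₁ (trans (≔-other (arrays s #VIS) 0 w≢) eq)
      ... | no  w≢   | inj₂ eq   = inj₂ (trans (≔-other (arrays s #VIS) 0 w≢) eq)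

  rootItems : List ℕ → List (ℕ × ℕ)
  rootItems = map (_, 2)

  record Loaded (roots : List ℕ) (s : Env) : Set where
    field
      top-roots : scalar s #top ≡ length roots
      stacked   : Holds (λ i → arrays s #SV i , arrays s #SK i) (rootItems roots)
      unvisited : ∀ w → arrays s #VIS w ≡ 0
      none-done : scalar s #len ≡ 0
      no-root   : scalar s #cur ≡ 0

  load-correct : ∀ roots s → Holds (arrays s #ORD) roots → scalar s #len ≡ length roots →
    (∀ w → arrays s #VIS w ≢ 0 → w ∈ roots) →
    Loaded roots (eval load-roots s) × cost load-roots s ≤ 100 + length roots * (cost loadBody s + 3)
  load-correct roots s held len≡ vis⊆ = loaded , bound
    where
    open Loading roots
    s₀ = eval (#i := lit 0) s
    s₁ = eval (loop (val #len) loadBody) s₀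
    result : LoadInv (arrays s #VIS) (length roots) s₁ × cost (loop (val #len) loadBody) s₀ ≤ 13 + length roots * (cost loadBody s + 3)
    result = loop-rule (val #len) loadBody (LoadInv (arrays s #VIS)) (length roots) (cost loadBody s) s₀ len≡
      (λ j s _ inv → load-step _ j s inv , ≤-refl)
      (record { index = refl ; nodes = λ _ () ; kinds = λ _ () ; held = held ; reset = λ _ () ; others = λ _ → inj₂ refl })
    open LoadInv (proj₁ result) renaming (held to held₁)
    stack : ∀ l → length l ≤ length roots → Holds (arrays s₁ #ORD) l → Holds (λ i → arrays s₁ #SV i , arrays s₁ #SK i) (rootItems l)
    stack []      l≤ h       = tt
    stack (r ∷ l) l≤ (p , h) rewrite length-map (_, 2) l =
      cong₂ _,_ (trans (nodes (length l) l≤) p) (kinds (length l) l≤) , stack l (<⇒≤ l≤) h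
    zero-everywhere : ∀ w → arrays s₁ #VIS w ≡ 0
    zero-everywhere w with others w
    ... | inj₁ eq = eq
    ... | inj₂ eq with arrays s #VIS w ≟ 0
    ...   | yes w≡0 = trans eq w≡0
    ...   | no  w≢0 = let i , i<l , ord≡ = holds-find roots held₁ (vis⊆ w w≢0) in
                      trans (cong (arrays s₁ #VIS) (sym ord≡)) (reset i i<l)
    len₁ : arrays s₁ #len ≡ arrays s #len
    len₁ = frame (loop (val #len) loadBody) #len tt s₀
    loaded : Loaded roots (eval load-roots s)
    loaded = record
      { top-roots = trans (cong (λ f → f 0) len₁) len≡
      ; stacked   = stack roots ≤-refl held₁
      ; unvisited = zero-everywhere
      ; none-done = refl
      ; no-root   = refl
      }
    bound : cost load-roots s ≤ 100 + length roots * (cost loadBody s + 3)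
    bound = begin
      11 + (cost (loop (val #len) loadBody) s₀ + 42)              ≤⟨ +-monoʳ-≤ 11 (+-monoˡ-≤ 42 (proj₂ result)) ⟩
      11 + (13 + length roots * (cost loadBody s + 3) + 42)       ≡⟨ lemma (length roots * (cost loadBody s + 3)) ⟩
      66 + length roots * (cost loadBody s + 3)                   ≤⟨ +-monoˡ-≤ _ (≤ᵇ⇒≤ 66 100 tt) ⟩
      100 + length roots * (cost loadBody s + 3)                  ∎
      where
      open ≤-Reasoning
      lemma : ∀ x → 11 + (13 + x + 42) ≡ 66 + x
      lemma = solve-∀

-- Simulation of the abstract search, with amortised cost

module SearchSimulation where

  open import Defs using (_[_]≔_)
  open LoopLanguage
  open LoopLogic
  open DepthFirstSearch
  open SearchProgram
  open import Data.List using (List; []; _∷_; _++_; length; map; _ʳ++_)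
  open import Data.Nat
  open import Data.Nat.Properties
  open import Data.Nat.Tactic.RingSolver using (solve-∀)
  open import Data.Product using (_×_; _,_; proj₁; proj₂)
  import Data.Product.Properties as Product
  open import Data.Unit using (tt)
  open import Relation.Binary.PropositionalEquality
  open import Relation.Nullary using (¬_; yes; no; contradiction)

  encode-item : Item → ℕ × ℕ
  encode-item (visit v)  = v , 0
  encode-item (finish v) = v , 1

  items : Search → List (ℕ × ℕ)
  items S = map encode-item (work S) ++ rootItems (todo S)

  pushAll : List ℕ → List (ℕ × ℕ) → List (ℕ × ℕ)
  pushAll []       l = l
  pushAll (w ∷ ws) l = pushAll ws ((w , 0) ∷ l)

  pushAll-visits : ∀ ws w r → map encode-item (map visit ws ʳ++ w) ++ r ≡ pushAll ws (map encode-item w ++ r)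
  pushAll-visits []       w r = refl
  pushAll-visits (x ∷ ws) w r = pushAll-visits ws (visit x ∷ w) r

  stackOf : Env → ℕ → ℕ × ℕ
  stackOf s i = arrays s #SV i , arrays s #SK i

  record Stack (s : Env) (l : List (ℕ × ℕ)) : Set where
    constructor stack
    field
      size    : scalar s #top ≡ length l
      content : Holds (stackOf s) l
  open Stack

  stack-push : ∀ {s s′ x l} → Stack s l → scalar s′ #top ≡ suc (length l) →
    (∀ i → i < length l → stackOf s′ i ≡ stackOf s i) → stackOf s′ (length l) ≡ x → Stack s′ (x ∷ l)
  stack-push {l = l} (stack _ held) top≡ below eq = stack top≡ (eq , holds-cong l below held)

  module Simulation (u v : ℕ → ℕ) (L : ℕ) (next-edge head-edge : ℕ → ℕ) where
    open Graph u v
    open DepthFirst L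
    open Linking u v using (Linked)

    record Static (s : Env) : Set where
      field
        V-same    : arrays s #V ≡ v
        next-same : arrays s #NEXT ≡ next-edge
        head-same : arrays s #HEAD ≡ head-edge
        deg-same  : ∀ w → arrays s #DEG w ≡ length (successors L w)
    open Static

    static-frame : ∀ {s s′} → arrays s′ #V ≡ arrays s #V → arrays s′ #NEXT ≡ arrays s #NEXT →
      arrays s′ #HEAD ≡ arrays s #HEAD → arrays s′ #DEG ≡ arrays s #DEG → Static s → Static s′
    static-frame p q r t st = record
      { V-same = trans p (V-same st) ; next-same = trans q (next-same st) ; head-same = trans r (head-same st)
      ; deg-same = λ w → trans (cong (λ f → f w) t) (deg-same st w) }

    pushCost : ℕ
    pushCost = cost pushBody (initial []) + 3

    push-loop : ∀ ws {l} s → Static s → Stack s l → Linked L next-edge (scalar s #edge) ws →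
      Stack (iter (length ws) (eval pushBody) s) (pushAll ws l)
      × iterCost (length ws) (eval pushBody) (cost pushBody) s ≡ length ws * pushCost
    push-loop []       s st stk lk = stk , refl
    push-loop (w ∷ ws) {l} s st stk (e<L , ve≡w , lk) =
      let stk′ , cost≡ = push-loop ws (eval pushBody s) (static-frame {s} refl refl refl refl st) pushed
                           (subst (λ e → Linked L next-edge e ws) (cong (λ f → f (scalar s #edge)) (sym (next-same st))) lk)
      in stk′ , cong (pushCost +_) cost≡
      where
      pushed : Stack (eval pushBody s) ((w , 0) ∷ l)
      pushed = stack-push {s} stk (trans (cong (_+ 1) (size stk)) (+-comm _ 1))
        (λ i i<l → let i≢ = λ eq → <-irrefl (trans eq (size stk)) i<l in
                   cong₂ _,_ (≔-other (arrays s #SV) _ i≢) (≔-other (arrays s #SK) _ i≢))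
        (cong₂ _,_
          (trans (≔-at (arrays s #SV) _ (size stk)) (trans (cong (λ f → f (scalar s #edge)) (V-same st)) ve≡w))
          (≔-at (arrays s #SK) 0 (size stk)))

    record Sim (s : Env) (S : Search) : Set where
      field
        static  : Static s
        stacked : Stack s (items S)
        vis≡    : ∀ w → arrays s #VIS w ≡ vis S w
        cur≡    : scalar s #cur ≡ cur S
        len≡    : scalar s #len ≡ length (ord S)
        done    : Holds (arrays s #ORD) (ord S)
    open Sim

    module _ (linked : ∀ w → Linked L next-edge (head-edge w) (successors L w)) where

      -- A generous bound on the instructions of one step apart from the pushes, checked by
      -- evaluating the costs of the branches.
      stepCost : ℕ
      stepCost = 400

      -- The unscanned edges are the credit: each push is paid for by an edge whose source has just
      -- been visited for the first time.
      Simulates : Env → Search → Cmd → Set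
      Simulates s S c = Sim (eval c s) (next S)
        × cost c s + pushCost * unscanned L (vis (next S)) ≤ stepCost + pushCost * unscanned L (vis S)

      popped : ∀ s {x k l} → Stack s ((x , k) ∷ l) →
        Stack (eval pop s) l × scalar (eval pop s) #node ≡ x × scalar (eval pop s) #kind ≡ k
        × stackOf (eval pop s) (scalar (eval pop s) #top) ≡ (x , k)
      popped s {x} {k} {l} (stack size≡ (at-top , below)) =
          stack top≡ below , proj₁ split , proj₂ split , at′
        where
        top≡ : scalar s #top ∸ 1 ≡ length l
        top≡ = cong (_∸ 1) size≡
        at′ : stackOf s (scalar s #top ∸ 1) ≡ (x , k)
        at′ = trans (cong (stackOf s) top≡) at-top
        split : arrays s #SV (scalar s #top ∸ 1) ≡ x × arrays s #SK (scalar s #top ∸ 1) ≡ k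
        split = Product.,-injective at′

      pushes mark : Cmd
      pushes = loop (#DEG ⟪ val #node ⟫) pushBody
      mark =
          #VIS ⟪ val #node ⟫≔ val #cur ⊕ lit 1
        ∙ #SK ⟪ val #top ⟫≔ lit 1
        ∙ #top := val #top ⊕ lit 1
        ∙ #edge := #HEAD ⟪ val #node ⟫

      push-successors : ∀ s {x work todo vis cur ord} → scalar s #node ≡ x → scalar s #edge ≡ head-edge x →
        Sim s (search (finish x ∷ work) todo vis cur ord) →
        Sim (eval pushes s) (search (map visit (successors L x) ʳ++ finish x ∷ work) todo vis cur ord)
        × cost pushes s ≡ 22 + length (successors L x) * pushCost
      push-successors s {x} {work} {todo} {vis} {cur} {ord} node≡ edge≡ sim = record
        { static  = static-frame {s} (frame pushes #V tt s) (frame pushes #NEXT tt s) (frame pushes #HEAD tt s) (frame pushes #DEG tt s) (static sim)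
        ; stacked = subst (Stack (eval pushes s)) (sym (pushAll-visits ws (finish x ∷ work) (rootItems todo)))
                      (subst (λ n → Stack (iter n (eval pushBody) s) _) (sym deg≡) (proj₁ pushed))
        ; vis≡    = λ w → trans (cong (λ f → f w) (frame pushes #VIS tt s)) (vis≡ sim w)
        ; cur≡    = trans (cong (λ f → f 0) (frame pushes #cur tt s)) (cur≡ sim)
        ; len≡    = trans (cong (λ f → f 0) (frame pushes #len tt s)) (len≡ sim)
        ; done    = subst (λ f → Holds f ord) (sym (frame pushes #ORD tt s)) (done sim)
        } , cong (21 +_) (trans (+-comm _ 1) (cong suc
              (trans (cong (λ n → iterCost n (eval pushBody) (cost pushBody) s) deg≡) (proj₂ pushed))))
        where
        ws = successors L x
        deg≡ : arrays s #DEG (scalar s #node) ≡ length ws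
        deg≡ = trans (cong (arrays s #DEG) node≡) (deg-same (static sim) x)
        pushed : Stack (iter (length ws) (eval pushBody) s) (pushAll ws ((x , 1) ∷ map encode-item work ++ rootItems todo))
          × iterCost (length ws) (eval pushBody) (cost pushBody) s ≡ length ws * pushCost
        pushed = push-loop ws s (static sim) (stacked sim) (subst (λ e → Linked L next-edge e ws) (sym edge≡) (linked x))

      module _ (s : Env) where
        private
          s₁ = eval pop s

        step-root : ∀ {r todo vis cur ord} → Sim s (search [] (r ∷ todo) vis cur ord) →
          Simulates s (search [] (r ∷ todo) vis cur ord) stepBody
        step-root {r} {todo} sim with stk , node≡ , kind≡ , at-top ← popped s (stacked sim) =
            subst (λ s′ → Sim s′ _) (sym eval≡) result
          , +-monoˡ-≤ _ (≤-trans (≤-reflexive cost≡) (≤ᵇ⇒≤ _ stepCost tt))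
          where
          s₂ = eval rootBranch s₁
          root≡ : eval (loop isRoot rootBranch) s₁ ≡ s₂
          root≡ = loop-once isRoot rootBranch s₁ (cong (_∸ 1) kind≡)
          finish≡0 : ⟦ isFinish ⟧ (arrays s₂) ≡ 0
          finish≡0 = cong (λ k → 1 ∸ ((k ∸ 1) + (1 ∸ k))) kind≡
          visit≡0 : ⟦ isVisit ⟧ (arrays s₂) ≡ 0
          visit≡0 = cong (1 ∸_) kind≡
          finish-skip = loop-skip isFinish finishBranch s₂ finish≡0
          visit-skip = loop-skip isVisit visitBranch s₂ visit≡0
          eval≡ : eval stepBody s ≡ s₂
          eval≡ = trans (cong (eval (loop isFinish finishBranch ∙ loop isVisit visitBranch)) root≡)
            (trans (cong (eval (loop isVisit visitBranch)) finish-skip) visit-skip)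
          cost≡ : cost stepBody s ≡ _
          cost≡ = cong (cost pop s +_) (cong₂ _+_ (cost-once isRoot rootBranch s₁ (cong (_∸ 1) kind≡))
            (trans (cong (cost (loop isFinish finishBranch ∙ loop isVisit visitBranch)) root≡)
              (cong₂ _+_ (cost-skip isFinish finishBranch s₂ finish≡0)
                (trans (cong (cost (loop isVisit visitBranch)) finish-skip) (cost-skip isVisit visitBranch s₂ visit≡0)))))
          result : Sim s₂ (search (visit r ∷ []) todo _ r _)
          result = record
            { static = static-frame {s} refl refl refl refl (static sim)
            ; stacked = stack-push {s₁} stk (trans (cong (_+ 1) (size stk)) (+-comm _ 1))
                (λ i i<l → cong₂ _,_ refl (≔-other (arrays s₁ #SK) 0 λ eq → <-irrefl (trans eq (size stk)) i<l))
                (cong₂ _,_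
                  (trans (cong (arrays s #SV) (sym (size stk))) (proj₁ (Product.,-injective at-top)))
                  (≔-at (arrays s₁ #SK) 0 (size stk)))
            ; vis≡ = vis≡ sim
            ; cur≡ = node≡
            ; len≡ = len≡ sim
            ; done = done sim
            }

        step-finish : ∀ {x work todo vis cur ord} → Sim s (search (finish x ∷ work) todo vis cur ord) →
          Simulates s (search (finish x ∷ work) todo vis cur ord) stepBody
        step-finish {x} {work} {todo} {ord = ord} sim with stk , node≡ , kind≡ , at-top ← popped s (stacked sim) =
            subst (λ s′ → Sim s′ _) (sym eval≡) result
          , +-monoˡ-≤ _ (≤-trans (≤-reflexive cost≡) (≤ᵇ⇒≤ _ stepCost tt))
          where
          s₂ = eval finishBranch s₁
          root≡0 : ⟦ isRoot ⟧ (arrays s₁) ≡ 0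
          root≡0 = cong (_∸ 1) kind≡
          root-skip = loop-skip isRoot rootBranch s₁ root≡0
          finish≡1 : ⟦ isFinish ⟧ (arrays s₁) ≡ 1
          finish≡1 = cong (λ k → 1 ∸ ((k ∸ 1) + (1 ∸ k))) kind≡
          finish≡ = loop-once isFinish finishBranch s₁ finish≡1
          visit≡0 : ⟦ isVisit ⟧ (arrays s₂) ≡ 0
          visit≡0 = cong (1 ∸_) kind≡
          visit-skip = loop-skip isVisit visitBranch s₂ visit≡0
          eval≡ : eval stepBody s ≡ s₂
          eval≡ = trans (cong (eval (loop isFinish finishBranch ∙ loop isVisit visitBranch)) root-skip)
            (trans (cong (eval (loop isVisit visitBranch)) finish≡) visit-skip)
          cost≡ : cost stepBody s ≡ _
          cost≡ = cong (cost pop s +_) (cong₂ _+_ (cost-skip isRoot rootBranch s₁ root≡0)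
            (trans (cong (cost (loop isFinish finishBranch ∙ loop isVisit visitBranch)) root-skip)
              (cong₂ _+_ (cost-once isFinish finishBranch s₁ finish≡1)
                (trans (cong (cost (loop isVisit visitBranch)) finish≡) (cost-skip isVisit visitBranch s₂ visit≡0)))))
          result : Sim s₂ (search work todo _ _ (x ∷ ord))
          result = record
            { static = static-frame {s} refl refl refl refl (static sim)
            ; stacked = stack (size stk) (content stk)
            ; vis≡ = vis≡ sim
            ; cur≡ = cur≡ sim
            ; len≡ = trans (cong (_+ 1) (len≡ sim)) (+-comm _ 1)
            ; done = subst (λ y → Holds (arrays s #ORD [ scalar s #len ]≔ scalar s₁ #node) (y ∷ ord)) node≡
                       (holds-push ord (len≡ sim) (done sim))
            }

        module _ {x work todo vis cur ord} (sim : Sim s (search (visit x ∷ work) todo vis cur ord)) where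
          private
            stk = proj₁ (popped s (stacked sim))
            node≡ : scalar s₁ #node ≡ x
            node≡ = proj₁ (proj₂ (popped s (stacked sim)))
            kind≡ : scalar s₁ #kind ≡ 0
            kind≡ = proj₁ (proj₂ (proj₂ (popped s (stacked sim))))
            top-item : stackOf s₁ (scalar s₁ #top) ≡ (x , 0)
            top-item = proj₂ (proj₂ (proj₂ (popped s (stacked sim))))
            root≡0 : ⟦ isRoot ⟧ (arrays s₁) ≡ 0
            root≡0 = cong (_∸ 1) kind≡
            finish≡0 : ⟦ isFinish ⟧ (arrays s₁) ≡ 0
            finish≡0 = cong (λ k → 1 ∸ ((k ∸ 1) + (1 ∸ k))) kind≡
            visit≡1 : ⟦ isVisit ⟧ (arrays s₁) ≡ 1
            visit≡1 = cong (1 ∸_) kind≡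
            root-skip = loop-skip isRoot rootBranch s₁ root≡0
            finish-skip = loop-skip isFinish finishBranch s₁ finish≡0
            visit≡ = loop-once isVisit visitBranch s₁ visit≡1
            eval≡ : eval stepBody s ≡ eval visitBranch s₁
            eval≡ = trans (cong (eval (loop isFinish finishBranch ∙ loop isVisit visitBranch)) root-skip)
              (trans (cong (eval (loop isVisit visitBranch)) finish-skip) visit≡)
            cost≡ : cost stepBody s ≡ cost pop s + ((sizeExp isRoot + 3) + ((sizeExp isFinish + 3) + (sizeExp isVisit + (6 + cost visitBranch s₁))))
            cost≡ = cong (cost pop s +_) (cong₂ _+_ (cost-skip isRoot rootBranch s₁ root≡0)
              (trans (cong (cost (loop isFinish finishBranch ∙ loop isVisit visitBranch)) root-skip)
                (cong₂ _+_ (cost-skip isFinish finishBranch s₁ finish≡0)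
                  (trans (cong (cost (loop isVisit visitBranch)) finish-skip) (cost-once isVisit visitBranch s₁ visit≡1)))))
            newExp = lit 1 ⊖ #VIS ⟪ val #node ⟫
            vis-node : ∀ {k} → vis x ≡ k → arrays s₁ #VIS (scalar s₁ #node) ≡ k
            vis-node eq = trans (cong (arrays s #VIS) node≡) (trans (vis≡ sim x) eq)

          step-skip : ∀ {k} → vis x ≡ suc k → Sim (eval stepBody s) (search work todo vis cur ord) × cost stepBody s ≤ stepCost
          step-skip {k} old = subst (λ s′ → Sim s′ _) (sym (trans eval≡ branch-skip)) result , (begin
            cost stepBody s ≡⟨ trans cost≡ (cong (λ c → cost pop s + ((sizeExp isRoot + 3) + ((sizeExp isFinish + 3) + (sizeExp isVisit + (6 + c))))) (cost-skip newExp openBranch s₁ new≡0)) ⟩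
            _               ≤⟨ ≤ᵇ⇒≤ _ stepCost tt ⟩
            stepCost        ∎)
            where
            open ≤-Reasoning
            new≡0 : ⟦ newExp ⟧ (arrays s₁) ≡ 0
            new≡0 = trans (cong (1 ∸_) (vis-node old)) (0∸n≡0 k)
            branch-skip : eval visitBranch s₁ ≡ s₁
            branch-skip = loop-skip newExp openBranch s₁ new≡0
            result : Sim s₁ (search work todo vis cur ord)
            result = record
              { static = static-frame {s} refl refl refl refl (static sim) ; stacked = stk
              ; vis≡ = vis≡ sim ; cur≡ = cur≡ sim ; len≡ = len≡ sim ; done = done sim }

          step-open : vis x ≡ 0 →
            Sim (eval stepBody s) (search (map visit (successors L x) ʳ++ finish x ∷ work) todo (vis [ x ]≔ suc cur) cur ord)
            × cost stepBody s ≤ stepCost + length (successors L x) * pushCost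
          step-open new = subst (λ s′ → Sim s′ _) (sym (trans eval≡ branch≡)) (proj₁ pushed) , bound
            where
            ws = successors L x
            new≡1 : ⟦ newExp ⟧ (arrays s₁) ≡ 1
            new≡1 = cong (1 ∸_) (vis-node new)
            branch≡ : eval visitBranch s₁ ≡ eval openBranch s₁
            branch≡ = loop-once newExp openBranch s₁ new≡1
            s₂ = eval mark s₁
            marked : ∀ w → arrays s₂ #VIS w ≡ (vis [ x ]≔ suc cur) w
            marked w = trans (cong₂ (λ n c → (arrays s #VIS [ n ]≔ c) w) node≡ (trans (+-comm _ 1) (cong suc (cur≡ sim)))) update-cong
              where
              update-cong : (arrays s #VIS [ x ]≔ suc cur) w ≡ (vis [ x ]≔ suc cur) w
              update-cong with w ≟ x
              ... | yes refl = trans (≔-same (arrays s #VIS) w _) (sym (≔-same vis w _))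
              ... | no  w≢x  = trans (≔-other (arrays s #VIS) _ w≢x) (trans (vis≡ sim w) (sym (≔-other vis _ w≢x)))
            sim₂ : Sim s₂ (search (finish x ∷ work) todo (vis [ x ]≔ suc cur) cur ord)
            sim₂ = record
              { static  = static-frame {s} refl refl refl refl (static sim)
              ; stacked = stack-push {s₁} stk (trans (cong (_+ 1) (size stk)) (+-comm _ 1))
                  (λ i i<l → cong₂ _,_ refl (≔-other (arrays s₁ #SK) 1 λ eq → <-irrefl (trans eq (size stk)) i<l))
                  (cong₂ _,_
                    (trans (cong (arrays s #SV) (sym (size stk))) (proj₁ (Product.,-injective top-item)))
                    (≔-at (arrays s₁ #SK) 1 (size stk)))
              ; vis≡    = marked
              ; cur≡    = cur≡ sim
              ; len≡    = len≡ sim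
              ; done    = done sim
              }
            pushed : Sim (eval pushes s₂) (search (map visit ws ʳ++ finish x ∷ work) todo (vis [ x ]≔ suc cur) cur ord)
              × cost pushes s₂ ≡ 22 + length ws * pushCost
            pushed = push-successors s₂ node≡
              (trans (cong (arrays s #HEAD) node≡) (cong (λ f → f x) (head-same (static sim)))) sim₂
            bound : cost stepBody s ≤ stepCost + length ws * pushCost
            bound = begin
              cost stepBody s ≡⟨ cost≡ ⟩
              _ ≡⟨ cong (λ c → cost pop s + ((sizeExp isRoot + 3) + ((sizeExp isFinish + 3) + (sizeExp isVisit + (6 + c)))))
                     (trans (cost-once newExp openBranch s₁ new≡1) (cong (λ c → sizeExp newExp + (6 + (cost mark s₁ + c))) (proj₂ pushed))) ⟩
              cost pop s + ((sizeExp isRoot + 3) + ((sizeExp isFinish + 3) + (sizeExp isVisit + (6 + (sizeExp newExp + (6 + (cost mark s₁ + (22 + length ws * pushCost))))))))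
                ≡⟨ lemma (cost pop s) (sizeExp isRoot + 3) (sizeExp isFinish + 3) (sizeExp isVisit) (sizeExp newExp) (cost mark s₁) (length ws * pushCost) ⟩
              cost pop s + ((sizeExp isRoot + 3) + ((sizeExp isFinish + 3) + (sizeExp isVisit + (6 + (sizeExp newExp + (6 + (cost mark s₁ + 22))))))) + length ws * pushCost
                ≤⟨ +-monoˡ-≤ (length ws * pushCost) (≤ᵇ⇒≤ (cost pop s + ((sizeExp isRoot + 3) + ((sizeExp isFinish + 3) + (sizeExp isVisit + (6 + (sizeExp newExp + (6 + (cost mark s₁ + 22)))))))) stepCost tt) ⟩
              stepCost + length ws * pushCost ∎
              where
              open ≤-Reasoning
              lemma : ∀ a b c d e f x → a + (b + (c + (d + (6 + (e + (6 + (f + (22 + x))))))))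
                ≡ a + (b + (c + (d + (6 + (e + (6 + (f + 22))))))) + x
              lemma = solve-∀

        step-visit : ∀ {x work todo vis cur ord} → Sim s (search (visit x ∷ work) todo vis cur ord) →
          Simulates s (search (visit x ∷ work) todo vis cur ord) stepBody
        step-visit {x} {vis = vis} {cur} sim with vis x in eq
        ... | suc k = let sim′ , bound = step-skip sim eq in sim′ , +-monoˡ-≤ _ bound
        ... | zero  = let sim′ , bound = step-open sim eq in sim′ , (begin
          cost stepBody s + pushCost * u′                                    ≤⟨ +-monoˡ-≤ _ bound ⟩
          stepCost + length (successors L x) * pushCost + pushCost * u′      ≡⟨ lemma stepCost (length (successors L x)) pushCost u′ ⟩
          stepCost + pushCost * (length (successors L x) + u′)               ≡⟨ cong (λ n → stepCost + pushCost * n) (unscanned-mark L vis x cur eq) ⟨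
          stepCost + pushCost * unscanned L vis                              ∎)
          where
          open ≤-Reasoning
          u′ = unscanned L (vis [ x ]≔ suc cur)
          lemma : ∀ c n p u → c + n * p + p * u ≡ c + p * (n + u)
          lemma = solve-∀

        step-any : ∀ S → Sim s S → ¬ Finished S → Simulates s S stepBody
        step-any (search (finish x ∷ work) todo vis cur ord) sim _ = step-finish sim
        step-any (search (visit x ∷ work) todo vis cur ord)  sim _ = step-visit sim
        step-any (search [] (r ∷ todo) vis cur ord)          sim _ = step-root sim
        step-any (search [] [] vis cur ord)                  sim unfinished = contradiction (refl , refl) unfinished

      iterationCost : ℕ
      iterationCost = stepCost + 30

      Iterates : Env → Search → Set
      Iterates s S = Sim (eval iteration s) (next S)
        × cost iteration s + pushCost * unscanned L (vis (next S)) ≤ iterationCost + pushCost * unscanned L (vis S)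

      iterate-unfinished : ∀ s S {x l} → Sim s S → ¬ Finished S → items S ≡ x ∷ l → Iterates s S
      iterate-unfinished s S {x} {l} sim unfinished full =
        let sim′ , bound = step-any s S sim unfinished
        in subst (λ s′ → Sim s′ (next S)) (sym (loop-once nonempty stepBody s one)) sim′
         , (begin
              cost iteration s + w                         ≡⟨ cong (_+ w) (cost-once nonempty stepBody s one) ⟩
              14 + (6 + cost stepBody s) + w               ≡⟨ lemma (cost stepBody s) w ⟩
              20 + (cost stepBody s + w)                   ≤⟨ +-monoʳ-≤ 20 bound ⟩
              20 + (stepCost + pushCost * unscanned L (vis S)) ≤⟨ +-monoˡ-≤ (stepCost + pushCost * unscanned L (vis S)) (≤ᵇ⇒≤ 20 30 tt) ⟩
              30 + (stepCost + pushCost * unscanned L (vis S)) ∎)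
        where
        open ≤-Reasoning
        w = pushCost * unscanned L (vis (next S))
        lemma : ∀ a b → 14 + (6 + a) + b ≡ 20 + (a + b)
        lemma = solve-∀
        one : ⟦ nonempty ⟧ (arrays s) ≡ 1
        one = trans (cong (λ t → 1 ∸ (1 ∸ t)) (trans (size (stacked sim)) (cong length full))) (cong (1 ∸_) (0∸n≡0 (length l)))

      iteration-correct : ∀ s S → Sim s S → Iterates s S
      iteration-correct s S@(search (finish x ∷ w) _ _ _ _) sim = iterate-unfinished s S sim (λ ()) refl
      iteration-correct s S@(search (visit x ∷ w) _ _ _ _)  sim = iterate-unfinished s S sim (λ ()) refl
      iteration-correct s S@(search [] (r ∷ t) _ _ _)       sim = iterate-unfinished s S sim (λ ()) refl
      iteration-correct s S@(search [] [] _ _ _)            sim =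
          subst (λ s′ → Sim s′ S) (sym (loop-skip nonempty stepBody s empty)) sim
        , +-monoˡ-≤ _ (≤-trans (≤-reflexive (cost-skip nonempty stepBody s empty)) (≤ᵇ⇒≤ _ iterationCost tt))
        where
        empty : ⟦ nonempty ⟧ (arrays s) ≡ 0
        empty = cong (λ t → 1 ∸ (1 ∸ t)) (size (stacked sim))

      iterations : ∀ n s S → Sim s S → Sim (iter n (eval iteration) s) (iter n next S)
        × iterCost n (eval iteration) (cost iteration) s ≤ n * (iterationCost + 3) + pushCost * unscanned L (vis S)
      iterations zero    s S sim = sim , z≤n
      iterations (suc n) s S sim =
        let sim₁ , bound₁ = iteration-correct s S sim
            sim₂ , bound₂ = iterations n (eval iteration s) (next S) sim₁
        in sim₂ , total (cost iteration s) _ (n * (iterationCost + 3)) (pushCost * unscanned L (vis (next S))) (pushCost * unscanned L (vis S)) bound₁ bound₂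
        where
        total : ∀ c i a u u₀ → c + u ≤ iterationCost + u₀ → i ≤ a + u → c + 3 + i ≤ iterationCost + 3 + a + u₀
        total c i a u u₀ b₁ b₂ = begin
          c + 3 + i                    ≤⟨ +-monoʳ-≤ (c + 3) b₂ ⟩
          c + 3 + (a + u)              ≡⟨ lemma c a u ⟩
          c + u + (3 + a)              ≤⟨ +-monoˡ-≤ (3 + a) b₁ ⟩
          iterationCost + u₀ + (3 + a) ≡⟨ lemma′ iterationCost u₀ a ⟩
          iterationCost + 3 + a + u₀   ∎
          where
          open ≤-Reasoning
          lemma : ∀ c a u → c + 3 + (a + u) ≡ c + u + (3 + a)
          lemma = solve-∀
          lemma′ : ∀ c u a → c + u + (3 + a) ≡ c + 3 + a + u
          lemma′ = solve-∀

-- Correctness and running time of one search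

module SearchCorrectness where

  open LoopLanguage
  open LoopLogic
  open DepthFirstSearch
  open SearchProgram
  open SearchSimulation
  open import Data.Bool using (T)
  open import Data.List using (List; []; length)
  open import Data.List.Membership.Propositional using (_∈_)
  open import Data.List.Properties using (length-map)
  open import Data.Nat
  open import Data.Nat.Properties
  open import Data.Nat.Tactic.RingSolver using (solve-∀)
  open import Data.Product using (_×_; _,_; proj₁; proj₂)
  open import Data.Unit using (tt)
  open import Relation.Binary.PropositionalEquality

  linkCost loadCost pushCost : ℕ
  linkCost = cost linkBody (initial []) + 3
  loadCost = cost loadBody (initial []) + 3
  pushCost = cost pushBody (initial []) + 3

  -- 433 is the cost of an iteration without pushes: 400 for the step, 30 allowed for the test that
  -- the stack is nonempty, 3 for the loop. The pushes are charged separately, once per edge.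
  searchBound : ℕ → ℕ → ℕ
  searchBound L r = 24 + L * linkCost + (100 + r * loadCost + (57 + ((r + r + r + L + L) * 433 + pushCost * L)))

  record Prepared (s : Env) (u v : ℕ → ℕ) (L : ℕ) (roots : List ℕ) : Set where
    field
      U≡   : arrays s #U ≡ u
      V≡   : arrays s #V ≡ v
      L≡   : scalar s #L ≡ L
      deg0 : ∀ w → arrays s #DEG w ≡ 0
      held : Holds (arrays s #ORD) roots
      len≡ : scalar s #len ≡ length roots
      vis⊆ : ∀ w → arrays s #VIS w ≢ 0 → w ∈ roots

  record Searched (s : Env) (u v : ℕ → ℕ) (L : ℕ) (roots : List ℕ) : Set where
    field
      {vis} : ℕ → ℕ
      {ord} : List ℕ
      complete : Graph.DepthFirst.Complete u v L roots vis ord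
      vis≡     : ∀ w → arrays s #VIS w ≡ vis w
      held     : Holds (arrays s #ORD) ord
      len≡     : scalar s #len ≡ length ord
      ord≤     : length ord ≤ 3 * length roots + 2 * L
      degrees  : ∀ w → arrays s #DEG w ≡ length (Graph.successors u v L w)

  searchAll-correct : ∀ s {u v L roots} → Prepared s u v L roots →
    Searched (eval searchAll s) u v L roots × cost searchAll s ≤ searchBound L (length roots)
  searchAll-correct s {u} {v} {L} {roots} prep = searched , bound
    where
    open Prepared prep
    s₁ = eval link s
    s₂ = eval load-roots s₁
    open Linking u v using (LinkInv; link-correct)
    links : LinkInv L s₁ × cost link s ≤ 24 + L * linkCost
    links = link-correct s U≡ L≡ deg0
    same₁ : ∀ a → T (keeps link a) → arrays s₁ a ≡ arrays s a
    same₁ a ok = frame link a ok s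
    loads : Loaded roots s₂ × cost load-roots s₁ ≤ 100 + length roots * loadCost
    loads = load-correct roots s₁ (subst (λ f → Holds f roots) (sym (same₁ #ORD tt)) held)
      (trans (cong (λ f → f 0) (same₁ #len tt)) len≡)
      (λ w w≢0 → vis⊆ w (λ w≡0 → w≢0 (trans (cong (λ f → f w) (same₁ #VIS tt)) w≡0)))
    same₂ : ∀ a → T (keeps load-roots a) → arrays s₂ a ≡ arrays s₁ a
    same₂ a ok = frame load-roots a ok s₁
    open LinkInv (proj₁ links)
    open Loaded (proj₁ loads)
    open Graph u v
    open DepthFirst L
    open Simulation u v L (arrays s₁ #NEXT) (arrays s₁ #HEAD) hiding (pushCost)
    sim : Sim s₂ (start roots)
    sim = record
      { static = record
          { V-same = trans (same₂ #V tt) (trans (same₁ #V tt) V≡)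
          ; next-same = same₂ #NEXT tt
          ; head-same = same₂ #HEAD tt
          ; deg-same = λ w → trans (cong (λ f → f w) (same₂ #DEG tt)) (degree w) }
      ; stacked = stack (trans top-roots (sym (length-map (_, 2) roots))) stacked
      ; vis≡ = unvisited
      ; cur≡ = no-root
      ; len≡ = none-done
      ; done = tt
      }
    n = length roots + length roots + length roots + L + L
    L₂ : scalar s₂ #L ≡ L
    L₂ = trans (cong (λ f → f 0) (trans (same₂ #L tt) (same₁ #L tt))) L≡
    n≡ : ⟦ val #top ⊕ val #top ⊕ val #top ⊕ val #L ⊕ val #L ⟧ (arrays s₂) ≡ n
    n≡ = cong₂ (λ t l → t + t + t + l + l) top-roots L₂
    ran : Sim (iter n (eval iteration) s₂) (iter n next (start roots))
      × iterCost n (eval iteration) (cost iteration) s₂ ≤ n * 433 + pushCost * unscanned L (λ _ → 0)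
    ran = iterations linked n s₂ (start roots) sim
    final = iter n next (start roots)
    -- The number of rounds that the program fixes in advance, 3r + 2L, covers the potential of the
    -- start; rounds left over once the stack is empty do nothing.
    enough : potential (start roots) ≤ n
    enough = ≤-trans (+-monoʳ-≤ (3 * length roots) (*-monoʳ-≤ 2 (unscanned≤ L (λ _ → 0)))) (≤-reflexive (lemma (length roots) L))
      where
      lemma : ∀ r l → 3 * r + 2 * l ≡ r + r + r + l + l
      lemma = solve-∀
    sim′ : Sim (eval searchLoop s₂) final
    sim′ = subst (λ k → Sim (iter k (eval iteration) s₂) final) (sym n≡) (proj₁ ran)
    searched : Searched (eval searchAll s) u v L roots
    searched = record
      { complete = finished-complete final (iter-finished n (start roots) enough)
                     (iter-reachable n (start roots) ([] , refl , start-invariant roots))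
      ; vis≡ = Sim.vis≡ sim′
      ; held = Sim.done sim′
      ; len≡ = Sim.len≡ sim′
      ; ord≤ = ≤-trans (iter-ord n (start roots)) (+-monoʳ-≤ (3 * length roots) (*-monoʳ-≤ 2 (unscanned≤ L (λ _ → 0))))
      ; degrees = Static.deg-same (Sim.static sim′)
      }
    loop≤ : cost searchLoop s₂ ≤ 57 + (n * 433 + pushCost * L)
    loop≤ = +-monoʳ-≤ 54 (+-monoʳ-≤ 2 (≤-trans (≤-reflexive (+-comm _ 1)) (s≤s (begin
      iterCost (⟦ val #top ⊕ val #top ⊕ val #top ⊕ val #L ⊕ val #L ⟧ (arrays s₂)) (eval iteration) (cost iteration) s₂
        ≡⟨ cong (λ k → iterCost k (eval iteration) (cost iteration) s₂) n≡ ⟩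
      iterCost n (eval iteration) (cost iteration) s₂ ≤⟨ proj₂ ran ⟩
      n * 433 + pushCost * unscanned L (λ _ → 0)  ≤⟨ +-monoʳ-≤ (n * 433) (*-monoʳ-≤ pushCost (unscanned≤ L (λ _ → 0))) ⟩
      n * 433 + pushCost * L ∎))))
      where open ≤-Reasoning
    bound : cost searchAll s ≤ searchBound L (length roots)
    bound = +-mono-≤ (proj₂ links) (+-mono-≤ (proj₂ loads) loop≤)

-- Strong components by two searches

module ComponentsProgram where

  open import Defs using (_[_]≔_)
  open LoopLanguage
  open LoopLogic
  open DepthFirstSearch
  open SearchProgram
  open SearchCorrectness
  open import Data.List using (List; []; _∷_; length)
  open import Data.List.Membership.Propositional using (_∈_)
  open import Data.List.Relation.Unary.Any using (here; there)
  open import Data.Nat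
  open import Data.Nat.Properties
  open import Data.Nat.Tactic.RingSolver using (solve-∀)
  open import Data.Product using (_×_; _,_; proj₁; proj₂)
  open import Data.Sum using (_⊎_; inj₁; inj₂)
  open import Data.Unit using (tt)
  open import Relation.Binary.Construct.Closure.ReflexiveTransitive using (return)
  open import Relation.Binary.PropositionalEquality
  open import Relation.Nullary using (yes; no; contradiction)

  -- The sources of all edges are the roots of the first search, so both ends of every edge get
  -- visited. Its finishing order, left in `#ORD`, lists the roots of the second one. `swapBody`
  -- also clears `#DEG`, which is nonzero only at sources.
  rootsBody swapBody initRoots swapEdges scc : Cmd
  rootsBody = #ORD ⟪ val #i ⟫≔ #U ⟪ val #i ⟫ ∙ #i := val #i ⊕ lit 1
  swapBody =
      #DEG ⟪ #U ⟪ val #i ⟫ ⟫≔ lit 0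
    ∙ #x := #U ⟪ val #i ⟫
    ∙ #U ⟪ val #i ⟫≔ #V ⟪ val #i ⟫
    ∙ #V ⟪ val #i ⟫≔ val #x
    ∙ #i := val #i ⊕ lit 1
  initRoots = #i := lit 0 ∙ loop (val #L) rootsBody ∙ #len := val #L
  swapEdges = #i := lit 0 ∙ loop (val #L) swapBody
  scc = initRoots ∙ searchAll ∙ swapEdges ∙ searchAll

  module _ (u : ℕ → ℕ) where

    sources : ℕ → List ℕ
    sources zero    = []
    sources (suc i) = u i ∷ sources i

    length-sources : ∀ i → length (sources i) ≡ i
    length-sources zero    = refl
    length-sources (suc i) = cong suc (length-sources i)

    ∈-sources : ∀ {i} L → i < L → u i ∈ sources L
    ∈-sources (suc L) i<1+L with m≤n⇒m<n∨m≡n (s≤s⁻¹ i<1+L)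
    ... | inj₁ i<L  = there (∈-sources L i<L)
    ... | inj₂ refl = here refl

    record RootsInv (i : ℕ) (s : Env) : Set where
      field
        index : scalar s #i ≡ i
        U≡    : arrays s #U ≡ u
        held  : Holds (arrays s #ORD) (sources i)

    roots-step : ∀ i s → RootsInv i s → RootsInv (suc i) (eval rootsBody s)
    roots-step i s inv = record
      { index = trans (cong (_+ 1) index) (+-comm i 1)
      ; U≡    = U≡
      ; held  = subst (λ x → Holds (arrays s #ORD [ scalar s #i ]≔ arrays s #U (scalar s #i)) (x ∷ sources i))
                  (trans (cong (arrays s #U) index) (cong (λ f → f i) U≡))
                  (holds-push (sources i) (trans index (sym (length-sources i))) held)
      }
      where open RootsInv inv

    roots-correct : ∀ s {L} → arrays s #U ≡ u → scalar s #L ≡ L →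
      RootsInv L (eval (loop (val #L) rootsBody) (eval (#i := lit 0) s))
      × cost (loop (val #L) rootsBody) (eval (#i := lit 0) s) ≤ 13 + L * (cost rootsBody s + 3)
    roots-correct s {L} U≡ L≡ = loop-rule (val #L) rootsBody RootsInv L (cost rootsBody s) (eval (#i := lit 0) s) L≡
      (λ j s _ inv → roots-step j s inv , ≤-refl)
      (record { index = refl ; U≡ = U≡ ; held = tt })

  module _ (u v deg : ℕ → ℕ) where

    record SwapInv (i : ℕ) (s : Env) : Set where
      field
        index  : scalar s #i ≡ i
        U-new  : ∀ j → j < i → arrays s #U j ≡ v j
        V-new  : ∀ j → j < i → arrays s #V j ≡ u j
        U-old  : ∀ j → i ≤ j → arrays s #U j ≡ u j
        V-old  : ∀ j → i ≤ j → arrays s #V j ≡ v j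
        reset  : ∀ j → j < i → arrays s #DEG (u j) ≡ 0
        others : ∀ w → arrays s #DEG w ≡ 0 ⊎ arrays s #DEG w ≡ deg w

    swap-step : ∀ i s → SwapInv i s → SwapInv (suc i) (eval swapBody s)
    swap-step i s inv = record
      { index  = trans (cong (_+ 1) index) (+-comm i 1)
      ; U-new  = λ j j<1+i → extend (arrays s #U) v (trans (cong (arrays s #V) index) (V-old i ≤-refl)) U-new j j<1+i
      ; V-new  = λ j j<1+i → extend (arrays s #V) u target≡ V-new j j<1+i
      ; U-old  = λ j i<j → trans (≔-other (arrays s #U) _ (λ j≡ → <-irrefl (sym (trans j≡ index)) i<j)) (U-old j (<⇒≤ i<j))
      ; V-old  = λ j i<j → trans (≔-other (arrays s #V) _ (λ j≡ → <-irrefl (sym (trans j≡ index)) i<j)) (V-old j (<⇒≤ i<j))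
      ; reset  = reset′
      ; others = others′
      }
      where
      open SwapInv inv
      target = arrays s #U (scalar s #i)
      target≡ : target ≡ u i
      target≡ = trans (cong (arrays s #U) index) (U-old i ≤-refl)
      extend : ∀ (f : ℕ → ℕ) (g : ℕ → ℕ) {x} → x ≡ g i → (∀ j → j < i → f j ≡ g j) →
        ∀ j → j < suc i → (f [ scalar s #i ]≔ x) j ≡ g j
      extend f g {x} x≡ old j j<1+i with m≤n⇒m<n∨m≡n (s≤s⁻¹ j<1+i)
      ... | inj₁ j<i  = trans (≔-other f x λ j≡ → <-irrefl (trans j≡ index) j<i) (old j j<i)
      ... | inj₂ refl = trans (≔-at f x index) x≡
      cleared : ∀ w → arrays s #DEG w ≡ 0 → (arrays s #DEG [ target ]≔ 0) w ≡ 0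
      cleared w w≡0 with w ≟ target
      ... | yes refl = ≔-same (arrays s #DEG) w 0
      ... | no  w≢   = trans (≔-other (arrays s #DEG) 0 w≢) w≡0
      reset′ : ∀ j → j < suc i → (arrays s #DEG [ target ]≔ 0) (u j) ≡ 0
      reset′ j j<1+i with m≤n⇒m<n∨m≡n (s≤s⁻¹ j<1+i)
      ... | inj₁ j<i  = cleared _ (reset j j<i)
      ... | inj₂ refl = ≔-at (arrays s #DEG) 0 target≡
      others′ : ∀ w → (arrays s #DEG [ target ]≔ 0) w ≡ 0 ⊎ (arrays s #DEG [ target ]≔ 0) w ≡ deg w
      others′ w with w ≟ target | others w
      ... | yes refl | _       = inj₁ (≔-same (arrays s #DEG) w 0)
      ... | no  w≢   | inj₁ eq = inj₁ (trans (≔-other (arrays s #DEG) 0 w≢) eq)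
      ... | no  w≢   | inj₂ eq = inj₂ (trans (≔-other (arrays s #DEG) 0 w≢) eq)

    swap-correct : ∀ s {L} → arrays s #U ≡ u → arrays s #V ≡ v → (∀ w → arrays s #DEG w ≡ deg w) → scalar s #L ≡ L →
      SwapInv L (eval swapEdges s) × cost swapEdges s ≤ 24 + L * (cost swapBody s + 3)
    swap-correct s {L} U≡ V≡ deg≡ L≡ =
      let inv , bound = loop-rule (val #L) swapBody SwapInv L (cost swapBody s) (eval (#i := lit 0) s) L≡
            (λ j s _ inv → swap-step j s inv , ≤-refl)
            (record { index = refl ; U-new = λ _ () ; V-new = λ _ ()
                    ; U-old = λ j _ → cong (λ f → f j) U≡ ; V-old = λ j _ → cong (λ f → f j) V≡
                    ; reset = λ _ () ; others = λ w → inj₂ (deg≡ w) })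
      in inv , +-monoʳ-≤ 11 bound

  rootsCost swapCost : ℕ
  rootsCost = cost rootsBody (initial []) + 3
  swapCost = cost swapBody (initial []) + 3

  searchBound-mono : ∀ L {r r′} → r ≤ r′ → searchBound L r ≤ searchBound L r′
  searchBound-mono L r≤ = +-monoʳ-≤ (24 + L * linkCost) (+-mono-≤ (+-monoʳ-≤ 100 (*-monoˡ-≤ loadCost r≤))
    (+-monoʳ-≤ 57 (+-monoˡ-≤ (pushCost * L) (*-monoˡ-≤ 433 (+-monoˡ-≤ L (+-monoˡ-≤ L (+-mono-≤ (+-mono-≤ r≤ r≤) r≤)))))))

  -- Component numbers are compared only at the two ends of an edge: they agree just when the edge
  -- lies on a cycle, which is the question asked of reset edges.
  record Components (s : Env) (u v : ℕ → ℕ) (L : ℕ) : Set where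
    private open module G = Graph.DepthFirst u v L using (_⟶*_)
    field
      same⇒back : ∀ {i} → i < L → arrays s #VIS (u i) ≡ arrays s #VIS (v i) → v i ⟶* u i
      back⇒same : ∀ {i} → i < L → v i ⟶* u i → arrays s #VIS (u i) ≡ arrays s #VIS (v i)

  module _ {u v : ℕ → ℕ} {L : ℕ} where

    private
      deg : ℕ → ℕ
      deg w = length (Graph.successors u v L w)

    at-zero : ∀ {s s′ a} → arrays s′ a ≡ arrays s a → scalar s′ a ≡ scalar s a
    at-zero = cong (λ f → f 0)

    backward-search : ∀ s₂ s → Searched s₂ u v L (sources u L) → SwapInv u v deg L s → scalar s #L ≡ L →
      arrays s #ORD ≡ arrays s₂ #ORD → arrays s #len ≡ arrays s₂ #len → arrays s #VIS ≡ arrays s₂ #VIS →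
      Components (eval searchAll s) u v L × cost searchAll s ≤ searchBound L (5 * L)
    backward-search s₂ s forth swapped L≡ ord-same len-same vis-same = components (proj₁ back)
      , ≤-trans (proj₂ back) (searchBound-mono L ord≤)
      where
      module First = Searched forth
      open SwapInv swapped
      deg-zero : ∀ w → arrays s #DEG w ≡ 0
      deg-zero w with others w
      ... | inj₁ eq = eq
      ... | inj₂ eq with Graph.successors u v L w in succ≡
      ...   | []    = eq
      ...   | x ∷ _ with i , i<L , refl , _ ← Graph.∈-successors⁻ u v L (subst (x ∈_) (sym succ≡) (here refl)) = reset i i<L
      back : Searched (eval searchAll s) (arrays s #U) (arrays s #V) L First.ord
        × cost searchAll s ≤ searchBound L (length First.ord)
      back = searchAll-correct s record
        { U≡   = refl
        ; V≡   = refl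
        ; L≡   = L≡
        ; deg0 = deg-zero
        ; held = subst (λ f → Holds f First.ord) (sym ord-same) First.held
        ; len≡ = trans (cong (λ f → f 0) len-same) First.len≡
        ; vis⊆ = λ w w≢0 → Graph.DepthFirst.Complete.visited-done First.complete
                   λ w≡0 → w≢0 (trans (cong (λ f → f w) vis-same) (trans (First.vis≡ w) w≡0))
        }
      open Kosaraju u v (arrays s #U) (arrays s #V) L (U-new _) (V-new _)
      u∈ : ∀ {i} → i < L → u i ∈ First.ord
      u∈ i<L = Graph.DepthFirst.Complete.roots-done First.complete (∈-sources u L i<L)
      v∈ : ∀ {i} → i < L → v i ∈ First.ord
      v∈ i<L = Graph.DepthFirst.Complete.closed First.complete (u∈ i<L) (_ , i<L , refl , refl)
      components : ∀ {s′} → Searched s′ (arrays s #U) (arrays s #V) L First.ord → Components s′ u v L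
      components found = record
        { same⇒back = λ {i} i<L eq → same-tree⇒connected First.complete Second.complete (u∈ i<L) (v∈ i<L)
            (trans (sym (Second.vis≡ (u i))) (trans eq (Second.vis≡ (v i))))
        ; back⇒same = λ {i} i<L p → trans (Second.vis≡ (u i)) (trans
            (connected⇒same-tree First.complete Second.complete (u∈ i<L) (v∈ i<L) (return (i , i<L , refl , refl)) p)
            (sym (Second.vis≡ (v i))))
        }
        where module Second = Searched found
      -- The first search has L roots and L edges, hence potential at most 3L + 2L at the start.
      ord≤ : length First.ord ≤ 5 * L
      ord≤ = ≤-trans First.ord≤ (≤-reflexive (trans (cong (λ r → 3 * r + 2 * L) (length-sources u L)) (lemma L)))
        where
        lemma : ∀ L → 3 * L + 2 * L ≡ 5 * L
        lemma = solve-∀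

    swap-and-search : ∀ s → Searched s u v L (sources u L) → arrays s #U ≡ u → arrays s #V ≡ v → scalar s #L ≡ L →
      Components (eval (swapEdges ∙ searchAll) s) u v L
      × cost (swapEdges ∙ searchAll) s ≤ (24 + L * swapCost) + searchBound L (5 * L)
    swap-and-search s forth U≡ V≡ L≡ =
      let swapped , bound₁ = swap-correct u v deg s U≡ V≡ (Searched.degrees forth) L≡
          found , bound₂ = backward-search s (eval swapEdges s) forth swapped
            (trans (at-zero {s} {eval swapEdges s} {#L} (frame swapEdges #L tt s)) L≡)
            (frame swapEdges #ORD tt s) (frame swapEdges #len tt s) (frame swapEdges #VIS tt s)
      in eval-∙ (λ s → Components s u v L) swapEdges searchAll s found , cost-∙ swapEdges searchAll s bound₁ bound₂

    search-forward : ∀ s → Prepared s u v L (sources u L) →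
      Components (eval (searchAll ∙ swapEdges ∙ searchAll) s) u v L
      × cost (searchAll ∙ swapEdges ∙ searchAll) s ≤ searchBound L L + ((24 + L * swapCost) + searchBound L (5 * L))
    search-forward s prepared =
      let forth , bound₁ = searchAll-correct s prepared
          found , bound₂ = swap-and-search (eval searchAll s) forth
            (trans (frame searchAll #U tt s) (Prepared.U≡ prepared)) (trans (frame searchAll #V tt s) (Prepared.V≡ prepared))
            (trans (at-zero {s} {eval searchAll s} {#L} (frame searchAll #L tt s)) (Prepared.L≡ prepared))
      in eval-∙ (λ s → Components s u v L) searchAll (swapEdges ∙ searchAll) s found , cost-∙ searchAll (swapEdges ∙ searchAll) s (≤-trans bound₁ (≤-reflexive (cong (searchBound L) (length-sources u L)))) bound₂

    init-prepared : ∀ s → arrays s #U ≡ u → arrays s #V ≡ v → scalar s #L ≡ L →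
      (∀ w → arrays s #DEG w ≡ 0) → (∀ w → arrays s #VIS w ≡ 0) →
      Prepared (eval initRoots s) u v L (sources u L) × cost initRoots s ≤ 44 + L * rootsCost
    init-prepared s U≡ V≡ L≡ deg0 vis0 =
      let rooted , bound = roots-correct u s U≡ L≡ in
      record
        { U≡   = trans (frame initRoots #U tt s) U≡
        ; V≡   = trans (frame initRoots #V tt s) V≡
        ; L≡   = trans (at-zero {s} {eval initRoots s} {#L} (frame initRoots #L tt s)) L≡
        ; deg0 = λ w → trans (cong (λ f → f w) (frame initRoots #DEG tt s)) (deg0 w)
        ; held = RootsInv.held rooted
        ; len≡ = trans (cong (λ f → f 0) (frame (loop (val #L) rootsBody) #L tt (eval (#i := lit 0) s)))
                   (trans L≡ (sym (length-sources u L)))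
        ; vis⊆ = λ w w≢0 → contradiction (trans (cong (λ f → f w) (frame initRoots #VIS tt s)) (vis0 w)) w≢0
        }
      , ≤-trans (cost-∙ (#i := lit 0) (loop (val #L) rootsBody ∙ #len := val #L) s {11} ≤-refl
                  (cost-∙ (loop (val #L) rootsBody) (#len := val #L) (eval (#i := lit 0) s) {n = 20} bound ≤-refl))
          (≤-reflexive (lemma (L * rootsCost)))
      where
      lemma : ∀ x → 11 + (13 + x + 20) ≡ 44 + x
      lemma = solve-∀

    scc-correct : ∀ s → arrays s #U ≡ u → arrays s #V ≡ v → scalar s #L ≡ L →
      (∀ w → arrays s #DEG w ≡ 0) → (∀ w → arrays s #VIS w ≡ 0) →
      Components (eval (initRoots ∙ searchAll ∙ swapEdges ∙ searchAll) s) u v L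
      × cost (initRoots ∙ searchAll ∙ swapEdges ∙ searchAll) s
        ≤ (44 + L * rootsCost) + (searchBound L L + ((24 + L * swapCost) + searchBound L (5 * L)))
    scc-correct s U≡ V≡ L≡ deg0 vis0 =
      let prepared , bound₁ = init-prepared s U≡ V≡ L≡ deg0 vis0
          found , bound₂ = search-forward (eval initRoots s) prepared
      in eval-∙ (λ s → Components s u v L) initRoots (searchAll ∙ swapEdges ∙ searchAll) s found
       , cost-∙ initRoots (searchAll ∙ swapEdges ∙ searchAll) s bound₁ bound₂

-- Reading the transitions and numbering the states

module ReadProgram where

  open import Defs using (Memory; _[_]≔_)
  open LoopLanguage hiding (at)
  open LoopLogic
  open SearchProgram using (val; _:=_; scalar; #m; #count; #slot; #p; #l; #q; #SRC; #LAB; #DST; #T)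
  open import Data.Bool using (T)
  open import Data.List using (List; []; _∷_; _++_; length; concatMap; _ʳ++_)
  open import Data.List.Relation.Unary.All as All using (All; []; _∷_)
  open import Data.List.Properties using (length-ʳ++)
  open import Data.Nat
  open import Data.Nat.Properties
  open import Data.Nat.Tactic.RingSolver using (solve-∀)
  open import Data.Product using (_×_; _,_)
  open import Data.Unit using (tt)
  open import Function using (_∘_)
  open import Relation.Binary.PropositionalEquality
  open import Relation.Nullary using (yes; no; contradiction)

  Triple : Set
  Triple = ℕ × ℕ × ℕ

  digits : Triple → List ℕ
  digits (p , l , q) = p ∷ l ∷ q ∷ []

  -- The ε-loops added at the end points of the transitions let a component of the
  -- triple graph stay where it is while another one reads ε.
  entries : List Triple → List Triple
  entries []                 = []
  entries ((p , l , q) ∷ es) = (q , 0 , q) ∷ (p , 0 , p) ∷ (p , l , q) ∷ entries es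

  append : Exp → Exp → Exp → Cmd
  append a b c =
      #SRC ⟪ val #count ⟫≔ a
    ∙ #LAB ⟪ val #count ⟫≔ b
    ∙ #DST ⟪ val #count ⟫≔ c
    ∙ #count := val #count ⊕ lit 1

  -- A state is numbered by the last end point, counted from 1, at which it occurs;
  -- 0 means that it has no transitions.
  number : ℕ → Cmd
  number a = #slot := val #slot ⊕ lit 1 ∙ #T ⟪ val a ⟫≔ val #slot

  getTriple appendStep appendSource appendTarget numberEnds readBody readAll : Cmd
  getTriple    = input #p (lit 0) ∙ input #l (lit 0) ∙ input #q (lit 0)
  appendStep   = append (val #p) (val #l) (val #q)
  appendSource = append (val #p) (lit 0) (val #p)
  appendTarget = append (val #q) (lit 0) (val #q)
  numberEnds   = number #p ∙ number #q
  readBody     = getTriple ∙ (appendStep ∙ appendSource ∙ appendTarget) ∙ numberEnds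
  -- The header is |Σ|, |Q|, |E|; each read overwrites the one before, and |E| remains.
  readAll = input #m (lit 0) ∙ input #m (lit 0) ∙ input #m (lit 0) ∙ loop (val #m) readBody

  entryAt : Env → ℕ → Triple
  entryAt s i = arrays s #SRC i , arrays s #LAB i , arrays s #DST i

  holds-push₃ : ∀ {f g h : Memory} l {n a b c} → n ≡ length l → Holds (λ i → f i , g i , h i) l →
    Holds (λ i → (f [ n ]≔ a) i , (g [ n ]≔ b) i , (h [ n ]≔ c) i) ((a , b , c) ∷ l)
  holds-push₃ {f} {g} {h} l {n} {a} {b} {c} refl held =
      cong₂ _,_ (≔-same f n a) (cong₂ _,_ (≔-same g n b) (≔-same h n c))
    , holds-cong l (λ i i<n → cong₂ _,_ (≔-below f a i<n) (cong₂ _,_ (≔-below g b i<n) (≔-below h c i<n))) held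

  record Numbering (t : ℕ → ℕ) (k : ℕ) : Set where
    field
      bounded₀  : ∀ p → t p ≤ k
      injective : ∀ {p q} → t p ≡ t q → t p ≢ 0 → p ≡ q
  open Numbering public

  -- A fresh number clashes with none in use, so a state can be numbered again without testing
  -- whether it already has a number. The price is that numbers run up to 2|E|, which is still
  -- linear.
  renumber : ∀ {t k} x → Numbering t k → Numbering (t [ x ]≔ (k + 1)) (k + 1)
  renumber {t} {k} x num = record { bounded₀ = bounded′ ; injective = injective′ }
    where
    k<k+1 : k < k + 1
    k<k+1 = ≤-reflexive (+-comm 1 k)
    bounded′ : ∀ p → (t [ x ]≔ (k + 1)) p ≤ k + 1
    bounded′ p with p ≟ x
    ... | yes refl = ≤-reflexive (≔-same t p (k + 1))
    ... | no  p≢x  = ≤-trans (≤-reflexive (≔-other t (k + 1) p≢x)) (≤-trans (bounded₀ num p) (m≤m+n k 1))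
    injective′ : ∀ {p q} → (t [ x ]≔ (k + 1)) p ≡ (t [ x ]≔ (k + 1)) q → (t [ x ]≔ (k + 1)) p ≢ 0 → p ≡ q
    injective′ {p} {q} eq p≢0 with p ≟ x | q ≟ x
    ... | yes refl | yes refl = refl
    ... | yes refl | no  q≢x  = contradiction (trans (sym (≔-same t p _)) (trans eq (≔-other t _ q≢x)))
                                  (λ k+1≡ → <⇒≱ k<k+1 (≤-trans (≤-reflexive k+1≡) (bounded₀ num q)))
    ... | no  p≢x  | yes refl = contradiction (trans (sym (≔-same t q _)) (trans (sym eq) (≔-other t _ p≢x)))
                                  (λ k+1≡ → <⇒≱ k<k+1 (≤-trans (≤-reflexive k+1≡) (bounded₀ num p)))
    ... | no  p≢x  | no  q≢x  = injective num (trans (sym (≔-other t _ p≢x)) (trans eq (≔-other t _ q≢x)))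
                                  (p≢0 ∘ trans (≔-other t _ p≢x))

  renumber-keeps : ∀ {t : ℕ → ℕ} {k} x {p} → t p ≢ 0 → (t [ x ]≔ (k + 1)) p ≢ 0
  renumber-keeps {t} {k} x {p} p≢0 with p ≟ x
  ... | yes refl = λ eq → contradiction (trans (+-comm 1 k) (trans (sym (≔-same t p (k + 1))) eq)) λ ()
  ... | no  p≢x  = p≢0 ∘ trans (sym (≔-other t (k + 1) p≢x))

  renumber-new : ∀ {t : ℕ → ℕ} {k} x → (t [ x ]≔ (k + 1)) x ≢ 0
  renumber-new {t} {k} x eq = contradiction (trans (+-comm 1 k) (trans (sym (≔-same t x (k + 1))) eq)) λ ()

  Numbered : (ℕ → ℕ) → Triple → Set
  Numbered t (p , _ , q) = t p ≢ 0 × t q ≢ 0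

  record Listed (l : List Triple) (s : Env) : Set where
    constructor listed
    field
      held   : Holds (entryAt s) l
      count≡ : scalar s #count ≡ length l

  listed-step : ∀ s {l p a q} → scalar s #p ≡ p → scalar s #l ≡ a → scalar s #q ≡ q →
    Listed l s → Listed ((p , a , q) ∷ l) (eval appendStep s)
  listed-step s {l} refl refl refl (listed held count≡) =
    listed (holds-push₃ l count≡ held) (trans (cong (_+ 1) count≡) (+-comm _ 1))

  listed-source : ∀ s {l p} → scalar s #p ≡ p → Listed l s → Listed ((p , 0 , p) ∷ l) (eval appendSource s)
  listed-source s {l} refl (listed held count≡) =
    listed (holds-push₃ l count≡ held) (trans (cong (_+ 1) count≡) (+-comm _ 1))

  listed-target : ∀ s {l q} → scalar s #q ≡ q → Listed l s → Listed ((q , 0 , q) ∷ l) (eval appendTarget s)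
  listed-target s {l} refl (listed held count≡) =
    listed (holds-push₃ l count≡ held) (trans (cong (_+ 1) count≡) (+-comm _ 1))

  record Numbers (es : List Triple) (s : Env) : Set where
    field
      slot≡    : scalar s #slot ≡ length es + length es
      numbers  : Numbering (arrays s #T) (scalar s #slot)
      numbered : All (Numbered (arrays s #T)) (entries es)

  numbers-step : ∀ s {es p l q} → scalar s #p ≡ p → scalar s #q ≡ q → Numbers es s → Numbers ((p , l , q) ∷ es) (eval numberEnds s)
  numbers-step s {es} {p} {l} {q} refl refl num = record
    { slot≡    = trans (cong (λ k → k + 1 + 1) slot≡) (lemma (length es))
    ; numbers  = renumber q (renumber p numbers)
    ; numbered = (new-q , new-q) ∷ (new-p , new-p) ∷ (new-p , new-q) ∷ All.map (λ (a , b) → keep a , keep b) numbered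
    }
    where
    open Numbers num
    lemma : ∀ n → n + n + 1 + 1 ≡ suc n + suc n
    lemma = solve-∀
    t  = arrays s #T
    k  = scalar s #slot
    t′ = t [ p ]≔ (k + 1)
    new-q : (t′ [ q ]≔ (k + 1 + 1)) q ≢ 0
    new-q = renumber-new {t′} q
    new-p : (t′ [ q ]≔ (k + 1 + 1)) p ≢ 0
    new-p = renumber-keeps {t′} q (renumber-new {t} p)
    keep : ∀ {x} → t x ≢ 0 → (t′ [ q ]≔ (k + 1 + 1)) x ≢ 0
    keep x≢0 = renumber-keeps {t′} q (renumber-keeps {t} p x≢0)

  record Table (es : List Triple) (s : Env) : Set where
    constructor tabulated
    field
      entered : Listed (entries es) s
      indexed : Numbers es s

  numbers-frame : ∀ {es s s′} → arrays s′ #slot ≡ arrays s #slot → arrays s′ #T ≡ arrays s #T → Numbers es s → Numbers es s′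
  numbers-frame {es} slot-same T-same num = record
    { slot≡    = trans (cong (λ f → f 0) slot-same) slot≡
    ; numbers  = subst₂ (λ t f → Numbering t (f 0)) (sym T-same) (sym slot-same) numbers
    ; numbered = subst (λ t → All (Numbered t) (entries es)) (sym T-same) numbered }
    where open Numbers num

  listed-frame : ∀ {l} c → T (keeps c #SRC) → T (keeps c #LAB) → T (keeps c #DST) → T (keeps c #count) → ∀ s →
    Listed l s → Listed l (eval c s)
  listed-frame {l} c ok₁ ok₂ ok₃ ok₄ s (listed held count≡) = listed
      (holds-cong l (λ i _ → cong₂ _,_ (same i ok₁) (cong₂ _,_ (same i ok₂) (same i ok₃))) held)
      (trans (same 0 ok₄) count≡)
    where
    same : ∀ {a} i → T (keeps c a) → arrays (eval c s) a i ≡ arrays s a i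
    same i ok = cong (λ f → f i) (frame c _ ok s)

  table-input : ∀ s {es p l q inp} → inputs s ≡ p ∷ l ∷ q ∷ inp → Table es s →
    Table es (eval getTriple s) × scalar (eval getTriple s) #p ≡ p × scalar (eval getTriple s) #l ≡ l
    × scalar (eval getTriple s) #q ≡ q × inputs (eval getTriple s) ≡ inp
  table-input s eq (tabulated old num) =
      tabulated (listed-frame getTriple tt tt tt tt s old)
        (numbers-frame {s = s} (frame getTriple #slot tt s) (frame getTriple #T tt s) num)
    , cong LoopLanguage.first eq , cong (LoopLanguage.first ∘ LoopLanguage.rest) eq , cong (LoopLanguage.first ∘ LoopLanguage.rest ∘ LoopLanguage.rest) eq
    , cong (LoopLanguage.rest ∘ LoopLanguage.rest ∘ LoopLanguage.rest) eq

  listed-appends : ∀ s {es p l q} → scalar s #p ≡ p → scalar s #l ≡ l → scalar s #q ≡ q →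
    Listed es s → Listed ((q , 0 , q) ∷ (p , 0 , p) ∷ (p , l , q) ∷ es) (eval (appendStep ∙ appendSource ∙ appendTarget) s)
  listed-appends s {es} {p} {l} {q} p≡ l≡ q≡ old =
    eval-∙ (Listed new) appendStep (appendSource ∙ appendTarget) s
      (eval-∙ (Listed new) appendSource appendTarget (eval appendStep s)
        (listed-target (eval appendSource (eval appendStep s))
          (trans (at-q appendSource (eval appendStep s) tt) (trans (at-q appendStep s tt) q≡))
          (listed-source (eval appendStep s) (trans (at-p appendStep s tt) p≡) (listed-step s p≡ l≡ q≡ old))))
    where
    new = (q , 0 , q) ∷ (p , 0 , p) ∷ (p , l , q) ∷ es
    at-p : ∀ c s → T (keeps c #p) → scalar (eval c s) #p ≡ scalar s #p
    at-p c s ok = cong (λ f → f 0) (frame c #p ok s)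
    at-q : ∀ c s → T (keeps c #q) → scalar (eval c s) #q ≡ scalar s #q
    at-q c s ok = cong (λ f → f 0) (frame c #q ok s)

  module _ (c : Cmd) (s : Env) where
    private
      same : ∀ a → T (keeps c a) → scalar (eval c s) a ≡ scalar s a
      same a ok = cong (λ f → f 0) (frame c a ok s)

    number-after : ∀ {es p l q} → T (keeps c #p) → T (keeps c #q) → T (keeps c #slot) → T (keeps c #T) →
      scalar s #p ≡ p → scalar s #q ≡ q → Numbers es s →
      Listed (entries ((p , l , q) ∷ es)) (eval c s) → Table ((p , l , q) ∷ es) (eval (c ∙ numberEnds) s)
    number-after ok₁ ok₂ ok₃ ok₄ p≡ q≡ num new =
      eval-∙ (Table _) c numberEnds s (tabulated (listed-frame numberEnds tt tt tt tt (eval c s) new)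
        (numbers-step (eval c s) (trans (same #p ok₁) p≡) (trans (same #q ok₂) q≡)
          (numbers-frame {s = s} (frame c #slot ok₃ s) (frame c #T ok₄ s) num)))

  enterTriple : Cmd
  enterTriple = (appendStep ∙ appendSource ∙ appendTarget) ∙ numberEnds

  enterTriple-def : enterTriple ≡ (appendStep ∙ appendSource ∙ appendTarget) ∙ numberEnds
  enterTriple-def = refl

  readBody-def : readBody ≡ getTriple ∙ enterTriple
  readBody-def = refl

  enter-triple : ∀ s {es p l q} → scalar s #p ≡ p → scalar s #l ≡ l → scalar s #q ≡ q → Table es s →
    Table ((p , l , q) ∷ es) (eval enterTriple s)
  enter-triple s {es} {p} {l} {q} p≡ l≡ q≡ (tabulated old num) =
    subst (λ c → Table ((p , l , q) ∷ es) (eval c s)) (sym enterTriple-def) (number-after (appendStep ∙ appendSource ∙ appendTarget) s tt tt tt tt p≡ q≡ num (listed-appends s p≡ l≡ q≡ old))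

  module _ (es : List Triple) (rest : List ℕ) where

    record ReadInv (i : ℕ) (s : Env) : Set where
      field
        {before todo} : List Triple
        position : length before ≡ i
        split    : es ≡ before ʳ++ todo
        pending  : inputs s ≡ concatMap digits todo ++ rest
        entered  : Table before s

    read-step : ∀ i s → i < length es → ReadInv i s → ReadInv (suc i) (eval readBody s)
    read-step i s i<n inv = go todo position split pending entered
      where
      open ReadInv inv
      go : ∀ todo → length before ≡ i → es ≡ before ʳ++ todo → inputs s ≡ concatMap digits todo ++ rest → Table before s →
        ReadInv (suc i) (eval readBody s)
      go [] position split _ _ = contradiction
        (trans (cong length split) (trans (length-ʳ++ before) (trans (+-identityʳ (length before)) position)))
        (λ eq → <-irrefl (sym eq) i<n)
      go ((p , l , q) ∷ todo′) position split pending entered =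
        let entered₁ , p≡ , l≡ , q≡ , inp≡ = table-input s pending entered
        in record
          { before = (p , l , q) ∷ before ; todo = todo′ ; position = cong suc position ; split = split
          ; pending = subst (λ c → inputs (eval c s) ≡ concatMap digits todo′ ++ rest) (sym readBody-def)
              (eval-∙ (λ s → inputs s ≡ concatMap digits todo′ ++ rest) getTriple enterTriple s
                (trans (frame-inputs enterTriple tt (eval getTriple s)) inp≡))
          ; entered = subst (λ c → Table ((p , l , q) ∷ before) (eval c s)) (sym readBody-def)
              (eval-∙ (Table ((p , l , q) ∷ before)) getTriple enterTriple s
                (enter-triple (eval getTriple s) p≡ l≡ q≡ entered₁))
          }

    read-correct : ∀ a b →
      let s = initial (a ∷ b ∷ length es ∷ concatMap digits es ++ rest) in
      ReadInv (length es) (eval readAll s) × cost readAll s ≤ 46 + length es * (cost readBody (initial []) + 3)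
    read-correct a b =
      let s₀ = eval (input #m (lit 0) ∙ input #m (lit 0) ∙ input #m (lit 0)) (initial (a ∷ b ∷ length es ∷ concatMap digits es ++ rest))
          inv , bound = loop-rule (val #m) readBody ReadInv (length es) (cost readBody (initial [])) s₀ refl
            (λ j s j<n inv → read-step j s j<n inv , ≤-refl)
            (record { before = [] ; todo = es ; position = refl ; split = refl ; pending = refl
                    ; entered = tabulated (listed tt refl) record { slot≡ = refl
                                       ; numbers = record { bounded₀ = λ _ → z≤n ; injective = λ _ p≢0 → contradiction refl p≢0 }
                                       ; numbered = [] } })
      in inv , +-monoʳ-≤ 33 bound

    number-read : ∀ a b → scalar (eval readAll (initial (a ∷ b ∷ length es ∷ concatMap digits es ++ rest))) #m ≡ length es
    number-read a b = cong (λ f → f 0) (frame (loop (val #m) readBody) #m tt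
      (eval (input #m (lit 0) ∙ input #m (lit 0) ∙ input #m (lit 0)) (initial (a ∷ b ∷ length es ∷ concatMap digits es ++ rest))))

-- Multiples of state numbers by repeated addition

module NumberingProgram where

  open import Defs using (_[_]≔_)
  open LoopLanguage
  open LoopLogic
  open SearchProgram using (val; _:=_; scalar; #m; #count; #x; #y; #z; #i; #N; #SRC; #T; #T₂; #T₃)
  open import Data.Bool using (T)
  open import Data.Nat
  open import Data.Nat.Properties
  open import Data.Product using (_×_; _,_)
  open import Data.Sum using (inj₁; inj₂)
  open import Data.Unit using (tt)
  open import Relation.Binary.PropositionalEquality
  open import Relation.Nullary using (yes; no)

  -- N additions give y = N t, and N more give z = N y = N² t. Doing this once per table entry,
  -- repeated sources included, costs O(|E|²).
  mul₁ mul₂ scaleStart scaleStore scaleBody scaleAll : Cmd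
  mul₁ = #y := val #y ⊕ val #x
  mul₂ = #z := val #z ⊕ val #y
  scaleStart = #x := #T ⟪ #SRC ⟪ val #i ⟫ ⟫ ∙ #y := lit 0 ∙ #z := lit 0
  scaleStore =
      #T₂ ⟪ #SRC ⟪ val #i ⟫ ⟫≔ val #y
    ∙ #T₃ ⟪ #SRC ⟪ val #i ⟫ ⟫≔ val #z
    ∙ #i := val #i ⊕ lit 1
  scaleBody = scaleStart ∙ loop (val #N) mul₁ ∙ loop (val #N) mul₂ ∙ scaleStore
  scaleAll = (#N := val #m ⊕ val #m ⊕ lit 1 ∙ #i := lit 0) ∙ loop (val #count) scaleBody

  at-frame : ∀ c a → T (keeps c a) → ∀ s {v} → scalar s a ≡ v → scalar (eval c s) a ≡ v
  at-frame c a ok s eq = trans (cong (λ f → f 0) (frame c a ok s)) eq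

  mul₁-correct : ∀ s {N x} → scalar s #N ≡ N → scalar s #x ≡ x → scalar s #y ≡ 0 →
    scalar (eval (loop (val #N) mul₁) s) #y ≡ N * x × cost (loop (val #N) mul₁) s ≤ 13 + N * 34
  mul₁-correct s {N} {x} N≡ x≡ y≡ =
    let (y≡′ , _) , bound = loop-rule (val #N) mul₁ (λ j s → scalar s #y ≡ j * x × scalar s #x ≡ x) N 31 s N≡
          (λ j s _ (y≡ , x≡) → (trans (cong₂ _+_ y≡ x≡) (+-comm (j * x) x) , x≡) , ≤-refl) (y≡ , x≡)
    in y≡′ , bound

  mul₂-correct : ∀ s {N y} → scalar s #N ≡ N → scalar s #y ≡ y → scalar s #z ≡ 0 →
    scalar (eval (loop (val #N) mul₂) s) #z ≡ N * y × cost (loop (val #N) mul₂) s ≤ 13 + N * 34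
  mul₂-correct s {N} {y} N≡ y≡ z≡ =
    let (z≡′ , _) , bound = loop-rule (val #N) mul₂ (λ j s → scalar s #z ≡ j * y × scalar s #y ≡ y) N 31 s N≡
          (λ j s _ (z≡ , y≡) → (trans (cong₂ _+_ z≡ y≡) (+-comm (j * y) y) , y≡) , ≤-refl) (z≡ , y≡)
    in z≡′ , bound

  module _ (src t : ℕ → ℕ) (N : ℕ) where

    record ScaleInv (i : ℕ) (s : Env) : Set where
      field
        index  : scalar s #i ≡ i
        SRC≡   : arrays s #SRC ≡ src
        T≡     : arrays s #T ≡ t
        N≡     : scalar s #N ≡ N
        twice  : ∀ j → j < i → arrays s #T₂ (src j) ≡ N * t (src j)
        thrice : ∀ j → j < i → arrays s #T₃ (src j) ≡ N * (N * t (src j))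

    scale-frame : ∀ c → T (keeps c #i) → T (keeps c #SRC) → T (keeps c #T) → T (keeps c #N) → T (keeps c #T₂) → T (keeps c #T₃) →
      ∀ i s → ScaleInv i s → ScaleInv i (eval c s)
    scale-frame c ok₁ ok₂ ok₃ ok₄ ok₅ ok₆ i s inv = record
      { index  = at-frame c #i ok₁ s index
      ; SRC≡   = trans (frame c #SRC ok₂ s) SRC≡
      ; T≡     = trans (frame c #T ok₃ s) T≡
      ; N≡     = at-frame c #N ok₄ s N≡
      ; twice  = λ j j<i → trans (cong (λ f → f (src j)) (frame c #T₂ ok₅ s)) (twice j j<i)
      ; thrice = λ j j<i → trans (cong (λ f → f (src j)) (frame c #T₃ ok₆ s)) (thrice j j<i)
      }
      where open ScaleInv inv

    store-correct : ∀ i s → ScaleInv i s → scalar s #y ≡ N * t (src i) → scalar s #z ≡ N * (N * t (src i)) →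
      ScaleInv (suc i) (eval scaleStore s)
    store-correct i s inv y≡ z≡ = record
      { index  = trans (cong (_+ 1) index) (+-comm i 1)
      ; SRC≡   = SRC≡
      ; T≡     = T≡
      ; N≡     = N≡
      ; twice  = λ j j<1+i → extend (arrays s #T₂) (λ p → N * t p) y≡ twice j j<1+i
      ; thrice = λ j j<1+i → extend (arrays s #T₃) (λ p → N * (N * t p)) z≡ thrice j j<1+i
      }
      where
      open ScaleInv inv
      target≡ : arrays s #SRC (scalar s #i) ≡ src i
      target≡ = trans (cong (arrays s #SRC) index) (cong (λ f → f i) SRC≡)
      extend : ∀ (f g : ℕ → ℕ) {v} → v ≡ g (src i) → (∀ j → j < i → f (src j) ≡ g (src j)) →
        ∀ j → j < suc i → (f [ arrays s #SRC (scalar s #i) ]≔ v) (src j) ≡ g (src j)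
      -- An earlier entry may have the same source as entry `i`; its value is then overwritten by an
      -- equal one.
      extend f g {v} v≡ old j j<1+i with src j ≟ arrays s #SRC (scalar s #i)
      ... | yes eq = trans (≔-at f v (sym eq)) (trans v≡ (cong g (sym (trans eq target≡))))
      ... | no neq with m≤n⇒m<n∨m≡n (s≤s⁻¹ j<1+i)
      ...   | inj₁ j<i  = trans (≔-other f v neq) (old j j<i)
      ...   | inj₂ refl = trans (≔-at f v target≡) v≡

    scaleCost : ℕ
    scaleCost = 60 + ((13 + N * 34) + ((13 + N * 34) + 100))

    scale-step : ∀ i s → ScaleInv i s →
      ScaleInv (suc i) (eval (scaleStart ∙ loop (val #N) mul₁ ∙ loop (val #N) mul₂ ∙ scaleStore) s)
      × cost (scaleStart ∙ loop (val #N) mul₁ ∙ loop (val #N) mul₂ ∙ scaleStore) s ≤ scaleCost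
    scale-step i s inv =
      let s₁ = eval scaleStart s
          inv₁ = scale-frame scaleStart tt tt tt tt tt tt i s inv
          y₂ , bound₁ = mul₁-correct s₁ (ScaleInv.N≡ inv₁) x₁ refl
          s₂ = eval (loop (val #N) mul₁) s₁
          inv₂ = scale-frame (loop (val #N) mul₁) tt tt tt tt tt tt i s₁ inv₁
          z₃ , bound₂ = mul₂-correct s₂ (ScaleInv.N≡ inv₂) y₂ (at-frame (loop (val #N) mul₁) #z tt s₁ refl)
          s₃ = eval (loop (val #N) mul₂) s₂
          inv₃ = scale-frame (loop (val #N) mul₂) tt tt tt tt tt tt i s₂ inv₂
          y₃ = at-frame (loop (val #N) mul₂) #y tt s₂ y₂
      in eval-∙ (ScaleInv (suc i)) scaleStart (loop (val #N) mul₁ ∙ loop (val #N) mul₂ ∙ scaleStore) s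
           (eval-∙ (ScaleInv (suc i)) (loop (val #N) mul₁) (loop (val #N) mul₂ ∙ scaleStore) s₁
             (eval-∙ (ScaleInv (suc i)) (loop (val #N) mul₂) scaleStore s₂ (store-correct i s₃ inv₃ y₃ z₃)))
       , cost-∙ scaleStart (loop (val #N) mul₁ ∙ loop (val #N) mul₂ ∙ scaleStore) s {60} ≤-refl
           (cost-∙ (loop (val #N) mul₁) (loop (val #N) mul₂ ∙ scaleStore) s₁ bound₁
             (cost-∙ (loop (val #N) mul₂) scaleStore s₂ {n = 100} bound₂ (≤ᵇ⇒≤ (cost scaleStore s₃) 100 tt)))
      where
      x₁ : scalar (eval scaleStart s) #x ≡ t (src i)
      x₁ = trans (cong₂ (λ f g → f (g (scalar s #i))) (ScaleInv.T≡ inv) (ScaleInv.SRC≡ inv)) (cong (λ i → t (src i)) (ScaleInv.index inv))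

    scale-correct : ∀ s {M} → arrays s #SRC ≡ src → arrays s #T ≡ t → scalar s #m + scalar s #m + 1 ≡ N → scalar s #count ≡ M →
      ScaleInv M (eval ((#N := val #m ⊕ val #m ⊕ lit 1 ∙ #i := lit 0) ∙ loop (val #count) (scaleStart ∙ loop (val #N) mul₁ ∙ loop (val #N) mul₂ ∙ scaleStore)) s)
      × cost ((#N := val #m ⊕ val #m ⊕ lit 1 ∙ #i := lit 0) ∙ loop (val #count) (scaleStart ∙ loop (val #N) mul₁ ∙ loop (val #N) mul₂ ∙ scaleStore)) s
        ≤ 44 + (13 + M * (scaleCost + 3))
    scale-correct s {M} SRC≡ T≡ N≡ count≡ =
      let inv , bound = loop-rule (val #count) (scaleStart ∙ loop (val #N) mul₁ ∙ loop (val #N) mul₂ ∙ scaleStore) ScaleInv M scaleCost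
            (eval (#N := val #m ⊕ val #m ⊕ lit 1 ∙ #i := lit 0) s) count≡ (λ j s _ → scale-step j s)
            (record { index = refl ; SRC≡ = SRC≡ ; T≡ = T≡ ; N≡ = N≡ ; twice = λ _ () ; thrice = λ _ () })
      in eval-∙ (ScaleInv M) (#N := val #m ⊕ val #m ⊕ lit 1 ∙ #i := lit 0) (loop (val #count) (scaleStart ∙ loop (val #N) mul₁ ∙ loop (val #N) mul₂ ∙ scaleStore)) s inv
       , cost-∙ (#N := val #m ⊕ val #m ⊕ lit 1 ∙ #i := lit 0) (loop (val #count) (scaleStart ∙ loop (val #N) mul₁ ∙ loop (val #N) mul₂ ∙ scaleStore)) s {m = 44} (≤ᵇ⇒≤ (cost (#N := val #m ⊕ val #m ⊕ lit 1 ∙ #i := lit 0) s) 44 tt) bound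

-- The graph of triples

module ProductProgram where

  open import Defs using (_[_]≔_)
  open LoopLanguage hiding (At; at; steps)
  open LoopLogic
  open SearchProgram using (val; _:=_; scalar; #count; #i; #j; #k; #L; #SRC; #LAB; #DST; #T; #T₂; #T₃; #U; #V)
  open import Data.Bool using (T)
  open import Data.List using (List; []; _∷_; length)
  open import Data.List.Membership.Propositional using (_∈_)
  open import Data.List.Relation.Unary.All as All using (All; []; _∷_)
  open import Data.List.Relation.Unary.Any using (here; there)
  open import Data.Nat
  open import Data.Nat.Properties
  open import Data.Nat.Tactic.RingSolver using (solve-∀)
  open import Data.Product using (∃-syntax; _×_; _,_; proj₁; proj₂)
  open import Data.Sum using (_⊎_; inj₁; inj₂)
  open import Data.Unit using (tt)
  open import Function using (_∘_)
  open import Relation.Binary.PropositionalEquality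
  open import Relation.Nullary using (¬_; Dec; yes; no; contradiction)
  open import Relation.Nullary.Decidable using (_×-dec_)

  -- `#T₂` and `#T₃` hold the multiples of `#T` by N and N², so this is the number with the three
  -- base-N digits `t a`, `t b`, `t c`, lowest first.
  codeOf : Exp → Exp → Exp → Exp
  codeOf a b c = #T ⟪ a ⟫ ⊕ #T₂ ⟪ b ⟫ ⊕ #T₃ ⟪ c ⟫

  -- With truncated subtraction a sum of the two differences is a distance. The sum of the
  -- distances, plus 1 for the label ε in `sameLetter`, vanishes just when the condition holds; the
  -- value is then 1, and otherwise 0.
  sameLabels sameLetter : Exp
  sameLabels = lit 1 ⊖ ( (#LAB ⟪ val #i ⟫ ⊖ #LAB ⟪ val #j ⟫) ⊕ (#LAB ⟪ val #j ⟫ ⊖ #LAB ⟪ val #i ⟫)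
                       ⊕ ((#LAB ⟪ val #j ⟫ ⊖ #LAB ⟪ val #k ⟫) ⊕ (#LAB ⟪ val #k ⟫ ⊖ #LAB ⟪ val #j ⟫)))
  sameLetter = lit 1 ⊖ ( (#LAB ⟪ val #i ⟫ ⊖ #LAB ⟪ val #k ⟫) ⊕ (#LAB ⟪ val #k ⟫ ⊖ #LAB ⟪ val #i ⟫)
                       ⊕ (lit 1 ⊖ #LAB ⟪ val #i ⟫))

  emitStep emitReset advance innerBody middleBody outerBody : Cmd
  emitStep =
      #U ⟪ val #L ⟫≔ codeOf (#SRC ⟪ val #i ⟫) (#SRC ⟪ val #j ⟫) (#SRC ⟪ val #k ⟫)
    ∙ #V ⟪ val #L ⟫≔ codeOf (#DST ⟪ val #i ⟫) (#DST ⟪ val #j ⟫) (#DST ⟪ val #k ⟫)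
    ∙ #L := val #L ⊕ lit 1
  emitReset =
      #U ⟪ val #L ⟫≔ codeOf (#SRC ⟪ val #i ⟫) (#SRC ⟪ val #k ⟫) (#SRC ⟪ val #k ⟫)
    ∙ #V ⟪ val #L ⟫≔ codeOf (#DST ⟪ val #i ⟫) (#DST ⟪ val #i ⟫) (#DST ⟪ val #k ⟫)
    ∙ #L := val #L ⊕ lit 1
  advance = #k := val #k ⊕ lit 1
  -- A reset edge does not depend on `j` and is emitted again for every `j`. Repeated edges are
  -- harmless, and there are still at most two edges per triple.
  innerBody = loop sameLabels emitStep ∙ loop sameLetter emitReset ∙ advance
  middleBody = #k := lit 0 ∙ loop (val #count) innerBody ∙ #j := val #j ⊕ lit 1
  outerBody = #j := lit 0 ∙ loop (val #count) middleBody ∙ #i := val #i ⊕ lit 1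

  differ : ∀ x y → x ≢ y → 1 ≤ (x ∸ y) + (y ∸ x)
  differ zero    zero    x≢y = contradiction refl x≢y
  differ zero    (suc y) x≢y = s≤s z≤n
  differ (suc x) zero    x≢y = s≤s z≤n
  differ (suc x) (suc y) x≢y = differ x y (x≢y ∘ cong suc)

  agree≡0 : ∀ x y → x ≡ y → (x ∸ y) + (y ∸ x) ≡ 0
  agree≡0 x .x refl = cong₂ _+_ (n∸n≡0 x) (n∸n≡0 x)

  record Tables : Set where
    field src lab dst t t₂ t₃ : ℕ → ℕ

  module Emission (tables : Tables) (M : ℕ) where
    open Tables tables

    code : ℕ → ℕ → ℕ → ℕ
    code p r q = t p + t₂ r + t₃ q

    Labels : ℕ → ℕ → ℕ → Set
    Labels i j k = lab i ≡ lab j × lab j ≡ lab k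

    Letters : ℕ → ℕ → Set
    Letters i k = lab i ≡ lab k × lab i ≢ 0

    stepEdge : ℕ → ℕ → ℕ → ℕ × ℕ
    stepEdge i j k = code (src i) (src j) (src k) , code (dst i) (dst j) (dst k)

    resetEdge : ℕ → ℕ → ℕ × ℕ
    resetEdge i k = code (src i) (src k) (src k) , code (dst i) (dst i) (dst k)

    Emits : ℕ × ℕ → Set
    Emits e = (∃[ i ] ∃[ j ] ∃[ k ] i < M × j < M × k < M × Labels i j k × e ≡ stepEdge i j k)
            ⊎ (∃[ i ] ∃[ k ] i < M × k < M × Letters i k × e ≡ resetEdge i k)

    record Static (s : Env) : Set where
      field
        SRC≡ : arrays s #SRC ≡ src
        LAB≡ : arrays s #LAB ≡ lab
        DST≡ : arrays s #DST ≡ dst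
        T≡   : arrays s #T ≡ t
        T₂≡  : arrays s #T₂ ≡ t₂
        T₃≡  : arrays s #T₃ ≡ t₃
        M≡   : scalar s #count ≡ M

    record At (i j k : ℕ) (s : Env) : Set where
      field
        i≡ : scalar s #i ≡ i
        j≡ : scalar s #j ≡ j
        k≡ : scalar s #k ≡ k

    edgeAt : Env → ℕ → ℕ × ℕ
    edgeAt s e = arrays s #U e , arrays s #V e

    record Edges (G : List (ℕ × ℕ)) (s : Env) : Set where
      field
        held : Holds (edgeAt s) G
        L≡   : scalar s #L ≡ length G

    static-frame : ∀ c → T (keeps c #SRC) → T (keeps c #LAB) → T (keeps c #DST) → T (keeps c #T) → T (keeps c #T₂) → T (keeps c #T₃) →
      T (keeps c #count) → ∀ s → Static s → Static (eval c s)
    static-frame c k₁ k₂ k₃ k₄ k₅ k₆ k₇ s st = record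
      { SRC≡ = trans (frame c #SRC k₁ s) SRC≡ ; LAB≡ = trans (frame c #LAB k₂ s) LAB≡ ; DST≡ = trans (frame c #DST k₃ s) DST≡
      ; T≡ = trans (frame c #T k₄ s) T≡ ; T₂≡ = trans (frame c #T₂ k₅ s) T₂≡ ; T₃≡ = trans (frame c #T₃ k₆ s) T₃≡
      ; M≡ = trans (cong (λ f → f 0) (frame c #count k₇ s)) M≡ }
      where open Static st

    edges-frame : ∀ c → T (keeps c #U) → T (keeps c #V) → T (keeps c #L) → ∀ {G} s → Edges G s → Edges G (eval c s)
    edges-frame c k₁ k₂ k₃ {G} s ed = record
      { held = holds-cong G (λ e _ → cong₂ _,_ (cong (λ f → f e) (frame c #U k₁ s)) (cong (λ f → f e) (frame c #V k₂ s))) held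
      ; L≡ = trans (cong (λ f → f 0) (frame c #L k₃ s)) L≡ }
      where open Edges ed

    at-frame : ∀ c → T (keeps c #i) → T (keeps c #j) → T (keeps c #k) → ∀ {i j k} s → At i j k s → At i j k (eval c s)
    at-frame c k₁ k₂ k₃ s at = record
      { i≡ = trans (cong (λ f → f 0) (frame c #i k₁ s)) i≡
      ; j≡ = trans (cong (λ f → f 0) (frame c #j k₂ s)) j≡
      ; k≡ = trans (cong (λ f → f 0) (frame c #k k₃ s)) k≡ }
      where open At at

    code≡ : ∀ {s} → Static s → ∀ {f g h : ℕ → ℕ} {a b c x y z} → arrays s a ≡ f → arrays s b ≡ g → arrays s c ≡ h →
      ∀ {x′ y′ z′} → scalar s x ≡ x′ → scalar s y ≡ y′ → scalar s z ≡ z′ →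
      ⟦ codeOf (a ⟪ val x ⟫) (b ⟪ val y ⟫) (c ⟪ val z ⟫) ⟧ (arrays s) ≡ code (f x′) (g y′) (h z′)
    code≡ {s} st {a = a} {b} {c} {x} {y} {z} a≡ b≡ c≡ x≡ y≡ z≡ =
      cong₂ _+_ (cong₂ _+_ (lookup a≡ x≡ T≡) (lookup b≡ y≡ T₂≡)) (lookup c≡ z≡ T₃≡)
      where
      open Static st
      lookup : ∀ {a x n} {f u tt : ℕ → ℕ} → arrays s a ≡ f → scalar s x ≡ n → u ≡ tt → u (arrays s a (scalar s x)) ≡ tt (f n)
      lookup refl refl refl = refl

    push-edge : ∀ {G U V L′ e} s s′ → Edges G s → arrays s′ #U ≡ arrays s #U [ scalar s #L ]≔ U → arrays s′ #V ≡ arrays s #V [ scalar s #L ]≔ V →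
      scalar s′ #L ≡ L′ → L′ ≡ scalar s #L + 1 → (U , V) ≡ e → Edges (e ∷ G) s′
    push-edge {G} {U} {V} s s′ ed U≡ V≡ refl L′≡ refl = record
      { held = cong₂ _,_ (trans (cong (λ f → f (length G)) U≡) (≔-at (arrays s #U) U L≡))
                         (trans (cong (λ f → f (length G)) V≡) (≔-at (arrays s #V) V L≡))
             , holds-cong G (λ e e<G → let e≢ = λ eq → <-irrefl (trans eq L≡) e<G in
                 cong₂ _,_ (trans (cong (λ f → f e) U≡) (≔-other (arrays s #U) U e≢))
                           (trans (cong (λ f → f e) V≡) (≔-other (arrays s #V) V e≢))) held
      ; L≡ = trans L′≡ (trans (cong (_+ 1) L≡) (+-comm _ 1)) }
      where open Edges ed

    emit-step : ∀ {i j k G} s → Static s → At i j k s → Edges G s → Edges (stepEdge i j k ∷ G) (eval emitStep s)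
    emit-step s st at ed = push-edge s (eval emitStep s) ed refl refl refl refl
      (cong₂ _,_ (code≡ st {a = #SRC} {#SRC} {#SRC} {#i} {#j} {#k} SRC≡ SRC≡ SRC≡ i≡ j≡ k≡)
                 (code≡ st {a = #DST} {#DST} {#DST} {#i} {#j} {#k} DST≡ DST≡ DST≡ i≡ j≡ k≡))
      where
      open Static st
      open At at

    emit-reset : ∀ {i j k G} s → Static s → At i j k s → Edges G s → Edges (resetEdge i k ∷ G) (eval emitReset s)
    emit-reset s st at ed = push-edge s (eval emitReset s) ed refl refl refl refl
      (cong₂ _,_ (code≡ st {a = #SRC} {#SRC} {#SRC} {#i} {#k} {#k} SRC≡ SRC≡ SRC≡ i≡ k≡ k≡)
                 (code≡ st {a = #DST} {#DST} {#DST} {#i} {#i} {#k} DST≡ DST≡ DST≡ i≡ i≡ k≡))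
      where
      open Static st
      open At at

    label : ∀ {s} → Static s → ∀ a {n} → scalar s a ≡ n → arrays s #LAB (scalar s a) ≡ lab n
    label st a refl = cong (λ f → f _) (Static.LAB≡ st)

    labels? : ∀ i j k → Dec (Labels i j k)
    labels? i j k = (lab i ≟ lab j) ×-dec (lab j ≟ lab k)

    letters? : ∀ i k → Dec (Letters i k)
    letters? i k with lab i ≟ lab k | lab i ≟ 0
    ... | yes p | no  q = yes (p , q)
    ... | yes p | yes q = no λ (_ , ¬q) → ¬q q
    ... | no ¬p | _     = no λ (p , _) → ¬p p

    sameLabels≡ : ∀ {i j k} s → Static s → At i j k s → ⟦ sameLabels ⟧ (arrays s)
      ≡ 1 ∸ ((lab i ∸ lab j) + (lab j ∸ lab i) + ((lab j ∸ lab k) + (lab k ∸ lab j)))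
    sameLabels≡ s st at = cong₃ (λ x y z → 1 ∸ ((x ∸ y) + (y ∸ x) + ((y ∸ z) + (z ∸ y)))) (label st #i i≡) (label st #j j≡) (label st #k k≡)
      where
      open At at
      cong₃ : ∀ (f : ℕ → ℕ → ℕ → ℕ) {a a′ b b′ c c′} → a ≡ a′ → b ≡ b′ → c ≡ c′ → f a b c ≡ f a′ b′ c′
      cong₃ f refl refl refl = refl

    sameLetter≡ : ∀ {i j k} s → Static s → At i j k s → ⟦ sameLetter ⟧ (arrays s)
      ≡ 1 ∸ ((lab i ∸ lab k) + (lab k ∸ lab i) + (1 ∸ lab i))
    sameLetter≡ s st at = cong₂ (λ x z → 1 ∸ ((x ∸ z) + (z ∸ x) + (1 ∸ x))) (label st #i i≡) (label st #k k≡)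
      where open At at

    -- `P` describes the triples of table indices already treated and `n` counts them, which gives
    -- the bound `2 * n` on the number of edges.
    record Progress (P : ℕ → ℕ → ℕ → Set) (n : ℕ) (s : Env) : Set where
      field
        {edges}  : List (ℕ × ℕ)
        stored   : Edges edges s
        size     : length edges ≤ 2 * n
        sound    : All Emits edges
        complete : ∀ {i j k} → i < M → j < M → k < M → P i j k →
                   (Labels i j k → stepEdge i j k ∈ edges) × (Letters i k → resetEdge i k ∈ edges)

    record Extended (G₀ : List (ℕ × ℕ)) (L : Set) (e : ℕ × ℕ) (c : Cmd) (b : ℕ) (s : Env) : Set where
      field
        {edges}  : List (ℕ × ℕ)
        stored   : Edges edges (eval c s)
        size     : length edges ≤ suc (length G₀)
        sound    : All Emits edges
        old      : ∀ {e} → e ∈ G₀ → e ∈ edges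
        new      : L → e ∈ edges
        bound    : cost c s ≤ b

    extend : ∀ {G e L} c x s → Dec L → Edges G s → All Emits G →
      (L → ⟦ x ⟧ (arrays s) ≡ 1) → (¬ L → ⟦ x ⟧ (arrays s) ≡ 0) → (L → Emits e) → (Edges G s → Edges (e ∷ G) (eval c s)) →
      Extended G L e (loop x c) (sizeExp x + (6 + cost c s)) s
    extend {G} {e} c x s (yes l) stored sound one _ emits emit = record
      { edges  = e ∷ G
      ; stored = subst (Edges (e ∷ G)) (sym (loop-once x c s (one l))) (emit stored)
      ; size   = ≤-refl
      ; sound  = emits l ∷ sound
      ; old    = there
      ; new    = λ _ → here refl
      ; bound  = ≤-reflexive (cost-once x c s (one l))
      }
    extend {G} {e} c x s (no ¬l) stored sound _ none _ _ = record
      { edges  = G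
      ; stored = subst (Edges G) (sym (loop-skip x c s (none ¬l))) stored
      ; size   = n≤1+n _
      ; sound  = sound
      ; old    = λ e∈ → e∈
      ; new    = λ l → contradiction l ¬l
      ; bound  = ≤-trans (≤-reflexive (cost-skip x c s (none ¬l))) (+-monoʳ-≤ (sizeExp x) (≤-trans (≤ᵇ⇒≤ 3 6 tt) (m≤m+n 6 _)))
      }

    extend-step : ∀ {i j k G} s → i < M → j < M → k < M → Static s → At i j k s → Edges G s → All Emits G →
      Extended G (Labels i j k) (stepEdge i j k) (loop sameLabels emitStep) (sizeExp sameLabels + (6 + cost emitStep s)) s
    extend-step {i} {j} {k} s i<M j<M k<M st at stored sound = extend emitStep sameLabels s (labels? i j k) stored sound
      (λ (p , q) → trans (sameLabels≡ s st at) (cong₂ (λ a b → 1 ∸ (a + b)) (agree≡0 (lab i) (lab j) p) (agree≡0 (lab j) (lab k) q)))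
      (λ ¬labels → trans (sameLabels≡ s st at) (m≤n⇒m∸n≡0 (positive ¬labels)))
      (λ l → inj₁ (i , j , k , i<M , j<M , k<M , l , refl))
      (emit-step s st at)
      where
      positive : ¬ Labels i j k → 1 ≤ (lab i ∸ lab j) + (lab j ∸ lab i) + ((lab j ∸ lab k) + (lab k ∸ lab j))
      positive ¬labels with lab i ≟ lab j
      ... | no  p = ≤-trans (differ (lab i) (lab j) p) (m≤m+n (lab i ∸ lab j + (lab j ∸ lab i)) (lab j ∸ lab k + (lab k ∸ lab j)))
      ... | yes p = ≤-trans (differ (lab j) (lab k) (λ q → ¬labels (p , q))) (m≤n+m _ (lab i ∸ lab j + (lab j ∸ lab i)))

    extend-reset : ∀ {i j k G} s → i < M → k < M → Static s → At i j k s → Edges G s → All Emits G →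
      Extended G (Letters i k) (resetEdge i k) (loop sameLetter emitReset) (sizeExp sameLetter + (6 + cost emitReset s)) s
    extend-reset {i} {j} {k} s i<M k<M st at stored sound = extend emitReset sameLetter s (letters? i k) stored sound
      (λ (p , q) → trans (sameLetter≡ s st at) (cong₂ (λ a b → 1 ∸ (a + b)) (agree≡0 (lab i) (lab k) p) (m≤n⇒m∸n≡0 (n≢0⇒n>0 q))))
      (λ ¬letters → trans (sameLetter≡ s st at) (m≤n⇒m∸n≡0 (positive ¬letters)))
      (λ l → inj₂ (i , k , i<M , k<M , l , refl))
      (emit-reset s st at)
      where
      positive : ¬ Letters i k → 1 ≤ (lab i ∸ lab k) + (lab k ∸ lab i) + (1 ∸ lab i)
      positive ¬letters with lab i ≟ lab k | lab i ≟ 0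
      ... | no  p | _     = ≤-trans (differ (lab i) (lab k) p) (m≤m+n (lab i ∸ lab k + (lab k ∸ lab i)) (1 ∸ lab i))
      ... | yes p | no  q = contradiction (p , q) ¬letters
      ... | yes p | yes q = ≤-trans (≤-reflexive (cong (1 ∸_) (sym q))) (m≤n+m (1 ∸ lab i) (lab i ∸ lab k + (lab k ∸ lab i)))

    record Inner (P : ℕ → ℕ → ℕ → Set) (n i j k : ℕ) (s : Env) : Set where
      constructor inner
      field
        static   : Static s
        position : At i j k s
        progress : Progress P n s

    Including : (ℕ → ℕ → ℕ → Set) → ℕ → ℕ → ℕ → ℕ → ℕ → ℕ → Set
    Including P i j k i′ j′ k′ = P i′ j′ k′ ⊎ (i′ ≡ i × j′ ≡ j × k′ ≡ k)

    emitCost : ℕ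
    emitCost = sizeExp sameLabels + (6 + cost emitStep (initial []))
             + ((sizeExp sameLetter + (6 + cost emitReset (initial []))) + 22)

    inner-step : ∀ {P n i j k} s → i < M → j < M → k < M → Inner P n i j k s →
      Inner (Including P i j k) (suc n) i j (suc k) (eval (loop sameLabels emitStep ∙ loop sameLetter emitReset ∙ advance) s)
      × cost (loop sameLabels emitStep ∙ loop sameLetter emitReset ∙ advance) s ≤ emitCost
    inner-step {P} {n} {i} {j} {k} s i<M j<M k<M (inner st at prog) =
      let module P₀ = Progress prog
          x₁ = extend-step s i<M j<M k<M st at P₀.stored P₀.sound
          s₁ = eval (loop sameLabels emitStep) s
          st₁ = static-frame (loop sameLabels emitStep) tt tt tt tt tt tt tt s st
          at₁ = at-frame (loop sameLabels emitStep) tt tt tt s at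
          x₂ = extend-reset s₁ i<M k<M st₁ at₁ (Extended.stored x₁) (Extended.sound x₁)
          s₂ = eval (loop sameLetter emitReset) s₁
          st₂ = static-frame (loop sameLetter emitReset) tt tt tt tt tt tt tt s₁ st₁
          at₂ = at-frame (loop sameLetter emitReset) tt tt tt s₁ at₁
      in eval-∙ Goal (loop sameLabels emitStep) (loop sameLetter emitReset ∙ advance) s
           (eval-∙ Goal (loop sameLetter emitReset) advance s₁ (conclude s₂ st₂ at₂ record
             { edges = Extended.edges x₂
             ; stored = Extended.stored x₂
             ; size = ≤-trans (Extended.size x₂) (≤-trans (s≤s (Extended.size x₁)) (≤-trans (s≤s (s≤s P₀.size)) (≤-reflexive (sym (*-suc 2 n)))))
             ; sound = Extended.sound x₂
             ; complete = complete P₀.complete (Extended.old x₁) (Extended.new x₁) (Extended.old x₂) (Extended.new x₂)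
             }))
       , cost-∙ (loop sameLabels emitStep) (loop sameLetter emitReset ∙ advance) s (Extended.bound x₁)
           (cost-∙ (loop sameLetter emitReset) advance s₁ {n = 22} (Extended.bound x₂) ≤-refl)
      where
      Goal = Inner (Including P i j k) (suc n) i j (suc k)
      conclude : ∀ s → Static s → At i j k s → Progress (Including P i j k) (suc n) s → Goal (eval advance s)
      conclude s st at prog = inner (static-frame advance tt tt tt tt tt tt tt s st)
        (record { i≡ = At.i≡ at ; j≡ = At.j≡ at ; k≡ = trans (cong (_+ 1) (At.k≡ at)) (+-comm k 1) })
        (record { stored = edges-frame advance tt tt tt s stored ; size = size ; sound = sound ; complete = complete })
        where open Progress prog
      complete : ∀ {G₀ G₁ G₂ : List (ℕ × ℕ)} →
        (∀ {i j k} → i < M → j < M → k < M → P i j k → (Labels i j k → stepEdge i j k ∈ G₀) × (Letters i k → resetEdge i k ∈ G₀)) →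
        (∀ {e} → e ∈ G₀ → e ∈ G₁) → (Labels i j k → stepEdge i j k ∈ G₁) →
        (∀ {e} → e ∈ G₁ → e ∈ G₂) → (Letters i k → resetEdge i k ∈ G₂) →
        ∀ {i′ j′ k′} → i′ < M → j′ < M → k′ < M → Including P i j k i′ j′ k′ →
        (Labels i′ j′ k′ → stepEdge i′ j′ k′ ∈ G₂) × (Letters i′ k′ → resetEdge i′ k′ ∈ G₂)
      complete done old₁ new₁ old₂ new₂ a b c (inj₁ p) = let x , y = done a b c p in (λ l → old₂ (old₁ (x l))) , (λ l → old₂ (old₁ (y l)))
      complete done old₁ new₁ old₂ new₂ a b c (inj₂ (refl , refl , refl)) = (λ l → old₂ (new₁ l)) , new₂

    Before : ℕ → ℕ → ℕ → ℕ → ℕ → ℕ → Set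
    Before i j k i′ j′ k′ = i′ < i ⊎ (i′ ≡ i × (j′ < j ⊎ (j′ ≡ j × k′ < k)))

    inner-weaken : ∀ {P Q n n′ i j k s} → n ≤ n′ → (∀ {i′ j′ k′} → i′ < M → j′ < M → k′ < M → Q i′ j′ k′ → P i′ j′ k′) →
      Inner P n i j k s → Inner Q n′ i j k s
    inner-weaken n≤n′ Q⊆P (inner st at prog) = inner st at (record
      { stored = stored ; size = ≤-trans size (*-monoʳ-≤ 2 n≤n′) ; sound = sound
      ; complete = λ a b c q → complete a b c (Q⊆P a b c q) })
      where open Progress prog

    private
      moved : ∀ c {P n i j k i′ j′ k′} → T (keeps c #SRC) → T (keeps c #LAB) → T (keeps c #DST) → T (keeps c #T) → T (keeps c #T₂) →
        T (keeps c #T₃) → T (keeps c #count) → T (keeps c #U) → T (keeps c #V) → T (keeps c #L) → ∀ s →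
        At i′ j′ k′ (eval c s) → Inner P n i j k s → Inner P n i′ j′ k′ (eval c s)
      moved c k₁ k₂ k₃ k₄ k₅ k₆ k₇ k₈ k₉ k₁₀ s at′ (inner st at prog) = inner (static-frame c k₁ k₂ k₃ k₄ k₅ k₆ k₇ s st) at′
        (record { stored = edges-frame c k₈ k₉ k₁₀ s stored ; size = size ; sound = sound ; complete = complete })
        where open Progress prog

    reset-k : ∀ {P n i j k} s → Inner P n i j k s → Inner P n i j 0 (eval (#k := lit 0) s)
    reset-k s x@(inner _ at _) = moved (#k := lit 0) tt tt tt tt tt tt tt tt tt tt s
      (record { i≡ = At.i≡ at ; j≡ = At.j≡ at ; k≡ = refl }) x

    reset-j : ∀ {P n i j k} s → Inner P n i j k s → Inner P n i 0 k (eval (#j := lit 0) s)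
    reset-j s x@(inner _ at _) = moved (#j := lit 0) tt tt tt tt tt tt tt tt tt tt s
      (record { i≡ = At.i≡ at ; j≡ = refl ; k≡ = At.k≡ at }) x

    next-j : ∀ {P n i j k} s → Inner P n i j k s → Inner P n i (suc j) k (eval (#j := val #j ⊕ lit 1) s)
    next-j {j = j} s x@(inner _ at _) = moved (#j := val #j ⊕ lit 1) tt tt tt tt tt tt tt tt tt tt s
      (record { i≡ = At.i≡ at ; j≡ = trans (cong (_+ 1) (At.j≡ at)) (+-comm j 1) ; k≡ = At.k≡ at }) x

    next-i : ∀ {P n i j k} s → Inner P n i j k s → Inner P n (suc i) j k (eval (#i := val #i ⊕ lit 1) s)
    next-i {i = i} s x@(inner _ at _) = moved (#i := val #i ⊕ lit 1) tt tt tt tt tt tt tt tt tt tt s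
      (record { i≡ = trans (cong (_+ 1) (At.i≡ at)) (+-comm i 1) ; j≡ = At.j≡ at ; k≡ = At.k≡ at }) x

    Mid : ℕ → ℕ → ℕ → Env → Set
    Mid n i j s = ∃[ k ] Inner (Before i j 0) (n + j * M) i j k s

    Out : ℕ → Env → Set
    Out i s = ∃[ j ] ∃[ k ] Inner (Before i 0 0) (i * (M * M)) i j k s

    midCost outCost : ℕ
    midCost = 11 + ((13 + M * (emitCost + 3)) + 22)
    outCost = 11 + ((13 + M * (midCost + 3)) + 22)

    inner-loop : ∀ {n i j} s → i < M → j < M → Inner (Before i j 0) n i j 0 s →
      Inner (Before i j M) (n + M) i j M (eval (loop (val #count) innerBody) s)
      × cost (loop (val #count) innerBody) s ≤ 13 + M * (emitCost + 3)
    inner-loop {n} {i} {j} s i<M j<M start = loop-rule (val #count) innerBody (λ k s → Inner (Before i j k) (n + k) i j k s) M emitCost s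
      (Static.M≡ (Inner.static start))
      (λ k s k<M inv → let inv′ , bound = inner-step s i<M j<M k<M inv in
        inner-weaken (≤-reflexive (sym (+-suc n k))) (λ _ _ _ → split k) inv′ , bound)
      (inner-weaken (≤-reflexive (sym (+-identityʳ n))) (λ _ _ _ b → b) start)
      where
      split : ∀ k {i′ j′ k′} → Before i j (suc k) i′ j′ k′ → Including (Before i j k) i j k i′ j′ k′
      split k (inj₁ lt) = inj₁ (inj₁ lt)
      split k (inj₂ (eq , inj₁ lt)) = inj₁ (inj₂ (eq , inj₁ lt))
      split k (inj₂ (refl , inj₂ (refl , lt))) with m≤n⇒m<n∨m≡n (s≤s⁻¹ lt)
      ... | inj₁ k′<k = inj₁ (inj₂ (refl , inj₂ (refl , k′<k)))
      ... | inj₂ refl = inj₂ (refl , refl , refl)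

    mid-step : ∀ {n i} j s → i < M → j < M → Mid n i j s → Mid n i (suc j) (eval middleBody s) × cost middleBody s ≤ midCost
    mid-step {n} {i} j s i<M j<M (k , inv) =
      let s₁ = eval (#k := lit 0) s
          inv₂ , bound = inner-loop s₁ i<M j<M (reset-k s inv)
          s₂ = eval (loop (val #count) innerBody) s₁
          inv₃ = next-j s₂ (inner-weaken (≤-reflexive (lemma n j M)) (λ _ _ k′<M → split k′<M) inv₂)
      in eval-∙ (Mid n i (suc j)) (#k := lit 0) (loop (val #count) innerBody ∙ #j := val #j ⊕ lit 1) s
           (eval-∙ (Mid n i (suc j)) (loop (val #count) innerBody) (#j := val #j ⊕ lit 1) s₁ (M , inv₃))
       , cost-∙ (#k := lit 0) (loop (val #count) innerBody ∙ #j := val #j ⊕ lit 1) s {11} ≤-refl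
           (cost-∙ (loop (val #count) innerBody) (#j := val #j ⊕ lit 1) s₁ {n = 22} bound ≤-refl)
      where
      lemma : ∀ n j M → n + j * M + M ≡ n + suc j * M
      lemma = solve-∀
      split : ∀ {i′ j′ k′} → k′ < M → Before i (suc j) 0 i′ j′ k′ → Before i j M i′ j′ k′
      split k′<M (inj₁ lt) = inj₁ lt
      split k′<M (inj₂ (refl , inj₁ lt)) with m≤n⇒m<n∨m≡n (s≤s⁻¹ lt)
      ... | inj₁ j′<j = inj₂ (refl , inj₁ j′<j)
      ... | inj₂ refl = inj₂ (refl , inj₂ (refl , k′<M))
      split k′<M (inj₂ (_ , inj₂ (_ , ())))

    out-step : ∀ i s → i < M → Out i s → Out (suc i) (eval outerBody s) × cost outerBody s ≤ outCost
    out-step i s i<M (j , k , inv) =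
      let s₁ = eval (#j := lit 0) s
          inv₁ = reset-j s inv
          (k′ , inv₂) , bound = loop-rule (val #count) middleBody (Mid (i * (M * M)) i) M midCost s₁
            (Static.M≡ (Inner.static inv₁)) (λ j s j<M → mid-step j s i<M j<M)
            (k , inner-weaken (≤-reflexive (sym (+-identityʳ (i * (M * M))))) (λ _ _ _ b → b) inv₁)
          s₂ = eval (loop (val #count) middleBody) s₁
          inv₃ = next-i s₂ (inner-weaken (≤-reflexive (lemma i M)) (λ _ j′<M _ → split j′<M) inv₂)
      in eval-∙ (Out (suc i)) (#j := lit 0) (loop (val #count) middleBody ∙ #i := val #i ⊕ lit 1) s
           (eval-∙ (Out (suc i)) (loop (val #count) middleBody) (#i := val #i ⊕ lit 1) s₁ (M , k′ , inv₃))
       , cost-∙ (#j := lit 0) (loop (val #count) middleBody ∙ #i := val #i ⊕ lit 1) s {11} ≤-refl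
           (cost-∙ (loop (val #count) middleBody) (#i := val #i ⊕ lit 1) s₁ {n = 22} bound ≤-refl)
      where
      lemma : ∀ i M → i * (M * M) + M * M ≡ suc i * (M * M)
      lemma = solve-∀
      split : ∀ {i′ j′ k′} → j′ < M → Before (suc i) 0 0 i′ j′ k′ → Before i M 0 i′ j′ k′
      split j′<M (inj₁ lt) with m≤n⇒m<n∨m≡n (s≤s⁻¹ lt)
      ... | inj₁ i′<i = inj₁ i′<i
      ... | inj₂ refl = inj₂ (refl , inj₁ j′<M)
      split j′<M (inj₂ (_ , inj₁ ()))
      split j′<M (inj₂ (_ , inj₂ (_ , ())))

    record Product (s : Env) : Set where
      field
        {edges} : List (ℕ × ℕ)
        static  : Static s
        stored  : Edges edges s
        size    : length edges ≤ 2 * (M * (M * M))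
        sound   : All Emits edges
        steps   : ∀ {i j k} → i < M → j < M → k < M → Labels i j k → stepEdge i j k ∈ edges
        resets  : ∀ {i k} → i < M → k < M → Letters i k → resetEdge i k ∈ edges

    emit-correct : ∀ s → Static s → scalar s #L ≡ 0 →
      Product (eval (#i := lit 0 ∙ loop (val #count) outerBody) s)
      × cost (#i := lit 0 ∙ loop (val #count) outerBody) s ≤ 11 + (13 + M * (outCost + 3))
    emit-correct s st L≡0 =
      let s₁ = eval (#i := lit 0) s
          st₁ = static-frame (#i := lit 0) tt tt tt tt tt tt tt s st
          (_ , _ , inv) , bound = loop-rule (val #count) outerBody Out M outCost s₁ (Static.M≡ st₁) (λ i s i<M → out-step i s i<M)
            (_ , _ , inner st₁ (record { i≡ = refl ; j≡ = refl ; k≡ = refl })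
                       (record { edges = [] ; stored = record { held = tt ; L≡ = L≡0 } ; size = z≤n ; sound = []
                               ; complete = λ { _ _ _ (inj₁ ()) ; _ _ _ (inj₂ (_ , inj₁ ())) ; _ _ _ (inj₂ (_ , inj₂ (_ , ()))) } }))
      in eval-∙ Product (#i := lit 0) (loop (val #count) outerBody) s (conclude inv)
       , cost-∙ (#i := lit 0) (loop (val #count) outerBody) s {11} ≤-refl bound
      where
      conclude : ∀ {j k s} → Inner (Before M 0 0) (M * (M * M)) M j k s → Product s
      conclude (inner st _ prog) = record
        { static = st ; stored = stored ; size = size ; sound = sound
        ; steps  = λ a b c → proj₁ (complete a b c (inj₁ a))
        -- Every `j` emits the reset edge of `i` and `k`; `j = i` is as good as any.
        ; resets = λ {i} {k} a c → proj₂ (complete a a c (inj₁ a)) }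
        where open Progress prog

-- Counting with duplicate-free lists

module Counting where

  open import Data.Fin using (Fin; zero; suc; fromℕ<)
  open import Data.Fin.Properties using (injective⇒≤; fromℕ<-injective)
  open import Data.List using (List; []; _∷_; length; map; filter; deduplicate; lookup)
  open import Data.List.Membership.Propositional using (_∈_)
  open import Data.List.Membership.Propositional.Properties
    using (∈-map⁺; ∈-map⁻; ∈-filter⁻; ∈-deduplicate⁺; ∈-deduplicate⁻; ∈-lookup)
  open import Data.List.Relation.Unary.All as All using (All; []; _∷_)
  import Data.List.Relation.Unary.All.Properties as All
  open import Data.List.Relation.Unary.AllPairs using ([]; _∷_)
  open import Data.List.Relation.Unary.Any using (here; there)
  open import Data.List.Relation.Unary.Unique.Propositional using (Unique)
  open import Data.List.Relation.Unary.Unique.Propositional.Properties using (filter⁺)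
  import Data.List.Relation.Unary.Unique.DecPropositional.Properties as Dedup
  open import Data.Nat
  open import Data.Nat.Properties
  open import Data.Product using (∃-syntax; _×_; _,_; proj₁; proj₂)
  open import Data.Sum using (_⊎_; inj₁; inj₂)
  open import Function using (_∘_)
  open import Relation.Binary.Definitions using (DecidableEquality)
  open import Relation.Binary.PropositionalEquality
  open import Relation.Nullary using (¬_; yes; no; contradiction; ¬?)
  open import Relation.Unary using (Decidable)

  -- Cardinality is bounded through lists of distinct members, so that `P` need be neither decidable
  -- nor enumerated; sets of runs are counted without listing them.
  AtMost : {A : Set} → ℕ → (A → Set) → Set
  AtMost n P = ∀ l → Unique l → All P l → length l ≤ n

  lookup-injective : ∀ {A : Set} {l : List A} → Unique l → ∀ i j → lookup l i ≡ lookup l j → i ≡ j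
  lookup-injective (_  ∷ _) zero    zero    eq = refl
  lookup-injective (x∉ ∷ _) zero    (suc j) eq = contradiction eq (All.lookup x∉ (∈-lookup j))
  lookup-injective (x∉ ∷ _) (suc i) zero    eq = contradiction (sym eq) (All.lookup x∉ (∈-lookup i))
  lookup-injective (_  ∷ u) (suc i) (suc j) eq = cong suc (lookup-injective u i j eq)

  atMost-Fin : ∀ {A : Set} {P : A → Set} {n} (f : ∀ a → P a → Fin n) →
    (∀ {a b} p q → f a p ≡ f b q → a ≡ b) → AtMost n P
  atMost-Fin f f-inj l l! ps =
    injective⇒≤ {f = λ i → f (lookup l i) (All.lookup ps (∈-lookup i))}
      λ {i} {j} eq → lookup-injective l! i j (f-inj _ _ eq)

  atMost-< : ∀ n → AtMost n (_< n)
  atMost-< n = atMost-Fin (λ _ a<n → fromℕ< a<n) λ p q → fromℕ<-injective _ _ p q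

  atMost-one : ∀ {A : Set} {P : A → Set} → (∀ {a b} → P a → P b → a ≡ b) → AtMost 1 P
  atMost-one unique []          _              _             = z≤n
  atMost-one unique (_ ∷ [])    _              _             = s≤s z≤n
  atMost-one unique (_ ∷ _ ∷ _) ((a≢b ∷ _) ∷ _) (pa ∷ pb ∷ _) = contradiction (unique pa pb) a≢b

  -- The empty set satisfies every bound, so the proof of a bound may use whatever the existence of
  -- one member entails.
  atMost-witness : ∀ {A : Set} {P : A → Set} {n} → (∀ a → P a → AtMost n P) → AtMost n P
  atMost-witness bound []          _  _             = z≤n
  atMost-witness bound l@(a ∷ _) l! ps@(pa ∷ _) = bound a pa l l! ps

  atMost-weaken : ∀ {A : Set} {P Q : A → Set} {m n} → m ≤ n → (∀ {a} → P a → Q a) → AtMost m Q → AtMost n P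
  atMost-weaken m≤n P⊆Q bound l l! ps = ≤-trans (bound l l! (All.map P⊆Q ps)) m≤n

  length-filter-¬ : ∀ {A : Set} {P : A → Set} (P? : Decidable P) l →
    length l ≡ length (filter P? l) + length (filter (¬? ∘ P?) l)
  length-filter-¬ P? []      = refl
  length-filter-¬ P? (x ∷ l) with P? x
  ... | yes _ = cong suc (length-filter-¬ P? l)
  ... | no  _ = trans (cong suc (length-filter-¬ P? l)) (sym (+-suc _ _))

  module _ {A C : Set} (_≟_ : DecidableEquality C) {P : A → Set} {Q : C → Set} (f : A → C) where

    -- Only values satisfying `Q` occur, so `m` bounds the number of nonempty fibres. Splitting a
    -- list into fibres asks for decidable equality of the values, but for nothing about `P`.
    atMost-fibres : ∀ {m n} → (∀ {a} → P a → Q (f a)) → AtMost m Q →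
      (∀ c → Q c → AtMost n (λ a → P a × f a ≡ c)) → AtMost (m * n) P
    atMost-fibres {m} {n} P⇒Q m-bound n-bound l l! ps =
      ≤-trans (covered values l l! ps (λ a∈ → ∈-deduplicate⁺ _≟_ (∈-map⁺ f a∈)) values-Q)
        (*-monoˡ-≤ n (m-bound values (Dedup.deduplicate-! _≟_ (map f l)) (All.tabulate values-Q)))
      where
      values = deduplicate _≟_ (map f l)
      values-Q : ∀ {c} → c ∈ values → Q c
      values-Q c∈ with a , a∈ , refl ← ∈-map⁻ f (∈-deduplicate⁻ _≟_ (map f l) c∈) = P⇒Q (All.lookup ps a∈)

      covered : ∀ cs l → Unique l → All P l → (∀ {a} → a ∈ l → f a ∈ cs) → (∀ {c} → c ∈ cs → Q c) →
        length l ≤ length cs * n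
      covered []       []      l! ps f∈ q = z≤n
      covered []       (a ∷ l) l! ps f∈ q with () ← f∈ (here refl)
      covered (c ∷ cs) l       l! ps f∈ q = begin
        length l                          ≡⟨ length-filter-¬ here? l ⟩
        length (filter here? l) + length (filter (¬? ∘ here?) l)
          ≤⟨ +-mono-≤ (n-bound c (q (here refl)) _ (filter⁺ here? l!)
                        (All.tabulate λ a∈ → let a∈l , eq = ∈-filter⁻ here? a∈ in All.lookup ps a∈l , eq))
                      (covered cs _ (filter⁺ (¬? ∘ here?) l!)
                        (All.tabulate λ a∈ → All.lookup ps (proj₁ (∈-filter⁻ (¬? ∘ here?) a∈)))
                        (λ a∈ → let a∈l , neq = ∈-filter⁻ (¬? ∘ here?) a∈ in later neq (f∈ a∈l))
                        (q ∘ there)) ⟩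
        n + length cs * n                 ∎
        where
        open ≤-Reasoning
        here? = λ a → f a ≟ c
        later : ∀ {a} → f a ≢ c → f a ∈ c ∷ cs → f a ∈ cs
        later neq (here eq) = contradiction eq neq
        later neq (there p) = p

  atMost-⊎ : ∀ {A : Set} {P Q R : A → Set} {m n} → (∀ {a} → P a → Q a ⊎ R a) →
    AtMost m Q → AtMost n R → AtMost (m + n) P
  atMost-⊎ {A} {P} {Q} {R} {m} {n} split Q-bound R-bound l l! ps =
    let l₁ , l₂ , eq , l₁! , l₂! , qs , rs , _ = parts l l! ps
    in ≤-trans (≤-reflexive eq) (+-mono-≤ (Q-bound l₁ l₁! qs) (R-bound l₂ l₂! rs))
    where
    -- The last component expresses that both parts consist of members of `l`; it carries the
    -- freshness of a new head over to the part that receives it.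
    parts : ∀ l → Unique l → All P l → ∃[ l₁ ] ∃[ l₂ ] length l ≡ length l₁ + length l₂
      × Unique l₁ × Unique l₂ × All Q l₁ × All R l₂ × (∀ {X : A → Set} → All X l → All X l₁ × All X l₂)
    parts []      []         []       = [] , [] , refl , [] , [] , [] , [] , λ _ → [] , []
    parts (a ∷ l) (a∉l ∷ l!) (p ∷ ps) with parts l l! ps | split p
    ... | l₁ , l₂ , eq , l₁! , l₂! , qs , rs , sub | inj₁ q =
      a ∷ l₁ , l₂ , cong suc eq , proj₁ (sub a∉l) ∷ l₁! , l₂! , q ∷ qs , rs
      , λ { (x ∷ xs) → x ∷ proj₁ (sub xs) , proj₂ (sub xs) }
    ... | l₁ , l₂ , eq , l₁! , l₂! , qs , rs , sub | inj₂ r =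
      l₁ , a ∷ l₂ , trans (cong suc eq) (sym (+-suc _ _)) , l₁! , proj₂ (sub a∉l) ∷ l₂! , qs , r ∷ rs
      , λ { (x ∷ xs) → proj₁ (sub xs) , x ∷ proj₂ (sub xs) }

  length-filter-< : ∀ {A : Set} {P Q : A → Set} (P? : Decidable P) (Q? : Decidable Q) → (∀ {a} → P a → Q a) →
    ∀ {a} l → a ∈ l → Q a → ¬ P a → length (filter P? l) < length (filter Q? l)
  length-filter-< {P = P} {Q} P? Q? P⊆Q l a∈ q ¬p = go l a∈ q ¬p
    where
    go≤ : ∀ l → length (filter P? l) ≤ length (filter Q? l)
    go≤ []      = z≤n
    go≤ (x ∷ l) with P? x | Q? x
    ... | yes p | yes q = s≤s (go≤ l)
    ... | yes p | no ¬q = contradiction (P⊆Q p) ¬q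
    ... | no  _ | yes q = m≤n⇒m≤1+n (go≤ l)
    ... | no  _ | no  _ = go≤ l
    go : ∀ {a} l → a ∈ l → Q a → ¬ P a → length (filter P? l) < length (filter Q? l)
    go (x ∷ l) (here refl) q ¬p with P? x | Q? x
    ... | yes p | _     = contradiction p ¬p
    ... | no  _ | yes _ = s≤s (go≤ l)
    ... | no  _ | no ¬q = contradiction q ¬q
    go (x ∷ l) (there a∈) q ¬p with P? x | Q? x
    ... | yes p | yes q′ = s≤s (go l a∈ q ¬p)
    ... | yes p | no ¬q = contradiction (P⊆Q p) ¬q
    ... | no  _ | yes _ = m<n⇒m<1+n (go l a∈ q ¬p)
    ... | no  _ | no  _ = go l a∈ q ¬p

  -- Over a finite index set double negation commutes with the quantifier. This lets finitely many
  -- instances of excluded middle be assumed at once in the proof of a stable statement.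
  ¬¬-Fin : ∀ n {P : Fin n → Set} → (∀ i → ¬ ¬ P i) → ¬ ¬ (∀ i → P i)
  ¬¬-Fin zero    p k = k λ ()
  ¬¬-Fin (suc n) p k = p zero λ p₀ → ¬¬-Fin n (p ∘ suc) λ ps → k λ { zero → p₀ ; (suc i) → ps i }

-- Flags and longest walks by relaxation

module LevelsProgram where

  open import Defs using (_[_]≔_)
  open LoopLanguage hiding (At; at; steps)
  open LoopLogic
  open SearchProgram using (val; _:=_; scalar; #out; #N; #count; #i; #j; #SRC; #LAB; #DST; #T; #T₂; #T₃; #VIS; #R)
  open ProductProgram using (codeOf; differ; agree≡0; Tables)
  open import Data.Bool using (T)
  open Counting using (AtMost; atMost-Fin)
  open import Data.Fin using (fromℕ<)
  open import Data.Fin.Properties using (fromℕ<-injective)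
  open import Data.List using (List; []; _∷_; length)
  open import Data.List.Membership.Propositional using (_∈_)
  open import Data.List.Relation.Unary.All as All using (All; []; _∷_)
  open import Data.List.Relation.Unary.AllPairs using ([]; _∷_)
  open import Data.List.Relation.Unary.Any using (here; there)
  open import Data.List.Relation.Unary.Unique.Propositional using (Unique)
  open import Data.Nat
  open import Data.Nat.Properties
  open import Data.List.Membership.DecPropositional _≟_ using (_∈?_)
  open import Data.Product using (Σ; ∃-syntax; _×_; _,_; proj₁; proj₂)
  open import Data.Sum using (_⊎_; inj₁; inj₂)
  open import Data.Unit using (tt)
  open import Function using (_∘_)
  open import Relation.Binary.Construct.Closure.ReflexiveTransitive using (Star; ε; _◅_; _◅◅_)
  open import Relation.Binary.PropositionalEquality
  open import Relation.Nullary using (¬_; Dec; yes; no; contradiction)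

  source target : Exp
  source = #SRC ⟪ val #i ⟫
  target = #SRC ⟪ val #j ⟫

  distance : Exp → Exp → Exp
  distance a b = (a ⊖ b) ⊕ (b ⊖ a)

  -- One minus a sum of four defects: the labels differ, the label is ε, the ends of the reset edge
  -- lie in different components, the two states coincide. The states p and q are the sources of the
  -- entries `i` and `j`.
  flagged : Exp
  flagged = lit 1 ⊖ ( distance (#LAB ⟪ val #i ⟫) (#LAB ⟪ val #j ⟫)
                    ⊕ (lit 1 ⊖ #LAB ⟪ val #i ⟫)
                    ⊕ distance (#VIS ⟪ codeOf source target target ⟫)
                               (#VIS ⟪ codeOf (#DST ⟪ val #i ⟫) (#DST ⟪ val #i ⟫) (#DST ⟪ val #j ⟫) ⟫)
                    ⊕ (lit 1 ⊖ distance source target))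

  -- With truncated subtraction, r + (x - r) is the maximum of r and x.
  relaxStep relaxFlag relaxBody relaxRow relaxRound maxBody : Cmd
  relaxStep = #R ⟪ source ⟫≔ #R ⟪ source ⟫ ⊕ (#R ⟪ #DST ⟪ val #i ⟫ ⟫ ⊖ #R ⟪ source ⟫)
  relaxFlag = #R ⟪ source ⟫≔ #R ⟪ source ⟫ ⊕ ((#R ⟪ target ⟫ ⊕ lit 1) ⊖ #R ⟪ source ⟫)
  relaxBody = relaxStep ∙ loop flagged relaxFlag ∙ #j := val #j ⊕ lit 1
  relaxRow = #j := lit 0 ∙ loop (val #count) relaxBody ∙ #i := val #i ⊕ lit 1
  relaxRound = #i := lit 0 ∙ loop (val #count) relaxRow
  maxBody = #out := val #out ⊕ (#R ⟪ source ⟫ ⊖ val #out) ∙ #i := val #i ⊕ lit 1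

  raise : (ℕ → ℕ) → ℕ → ℕ → ℕ → ℕ
  raise R p c = R [ p ]≔ (R p + (c ∸ R p))

  raise-≥ : ∀ R p c u → R u ≤ raise R p c u
  raise-≥ R p c u with u ≟ p
  ... | yes refl = ≤-trans (m≤m+n (R u) _) (≤-reflexive (sym (≔-same R u _)))
  ... | no  u≢p  = ≤-reflexive (sym (≔-other R _ u≢p))

  raise-at : ∀ R p c → c ≤ raise R p c p
  raise-at R p c = ≤-trans (m≤n+m∸n c (R p)) (≤-reflexive (sym (≔-same R p _)))

  raise-cases : ∀ R p c u → raise R p c u ≡ R u ⊎ (u ≡ p × raise R p c u ≡ c)
  raise-cases R p c u with u ≟ p
  ... | no  u≢p  = inj₁ (≔-other R _ u≢p)
  ... | yes refl with ≤-total c (R u)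
  ...   | inj₁ c≤ = inj₁ (trans (≔-same R u _) (trans (cong (R u +_) (m≤n⇒m∸n≡0 c≤)) (+-identityʳ (R u))))
  ...   | inj₂ ≤c = inj₂ (refl , trans (≔-same R u _) (m+[n∸m]≡n ≤c))

  module Relaxation (tables : Tables) (vis : ℕ → ℕ) (M : ℕ) where
    open Tables tables

    code : ℕ → ℕ → ℕ → ℕ
    code p r q = t p + t₂ r + t₃ q

    Flagged : ℕ → ℕ → Set
    Flagged i j = lab i ≡ lab j × lab i ≢ 0
      × vis (code (src i) (src j) (src j)) ≡ vis (code (dst i) (dst i) (dst j)) × src i ≢ src j

    -- The first index is a weight, so that the weight of a walk counts its flags. Plain arcs come
    -- from table entries and so include the added loops.
    data Arc : ℕ → ℕ → ℕ → Set where
      plain   : ∀ {i} → i < M → Arc 0 (src i) (dst i)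
      special : ∀ {i j} → i < M → j < M → Flagged i j → Arc 1 (src i) (src j)

    infixr 5 _∷_
    data Walk : ℕ → ℕ → ℕ → Set where
      []  : ∀ {u} → Walk 0 0 u
      _∷_ : ∀ {w n k u v} → Arc w u v → Walk n k v → Walk (suc n) (w + k) u

    Realised : ℕ → ℕ → Set
    Realised k u = ∃[ n ] Walk n k u

    flagged? : ∀ i j → Dec (Flagged i j)
    flagged? i j with lab i ≟ lab j | lab i ≟ 0 | vis (code (src i) (src j) (src j)) ≟ vis (code (dst i) (dst i) (dst j)) | src i ≟ src j
    ... | yes a | no b  | yes c | no d  = yes (a , b , c , d)
    ... | no ¬a | _     | _     | _     = no (¬a ∘ proj₁)
    ... | yes _ | yes b | _     | _     = no λ (_ , ¬b , _) → ¬b b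
    ... | yes _ | no _  | no ¬c | _     = no λ (_ , _ , c , _) → ¬c c
    ... | yes _ | no _  | yes _ | yes d = no λ (_ , _ , _ , ¬d) → ¬d d

    record Static (s : Env) : Set where
      field
        SRC≡ : arrays s #SRC ≡ src
        LAB≡ : arrays s #LAB ≡ lab
        DST≡ : arrays s #DST ≡ dst
        T≡   : arrays s #T ≡ t
        T₂≡  : arrays s #T₂ ≡ t₂
        T₃≡  : arrays s #T₃ ≡ t₃
        VIS≡ : ∀ w → arrays s #VIS w ≡ vis w
        M≡   : scalar s #count ≡ M

    static-frame : ∀ c → T (keeps c #SRC) → T (keeps c #LAB) → T (keeps c #DST) → T (keeps c #T) → T (keeps c #T₂) → T (keeps c #T₃) →
      T (keeps c #VIS) → T (keeps c #count) → ∀ s → Static s → Static (eval c s)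
    static-frame c k₁ k₂ k₃ k₄ k₅ k₆ k₇ k₈ s st = record
      { SRC≡ = trans (frame c #SRC k₁ s) SRC≡ ; LAB≡ = trans (frame c #LAB k₂ s) LAB≡ ; DST≡ = trans (frame c #DST k₃ s) DST≡
      ; T≡ = trans (frame c #T k₄ s) T≡ ; T₂≡ = trans (frame c #T₂ k₅ s) T₂≡ ; T₃≡ = trans (frame c #T₃ k₆ s) T₃≡
      ; VIS≡ = λ w → trans (cong (λ f → f w) (frame c #VIS k₇ s)) (VIS≡ w)
      ; M≡ = trans (cong (λ f → f 0) (frame c #count k₈ s)) M≡ }
      where open Static st

    flagValue : (a b c d e f : ℕ) → ℕ
    flagValue a b c d e f = 1 ∸ ((a ∸ b) + (b ∸ a) + (1 ∸ a) + ((c ∸ d) + (d ∸ c)) + (1 ∸ ((e ∸ f) + (f ∸ e))))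

    flagged≡ : ∀ {i j} s → Static s → scalar s #i ≡ i → scalar s #j ≡ j → ⟦ flagged ⟧ (arrays s)
      ≡ flagValue (lab i) (lab j) (vis (code (src i) (src j) (src j))) (vis (code (dst i) (dst i) (dst j))) (src i) (src j)
    flagged≡ {i} {j} s st refl refl = cong₆ flagValue
      (at LAB≡ (scalar s #i)) (at LAB≡ (scalar s #j))
      (visit (cong₃ (at SRC≡ (scalar s #i)) (at SRC≡ (scalar s #j)) (at SRC≡ (scalar s #j))))
      (visit (cong₃ (at DST≡ (scalar s #i)) (at DST≡ (scalar s #i)) (at DST≡ (scalar s #j))))
      (at SRC≡ (scalar s #i)) (at SRC≡ (scalar s #j))
      where
      open Static st
      at : ∀ {f g : ℕ → ℕ} → f ≡ g → ∀ n → f n ≡ g n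
      at eq n = cong (λ f → f n) eq
      visit : ∀ {x y} → x ≡ y → arrays s #VIS x ≡ vis y
      visit {x} refl = VIS≡ x
      cong₃ : ∀ {p p′ q q′ r r′} → p ≡ p′ → q ≡ q′ → r ≡ r′ →
        arrays s #T p + arrays s #T₂ q + arrays s #T₃ r ≡ code p′ q′ r′
      cong₃ {p} {_} {q} {_} {r} refl refl refl = cong₂ _+_ (cong₂ _+_ (at T≡ p) (at T₂≡ q)) (at T₃≡ r)
      cong₆ : ∀ (g : (a b c d e f : ℕ) → ℕ) {a a′ b b′ c c′ d d′ e e′ f f′} → a ≡ a′ → b ≡ b′ → c ≡ c′ → d ≡ d′ → e ≡ e′ → f ≡ f′ →
        g a b c d e f ≡ g a′ b′ c′ d′ e′ f′
      cong₆ g refl refl refl refl refl refl = refl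

    flag-one : ∀ a b c d e f → a ≡ b → a ≢ 0 → c ≡ d → e ≢ f → flagValue a b c d e f ≡ 1
    flag-one a b c d e f a≡b a≢0 c≡d e≢f
      rewrite agree≡0 a b a≡b | agree≡0 c d c≡d | m≤n⇒m∸n≡0 (n≢0⇒n>0 a≢0) | m≤n⇒m∸n≡0 (differ e f e≢f) = refl

    flag-zero : ∀ a b c d e f → ¬ (a ≡ b × a ≢ 0 × c ≡ d × e ≢ f) → flagValue a b c d e f ≡ 0
    flag-zero a b c d e f ¬flag = m≤n⇒m∸n≡0 positive
      where
      w = (a ∸ b) + (b ∸ a)
      x = 1 ∸ a
      y = (c ∸ d) + (d ∸ c)
      z = 1 ∸ ((e ∸ f) + (f ∸ e))
      positive : 1 ≤ w + x + y + z
      positive with a ≟ b | a ≟ 0 | c ≟ d | e ≟ f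
      ... | no p  | _     | _     | _      = ≤-trans (differ a b p) (≤-trans (m≤m+n w x) (≤-trans (m≤m+n (w + x) y) (m≤m+n (w + x + y) z)))
      ... | yes _ | yes q | _     | _      = ≤-trans (≤-reflexive (cong (1 ∸_) (sym q))) (≤-trans (m≤n+m x w) (≤-trans (m≤m+n (w + x) y) (m≤m+n (w + x + y) z)))
      ... | yes _ | no _  | no r  | _      = ≤-trans (differ c d r) (≤-trans (m≤n+m y (w + x)) (m≤m+n (w + x + y) z))
      ... | yes _ | no _  | yes _ | yes t′ = ≤-trans (≤-reflexive (cong (1 ∸_) (sym (agree≡0 e f t′)))) (m≤n+m z (w + x + y))
      ... | yes p | no q  | yes r | no t′  = contradiction (p , q , r , t′) ¬flag

    Before : ℕ → ℕ → ℕ → ℕ → Set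
    Before i j i′ j′ = i′ < i ⊎ (i′ ≡ i × j′ < j)

    -- `R₀` is the table at the start of the round. Updates are made in place and may already use
    -- newer values; as entries only grow, comparison with `R₀` is enough.
    Relaxed : (ℕ → ℕ) → ℕ → ℕ → (ℕ → ℕ) → Set
    Relaxed R₀ i j R = R₀ (dst i) ≤ R (src i) × (Flagged i j → suc (R₀ (src j)) ≤ R (src i))

    record Round (R₀ : ℕ → ℕ) (P : ℕ → ℕ → Set) (i j : ℕ) (s : Env) : Set where
      field
        static : Static s
        i≡     : scalar s #i ≡ i
        j≡     : scalar s #j ≡ j
        sound  : ∀ u → Realised (arrays s #R u) u
        grown  : ∀ u → R₀ u ≤ arrays s #R u
        done   : ∀ {i′ j′} → i′ < M → j′ < M → P i′ j′ → Relaxed R₀ i′ j′ (arrays s #R)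

    private
      raised : ∀ {R₀ P i j p c} s s′ → Round R₀ P i j s → Static s′ → scalar s′ #i ≡ scalar s #i → scalar s′ #j ≡ scalar s #j →
        arrays s′ #R ≡ raise (arrays s #R) p c → Realised c p → Round R₀ P i j s′
      raised {R₀} {p = p} {c} s s′ rnd st i-same j-same R≡ real = record
        { static = st
        ; i≡ = trans i-same i≡
        ; j≡ = trans j-same j≡
        ; sound = λ u → subst (λ f → Realised (f u) u) (sym R≡) (sound′ u)
        ; grown = λ u → ≤-trans (grown u) (above u)
        ; done = λ a b p → let x , y = done a b p in ≤-trans x (above _) , λ f → ≤-trans (y f) (above _)
        }
        where
        open Round rnd
        above : ∀ u → arrays s #R u ≤ arrays s′ #R u
        above u = ≤-trans (raise-≥ (arrays s #R) p c u) (≤-reflexive (cong (λ f → f u) (sym R≡)))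
        sound′ : ∀ u → Realised (raise (arrays s #R) p c u) u
        sound′ u with raise-cases (arrays s #R) p c u
        ... | inj₁ eq          = subst (λ k → Realised k u) (sym eq) (sound u)
        ... | inj₂ (refl , eq) = subst (λ k → Realised k u) (sym eq) real

    relax-step : ∀ {R₀ P i j} s → i < M → Round R₀ P i j s →
      Round R₀ P i j (eval relaxStep s) × R₀ (dst i) ≤ arrays (eval relaxStep s) #R (src i)
    relax-step {R₀} {i = i} s i<M rnd =
        raised s (eval relaxStep s) rnd (static-frame relaxStep tt tt tt tt tt tt tt tt s static) refl refl refl
          (let n , walk = sound (arrays s #DST (scalar s #i)) in suc n , subst₂ (Walk (suc n)) refl (sym src≡) (plain i<M ∷ subst (Walk n _) dst≡ walk))
      , ≤-trans (grown (dst i)) (≤-trans (≤-reflexive (cong (arrays s #R) (sym dst≡)))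
          (≤-trans (raise-at (arrays s #R) (arrays s #SRC (scalar s #i)) _) (≤-reflexive (cong (arrays (eval relaxStep s) #R) src≡))))
      where
      open Round rnd
      open Static static
      src≡ : arrays s #SRC (scalar s #i) ≡ src i
      src≡ = trans (cong (arrays s #SRC) i≡) (cong (λ f → f i) SRC≡)
      dst≡ : arrays s #DST (scalar s #i) ≡ dst i
      dst≡ = trans (cong (arrays s #DST) i≡) (cong (λ f → f i) DST≡)

    relax-flag : ∀ {R₀ P i j} s → i < M → j < M → Flagged i j → Round R₀ P i j s →
      Round R₀ P i j (eval relaxFlag s) × suc (R₀ (src j)) ≤ arrays (eval relaxFlag s) #R (src i)
    relax-flag {R₀} {i = i} {j} s i<M j<M fl rnd =
        raised s (eval relaxFlag s) rnd (static-frame relaxFlag tt tt tt tt tt tt tt tt s static) refl refl refl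
          (let n , walk = sound (arrays s #SRC (scalar s #j)) in
            suc n , subst₂ (Walk (suc n)) (+-comm 1 _) (sym src≡) (special i<M j<M fl ∷ subst (Walk n _) tgt≡ walk))
      , ≤-trans (s≤s (grown (src j))) (≤-trans (≤-reflexive (trans (cong (λ p → suc (arrays s #R p)) (sym tgt≡)) (+-comm 1 _)))
          (≤-trans (raise-at (arrays s #R) (arrays s #SRC (scalar s #i)) _) (≤-reflexive (cong (arrays (eval relaxFlag s) #R) src≡))))
      where
      open Round rnd
      open Static static
      src≡ : arrays s #SRC (scalar s #i) ≡ src i
      src≡ = trans (cong (arrays s #SRC) i≡) (cong (λ f → f i) SRC≡)
      tgt≡ : arrays s #SRC (scalar s #j) ≡ src j
      tgt≡ = trans (cong (arrays s #SRC) j≡) (cong (λ f → f j) SRC≡)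

    flagCost : ℕ
    flagCost = sizeExp flagged + (6 + cost relaxFlag (initial []))

    relax-flagged : ∀ {R₀ P i j} s → i < M → j < M → Round R₀ P i j s → R₀ (dst i) ≤ arrays s #R (src i) →
      Round R₀ P i j (eval (loop flagged relaxFlag) s)
      × Relaxed R₀ i j (arrays (eval (loop flagged relaxFlag) s) #R)
      × cost (loop flagged relaxFlag) s ≤ flagCost
    relax-flagged {R₀} {P} {i} {j} s i<M j<M rnd dst≤ with flagged? i j
    ... | no ¬fl =
      let none = trans (flagged≡ s static i≡ j≡) (flag-zero _ _ _ _ (src i) (src j) ¬fl)
      in subst (λ s′ → Round R₀ P i j s′ × Relaxed R₀ i j (arrays s′ #R) × cost (loop flagged relaxFlag) s ≤ flagCost)
           (sym (loop-skip flagged relaxFlag s none))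
           (rnd , (dst≤ , λ fl → contradiction fl ¬fl)
           , ≤-trans (≤-reflexive (cost-skip flagged relaxFlag s none)) (+-monoʳ-≤ (sizeExp flagged) (≤-trans (≤ᵇ⇒≤ 3 6 tt) (m≤m+n 6 _))))
      where open Round rnd
    ... | yes fl@(a , b , c , d) =
      let one = trans (flagged≡ s static i≡ j≡) (flag-one (lab i) (lab j) _ _ (src i) (src j) a b c d)
          rnd′ , ≤R = relax-flag s i<M j<M fl rnd
      in subst (λ s′ → Round R₀ P i j s′ × Relaxed R₀ i j (arrays s′ #R) × cost (loop flagged relaxFlag) s ≤ flagCost)
           (sym (loop-once flagged relaxFlag s one))
           (rnd′ , (≤-trans dst≤ (subst (arrays s #R (src i) ≤_) refl (raise-≥ (arrays s #R) (arrays s #SRC (scalar s #i)) _ (src i))) , λ _ → ≤R)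
           , ≤-reflexive (cost-once flagged relaxFlag s one))
      where open Round rnd

    Including : (ℕ → ℕ → Set) → ℕ → ℕ → ℕ → ℕ → Set
    Including P i j i′ j′ = P i′ j′ ⊎ (i′ ≡ i × j′ ≡ j)

    round-weaken : ∀ {R₀ P Q i j s} → (∀ {i′ j′} → i′ < M → j′ < M → Q i′ j′ → P i′ j′) → Round R₀ P i j s → Round R₀ Q i j s
    round-weaken Q⊆P rnd = record
      { static = static ; i≡ = i≡ ; j≡ = j≡ ; sound = sound ; grown = grown ; done = λ a b q → done a b (Q⊆P a b q) }
      where open Round rnd

    round-add : ∀ {R₀ P i j s} → Round R₀ P i j s → Relaxed R₀ i j (arrays s #R) → Round R₀ (Including P i j) i j s
    round-add rnd new = record
      { static = static ; i≡ = i≡ ; j≡ = j≡ ; sound = sound ; grown = grown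
      ; done = λ { a b (inj₁ p) → done a b p ; a b (inj₂ (refl , refl)) → new } }
      where open Round rnd

    private
      moved : ∀ c {R₀ P i j i′ j′} → T (keeps c #SRC) → T (keeps c #LAB) → T (keeps c #DST) → T (keeps c #T) → T (keeps c #T₂) →
        T (keeps c #T₃) → T (keeps c #VIS) → T (keeps c #count) → T (keeps c #R) → ∀ s →
        scalar (eval c s) #i ≡ i′ → scalar (eval c s) #j ≡ j′ → Round R₀ P i j s → Round R₀ P i′ j′ (eval c s)
      moved c {R₀} k₁ k₂ k₃ k₄ k₅ k₆ k₇ k₈ k₉ s i′≡ j′≡ rnd = record
        { static = static-frame c k₁ k₂ k₃ k₄ k₅ k₆ k₇ k₈ s static ; i≡ = i′≡ ; j≡ = j′≡
        ; sound = λ u → subst (λ f → Realised (f u) u) (sym R≡) (sound u)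
        ; grown = λ u → subst (λ f → R₀ u ≤ f u) (sym R≡) (grown u)
        ; done = λ {i′} {j′} a b p → subst (Relaxed R₀ i′ j′) (sym R≡) (done a b p) }
        where
        open Round rnd
        R≡ : arrays (eval c s) #R ≡ arrays s #R
        R≡ = frame c #R k₉ s

    next-j : ∀ {R₀ P i j} s → Round R₀ P i j s → Round R₀ P i (suc j) (eval (#j := val #j ⊕ lit 1) s)
    next-j {j = j} s rnd = moved (#j := val #j ⊕ lit 1) tt tt tt tt tt tt tt tt tt s (Round.i≡ rnd)
      (trans (cong (_+ 1) (Round.j≡ rnd)) (+-comm j 1)) rnd

    next-i : ∀ {R₀ P i j} s → Round R₀ P i j s → Round R₀ P (suc i) j (eval (#i := val #i ⊕ lit 1) s)
    next-i {i = i} s rnd = moved (#i := val #i ⊕ lit 1) tt tt tt tt tt tt tt tt tt s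
      (trans (cong (_+ 1) (Round.i≡ rnd)) (+-comm i 1)) (Round.j≡ rnd) rnd

    reset-j : ∀ {R₀ P i j} s → Round R₀ P i j s → Round R₀ P i 0 (eval (#j := lit 0) s)
    reset-j s rnd = moved (#j := lit 0) tt tt tt tt tt tt tt tt tt s (Round.i≡ rnd) refl rnd

    reset-i : ∀ {R₀ P i j} s → Round R₀ P i j s → Round R₀ P 0 j (eval (#i := lit 0) s)
    reset-i s rnd = moved (#i := lit 0) tt tt tt tt tt tt tt tt tt s refl (Round.j≡ rnd) rnd

    bodyCost rowCost roundCost : ℕ
    bodyCost = cost relaxStep (initial []) + (flagCost + 22)
    rowCost = 11 + ((13 + M * (bodyCost + 3)) + 22)
    roundCost = 11 + (13 + M * (rowCost + 3))

    body-step : ∀ {R₀ P i j} s → i < M → j < M → Round R₀ P i j s →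
      Round R₀ (Including P i j) i (suc j) (eval relaxBody s) × cost relaxBody s ≤ bodyCost
    body-step {R₀} {P} {i} {j} s i<M j<M rnd =
      let rnd₁ , dst≤ = relax-step s i<M rnd
          s₁ = eval relaxStep s
          rnd₂ , new , bound = relax-flagged s₁ i<M j<M rnd₁ dst≤
          s₂ = eval (loop flagged relaxFlag) s₁
      in eval-∙ (Round R₀ (Including P i j) i (suc j)) relaxStep (loop flagged relaxFlag ∙ #j := val #j ⊕ lit 1) s
           (eval-∙ (Round R₀ (Including P i j) i (suc j)) (loop flagged relaxFlag) (#j := val #j ⊕ lit 1) s₁
             (next-j s₂ (round-add rnd₂ new)))
       , cost-∙ relaxStep (loop flagged relaxFlag ∙ #j := val #j ⊕ lit 1) s {cost relaxStep (initial [])} ≤-refl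
           (cost-∙ (loop flagged relaxFlag) (#j := val #j ⊕ lit 1) s₁ {n = 22} bound ≤-refl)

    Row : (ℕ → ℕ) → ℕ → Env → Set
    Row R₀ i s = ∃[ j ] Round R₀ (Before i 0) i j s

    row-step : ∀ {R₀} i s → i < M → Row R₀ i s → Row R₀ (suc i) (eval relaxRow s) × cost relaxRow s ≤ rowCost
    row-step {R₀} i s i<M (j , rnd) =
      let s₁ = eval (#j := lit 0) s
          rnd₁ = reset-j s rnd
          rnd₂ , bound = loop-rule (val #count) relaxBody (λ j s → Round R₀ (Before i j) i j s) M bodyCost s₁
            (Static.M≡ (Round.static rnd₁))
            (λ j s j<M rnd → let rnd′ , b = body-step s i<M j<M rnd in round-weaken (λ _ _ → split j) rnd′ , b) rnd₁
          s₂ = eval (loop (val #count) relaxBody) s₁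
      in eval-∙ (Row R₀ (suc i)) (#j := lit 0) (loop (val #count) relaxBody ∙ #i := val #i ⊕ lit 1) s
           (eval-∙ (Row R₀ (suc i)) (loop (val #count) relaxBody) (#i := val #i ⊕ lit 1) s₁
             (M , next-i s₂ (round-weaken (λ _ j′<M → finish j′<M) rnd₂)))
       , cost-∙ (#j := lit 0) (loop (val #count) relaxBody ∙ #i := val #i ⊕ lit 1) s {11} ≤-refl
           (cost-∙ (loop (val #count) relaxBody) (#i := val #i ⊕ lit 1) s₁ {n = 22} bound ≤-refl)
      where
      split : ∀ j {i′ j′} → Before i (suc j) i′ j′ → Including (Before i j) i j i′ j′
      split j (inj₁ lt) = inj₁ (inj₁ lt)
      split j (inj₂ (refl , lt)) with m≤n⇒m<n∨m≡n (s≤s⁻¹ lt)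
      ... | inj₁ j′<j = inj₁ (inj₂ (refl , j′<j))
      ... | inj₂ refl = inj₂ (refl , refl)
      finish : ∀ {i′ j′} → j′ < M → Before (suc i) 0 i′ j′ → Before i M i′ j′
      finish j′<M (inj₁ lt) with m≤n⇒m<n∨m≡n (s≤s⁻¹ lt)
      ... | inj₁ i′<i = inj₁ i′<i
      ... | inj₂ refl = inj₂ (refl , j′<M)
      finish j′<M (inj₂ (_ , ()))

    -- The Bellman-Ford invariant: after `r` rounds an entry is at least the weight of every walk of
    -- at most `r` arcs, and at all times it is the weight of an actual walk, of whatever length.
    record Rounds (r : ℕ) (s : Env) : Set where
      field
        static : Static s
        sound  : ∀ u → Realised (arrays s #R u) u
        longer : ∀ {n k u} → n ≤ r → Walk n k u → k ≤ arrays s #R u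

    round-step : ∀ r s → Rounds r s → Rounds (suc r) (eval relaxRound s) × cost relaxRound s ≤ roundCost
    round-step r s rounds =
      let s₁ = eval (#i := lit 0) s
          rnd₀ = record { static = static ; i≡ = refl ; j≡ = refl ; sound = sound ; grown = λ _ → ≤-refl
                        ; done = λ { _ _ (inj₁ ()) ; _ _ (inj₂ (_ , ())) } }
          rnd₁ = reset-i {R₀ = arrays s #R} {P = Before 0 0} s rnd₀
          (_ , rnd₂) , bound = loop-rule (val #count) relaxRow (Row (arrays s #R)) M rowCost s₁ (Static.M≡ (Round.static rnd₁))
            (λ i s i<M → row-step i s i<M) (_ , rnd₁)
      in eval-∙ (Rounds (suc r)) (#i := lit 0) (loop (val #count) relaxRow) s (conclude rnd₂)
       , cost-∙ (#i := lit 0) (loop (val #count) relaxRow) s {11} ≤-refl bound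
      where
      open Rounds rounds
      conclude : ∀ {j s′} → Round (arrays s #R) (Before M 0) M j s′ → Rounds (suc r) s′
      conclude {s′ = s′} rnd = record { static = Round.static rnd ; sound = Round.sound rnd ; longer = longer′ }
        where
        longer′ : ∀ {n k u} → n ≤ suc r → Walk n k u → k ≤ arrays s′ #R u
        longer′ n≤ []                    = z≤n
        longer′ (s≤s n≤) (plain i<M ∷ w) = ≤-trans (longer n≤ w) (proj₁ (Round.done rnd i<M i<M (inj₁ i<M)))
        longer′ (s≤s n≤) (special i<M j<M fl ∷ w) = ≤-trans (s≤s (longer n≤ w)) (proj₂ (Round.done rnd i<M j<M (inj₁ i<M)) fl)

    rounds-correct : ∀ {N} s → Static s → scalar s #N ≡ N → (∀ u → arrays s #R u ≡ 0) →
      Rounds N (eval (loop (val #N) relaxRound) s) × cost (loop (val #N) relaxRound) s ≤ 13 + N * (roundCost + 3)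
    rounds-correct {N} s st N≡ R≡0 = loop-rule (val #N) relaxRound Rounds N roundCost s N≡ (λ r s _ → round-step r s)
      (record { static = st ; sound = λ u → 0 , subst (λ k → Walk 0 k u) (sym (R≡0 u)) [] ; longer = λ { z≤n [] → z≤n } })

    record Maximum (R : ℕ → ℕ) (i : ℕ) (s : Env) : Set where
      field
        static   : Static s
        i≡       : scalar s #i ≡ i
        R≡       : arrays s #R ≡ R
        above    : ∀ j → j < i → R (src j) ≤ scalar s #out
        attained : scalar s #out ≡ 0 ⊎ (∃[ j ] j < M × R (src j) ≡ scalar s #out)

    max-step : ∀ {R} i s → i < M → Maximum R i s → Maximum R (suc i) (eval maxBody s) × cost maxBody s ≤ cost maxBody (initial [])
    max-step {R} i s i<M mx = record
      { static = static-frame maxBody tt tt tt tt tt tt tt tt s static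
      ; i≡ = trans (cong (_+ 1) i≡) (+-comm i 1)
      ; R≡ = R≡
      ; above = above′
      ; attained = attained′
      } , ≤-refl
      where
      open Maximum mx
      out = scalar s #out
      value≡ : arrays s #R (arrays s #SRC (scalar s #i)) ≡ R (src i)
      value≡ = trans (cong (λ f → f _) R≡) (cong R (trans (cong (arrays s #SRC) i≡) (cong (λ f → f i) (Static.SRC≡ static))))
      out′ = out + (arrays s #R (arrays s #SRC (scalar s #i)) ∸ out)
      above′ : ∀ j → j < suc i → R (src j) ≤ out′
      above′ j j<1+i with m≤n⇒m<n∨m≡n (s≤s⁻¹ j<1+i)
      ... | inj₁ j<i  = ≤-trans (above j j<i) (m≤m+n out _)
      ... | inj₂ refl = ≤-trans (≤-reflexive (sym value≡)) (m≤n+m∸n _ out)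
      attained′ : out′ ≡ 0 ⊎ (∃[ j ] j < M × R (src j) ≡ out′)
      attained′ with ≤-total (arrays s #R (arrays s #SRC (scalar s #i))) out
      ... | inj₂ out≤ = inj₂ (i , i<M , trans (sym value≡) (sym (m+[n∸m]≡n out≤)))
      ... | inj₁ ≤out rewrite m≤n⇒m∸n≡0 ≤out | +-identityʳ out = attained

    max-correct : ∀ s → Static s → scalar s #out ≡ 0 →
      Maximum (arrays s #R) M (eval (#i := lit 0 ∙ loop (val #count) maxBody) s)
      × cost (#i := lit 0 ∙ loop (val #count) maxBody) s ≤ 11 + (13 + M * (cost maxBody (initial []) + 3))
    max-correct s st out≡0 =
      let s₁ = eval (#i := lit 0) s
          st₁ = static-frame (#i := lit 0) tt tt tt tt tt tt tt tt s st
          mx , bound = loop-rule (val #count) maxBody (Maximum (arrays s #R)) M (cost maxBody (initial [])) s₁ (Static.M≡ st₁)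
            (λ i s i<M → max-step i s i<M)
            (record { static = st₁ ; i≡ = refl ; R≡ = refl ; above = λ _ () ; attained = inj₁ out≡0 })
      in eval-∙ (Maximum (arrays s #R) M) (#i := lit 0) (loop (val #count) maxBody) s mx
       , cost-∙ (#i := lit 0) (loop (val #count) maxBody) s {11} ≤-refl bound

    _⇒*_ : ℕ → ℕ → Set
    _⇒*_ = Star (λ u v → ∃[ w ] Arc w u v)

    vertices : ∀ {n k u} → Walk n k u → List ℕ
    vertices []              = []
    vertices (_∷_ {u = u} _ w) = u ∷ vertices w

    length-vertices : ∀ {n k u} (w : Walk n k u) → length (vertices w) ≡ n
    length-vertices []      = refl
    length-vertices (_ ∷ w) = cong suc (length-vertices w)

    arc-source : ∀ {w u v} → Arc w u v → ∃[ i ] i < M × u ≡ src i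
    arc-source (plain i<M)       = _ , i<M , refl
    arc-source (special i<M _ _) = _ , i<M , refl

    module Shortening {N}
        (bounded : ∀ {i} → i < M → t (src i) < N)
        (distinct : ∀ {i j} → i < M → j < M → t (src i) ≡ t (src j) → src i ≡ src j)
        (acyclic : ∀ {i j} → i < M → j < M → Flagged i j → ¬ src j ⇒* src i) where

      -- Cutting a walk at a later visit to x loses weight only if a special arc
      -- lies in the part cut off.
      cut : ∀ {n k v x} (w : Walk n k v) → x ∈ vertices w → Unique (vertices w) →
        ∃[ n′ ] ∃[ k′ ] Σ (Walk n′ k′ x) λ w′ → Unique (vertices w′) × v ⇒* x
          × (k′ ≡ k ⊎ (∃[ i ] ∃[ j ] i < M × j < M × Flagged i j × v ⇒* src i × src j ⇒* x))
      cut w@(_ ∷ _) (here refl) w! = _ , _ , w , w! , ε , inj₁ refl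
      cut (plain i<M ∷ w) (there x∈) (_ ∷ w!) with cut w x∈ w!
      ... | n′ , k′ , w′ , w′! , r , inj₁ eq = n′ , k′ , w′ , w′! , (_ , plain i<M) ◅ r , inj₁ eq
      ... | n′ , k′ , w′ , w′! , r , inj₂ (i , j , a , b , f , p , q) =
        n′ , k′ , w′ , w′! , (_ , plain i<M) ◅ r , inj₂ (i , j , a , b , f , (_ , plain i<M) ◅ p , q)
      cut (special i<M j<M fl ∷ w) (there x∈) (_ ∷ w!) with cut w x∈ w!
      ... | n′ , k′ , w′ , w′! , r , _ =
        n′ , k′ , w′ , w′! , (_ , special i<M j<M fl) ◅ r , inj₂ (_ , _ , i<M , j<M , fl , ε , r)

      -- A return to the start of the walk closes a cycle. A special arc on it would contradict
      -- acyclicity, so the part cut off has weight 0 and the weight survives.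
      simplify : ∀ {n k u} → Walk n k u → ∃[ n′ ] Σ (Walk n′ k u) λ w → Unique (vertices w)
      simplify [] = 0 , [] , []
      simplify (_∷_ {u = u} a w) with simplify w
      ... | n′ , w′ , w′! with u ∈? vertices w′
      ...   | no u∉ = suc n′ , a ∷ w′ , All.tabulate (λ { x∈ refl → u∉ x∈ }) ∷ w′!
      ...   | yes u∈ with cut w′ u∈ w′!
      ...     | n″ , k″ , w″ , w″! , r , inj₂ (i , j , i<M , j<M , fl , p , q) = contradiction (q ◅◅ (_ , a) ◅ p) (acyclic i<M j<M fl)
      simplify (plain _ ∷ w)            | n′ , w′ , w′! | yes u∈ | n″ , k″ , w″ , w″! , r , inj₁ refl = n″ , w″ , w″!
      simplify (special i<M j<M fl ∷ w) | n′ , w′ , w′! | yes u∈ | n″ , k″ , w″ , w″! , r , inj₁ refl =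
        contradiction r (acyclic i<M j<M fl)

      vertices-source : ∀ {n k u} (w : Walk n k u) → All (λ x → ∃[ i ] i < M × x ≡ src i) (vertices w)
      vertices-source []      = []
      vertices-source (a ∷ w) = arc-source a ∷ vertices-source w

      -- `vertices` has one state per arc. After simplification these states have distinct numbers
      -- below N.
      short : ∀ {n k u} → Walk n k u → ∃[ n′ ] n′ ≤ N × Walk n′ k u
      short walk = let n′ , w , w! = simplify walk in
        n′ , ≤-trans (≤-reflexive (sym (length-vertices w))) (few (vertices w) w! (vertices-source w)) , w
        where
        few : AtMost N (λ x → ∃[ i ] i < M × x ≡ src i)
        few = atMost-Fin (λ { x (i , i<M , _) → fromℕ< (bounded i<M) })
          (λ { (i , i<M , refl) (j , j<M , refl) eq → distinct i<M j<M (fromℕ<-injective _ _ (bounded i<M) (bounded j<M) eq) })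

      -- The walk realising the entry of `v`, prolonged by the arc, may exceed N arcs, but it can be
      -- shortened at equal weight and is then covered by N rounds.
      fixpoint : ∀ {s} → Rounds N s → ∀ {w u v} → Arc w u v → w + arrays s #R v ≤ arrays s #R u
      fixpoint rounds {v = v} arc =
        let n , walk = Rounds.sound rounds v
            n′ , n′≤N , walk′ = short (arc ∷ walk)
        in Rounds.longer rounds n′≤N walk′

-- Polynomial growth

module Growth where

  open import Defs using (Polynomial; eval; degree)
  open import Data.List using ([]; _∷_; replicate)
  open import Data.List.Relation.Unary.All as All using (All; all?; []; _∷_)
  open import Data.Nat
  open import Data.Nat.ListAction using (sum)
  open import Data.Nat.Properties
  open import Data.Nat.Tactic.RingSolver using (solve-∀)
  open import Data.Product using (∃-syntax; _,_)
  open import Relation.Binary.PropositionalEquality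
  open import Relation.Nullary using (yes; no; contradiction)
  open ≤-Reasoning

  eval-zero : ∀ {h} → All (_≡ 0) h → ∀ x → eval h x ≡ 0
  eval-zero []            x = refl
  eval-zero (refl ∷ zeros) x = trans (cong (x *_) (eval-zero zeros x)) (*-zeroʳ x)

  -- All powers of 1 + x are at least 1, also at x = 0, so each absorbs the lower ones. A tail of
  -- zeros is treated apart because `degree` ignores it.
  eval≤ : ∀ h x → eval h x ≤ sum h * suc x ^ degree h
  eval≤ []      x = z≤n
  eval≤ (a ∷ h) x with all? (_≟ 0) h
  ... | yes zeros = begin
    a + x * eval h x   ≡⟨ cong (λ k → a + x * k) (eval-zero zeros x) ⟩
    a + x * 0          ≡⟨ cong (a +_) (*-zeroʳ x) ⟩
    a + 0              ≤⟨ +-monoʳ-≤ a z≤n ⟩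
    a + sum h          ≡⟨ *-identityʳ (a + sum h) ⟨
    (a + sum h) * 1    ∎
  ... | no _ = begin
    a + x * eval h x                       ≤⟨ +-mono-≤ (m≤m*n a (suc x * suc x ^ degree h) {{power≢0}}) (*-mono-≤ (n≤1+n x) (eval≤ h x)) ⟩
    a * power + suc x * (sum h * suc x ^ degree h)
      ≡⟨ cong (a * power +_) (lemma (suc x) (sum h) (suc x ^ degree h)) ⟩
    a * power + sum h * power              ≡⟨ *-distribʳ-+ power a (sum h) ⟨
    (a + sum h) * power                    ∎
    where
    power = suc x * suc x ^ degree h
    power≢0 : NonZero power
    power≢0 = m^n≢0 (suc x) (suc (degree h))
    lemma : ∀ y s p → y * (s * p) ≡ s * (y * p)
    lemma = solve-∀

  geometric : ℕ → ℕ → Polynomial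
  geometric K d = replicate (suc d) K

  degree-geometric : ∀ K d .{{_ : NonZero K}} → degree (geometric K d) ≡ d
  degree-geometric (suc K) zero    = refl
  degree-geometric (suc K) (suc d) = cong suc (degree-geometric (suc K) d)

  -- Let G and G′ be the sums 1 + x + ... up to the powers d and d + 1. Multiplication by 1 + x
  -- turns G into G + xG, which is at most 2G′; hence the factor 2 per degree.
  geometric-bound : ∀ C d x → C * suc x ^ d ≤ eval (geometric (C * 2 ^ d) d) x
  geometric-bound C d x = ≤-trans (go d) (≤-reflexive (sym (scale d (C * 2 ^ d))))
    where
    scale : ∀ d K → eval (geometric K d) x ≡ K * eval (geometric 1 d) x
    scale zero    K = lemma K x
      where
      lemma : ∀ K x → K + x * 0 ≡ K * (1 + x * 0)
      lemma = solve-∀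
    scale (suc d) K = trans (cong (λ k → K + x * k) (scale d K)) (lemma K x (eval (geometric 1 d) x))
      where
      lemma : ∀ K x e → K + x * (K * e) ≡ K * (1 + x * e)
      lemma = solve-∀
    monotone : ∀ d → eval (geometric 1 d) x ≤ eval (geometric 1 (suc d)) x
    monotone zero    = s≤s (*-monoʳ-≤ x z≤n)
    monotone (suc d) = s≤s (*-monoʳ-≤ x (monotone d))
    expand : ∀ d → suc x ^ d ≤ 2 ^ d * eval (geometric 1 d) x
    expand zero    = s≤s z≤n
    expand (suc d) = begin
      suc x * suc x ^ d                     ≤⟨ *-monoʳ-≤ (suc x) (expand d) ⟩
      suc x * (2 ^ d * G)                   ≡⟨ lemma x (2 ^ d) G ⟩
      2 ^ d * (G + x * G)                   ≤⟨ *-monoʳ-≤ (2 ^ d) (+-mono-≤ (monotone d) (n≤1+n (x * G))) ⟩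
      2 ^ d * (G′ + G′)                     ≡⟨ lemma₂ (2 ^ d) G′ ⟩
      2 * 2 ^ d * G′                        ∎
      where
      G  = eval (geometric 1 d) x
      G′ = eval (geometric 1 (suc d)) x
      lemma : ∀ x p g → suc x * (p * g) ≡ p * (g + x * g)
      lemma = solve-∀
      lemma₂ : ∀ p g → p * (g + g) ≡ 2 * p * g
      lemma₂ = solve-∀
    go : ∀ d → C * suc x ^ d ≤ C * 2 ^ d * eval (geometric 1 d) x
    go d = ≤-trans (*-monoʳ-≤ C (expand d)) (≤-reflexive (sym (*-assoc C (2 ^ d) _)))

  n<2^n : ∀ n → n < 2 ^ n
  n<2^n zero    = s≤s z≤n
  n<2^n (suc n) = begin-strict
    suc n          <⟨ s≤s (n<2^n n) ⟩
    suc (2 ^ n)    ≤⟨ +-monoˡ-≤ (2 ^ n) (m^n>0 2 n) ⟩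
    2 ^ n + 2 ^ n  ≡⟨ cong (2 ^ n +_) (+-identityʳ (2 ^ n)) ⟨
    2 * 2 ^ n      ∎

  -- At n = 2^k the left-hand side is at most 2^(c+ke) with c, e fixed, and
  -- k = 2j with j large makes c + ke smaller than 2^k.
  polynomial<exponential : ∀ C a e → ∃[ n ] C * (a * suc n) ^ e < 2 ^ n
  polynomial<exponential C a e = 2 ^ k , (begin-strict
    C * (a * suc (2 ^ k)) ^ e       ≤⟨ *-monoʳ-≤ C (^-monoˡ-≤ e (*-monoʳ-≤ a suc2^k≤)) ⟩
    C * (a * (2 * 2 ^ k)) ^ e       ≤⟨ *-mono-≤ (<⇒≤ (n<2^n C)) (^-monoˡ-≤ e (*-monoˡ-≤ (2 * 2 ^ k) (<⇒≤ (n<2^n a)))) ⟩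
    2 ^ C * (2 ^ a * 2 ^ suc k) ^ e ≡⟨ cong (λ x → 2 ^ C * x ^ e) (^-distribˡ-+-* 2 a (suc k)) ⟨
    2 ^ C * (2 ^ (a + suc k)) ^ e   ≡⟨ cong (2 ^ C *_) (^-*-assoc 2 (a + suc k) e) ⟩
    2 ^ C * 2 ^ ((a + suc k) * e)   ≡⟨ ^-distribˡ-+-* 2 C ((a + suc k) * e) ⟨
    2 ^ (C + (a + suc k) * e)       <⟨ ^-monoʳ-< 2 (s≤s (s≤s z≤n)) exponent< ⟩
    2 ^ (2 ^ k)                     ∎)
    where
    c = C + a + 1
    j = c + (e + e)
    k = j + j
    suc2^k≤ : suc (2 ^ k) ≤ 2 * 2 ^ k
    suc2^k≤ = ≤-trans (+-monoˡ-≤ (2 ^ k) (m^n>0 2 k)) (≤-reflexive (cong (2 ^ k +_) (sym (+-identityʳ (2 ^ k)))))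
    expand : ∀ a j e C → C + (a + suc (j + j)) * e ≡ C + (suc a * e + (j + j) * e)
    expand = solve-∀
    collect : ∀ j c e → suc (j + (c * j + (j + j) * e) + j) ≡ suc (j + j + j * (c + (e + e)))
    collect = solve-∀
    square : ∀ j → suc (j + j + j * j) ≡ suc j * suc j
    square = solve-∀
    C≤j : C ≤ j
    C≤j = ≤-trans (m≤m+n C a) (≤-trans (m≤m+n (C + a) 1) (m≤m+n c (e + e)))
    1+a≤c : suc a ≤ c
    1+a≤c = ≤-trans (≤-reflexive (+-comm 1 a)) (+-monoˡ-≤ 1 (m≤n+m a C))
    e≤j : e ≤ j
    e≤j = ≤-trans (m≤m+n e e) (m≤n+m (e + e) c)
    exponent< : C + (a + suc k) * e < 2 ^ k
    exponent< = begin-strict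
      C + (a + suc (j + j)) * e              ≡⟨ expand a j e C ⟩
      C + (suc a * e + (j + j) * e)          ≤⟨ +-mono-≤ C≤j (+-monoˡ-≤ ((j + j) * e) (*-mono-≤ 1+a≤c e≤j)) ⟩
      j + (c * j + (j + j) * e)              <⟨ s≤s (m≤m+n _ j) ⟩
      suc (j + (c * j + (j + j) * e) + j)    ≡⟨ collect j c e ⟩
      suc (j + j + j * j)                    ≡⟨ square j ⟩
      suc j * suc j                          ≤⟨ *-mono-≤ (n<2^n j) (n<2^n j) ⟩
      2 ^ j * 2 ^ j                          ≡⟨ ^-distribˡ-+-* 2 j j ⟨
      2 ^ k                                  ∎

  ^-distribʳ-* : ∀ e a b → (a * b) ^ e ≡ a ^ e * b ^ e
  ^-distribʳ-* zero    a b = refl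
  ^-distribʳ-* (suc e) a b = trans (cong (a * b *_) (^-distribʳ-* e a b)) (lemma a b (a ^ e) (b ^ e))
    where
    lemma : ∀ a b x y → a * b * (x * y) ≡ a * x * (b * y)
    lemma = solve-∀

  -- If n^d ≤ C (a(n+1))^e with e < d, then n ≤ C (2a)^e, which fails for large n.
  degree-comparison : ∀ d e C a → (∀ n → n ^ d ≤ C * (a * suc n) ^ e) → d ≤ e
  degree-comparison d e C a bound with d ≤? e
  ... | yes d≤e = d≤e
  ... | no  d≰e = contradiction large (<⇒≱ ≤-refl)
    where
    K = C * (a * 2) ^ e
    n = suc K
    rearrange : ∀ C x y → C * (x * y) ≡ C * x * y
    rearrange C x y = sym (*-assoc C x y)
    large : n ≤ K
    large = *-cancelʳ-≤ n K (n ^ e) {{m^n≢0 n e}} (begin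
      n ^ suc e                 ≤⟨ ^-monoʳ-≤ n (≰⇒> d≰e) ⟩
      n ^ d                     ≤⟨ bound n ⟩
      C * (a * suc n) ^ e       ≤⟨ *-monoʳ-≤ C (^-monoˡ-≤ e (*-monoʳ-≤ a (≤-trans (+-monoˡ-≤ n (s≤s z≤n)) (≤-reflexive (cong (n +_) (sym (+-identityʳ n))))))) ⟩
      C * (a * (2 * n)) ^ e     ≡⟨ cong (λ x → C * x ^ e) (*-assoc a 2 n) ⟨
      C * (a * 2 * n) ^ e       ≡⟨ cong (C *_) (^-distribʳ-* e (a * 2) n) ⟩
      C * ((a * 2) ^ e * n ^ e) ≡⟨ rearrange C ((a * 2) ^ e) (n ^ e) ⟩
      K * n ^ e                 ∎)

-- Runs, flags, chains and levels

module Traces where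

  open import Defs hiding (eval)
  open import Data.Fin using (Fin)
  import Data.Fin.Properties as Fin
  open import Data.List using (List; []; _∷_; _++_; length; map; catMaybes)
  open import Data.List.Membership.Propositional renaming (_∈_ to _∈ₗ_)
  open import Data.List.Membership.Propositional.Properties.WithK using (unique⇒irrelevant)
  open import Data.List.Properties using (++-assoc; ++-identityʳ; ∷-injectiveˡ; ∷-injectiveʳ; length-++; ∷-injective)
  import Data.List.Properties as List
  open import Data.List.Relation.Unary.All as All using ([]; _∷_)
  open import Data.List.Relation.Unary.Any using (here; there)
  open import Data.Maybe using (Maybe; just; nothing)
  import Data.Maybe.Properties as Maybe
  open import Data.Nat
  open import Data.Nat.Properties
  open import Data.Product using (∃-syntax; ∃₂; _×_; _,_; proj₁; proj₂)
  import Data.Product.Properties as Product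
  open import Data.Sum using (_⊎_; inj₁; inj₂)
  open import Function using (_∘_)
  open import Relation.Binary.Construct.Closure.ReflexiveTransitive using (ε; _◅_)
  open import Relation.Binary.Definitions using (DecidableEquality)
  open import Relation.Binary.PropositionalEquality

  module _ {X : Set} where

    _×ₗ_ : ℕ → List X → List X
    zero  ×ₗ x = []
    suc k ×ₗ x = x ++ k ×ₗ x

    ×ₗ-+ : ∀ a b x → (a + b) ×ₗ x ≡ a ×ₗ x ++ b ×ₗ x
    ×ₗ-+ zero    b x = refl
    ×ₗ-+ (suc a) b x = trans (cong (x ++_) (×ₗ-+ a b x)) (sym (++-assoc x (a ×ₗ x) (b ×ₗ x)))

    ×ₗ-* : ∀ a b x → a ×ₗ (b ×ₗ x) ≡ (a * b) ×ₗ x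
    ×ₗ-* zero    b x = refl
    ×ₗ-* (suc a) b x = trans (cong (b ×ₗ x ++_) (×ₗ-* a b x)) (sym (×ₗ-+ b (a * b) x))

    ×ₗ-snoc : ∀ k x → k ×ₗ x ++ x ≡ suc k ×ₗ x
    ×ₗ-snoc zero    x = sym (++-identityʳ x)
    ×ₗ-snoc (suc k) x = trans (++-assoc x (k ×ₗ x) x) (cong (x ++_) (×ₗ-snoc k x))

    length-×ₗ : ∀ k x → length (k ×ₗ x) ≡ k * length x
    length-×ₗ zero    x = refl
    length-×ₗ (suc k) x = trans (length-++ x) (cong (length x +_) (length-×ₗ k x))

    ++-comparable : ∀ (x x′ : List X) {y y′} → x ++ y ≡ x′ ++ y′ →
      (∃[ z ] x′ ≡ x ++ z) ⊎ (∃[ z ] x ≡ x′ ++ z)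
    ++-comparable []      x′       eq = inj₁ (x′ , refl)
    ++-comparable (a ∷ x) []       eq = inj₂ (a ∷ x , refl)
    ++-comparable (a ∷ x) (b ∷ x′) eq with refl , eq′ ← ∷-injective eq with ++-comparable x x′ eq′
    ... | inj₁ (z , refl) = inj₁ (z , refl)
    ... | inj₂ (z , refl) = inj₂ (z , refl)

  module Runs (A : Automaton) where
    open Automaton A

    Trace Word : Set
    Trace = List Transition
    Word  = List Letter

    infixr 5 _∷_
    -- The trace is an index, so that paths are compared, cut and concatenated as plain lists of
    -- transitions, apart from the proofs that these belong to `E`.
    data Run : State → Trace → State → Set where
      []  : ∀ {p} → Run p [] p
      _∷_ : ∀ {p l q τ r} → (p , l , q) ∈ₗ E → Run q τ r → Run p ((p , l , q) ∷ τ) r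

    word : Trace → Word
    word τ = catMaybes (map (proj₁ ∘ proj₂) τ)

    _≟ₜ_ : DecidableEquality Transition
    _≟ₜ_ = Product.≡-dec Fin._≟_ (Product.≡-dec (Maybe.≡-dec Fin._≟_) Fin._≟_)

    _≟ᵗ_ : DecidableEquality Trace
    _≟ᵗ_ = List.≡-dec _≟ₜ_

    word-++ : ∀ τ τ′ → word (τ ++ τ′) ≡ word τ ++ word τ′
    word-++ τ τ′ = trans (cong catMaybes (List.map-++ (proj₁ ∘ proj₂) τ τ′)) (List.catMaybes-++ (map (proj₁ ∘ proj₂) τ) _)

    word-×ₗ : ∀ k τ → word (k ×ₗ τ) ≡ k ×ₗ word τ
    word-×ₗ zero    τ = refl
    word-×ₗ (suc k) τ = trans (word-++ τ (k ×ₗ τ)) (cong (word τ ++_) (word-×ₗ k τ))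

    infixr 5 _⊕ʳ_
    _⊕ʳ_ : ∀ {p τ q τ′ r} → Run p τ q → Run q τ′ r → Run p (τ ++ τ′) r
    []      ⊕ʳ ρ = ρ
    (e ∷ π) ⊕ʳ ρ = e ∷ (π ⊕ʳ ρ)

    run-×ₗ : ∀ k {p τ} → Run p τ p → Run p (k ×ₗ τ) p
    run-×ₗ zero    π = []
    run-×ₗ (suc k) π = π ⊕ʳ run-×ₗ k π

    run-++⁻ : ∀ τ {τ′ p r} → Run p (τ ++ τ′) r → ∃[ q ] Run p τ q × Run q τ′ r
    run-++⁻ []      π       = _ , [] , π
    run-++⁻ (_ ∷ τ) (e ∷ π) = let q , π₁ , π₂ = run-++⁻ τ π in q , e ∷ π₁ , π₂

    run-target : ∀ {p τ q q′} → Run p τ q → Run p τ q′ → q ≡ q′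
    run-target []      []       = refl
    run-target (_ ∷ π) (_ ∷ π′) = run-target π π′

    run-∈E : ∀ {p τ q} → Run p τ q → ∀ {e} → e ∈ₗ τ → e ∈ₗ E
    run-∈E (e∈ ∷ _) (here refl) = e∈
    run-∈E (_ ∷ π)  (there e∈)  = run-∈E π e∈

    infix 4 _─[_]→_
    _─[_]→_ : State → Word → State → Set
    p ─[ x ]→ q = ∃[ τ ] Run p τ q × word τ ≡ x

    Reach : State → State → Set
    Reach p q = ∃[ τ ] Run p τ q

    reach : ∀ {p x q} → p ─[ x ]→ q → Reach p q
    reach (τ , π , _) = τ , π

    reach-refl : ∀ {p} → Reach p p
    reach-refl = [] , []

    reach-trans : ∀ {p q r} → Reach p q → Reach q r → Reach p r
    reach-trans (τ , π) (τ′ , π′) = τ ++ τ′ , π ⊕ʳ π′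

    infixr 5 _▸_
    _▸_ : ∀ {p x q y r} → p ─[ x ]→ q → q ─[ y ]→ r → p ─[ x ++ y ]→ r
    (τ , π , refl) ▸ (τ′ , π′ , refl) = τ ++ τ′ , π ⊕ʳ π′ , word-++ τ τ′

    stay : ∀ {p} → p ─[ [] ]→ p
    stay = [] , [] , refl

    repeat : ∀ k {p x} → p ─[ x ]→ p → p ─[ k ×ₗ x ]→ p
    repeat zero    π = stay
    repeat (suc k) π = π ▸ repeat k π

    trace-split : ∀ x {y} τ → word τ ≡ x ++ y → ∃₂ λ τ₁ τ₂ → τ ≡ τ₁ ++ τ₂ × word τ₁ ≡ x × word τ₂ ≡ y
    trace-split []      τ  eq = [] , τ , refl , refl , eq
    trace-split (a ∷ x) ((p , nothing , q) ∷ τ) eq =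
      let τ₁ , τ₂ , τ≡ , eq₁ , eq₂ = trace-split (a ∷ x) τ eq in (p , nothing , q) ∷ τ₁ , τ₂ , cong (_ ∷_) τ≡ , eq₁ , eq₂
    trace-split (a ∷ x) ((p , just b , q) ∷ τ) eq =
      let τ₁ , τ₂ , τ≡ , eq₁ , eq₂ = trace-split x τ (∷-injectiveʳ eq)
      in (p , just b , q) ∷ τ₁ , τ₂ , cong (_ ∷_) τ≡ , cong₂ _∷_ (∷-injectiveˡ eq) eq₁ , eq₂

    split : ∀ x {y p r} → p ─[ x ++ y ]→ r → ∃[ q ] p ─[ x ]→ q × q ─[ y ]→ r
    split x (τ , π , eq) with τ₁ , τ₂ , refl , eq₁ , eq₂ ← trace-split x τ eq =
      let q , π₁ , π₂ = run-++⁻ τ₁ π in q , (τ₁ , π₁ , eq₁) , (τ₂ , π₂ , eq₂)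

    first-letter : ∀ {a x p q} → p ─[ a ∷ x ]→ q →
      ∃₂ λ p₁ p₂ → p ─[ [] ]→ p₁ × (p₁ , just a , p₂) ∈ₗ E × p₂ ─[ x ]→ q
    first-letter (_ , _∷_ {l = nothing} e π , eq) =
      let p₁ , p₂ , (τ , π₁ , eq₁) , e′ , rest = first-letter (_ , π , eq) in p₁ , p₂ , (_ , e ∷ π₁ , eq₁) , e′ , rest
    first-letter (_ , _∷_ {l = just b} e π , refl) = _ , _ , stay , e , (_ , π , refl)

    trace : ∀ {p q} → Path A p q → Trace
    trace ε                       = []
    trace (_◅_ {p} {q} (l , _) π) = (p , l , q) ∷ trace π

    trace-run : ∀ {p q} (π : Path A p q) → Run p (trace π) q
    trace-run ε             = []
    trace-run ((_ , e) ◅ π) = e ∷ trace-run π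

    word-trace : ∀ {p q} (π : Path A p q) → word (trace π) ≡ pathLabel A π
    word-trace π = cong catMaybes (labels-trace π)
      where
      labels-trace : ∀ {p q} (π : Path A p q) → map (proj₁ ∘ proj₂) (trace π) ≡ labels A π
      labels-trace ε       = refl
      labels-trace (_ ◅ π) = cong (_ ∷_) (labels-trace π)

    run-path : ∀ {p τ q} → Run p τ q → Path A p q
    run-path []      = ε
    run-path (e ∷ π) = (_ , e) ◅ run-path π

    trace-run-path : ∀ {p τ q} (π : Run p τ q) → trace (run-path π) ≡ τ
    trace-run-path []      = refl
    trace-run-path (e ∷ π) = cong (_ ∷_) (trace-run-path π)

    trace-injective : ∀ {p q} {π π′ : Path A p q} → trace π ≡ trace π′ → π ≡ π′
    trace-injective {π = ε}     {ε}     eq = refl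
    trace-injective {π = (l , e) ◅ π} {(l′ , e′) ◅ π′} eq with ∷-injective eq
    ... | refl , eq′ = cong₂ (λ e π → (l , e) ◅ π) (unique⇒irrelevant E-unique e e′) (trace-injective eq′)

    path-reach : ∀ {p q} → Path A p q → Reach p q
    path-reach π = trace π , trace-run π

    -- Requiring p and q to start with a letter (after rotating their loops) rules out
    -- the pairs that two states joined by an ε-transition on one cycle would form.
    record Flag (p q : State) : Set where
      field
        distinct : p ≢ q
        {letter} : Letter
        {p′ q′}  : State
        p-step   : (p , just letter , p′) ∈ₗ E
        q-step   : (q , just letter , q′) ∈ₗ E
        {suffix} : Word
        p-loop   : p′ ─[ suffix ]→ p
        cross    : p′ ─[ suffix ]→ q
        q-loop   : q′ ─[ suffix ]→ q

    data Chain : ℕ → State → Set where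
      stop : ∀ {s} → Chain 0 s
      move : ∀ {k s l s′} → (s , l , s′) ∈ₗ E → Chain k s′ → Chain k s
      flag : ∀ {k p q} → Flag p q → Chain k q → Chain (suc k) p

    -- What the program must deliver to the analysis of ambiguity. The two inequalities place the
    -- level above the length of every chain, and `chain` shows that it is attained.
    record Levels (d : ℕ) : Set where
      field
        level      : State → ℕ
        level-step : ∀ {p l q} → (p , l , q) ∈ₗ E → level q ≤ level p
        level-flag : ∀ {p q} → Flag p q → level q < level p
        chain      : ∀ s → Chain (level s) s
        level≤     : ∀ s → level s ≤ d
        attained   : d ≡ 0 ⊎ ∃[ s ] level s ≡ d

      level-run : ∀ {p τ q} → Run p τ q → level q ≤ level p
      level-run []      = ≤-refl
      level-run (e ∷ π) = ≤-trans (level-run π) (level-step e)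

      level-reach : ∀ {p q} → Reach p q → level q ≤ level p
      level-reach (_ , π) = level-run π

      level-chain : ∀ {k s} → Chain k s → k ≤ level s
      level-chain stop       = z≤n
      level-chain (move e c) = ≤-trans (level-chain c) (level-step e)
      level-chain (flag f c) = ≤-trans (s≤s (level-chain c)) (level-flag f)

-- Ambiguity from below

module LowerBounds where

  open import Defs
  open Growth
  open Traces
  open import Data.Fin using (Fin; zero; suc; toℕ; remQuot; combine)
  import Data.Fin.Properties as Fin
  open import Data.Fin.Subset using (_∈_)
  open import Data.List using ([]; _∷_; _++_; length; filter)
  open import Data.List.Membership.Propositional using () renaming (_∈_ to _∈ₗ_)
  open import Data.List.Properties using (++-assoc; ++-identityʳ; ++-cancelˡ; ++-cancelʳ; ∷-injective; length-++; filter-++; filter-accept; filter-reject)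
  open import Data.List.Relation.Unary.All as All using (All; []; _∷_)
  open import Data.List.Relation.Unary.Any using (here; there)
  open import Data.Maybe using (just; nothing; maybe′)
  open import Data.Nat
  open import Data.Nat.ListAction using (sum)
  open import Data.Nat.Properties
  open import Data.Nat.Tactic.RingSolver using (solve-∀)
  open import Data.Product using (∃-syntax; ∃₂; _×_; _,_; proj₁; proj₂)
  open import Data.Sum using (inj₁; inj₂)
  open import Function using (_∘_; Inverse)
  open import Relation.Binary.Construct.Closure.ReflexiveTransitive using (ε; _◅_)
  open import Relation.Binary.PropositionalEquality
  open import Relation.Nullary using (¬_; Dec; contradiction)
  open import Relation.Nullary.Decidable using (decidable-stable)

  record AtLeast {A : Set} (m : ℕ) (P : A → Set) : Set where
    constructor atLeast
    field
      member    : Fin m → A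
      injective : ∀ {i j} → member i ≡ member j → i ≡ j
      satisfies : ∀ i → P (member i)
  open AtLeast

  atLeast-one : ∀ {A : Set} {P : A → Set} {a} → P a → AtLeast 1 P
  atLeast-one {a = a} p = atLeast (λ _ → a) (λ { {zero} {zero} _ → refl }) (λ _ → p)

  atLeast-product : ∀ {A B C : Set} {m n} {P : A → Set} {Q : B → Set} {R : C → Set} (f : A → B → C) →
    (∀ {a b} → P a → Q b → R (f a b)) →
    (∀ {a b a′ b′} → P a → P a′ → Q b → Q b′ → f a b ≡ f a′ b′ → a ≡ a′ × b ≡ b′) →
    AtLeast m P → AtLeast n Q → AtLeast (m * n) R
  atLeast-product {m = m} {n} f R-f f-inj as bs = atLeast
    (λ i → f (member as (proj₁ (remQuot {m} n i))) (member bs (proj₂ (remQuot {m} n i))))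
    (λ {i} {j} eq →
      let eqᵃ , eqᵇ = f-inj (satisfies as _) (satisfies as _) (satisfies bs _) (satisfies bs _) eq
      in trans (sym (Fin.combine-remQuot {m} n i))
           (trans (cong₂ combine (injective as eqᵃ) (injective bs eqᵇ)) (Fin.combine-remQuot {m} n j)))
    (λ i → R-f (satisfies as _) (satisfies bs _))

  module _ (A : Automaton) where
    open Automaton A
    open Runs A

    RunsOn : State → State → Word → Trace → Set
    RunsOn p q x τ = Run p τ q × word τ ≡ x

    atLeast≤da : ∀ {k m p q x} → p ∈ I → q ∈ F → AtLeast k (RunsOn p q x) → Da A x m → k ≤ m
    atLeast≤da {p = p} {q} {x} p∈I q∈F many da = Fin.injective⇒≤ {f = Inverse.to da ∘ path} λ {i} {j} eq →
        injective many (trans (sym (trace-path i)) (trans (cong traceOf (to-injective eq)) (trace-path j)))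
      where
      path : Fin _ → SuccessfulPathLabelled A x
      path i = let π , eq = satisfies many i in
        (p , q , p∈I , q∈F , run-path π) , trans (sym (trans (cong word (sym (trace-run-path π))) (word-trace (run-path π)))) eq
      traceOf : SuccessfulPathLabelled A x → Trace
      traceOf ((_ , _ , _ , _ , π) , _) = trace π
      trace-path : ∀ i → traceOf (path i) ≡ member many i
      trace-path i = trace-run-path (proj₁ (satisfies many i))
      to-injective : ∀ {a b} → Inverse.to da a ≡ Inverse.to da b → a ≡ b
      to-injective {a} {b} eq =
        trans (sym (Inverse.strictlyInverseʳ da a)) (trans (cong (Inverse.from da) eq) (Inverse.strictlyInverseʳ da b))

    atLeast-wrap : ∀ {k p q i f x α β} → Run i α p → Run q β f →
      AtLeast k (RunsOn p q x) → AtLeast k (RunsOn i f (word α ++ x ++ word β))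
    atLeast-wrap {α = α} {β} πα πβ many = atLeast
      (λ i → α ++ member many i ++ β)
      (λ eq → injective many (++-cancelʳ β _ _ (++-cancelˡ α _ _ eq)))
      (λ i → πα ⊕ʳ proj₁ (satisfies many i) ⊕ʳ πβ
           , trans (word-++ α _) (cong (word α ++_) (trans (word-++ (member many i) β) (cong (_++ word β) (proj₂ (satisfies many i))))))

    states-split : ∀ {p q s} (π : Path A p q) → s ∈ₗ states A π → Path A p s × Path A s q
    states-split ε       (here refl) = ε , ε
    states-split (e ◅ π) (here refl) = ε , e ◅ π
    states-split (e ◅ π) (there s∈)  = let π₁ , π₂ = states-split π s∈ in e ◅ π₁ , π₂

    module _ (trim : Trim A) where

      accessible : ∀ s → ∃[ i ] i ∈ I × Reach i s
      accessible s = let (i , _ , i∈I , _ , π) , s∈ = trim s in i , i∈I , path-reach (proj₁ (states-split π s∈))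

      coaccessible : ∀ s → ∃[ f ] f ∈ F × Reach s f
      coaccessible s = let (_ , f , _ , f∈F , π) , s∈ = trim s in f , f∈F , path-reach (proj₂ (states-split π s∈))

      module _ (ε-free : ε-CycleFree A) where

        ε-cycle : ∀ {p τ} → Run p τ p → word τ ≡ [] → τ ≡ []
        ε-cycle {p} {[]}    π eq = refl
        ε-cycle {p} {_ ∷ _} π eq =
          contradiction (p , run-path π , nonempty π , all-ε (run-path π) (trans (sym (word-trace (run-path π))) (trans (cong word (trace-run-path π)) eq))) ε-free
          where
          nonempty : ∀ {p q e τ} (π : Run p (e ∷ τ) q) → 0 < length (labels A (run-path π))
          nonempty (_ ∷ _) = s≤s z≤n
          all-ε : ∀ {p q} (π : Path A p q) → pathLabel A π ≡ [] → All (_≡ nothing) (labels A π)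
          all-ε ε                   eq = []
          all-ε ((nothing , _) ◅ π) eq = refl ∷ all-ε π eq

        -- Both cycles end in p, so `z` is itself a cycle at p, and it reads nothing; ε-cycle
        -- freeness makes it empty.
        cycle-extend : ∀ {p c z} → Run p c p → Run p (c ++ z) p → word (c ++ z) ≡ word c → c ++ z ≡ c
        cycle-extend {p} {c} {z} π π′ eq with q , π₁ , π₂ ← run-++⁻ c π′ with refl ← run-target π π₁ =
          trans (cong (c ++_) (ε-cycle π₂ (++-cancelˡ (word c) _ _
            (trans (sym (word-++ c z)) (trans eq (sym (++-identityʳ (word c)))))))) (++-identityʳ c)

        -- Cycles at p reading one word form a prefix code, so a concatenation of such cycles
        -- determines its factors.
        cycle-prefix : ∀ {p c c′ y y′} → Run p c p → Run p c′ p → word c ≡ word c′ → c ++ y ≡ c′ ++ y′ → c ≡ c′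
        cycle-prefix {c = c} {c′} π π′ eq ys with ++-comparable c c′ ys
        ... | inj₁ (z , refl) = sym (cycle-extend π π′ (sym eq))
        ... | inj₂ (z , refl) = cycle-extend π′ π eq

        -- Each of the n factors may be `c` or `c′`, and by `cycle-prefix` different choices give
        -- different runs.
        atLeast-two-cycles : ∀ {p c c′} → Run p c p → Run p c′ p → word c ≡ word c′ → c ≢ c′ →
          ∀ n → AtLeast (2 ^ n) (RunsOn p p (n ×ₗ word c))
        atLeast-two-cycles π π′ eq c≢c′ zero    = atLeast-one ([] , refl)
        atLeast-two-cycles {p} {c} {c′} π π′ eq c≢c′ (suc n) =
          atLeast-product _++_
            (λ { {a} {b} (πa , eqa) (πb , eqb) → πa ⊕ʳ πb , trans (word-++ a b) (cong₂ _++_ eqa eqb) })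
            (λ { {a} {b} {a′} {b′} (πa , eqa) (πa′ , eqa′) _ _ ab≡ →
                 let a≡a′ = cycle-prefix πa πa′ (trans eqa (sym eqa′)) ab≡
                 in a≡a′ , ++-cancelˡ a _ _ (trans ab≡ (cong (_++ b′) (sym a≡a′))) })
            two (atLeast-two-cycles π π′ eq c≢c′ n)
          where
          two : AtLeast 2 (RunsOn p p (word c))
          two = atLeast (λ { zero → c ; (suc _) → c′ })
            (λ { {zero} {zero} _ → refl ; {zero} {suc _} e → contradiction e c≢c′
               ; {suc _} {zero} e → contradiction (sym e) c≢c′ ; {suc zero} {suc zero} _ → refl })
            (λ { zero → π , refl ; (suc _) → π′ , sym eq })

        module _ (poly : PolynomiallyAmbiguous A) where

          -- Trimness completes the pumped cycles to successful paths, so two cycles would give 2^n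
          -- paths on words of length linear in n, more than any polynomial allows.
          no-two-cycles : ∀ {p c c′} → Run p c p → Run p c′ p → word c ≡ word c′ → c ≡ c′
          no-two-cycles {p} {c} {c′} π π′ eq = decidable-stable (c ≟ᵗ c′) λ c≢c′ →
            let h , bounded = poly
                i , i∈I , α , πα = accessible p
                f , f∈F , β , πβ = coaccessible p
                -- Chosen so that 1 + |x| ≤ a (n + 1) for the pumped word `x`.
                a = suc (length (word α) + length (word c) + length (word β))
                n , large = polynomial<exponential (sum h) a (degree h)
                x = word α ++ n ×ₗ word c ++ word β
                m , da , m≤ = bounded x
            in <-irrefl refl (begin-strict
                 2 ^ n                          ≤⟨ atLeast≤da i∈I f∈F (atLeast-wrap πα πβ (atLeast-two-cycles π π′ eq c≢c′ n)) da ⟩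
                 m                              ≤⟨ m≤ ⟩
                 eval h (length x)              ≤⟨ eval≤ h (length x) ⟩
                 sum h * suc (length x) ^ degree h ≤⟨ *-monoʳ-≤ (sum h) (^-monoˡ-≤ (degree h) (length≤ n α β)) ⟩
                 sum h * (a * suc n) ^ degree h <⟨ large ⟩
                 2 ^ n                          ∎)
            where
            open ≤-Reasoning
            length≤ : ∀ n α β → suc (length (word α ++ n ×ₗ word c ++ word β))
                      ≤ suc (length (word α) + length (word c) + length (word β)) * suc n
            length≤ n α β = begin
              suc (length (word α ++ n ×ₗ word c ++ word β)) ≡⟨ cong suc (trans (length-++ (word α)) (cong (length (word α) +_) (trans (length-++ (n ×ₗ word c)) (cong (_+ length (word β)) (length-×ₗ n (word c)))))) ⟩
              suc (length (word α) + (n * length (word c) + length (word β))) ≤⟨ m≤m+n _ (n + n * length (word α) + length (word c) + n * length (word β)) ⟩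
              suc (length (word α) + (n * length (word c) + length (word β))) + (n + n * length (word α) + length (word c) + n * length (word β))
                ≡⟨ lemma n (length (word α)) (length (word c)) (length (word β)) ⟩
              suc (length (word α) + length (word c) + length (word β)) * suc n ∎
              where
              lemma : ∀ n a c b → suc (a + (n * c + b)) + (n + n * a + c + n * b) ≡ suc (a + c + b) * suc n
              lemma = solve-∀

          -- One common way back from q to p turns both runs into cycles at p with the same label.
          unambiguous : ∀ {p q τ τ′} → Reach q p → Run p τ q → Run p τ′ q → word τ ≡ word τ′ → τ ≡ τ′
          unambiguous {τ = τ} {τ′} (σ , back) π π′ eq =
            ++-cancelʳ σ τ τ′ (no-two-cycles (π ⊕ʳ back) (π′ ⊕ʳ back)
              (trans (word-++ τ σ) (trans (cong (_++ word σ) eq) (sym (word-++ τ′ σ)))))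

          -- If one of the two were a proper prefix of the other, the longer one would contain the
          -- transition reading a letter that follows the shorter, and its word would be longer.
          letter-aligned : ∀ {p q p′ q′ a a′ ρ ρ′} τ τ′ → word τ ≡ word τ′ →
            τ ++ (p , just a , q) ∷ ρ ≡ τ′ ++ (p′ , just a′ , q′) ∷ ρ′ → τ ≡ τ′
          letter-aligned []      []       w eq = refl
          letter-aligned []      (_ ∷ τ′) w eq with refl , _ ← ∷-injective eq with () ← w
          letter-aligned (_ ∷ τ) []       w eq with refl , _ ← ∷-injective eq with () ← w
          letter-aligned ((_ , l , _) ∷ τ) (_ ∷ τ′) w eq with refl , eq′ ← ∷-injective eq =
            cong (_ ∷_) (letter-aligned τ τ′ (tail l w) eq′)
            where
            tail : ∀ l {x y : Word} → maybe′ _∷_ (λ z → z) l x ≡ maybe′ _∷_ (λ z → z) l y → x ≡ y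
            tail nothing  w = w
            tail (just _) w = proj₂ (∷-injective w)

          -- If q reached p, the two paths π₁π₂ and π₂π₃ from p to q below would
          -- coincide, and so would the states p and q reached after reading π₁ and π₂.
          flag-irreversible : ∀ {p q} → Flag p q → ¬ Reach q p
          flag-irreversible {p} {q} f q⇝p with Flag.p-loop f | Flag.cross f | Flag.q-loop f
          ... | τ₁ , π₁ , w₁ | τ₂ , π₂ , w₂ | τ₃ , π₃ , w₃ =
            Flag.distinct f (run-target (e ∷ π₁) (subst (λ τ → Run p τ q) (sym same) (e ∷ π₂)))
            where
            e = Flag.p-step f
            e′ = Flag.q-step f
            a = Flag.letter f
            c₁ = (p , just a , Flag.p′ f) ∷ τ₁
            c₂ = (p , just a , Flag.p′ f) ∷ τ₂
            c₃ = (q , just a , Flag.q′ f) ∷ τ₃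
            word₁₂ : word c₁ ≡ word c₂
            word₁₂ = cong (a ∷_) (trans w₁ (sym w₂))
            same : c₁ ≡ c₂
            same = letter-aligned c₁ c₂ word₁₂
              (unambiguous q⇝p ((e ∷ π₁) ⊕ʳ (e ∷ π₂)) ((e ∷ π₂) ⊕ʳ (e′ ∷ π₃))
                (trans (word-++ c₁ c₂) (trans (cong₂ _++_ word₁₂ (cong (a ∷_) (trans w₂ (sym w₃)))) (sym (word-++ c₂ c₃)))))

        module LowerBound {d} (levels : Levels d) where
          open Levels levels

          high : ℕ → Transition → Set
          high k (p , _) = k < level p

          high? : ∀ k e → Dec (high k e)
          high? k (p , _) = k <? level p

          -- Counts the transitions that start above level `k`. Turns at p, of level k + 1,
          -- contribute a positive constant each, and everything from q on, of level k, contributes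
          -- nothing; so the weight reveals how many turns were made before the crossing.
          weight : ℕ → Trace → ℕ
          weight k τ = length (filter (high? k) τ)

          weight-++ : ∀ k τ τ′ → weight k (τ ++ τ′) ≡ weight k τ + weight k τ′
          weight-++ k τ τ′ = trans (cong length (filter-++ (high? k) τ τ′)) (length-++ (filter (high? k) τ))

          weight-×ₗ : ∀ k j τ → weight k (j ×ₗ τ) ≡ j * weight k τ
          weight-×ₗ k zero    τ = refl
          weight-×ₗ k (suc j) τ = trans (weight-++ k τ (j ×ₗ τ)) (cong (weight k τ +_) (weight-×ₗ k j τ))

          weight-low : ∀ {k p τ q} → Run p τ q → level p ≤ k → weight k τ ≡ 0
          weight-low []      p≤k = refl
          weight-low {k} (e ∷ π) p≤k =
            trans (cong length (filter-reject (high? k) (≤⇒≯ p≤k))) (weight-low π (≤-trans (level-step e) p≤k))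

          weight-first : ∀ {k p e τ q} → Run p (e ∷ τ) q → k < level p → 0 < weight k (e ∷ τ)
          weight-first {k} (e ∷ π) k<p =
            subst (0 <_) (cong length (sym (filter-accept (high? k) k<p))) (s≤s z≤n)

          -- The chain is as long as the level allows, so no level is lost on the moves before its
          -- first flag and exactly one at that flag.
          next-flag : ∀ {k s} → level s ≡ suc k → Chain (suc k) s →
            ∃₂ λ p q → Reach s p × Flag p q × level p ≡ suc k × level q ≡ k
          next-flag {k} {s} eq (move e c) =
            let p , q , (τ , π) , rest = next-flag (≤-antisym (≤-trans (level-step e) (≤-reflexive eq)) (level-chain c)) c
            in p , q , (_ , e ∷ π) , rest
          next-flag {k} {s} eq (flag f c) = _ , _ , reach-refl , f , eq
            , ≤-antisym (s≤s⁻¹ (≤-trans (level-flag f) (≤-reflexive eq))) (level-chain c)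

          power-split : ∀ {n} (j : Fin n) (x : Word) → toℕ j ×ₗ x ++ x ++ (n ∸ suc (toℕ j)) ×ₗ x ≡ n ×ₗ x
          power-split {suc n} zero    x = refl
          power-split {suc n} (suc j) x = trans (++-assoc x (toℕ j ×ₗ x) _) (cong (x ++_) (power-split j x))

          Grows : ℕ → State → Set
          Grows k s = ∃[ a ] ∀ n → ∃₂ λ f x → f ∈ F × AtLeast (n ^ k) (RunsOn s f x) × length x ≤ a * suc n

          -- For `j < n` a block makes j turns at p, crosses to q and makes n - 1 - j turns at q;
          -- all these blocks read the n-th power of `v`. Each can be followed by any of the n^k
          -- runs that induction provides at q.
          grows : ∀ k s → level s ≡ k → Grows k s
          grows zero s eq = let f , f∈F , τ , π = coaccessible s in
            length (word τ) , λ n → f , word τ , f∈F , atLeast-one (π , refl) , m≤m*n (length (word τ)) (suc n)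
          grows (suc k) s eq
            with p , q , (α , πα) , f , p≡ , q≡ ← next-flag eq (subst (λ k → Chain k s) eq (chain s))
            with b , rest ← grows k q q≡
            with τ₁ , π₁ , w₁ ← Flag.p-loop f | τ₂ , π₂ , w₂ ← Flag.cross f | τ₃ , π₃ , w₃ ← Flag.q-loop f
            = length (word α) + length v + b , λ n → let f , y , f∈F , many , y≤ = rest n in
                f , word α ++ n ×ₗ v ++ y , f∈F
                , atLeast-product (λ j ρ → α ++ block n j ++ ρ)
                    (λ {j} {ρ} _ (πρ , w) → πα ⊕ʳ block-run n j ⊕ʳ πρ
                       , trans (word-++ α _) (cong (word α ++_) (trans (word-++ (block n j) ρ) (cong₂ _++_ (block-word n j) w))))
                    (λ {j} {ρ} {j′} {ρ′} _ _ (πρ , _) (πρ′ , _) same →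
                       let j≡j′ = block-injective n j j′ πρ πρ′ (++-cancelˡ α _ _ same)
                       in j≡j′ , ++-cancelˡ (block n j) _ _ (trans (++-cancelˡ α _ _ same) (cong (λ i → block n i ++ ρ′) (sym j≡j′))))
                    (atLeast {P = λ _ → Fin n} (λ i → i) (λ e → e) (λ i → i)) many
                , length≤ n y y≤
            where
            open ≤-Reasoning
            v = Flag.letter f ∷ Flag.suffix f
            c₁ = (p , just (Flag.letter f) , Flag.p′ f) ∷ τ₁
            c₂ = (p , just (Flag.letter f) , Flag.p′ f) ∷ τ₂
            c₃ = (q , just (Flag.letter f) , Flag.q′ f) ∷ τ₃
            r₁ = Flag.p-step f ∷ π₁
            r₂ = Flag.p-step f ∷ π₂
            r₃ = Flag.q-step f ∷ π₃
            block : ∀ n → Fin n → Trace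
            block n j = toℕ j ×ₗ c₁ ++ c₂ ++ (n ∸ suc (toℕ j)) ×ₗ c₃
            block-run : ∀ n j → Run p (block n j) q
            block-run n j = run-×ₗ (toℕ j) r₁ ⊕ʳ r₂ ⊕ʳ run-×ₗ (n ∸ suc (toℕ j)) r₃
            block-word : ∀ n j → word (block n j) ≡ n ×ₗ v
            block-word n j = trans (word-++ (toℕ j ×ₗ c₁) _) (trans
              (cong₂ _++_ (trans (word-×ₗ (toℕ j) c₁) (cong (toℕ j ×ₗ_) (cong (_ ∷_) w₁)))
                (trans (word-++ c₂ _) (cong₂ _++_ (cong (_ ∷_) w₂)
                  (trans (word-×ₗ (n ∸ suc (toℕ j)) c₃) (cong ((n ∸ suc (toℕ j)) ×ₗ_) (cong (_ ∷_) w₃))))))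
              (power-split j v))
            block-weight : ∀ n j {ρ g} → Run q ρ g → weight k (block n j ++ ρ) ≡ toℕ j * weight k c₁ + weight k c₂
            block-weight n j {ρ} πρ = begin-equality
              weight k (block n j ++ ρ) ≡⟨ weight-++ k (block n j) ρ ⟩
              weight k (block n j) + weight k ρ ≡⟨ cong₂ _+_ (trans (weight-++ k (toℕ j ×ₗ c₁) _) (cong₂ _+_ (weight-×ₗ k (toℕ j) c₁) (weight-++ k c₂ _))) (weight-low πρ (≤-reflexive q≡)) ⟩
              toℕ j * weight k c₁ + (weight k c₂ + weight k ((n ∸ suc (toℕ j)) ×ₗ c₃)) + 0
                ≡⟨ cong (λ z → toℕ j * weight k c₁ + (weight k c₂ + z) + 0) (weight-low (run-×ₗ (n ∸ suc (toℕ j)) r₃) (≤-reflexive q≡)) ⟩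
              toℕ j * weight k c₁ + (weight k c₂ + 0) + 0 ≡⟨ lemma (toℕ j * weight k c₁) (weight k c₂) ⟩
              toℕ j * weight k c₁ + weight k c₂ ∎
              where
              lemma : ∀ a b → a + (b + 0) + 0 ≡ a + b
              lemma = solve-∀
            block-injective : ∀ n j j′ {ρ ρ′ g g′} → Run q ρ g → Run q ρ′ g′ → block n j ++ ρ ≡ block n j′ ++ ρ′ → j ≡ j′
            block-injective n j j′ πρ πρ′ same = Fin.toℕ-injective
              (*-cancelʳ-≡ (toℕ j) (toℕ j′) (weight k c₁) {{>-nonZero (weight-first r₁ (≤-reflexive (sym p≡)))}}
                (+-cancelʳ-≡ (weight k c₂) _ _ (trans (sym (block-weight n j πρ)) (trans (cong (weight k) same) (block-weight n j′ πρ′)))))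
            length≤ : ∀ n y → length y ≤ b * suc n → length (word α ++ n ×ₗ v ++ y) ≤ (length (word α) + length v + b) * suc n
            length≤ n y y≤ = begin
              length (word α ++ n ×ₗ v ++ y) ≡⟨ trans (length-++ (word α)) (cong (length (word α) +_) (trans (length-++ (n ×ₗ v)) (cong (_+ length y) (length-×ₗ n v)))) ⟩
              length (word α) + (n * length v + length y) ≤⟨ +-mono-≤ (m≤m*n (length (word α)) (suc n)) (+-mono-≤ (≤-trans (≤-reflexive (*-comm n (length v))) (*-monoʳ-≤ (length v) (n≤1+n n))) y≤) ⟩
              length (word α) * suc n + (length v * suc n + b * suc n) ≡⟨ lemma (length (word α)) (length v) b (suc n) ⟩
              (length (word α) + length v + b) * suc n ∎
              where
              lemma : ∀ a c b n → a * n + (c * n + b * n) ≡ (a + c + b) * n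
              lemma = solve-∀

          d≤degree : ∀ h → AmbiguityBoundedBy A h → d ≤ degree h
          d≤degree h bounded with attained
          ... | inj₁ refl = z≤n
          ... | inj₂ (s , s≡d) =
            let i , i∈I , α , πα = accessible s
                a , many = grows d s s≡d
            in degree-comparison d (degree h) (sum h) (suc (length (word α) + a)) λ n →
                 let f , x , f∈F , runs , x≤ = many n
                     m , da , m≤ = bounded (word α ++ x ++ [])
                 in begin
                   n ^ d                                  ≤⟨ atLeast≤da i∈I f∈F (atLeast-wrap πα [] runs) da ⟩
                   m                                      ≤⟨ m≤ ⟩
                   eval h (length (word α ++ x ++ []))    ≤⟨ eval≤ h _ ⟩
                   sum h * suc (length (word α ++ x ++ [])) ^ degree h
                     ≤⟨ *-monoʳ-≤ (sum h) (^-monoˡ-≤ (degree h) (length≤ n a (word α) x x≤)) ⟩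
                   sum h * (suc (length (word α) + a) * suc n) ^ degree h ∎
            where
            open ≤-Reasoning
            length≤ : ∀ n a (y x : Word) → length x ≤ a * suc n → suc (length (y ++ x ++ [])) ≤ suc (length y + a) * suc n
            length≤ n a y x x≤ = begin
              suc (length (y ++ x ++ []))           ≡⟨ cong suc (trans (length-++ y) (cong (λ z → length y + length z) (++-identityʳ x))) ⟩
              suc (length y + length x)             ≤⟨ s≤s (+-mono-≤ (m≤m*n (length y) (suc n)) x≤) ⟩
              suc (length y * suc n + a * suc n)    ≡⟨ cong suc (*-distribʳ-+ (suc n) (length y) a) ⟨
              suc ((length y + a) * suc n)          ≤⟨ s≤s (m≤n+m ((length y + a) * suc n) n) ⟩
              suc (length y + a) * suc n            ∎

-- Ambiguity from above

module UpperBounds where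

  open import Defs
  open Counting
  open Growth
  open Traces
  open LowerBounds
  open import Data.Empty using (⊥)
  open import Data.Fin using (Fin; zero; suc; toℕ; combine; funToFin; finToFun)
  import Data.Fin.Properties as Fin
  open import Data.List using (List; []; _∷_; _++_; length; map; filter; head; drop; take; allFin; lookup)
  open import Data.List.Membership.Propositional using () renaming (_∈_ to _∈ₗ_)
  open import Data.List.Membership.Propositional.Properties using (∈-allFin; ∈-lookup; ∈-++⁺ʳ)
  open import Data.List.Properties using (++-assoc; ++-identityʳ; ++-cancelˡ; ∷-injective; length-++; length-map; length-tabulate)
  import Data.List.Properties as List
  open import Data.List.Relation.Unary.All as All using (All; []; _∷_)
  import Data.List.Relation.Unary.All.Properties as All
  open import Data.List.Relation.Unary.Any using (here; index)
  open import Data.List.Relation.Unary.Any.Properties using (lookup-index)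
  open import Data.List.Relation.Unary.Unique.Propositional using (Unique)
  import Data.List.Relation.Unary.Unique.Propositional.Properties as Unique
  open import Data.Maybe using (Maybe; just)
  import Data.Maybe.Properties as Maybe
  open import Data.Nat
  open import Data.Nat.Properties
  open import Data.Nat.Tactic.RingSolver using (solve-∀)
  open import Data.Product using (Σ; ∃-syntax; ∃₂; _×_; _,_; proj₁; proj₂)
  import Data.Product.Properties as Product
  open import Data.Vec.Properties.WithK using ([]=-irrelevant)
  open import Data.Sum using (_⊎_; inj₁; inj₂)
  open import Function using (_∘_; Inverse)
  open import Relation.Binary using (tri<; tri≈; tri>)
  open import Relation.Binary.PropositionalEquality
  open import Relation.Nullary using (¬_; Dec; yes; no; contradiction)
  open import Relation.Nullary.Decidable using (decidable-stable; ¬¬-excluded-middle)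

  Pow : ∀ {A : Set} → (A → A → Set) → ℕ → A → A → Set
  Pow R zero    a b = a ≡ b
  Pow R (suc k) a b = ∃[ c ] R a c × Pow R k c b

  -- Following the chosen successors from `a` for n steps must repeat a state. `S` is carried along
  -- so that the repeated state retains its connection to s or t.
  eventually-periodic : ∀ {n} (R : Fin n → Fin n → Set) (S : Fin n → Set) →
    (∀ a → S a → ∃[ b ] S b × R a b) → ∀ a → S a →
    ∃[ p ] ∃[ j ] ∃[ m ] S p × Pow R j a p × Pow R (suc m) p p
  eventually-periodic {n} R S next a Sa =
    let i , j , i<j , same = Fin.pigeonhole {n} {suc n} ≤-refl (λ i → proj₁ (orbit (toℕ i))) in
      proj₁ (orbit (toℕ i)) , toℕ i , toℕ j ∸ suc (toℕ i) , proj₂ (orbit (toℕ i))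
    , subst (λ k → Pow R (toℕ i) a (proj₁ (orbit k))) (+-identityʳ (toℕ i)) (advance 0 (toℕ i))
    , subst (Pow R (suc (toℕ j ∸ suc (toℕ i))) (proj₁ (orbit (toℕ i))))
        (trans (cong (proj₁ ∘ orbit) (trans (sym (+-suc (toℕ j ∸ suc (toℕ i)) (toℕ i))) (m∸n+n≡m i<j))) (sym same))
        (advance (toℕ i) (suc (toℕ j ∸ suc (toℕ i))))
    where
    orbit : ℕ → Σ (Fin n) S
    orbit zero    = a , Sa
    orbit (suc k) = let b , Sb , _ = next (proj₁ (orbit k)) (proj₂ (orbit k)) in b , Sb
    advance : ∀ i k → Pow R k (proj₁ (orbit i)) (proj₁ (orbit (k + i)))
    advance i zero    = refl
    advance i (suc k) = proj₁ (orbit (suc i)) , proj₂ (proj₂ (next (proj₁ (orbit i)) (proj₂ (orbit i))))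
      , subst (λ m → Pow R k (proj₁ (orbit (suc i))) (proj₁ (orbit m))) (+-suc k i) (advance (suc i) k)

  bit : {P : Set} → Dec P → Fin 2
  bit (yes _) = suc zero
  bit (no  _) = zero

  bit-transport : ∀ {P Q : Set} {p : Dec P} {q : Dec Q} → bit p ≡ bit q → P → Q
  bit-transport {p = yes _}  {yes q} eq x = q
  bit-transport {p = no ¬p}  {_}     eq x = contradiction x ¬p

  module _ (A : Automaton) where
    open Automaton A
    open Runs A

    pow-run : ∀ {w} k {a b} → Pow (λ a b → a ─[ w ]→ b) k a b → a ─[ k ×ₗ w ]→ b
    pow-run zero    refl         = stay
    pow-run (suc k) (c , π , ps) = π ▸ pow-run k ps

    pow-run⁻ : ∀ {w} k {a b} → Pow (λ a b → b ─[ w ]→ a) k a b → b ─[ k ×ₗ w ]→ a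
    pow-run⁻ zero    refl         = stay
    pow-run⁻ {w} (suc k) {a} {b} (c , π , ps) = subst (λ x → b ─[ x ]→ a) (×ₗ-snoc k w) (pow-run⁻ k ps ▸ π)

    recast : ∀ {p x y q} → x ≡ y → p ─[ x ]→ q → p ─[ y ]→ q
    recast refl π = π

    -- p is moved along its loop to a state p′ from which the way to q is a whole
    -- number of turns of both loops.
    common-power : ∀ {p q w} m m′ L → p ─[ suc m ×ₗ w ]→ p → q ─[ suc m′ ×ₗ w ]→ q → p ─[ suc L ×ₗ w ]→ q →
      ∃[ p′ ] ∃[ M ] Reach p p′ × Reach p′ p
        × p′ ─[ suc M ×ₗ w ]→ p′ × p′ ─[ suc M ×ₗ w ]→ q × q ─[ suc M ×ₗ w ]→ q
    common-power {p} {q} {w} m m′ L p-loop q-loop p→q =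
      let p′ , π₁ , π₂ = split (suc L ×ₗ w) {R ×ₗ w} {p} {p}
             (recast (trans (×ₗ-* (suc L * suc m′) (suc m) w) (trans (cong (_×ₗ w) total) (×ₗ-+ (suc L) R w)))
               (repeat (suc L * suc m′) p-loop))
      in p′ , L + R , reach π₁ , reach π₂
      , recast turn (π₂ ▸ π₁)
      , recast turn (π₂ ▸ p→q)
      , recast (trans (×ₗ-* (suc L * suc m) (suc m′) w) (cong (_×ₗ w) total′)) (repeat (suc L * suc m) q-loop)
      where
      -- Determined by (L + 1)(m′ + 1)(m + 1) = (L + 1) + R. The repeated loop at p reads L + 1
      -- copies of `w` up to p′ and R copies back to p, from where the way to q takes the missing L
      -- + 1 copies.
      R = suc L * (m + m′ + m * m′)
      lemma : ∀ L m m′ → suc L * suc m′ * suc m ≡ suc L + suc L * (m + m′ + m * m′)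
      lemma = solve-∀
      total : suc L * suc m′ * suc m ≡ suc L + R
      total = lemma L m m′
      total′ : suc L * suc m * suc m′ ≡ suc L + R
      total′ = trans (*-assoc (suc L) (suc m) (suc m′)) (trans (cong (suc L *_) (*-comm (suc m) (suc m′))) (trans (sym (*-assoc (suc L) (suc m′) (suc m))) total))
      turn : R ×ₗ w ++ suc L ×ₗ w ≡ suc (L + R) ×ₗ w
      turn = trans (sym (×ₗ-+ R (suc L) w)) (cong (_×ₗ w) (+-comm R (suc L)))

    -- Both loops are rotated past their initial ε-transitions, so that p₁ and q₁ read the letter at
    -- once. If p₁ and q₁ coincided, q would reach p through them.
    loops⇒flag : ∀ {p q a x} → p ─[ a ∷ x ]→ p → p ─[ a ∷ x ]→ q → q ─[ a ∷ x ]→ q → ¬ Reach q p →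
      ∃₂ λ p₁ q₁ → Reach p p₁ × Reach q₁ q × Flag p₁ q₁
    loops⇒flag {p} {q} {a} {x} p-loop p→q q-loop ¬q⇝p
      with p₁ , p₂ , ε₁ , e₁ , π₁ ← first-letter p-loop
      with q₁ , q₂ , ε₃ , e₃ , π₃ ← first-letter q-loop
      = p₁ , q₁ , reach ε₁ , (_ , e₃ ∷ proj₂ (reach π₃)) , record
        { distinct = λ { refl → ¬q⇝p (reach-trans (reach ε₃) (_ , e₁ ∷ proj₂ (reach π₁))) }
        ; p-step   = e₁
        ; q-step   = e₃
        -- The rest of one turn is followed by another whole turn, which is where the crossing path
        -- changes from p to q; the word of the flag is thus `a ∷ x` read twice.
        ; p-loop   = π₁ ▸ p-loop ▸ ε₁
        ; cross    = π₁ ▸ p→q ▸ ε₃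
        ; q-loop   = π₃ ▸ q-loop ▸ ε₃
        }

    -- Positions are measured in letters of `x` read so far, so they are bounded by the length of
    -- `x` whatever the number of ε-transitions.
    Crossing : State → State → Word → Transition → ℕ → Set
    Crossing s t x (u , l , v) i = ∃₂ λ τ₁ τ₂ →
      Run s τ₁ u × Run v τ₂ t × word τ₁ ++ word ((u , l , v) ∷ τ₂) ≡ x × length (word τ₁) ≡ i

    -- Runs are cut before their first transition in `X`. The scheme is used twice: for the
    -- transitions that leave a component and for those that drop in level.
    module Cut {X : Transition → Set} (X? : ∀ e → Dec (X e)) where

      before after : Trace → Trace
      before []      = []
      before (e ∷ τ) with X? e
      ... | yes _ = []
      ... | no  _ = e ∷ before τ
      after []      = []
      after (e ∷ τ) with X? e
      ... | yes _ = e ∷ τ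
      ... | no  _ = after τ

      before++after : ∀ τ → before τ ++ after τ ≡ τ
      before++after []      = refl
      before++after (e ∷ τ) with X? e
      ... | yes _ = refl
      ... | no  _ = cong (e ∷_) (before++after τ)

      before-¬X : ∀ τ → All (¬_ ∘ X) (before τ)
      before-¬X []      = []
      before-¬X (e ∷ τ) with X? e
      ... | yes _  = []
      ... | no  ¬x = ¬x ∷ before-¬X τ

      after-X : ∀ τ {e ρ} → after τ ≡ e ∷ ρ → X e
      after-X (e ∷ τ) eq with X? e
      ... | no  _ = after-X τ eq
      after-X (e ∷ τ) refl | yes x = x

      tail : Trace → Trace
      tail []      = []
      tail (_ ∷ τ) = τ

      Avoids : State → State → Word → Trace → Set
      Avoids s t x τ = RunsOn A s t x τ × All (¬_ ∘ X) τ

      module _ {s t x b K B₀ B₁}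
          (avoiding : AtMost b (Avoids s t x))
          (positions : ∀ {e} → e ∈ₗ E → X e → AtMost K (Crossing s t x e))
          (prefixes : ∀ u y → AtMost B₀ (Avoids s u y))
          (suffixes : ∀ {u l v τ₁} → (u , l , v) ∈ₗ E → X (u , l , v) → Run s τ₁ u →
                      ∀ y → length y ≤ length x → AtMost B₁ (RunsOn A v t y)) where

        CutAt : Transition → Trace → Set
        CutAt e τ = RunsOn A s t x τ × head (after τ) ≡ just e

        cut-edge : ∀ {e τ} → CutAt e τ → e ∈ₗ E × X e
        cut-edge {e} {τ} ((π , _) , eq) with after τ in after≡ | before++after τ
        ... | e′ ∷ ρ | split≡ with refl ← Maybe.just-injective eq =
          run-∈E π (subst (e ∈ₗ_) split≡ (∈-++⁺ʳ (before τ) (here refl))) , after-X τ after≡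

        cut-parts : ∀ {u l v τ} → CutAt (u , l , v) τ →
          τ ≡ before τ ++ (u , l , v) ∷ tail (after τ) × Run s (before τ) u × Run v (tail (after τ)) t
        cut-parts {u} {l} {v} {τ} ((π , _) , eq) with after τ | before++after τ
        ... | _ ∷ ρ | split≡ with refl ← Maybe.just-injective eq
          with q , π₁ , e∈ ∷ π₂ ← run-++⁻ (before τ) (subst (λ τ → Run s τ t) (sym split≡) π) = sym split≡ , π₁ , π₂

        -- The factors count the position of the cut, the part before it, which avoids `X`, and the
        -- part after it. The position fixes the words of both parts, and these data determine the
        -- run, whence the last factor 1.
        at-edge : ∀ {u l v} → (u , l , v) ∈ₗ E → X (u , l , v) → AtMost (K * (B₀ * (B₁ * 1))) (CutAt (u , l , v))
        at-edge {u} {l} {v} e∈ Xe =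
          atMost-fibres _≟_ (length ∘ word ∘ before) crossing (positions e∈ Xe) λ i _ →
          atMost-fibres _≟ᵗ_ before {n = B₁ * 1} (prefix i) (prefixes u (take i x)) λ { τ₁ ((π₁ , _) , _) →
          atMost-fibres _≟ᵗ_ {Q = RunsOn A v t (rest τ₁)} (tail ∘ after) (suffix i τ₁)
            (suffixes e∈ Xe π₁ (rest τ₁) (≤-trans (≤-reflexive (List.length-drop (length (word (τ₁ ++ _ ∷ []))) x)) (m∸n≤m (length x) (length (word (τ₁ ++ (u , l , v) ∷ []))))))
            λ ρ _ → atMost-one (determined i τ₁ ρ) }
          where
          e = (u , l , v)
          rest : Trace → Word
          rest τ₁ = drop (length (word (τ₁ ++ e ∷ []))) x
          word-parts : ∀ {τ} → CutAt e τ → word (before τ) ++ word (e ∷ tail (after τ)) ≡ x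
          word-parts {τ} c@((_ , w) , _) = trans (sym (word-++ (before τ) _)) (trans (cong word (sym (proj₁ (cut-parts c)))) w)
          crossing : ∀ {τ} → CutAt e τ → Crossing s t x e (length (word (before τ)))
          crossing {τ} c = let _ , π₁ , π₂ = cut-parts c in before τ , tail (after τ) , π₁ , π₂ , word-parts c , refl
          take-length : ∀ (y : Word) {z} → take (length y) (y ++ z) ≡ y
          take-length []      = refl
          take-length (a ∷ y) = cong (a ∷_) (take-length y)
          drop-length : ∀ (y : Word) {z} → drop (length y) (y ++ z) ≡ z
          drop-length []      = refl
          drop-length (a ∷ y) = drop-length y
          prefix : ∀ i {τ} → CutAt e τ × length (word (before τ)) ≡ i → Avoids s u (take i x) (before τ)
          prefix i {τ} (c , refl) = (proj₁ (proj₂ (cut-parts c))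
            , sym (trans (cong (take _) (sym (word-parts c))) (take-length (word (before τ))))) , before-¬X τ
          suffix : ∀ i τ₁ {τ} → (CutAt e τ × length (word (before τ)) ≡ i) × before τ ≡ τ₁ → RunsOn A v t (rest τ₁) (tail (after τ))
          suffix i τ₁ {τ} ((c , _) , refl) = proj₂ (proj₂ (cut-parts c)) , sym (begin
            drop n x                                                       ≡⟨ cong (drop n) (proj₂ (proj₁ c)) ⟨
            drop n (word τ)                                                ≡⟨ cong (drop n ∘ word) (proj₁ (cut-parts c)) ⟩
            drop n (word (before τ ++ e ∷ tail (after τ)))                 ≡⟨ cong (drop n ∘ word) (++-assoc (before τ) (e ∷ []) _) ⟨
            drop n (word ((before τ ++ e ∷ []) ++ tail (after τ)))         ≡⟨ cong (drop n) (word-++ (before τ ++ e ∷ []) _) ⟩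
            drop n (word (before τ ++ e ∷ []) ++ word (tail (after τ)))    ≡⟨ drop-length (word (before τ ++ e ∷ [])) ⟩
            word (tail (after τ))                                          ∎)
            where
            open ≡-Reasoning
            n = length (word (before τ ++ e ∷ []))
          determined : ∀ i τ₁ ρ {τ τ′} →
            ((CutAt e τ × length (word (before τ)) ≡ i) × before τ ≡ τ₁) × tail (after τ) ≡ ρ →
            ((CutAt e τ′ × length (word (before τ′)) ≡ i) × before τ′ ≡ τ₁) × tail (after τ′) ≡ ρ → τ ≡ τ′
          determined i τ₁ ρ (((c , _) , eq₁) , eq₂) (((c′ , _) , eq₁′) , eq₂′) =
            trans (proj₁ (cut-parts c)) (trans (cong₂ (λ a b → a ++ e ∷ b) (trans eq₁ (sym eq₁′)) (trans eq₂ (sym eq₂′)))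
              (sym (proj₁ (cut-parts c′))))

        decompose : AtMost (b + length E * (K * (B₀ * (B₁ * 1)))) (RunsOn A s t x)
        decompose = atMost-⊎ split-τ avoiding
          (atMost-fibres (Maybe.≡-dec _≟ₜ_) {P = λ τ → ∃[ e ] CutAt e τ} {Q = λ c → ∃[ e ] c ≡ just e × e ∈ₗ E × X e} (head ∘ after)
            (λ { (e , c) → e , proj₂ c , cut-edge c })
            (atMost-Fin (λ { _ (_ , _ , e∈ , _) → index e∈ }) index-inj)
            (λ { _ ((u , l , v) , refl , e∈ , Xe) → atMost-weaken ≤-refl (λ { ((_ , c , _) , eq) → c , eq }) (at-edge e∈ Xe) }))
          where
          index-inj : ∀ {c c′} (p : ∃[ e ] c ≡ just e × e ∈ₗ E × X e) (q : ∃[ e ] c′ ≡ just e × e ∈ₗ E × X e) →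
            index (proj₁ (proj₂ (proj₂ p))) ≡ index (proj₁ (proj₂ (proj₂ q))) → c ≡ c′
          index-inj (_ , refl , p , _) (_ , refl , q , _) eq =
            cong just (trans (lookup-index p) (trans (cong (lookup E) eq) (sym (lookup-index q))))
          split-τ : ∀ {τ} → RunsOn A s t x τ → Avoids s t x τ ⊎ ∃[ e ] CutAt e τ
          split-τ {τ} r with after τ in eq
          ... | []    = inj₁ (r , subst (All (¬_ ∘ X)) (trans (sym (++-identityʳ (before τ))) (trans (cong (before τ ++_) (sym eq)) (before++after τ))) (before-¬X τ))
          ... | e ∷ ρ = inj₂ (e , r , refl)

    module UpperBound {d} (levels : Levels d)
        (unambiguous : ∀ {p q τ τ′} → Reach q p → Run p τ q → Run p τ′ q → word τ ≡ word τ′ → τ ≡ τ′) where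
      open Levels levels

      -- After passing to a common power the two loops and the crossing yield a flag on a way from s
      -- to t, so the level would fall strictly between states of equal level.
      loops-drop-level : ∀ {s t p q w} m m′ L → level s ≡ level t → w ≢ [] → Reach s p → Reach q t → ¬ Reach q p →
        p ─[ suc m ×ₗ w ]→ p → q ─[ suc m′ ×ₗ w ]→ q → p ─[ suc L ×ₗ w ]→ q → ⊥
      loops-drop-level {s} {t} {p} {q} {w} m m′ L s≡t w≢[] s⇝p q⇝t ¬q⇝p p-loop q-loop p→q =
        let p′ , M , p⇝p′ , p′⇝p , p′-loop , p′→q , q-loop′ = common-power m m′ L p-loop q-loop p→q
        in impossible M (suc M ×ₗ w) refl (reach-trans s⇝p p⇝p′) (λ q⇝p′ → ¬q⇝p (reach-trans q⇝p′ p′⇝p)) p′-loop p′→q q-loop′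
        where
        open ≤-Reasoning
        impossible : ∀ M x {p′} → x ≡ suc M ×ₗ w → Reach s p′ → ¬ Reach q p′ →
          p′ ─[ x ]→ p′ → p′ ─[ x ]→ q → q ─[ x ]→ q → ⊥
        impossible M []      x≡ _ _ _ _ _ = w≢[] (List.++-conicalˡ w (M ×ₗ w) (sym x≡))
        impossible M (a ∷ x) _ s⇝p′ ¬q⇝p′ π₁ π₂ π₃ =
          let p₁ , q₁ , p′⇝p₁ , q₁⇝q , f = loops⇒flag π₁ π₂ π₃ ¬q⇝p′
          in <-irrefl refl (begin-strict
               level q₁ <⟨ level-flag f ⟩
               level p₁ ≤⟨ level-reach (reach-trans s⇝p′ p′⇝p₁) ⟩
               level s  ≡⟨ s≡t ⟩
               level t  ≤⟨ level-reach (reach-trans q₁⇝q q⇝t) ⟩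
               level q₁ ∎)

      -- From u one walks back along w for ever, and from b forward along w for
      -- ever; the two loops met on the way make a flag within one level.
      no-shift : ∀ {s t y w z u b} → level s ≡ level t → w ≢ [] → ¬ Reach b u →
        (∀ a → s ─[ y ]→ a → s ─[ y ++ w ]→ a) → (∀ a → a ─[ z ]→ t → a ─[ w ++ z ]→ t) →
        s ─[ y ]→ u → u ─[ w ]→ b → b ─[ z ]→ t → ⊥
      no-shift {s} {t} {y} {w} {z} {u} {b} s≡t w≢[] ¬b⇝u backward forward s→u u→b b→t =
        let p , j , m , s→p , u←p , p-loop = eventually-periodic (λ a b → b ─[ w ]→ a) (s ─[ y ]→_)
              (λ a s→a → split y (backward a s→a)) u s→u
            q , j′ , m′ , q→t , b→q , q-loop = eventually-periodic (λ a b → a ─[ w ]→ b) (_─[ z ]→ t)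
              (λ a a→t → let c , a→c , c→t = split w (forward a a→t) in c , c→t , a→c) b b→t
            p→u = pow-run⁻ j u←p
            b→q = pow-run j′ b→q
        in loops-drop-level m m′ (j + j′) s≡t w≢[] (reach s→p) (reach q→t)
             (λ q⇝p → ¬b⇝u (reach-trans (reach b→q) (reach-trans q⇝p (reach p→u))))
             (pow-run⁻ (suc m) p-loop) (pow-run (suc m′) q-loop)
             (recast (trans (sym (×ₗ-+ j (suc j′) w)) (cong (_×ₗ w) (+-suc j j′))) (p→u ▸ u→b ▸ b→q))

      subsets : ℕ
      subsets = 2 ^ ∣Q∣ * 2 ^ ∣Q∣

      -- To each position belong the set of states reached from s before it and the set of states
      -- leading to t after it. There are `subsets` pairs of such sets, and two positions with equal
      -- pairs are refuted by `no-shift`. Membership is decided only under a double negation, which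
      -- an inequality as goal permits.
      few-crossings : ∀ {s t x u l v} → level s ≡ level t → (u , l , v) ∈ₗ E → ¬ Reach v u →
        AtMost subsets (Crossing s t x (u , l , v))
      few-crossings {s} {t} {x} {u} {l} {v} s≡t e ¬v⇝u is is! cs =
        decidable-stable (length is ≤? subsets) λ too-many →
        ¬¬-Fin (length is) {λ j → ∀ a → Dec (s ─[ prefix j ]→ a) × Dec (a ─[ suffix j ]→ t)}
          (λ j → ¬¬-Fin ∣Q∣ (λ a k → ¬¬-excluded-middle (λ S? → ¬¬-excluded-middle (λ T? → k (S? , T?)))))
          (λ dec → clash (≰⇒> too-many) dec)
        where
        crossing : ∀ j → Crossing s t x (u , l , v) (lookup is j)
        crossing j = All.lookup cs (∈-lookup j)
        prefix suffix : Fin (length is) → Word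
        prefix j = word (proj₁ (crossing j))
        suffix j = word ((u , l , v) ∷ proj₁ (proj₂ (crossing j)))
        parts : ∀ j → prefix j ++ suffix j ≡ x
        parts j = let _ , _ , _ , _ , eq , _ = crossing j in eq
        prefix-length : ∀ j → length (prefix j) ≡ lookup is j
        prefix-length j = let _ , _ , _ , _ , _ , eq = crossing j in eq

        compare-at : ∀ j j′ → lookup is j < lookup is j′ →
          (∀ a → s ─[ prefix j ]→ a → s ─[ prefix j′ ]→ a) → (∀ a → a ─[ suffix j′ ]→ t → a ─[ suffix j ]→ t) → ⊥
        compare-at j j′ j<j′ S⇒S′ T′⇒T with ++-comparable (prefix j) (prefix j′) (trans (parts j) (sym (parts j′)))
        ... | inj₂ (w , eq) = <⇒≱ j<j′ (≤-trans (m≤m+n _ (length w)) (≤-reflexive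
                (trans (cong (_+ length w) (sym (prefix-length j′))) (trans (sym (length-++ (prefix j′))) (trans (sym (cong length eq)) (prefix-length j))))))
        ... | inj₁ (w , eq) = shifted (trace-split w ((u , l , v) ∷ τ₂) suffix≡)
          where
          τ₁ = proj₁ (crossing j)
          τ₂ = proj₁ (proj₂ (crossing j))
          suffix≡ : suffix j ≡ w ++ suffix j′
          suffix≡ = ++-cancelˡ (prefix j) _ _ (trans (parts j) (trans (sym (parts j′))
            (trans (cong (_++ suffix j′) eq) (++-assoc (prefix j) w (suffix j′)))))
          w≢[] : w ≢ []
          w≢[] refl = <-irrefl (trans (sym (prefix-length j))
            (trans (cong length (sym (trans eq (++-identityʳ (prefix j))))) (prefix-length j′))) j<j′
          -- The run through the earlier position takes the transition and then reads the rest of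
          -- `w` up to some b. Having passed v, it cannot return from b to u.
          shifted : (∃₂ λ ρ₁ ρ₂ → (u , l , v) ∷ τ₂ ≡ ρ₁ ++ ρ₂ × word ρ₁ ≡ w × word ρ₂ ≡ suffix j′) → ⊥
          shifted ([]     , _  , _  , w≡ , _)  = w≢[] (sym w≡)
          shifted (_ ∷ ρ₁ , ρ₂ , τ≡ , w≡ , z≡) with refl , τ₂≡ ← ∷-injective τ≡ =
            let _ , _ , π₁ , π₂ , _ = crossing j
                b , π₃ , π₄ = run-++⁻ ρ₁ (subst (λ τ → Run v τ t) τ₂≡ π₂)
            in no-shift s≡t w≢[] (λ b⇝u → ¬v⇝u (reach-trans (ρ₁ , π₃) b⇝u))
                 (λ a → recast eq ∘ S⇒S′ a) (λ a → recast suffix≡ ∘ T′⇒T a)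
                 (τ₁ , π₁ , refl) (_ , e ∷ π₃ , w≡) (ρ₂ , π₄ , z≡)

        bits : ∀ {f g : Fin ∣Q∣ → Fin 2} → funToFin f ≡ funToFin g → ∀ a → f a ≡ g a
        bits {f} {g} eq a = trans (sym (Fin.finToFun-funToFin f a)) (trans (cong (λ k → finToFun k a) eq) (Fin.finToFun-funToFin g a))

        clash : subsets < length is →
          (∀ j a → Dec (s ─[ prefix j ]→ a) × Dec (a ─[ suffix j ]→ t)) → ⊥
        clash many dec
          with j , j′ , j<j′ , same ← Fin.pigeonhole many (λ j → combine (funToFin (bit ∘ proj₁ ∘ dec j)) (funToFin (bit ∘ proj₂ ∘ dec j)))
          with S≡ , T≡ ← Fin.combine-injective _ _ _ _ same
          with <-cmp (lookup is j) (lookup is j′)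
        ... | tri≈ _ eq _ = <-irrefl (cong toℕ (lookup-injective is! j j′ eq)) j<j′
        ... | tri< lt _ _ = compare-at j j′ lt (λ a → bit-transport (bits S≡ a)) (λ a → bit-transport (bits (sym T≡) a))
        ... | tri> _ _ gt = compare-at j′ j gt (λ a → bit-transport (bits (sym S≡) a)) (λ a → bit-transport (bits T≡ a))

      -- The argument exceeds the rank of the start. The factors are those of the cut at the first
      -- transition leaving a component: the transition, its position, the one run before it, the
      -- runs after it.
      levelBound : ℕ → ℕ
      levelBound zero    = 0
      levelBound (suc f) = 1 + length E * (subsets * (1 * (levelBound f * 1)))

      B : ℕ
      B = levelBound (suc ∣Q∣)

      constant : ℕ → ℕ
      constant zero    = B
      constant (suc k) = B + length E * (B * constant k)

      -- Decidability of reachability is assumed here and discharged in `upper-bound`, where the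
      -- goal is stable under double negation.
      module Classical (reach? : ∀ p q → Dec (Reach p q)) where

        -- The number of reachable states falls along every run that cannot return, which gives the
        -- induction over components.
        rank : State → ℕ
        rank s = length (filter (reach? s) (allFin ∣Q∣))

        rank≤ : ∀ s → rank s ≤ ∣Q∣
        rank≤ s = ≤-trans (List.length-filter (reach? s) (allFin ∣Q∣)) (≤-reflexive (length-tabulate (λ i → i)))

        rank-reach : ∀ {p q} → Reach p q → ¬ Reach q p → rank q < rank p
        rank-reach {p} {q} p⇝q ¬q⇝p =
          length-filter-< (reach? q) (reach? p) (reach-trans p⇝q) (allFin ∣Q∣) (∈-allFin p) reach-refl ¬q⇝p

        Leaves : Transition → Set
        Leaves (u , _ , v) = ¬ Reach v u

        leaves? : ∀ e → Dec (Leaves e)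
        leaves? (u , _ , v) with reach? v u
        ... | yes r = no λ ¬r → ¬r r
        ... | no ¬r = yes ¬r

        stays-back : ∀ {p τ q} → Run p τ q → All (¬_ ∘ Leaves) τ → Reach q p
        stays-back []      []       = reach-refl
        stays-back (_∷_ {p} {l} {q} e π) (¬leaves ∷ rest) with reach? q p
        ... | yes r = reach-trans (stays-back π rest) r
        ... | no ¬r = contradiction ¬r ¬leaves

        open Cut leaves? using () renaming (Avoids to AvoidsLeaving; decompose to decompose-leaving)

        within-component : ∀ {s t x} → AtMost 1 (AvoidsLeaving s t x)
        within-component = atMost-one λ { ((π , w) , stays) ((π′ , w′) , _) →
          unambiguous (stays-back π stays) π π′ (trans w (sym w′)) }

        -- Before the first leaving transition the run stays in one component and is unique; after
        -- it the rank is smaller. That the remaining run again joins states of equal level is known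
        -- only once such a run exists, hence `atMost-witness`.
        same-level : ∀ f {s t x} → rank s < f → level s ≡ level t → AtMost (levelBound f) (RunsOn A s t x)
        same-level (suc f) {s} {t} {x} s<f s≡t = decompose-leaving within-component (few-crossings s≡t) (λ _ _ → within-component)
          (λ e leaves π₁ y _ → atMost-witness λ { _ (π₂ , _) →
            same-level f
              (<-≤-trans (rank-reach (reach-trans (_ , π₁) (_ , e ∷ [])) λ v⇝s → leaves (reach-trans v⇝s (_ , π₁))) (s≤s⁻¹ s<f))
              (≤-antisym (≤-trans (level-reach (_ , π₁ ⊕ʳ e ∷ [])) (≤-reflexive s≡t)) (level-run π₂)) })

        Drops : Transition → Set
        Drops (u , _ , v) = level v < level u

        drops? : ∀ e → Dec (Drops e)
        drops? (u , _ , v) = level v <? level u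

        no-drop : ∀ {p τ q} → Run p τ q → All (¬_ ∘ Drops) τ → level p ≡ level q
        no-drop []      []           = refl
        no-drop (e ∷ π) (keeps ∷ ks) = trans (≤-antisym (≮⇒≥ keeps) (level-step e)) (no-drop π ks)

        open Cut drops? using () renaming (Avoids to AvoidsDrop; decompose to decompose-drop)

        within-level : ∀ {s t x} → AtMost B (AvoidsDrop s t x)
        within-level {s} {t} {x} = atMost-witness λ { _ ((π , _) , keeps) →
          atMost-weaken ≤-refl proj₁ (same-level (suc ∣Q∣) (s≤s (rank≤ s)) (no-drop π keeps)) }

        crossings≤ : ∀ {s t x e} → AtMost (suc (length x)) (Crossing s t x e)
        crossings≤ {s} {t} {x} {e} = atMost-weaken {P = Crossing s t x e} ≤-refl
          (λ { (τ₁ , τ₂ , _ , _ , eq , refl) →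
               s≤s (≤-trans (m≤m+n _ _) (≤-reflexive (trans (sym (length-++ (word τ₁))) (cong length eq)))) })
          (atMost-< (suc (length x)))

        -- Only the position of a drop in level has a number of choices that depends on `x`. It
        -- contributes a factor |x| + 1, and at most `k` drops occur.
        all-runs : ∀ k {s t} x → level s ≤ k → AtMost (constant k * suc (length x) ^ k) (RunsOn A s t x)
        all-runs zero {s} {t} x s≤0 = atMost-witness λ { _ (π , _) →
          atMost-weaken (≤-reflexive (sym (*-identityʳ B))) (λ r → r)
            (same-level (suc ∣Q∣) (s≤s (rank≤ s)) (trans (n≤0⇒n≡0 s≤0) (sym (n≤0⇒n≡0 (≤-trans (level-run π) s≤0))))) }
        all-runs (suc k) {s} {t} x s≤1+k = atMost-weaken bound (λ r → r)
          (decompose-drop within-level (λ {e} _ _ → crossings≤ {e = e}) (λ _ _ → within-level)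
            (λ e drops π₁ y y≤x → atMost-weaken (*-monoʳ-≤ (constant k) (^-monoˡ-≤ k (s≤s y≤x))) (λ r → r)
              (all-runs k y (s≤s⁻¹ (≤-trans (<-≤-trans drops (level-run π₁)) s≤1+k)))))
          where
          open ≤-Reasoning
          L = suc (length x)
          lemma : ∀ b e l c p → b * (l * p) + e * (l * (b * (c * p * 1))) ≡ (b + e * (b * c)) * (l * p)
          lemma = solve-∀
          bound : B + length E * (L * (B * (constant k * L ^ k * 1))) ≤ constant (suc k) * L ^ suc k
          bound = begin
            B + length E * (L * (B * (constant k * L ^ k * 1)))
              ≤⟨ +-monoˡ-≤ _ (m≤m*n B (L * L ^ k) {{m^n≢0 L (suc k)}}) ⟩
            B * (L * L ^ k) + length E * (L * (B * (constant k * L ^ k * 1)))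
              ≡⟨ lemma B (length E) L (constant k) (L ^ k) ⟩
            constant (suc k) * L ^ suc k ∎

        successful : ∀ x {m} → Da A x m → m ≤ ∣Q∣ * ∣Q∣ * (constant d * suc (length x) ^ d)
        successful x {m} da = ≤-trans (≤-reflexive (sym (trans (length-map _ (allFin m)) (length-tabulate (λ i → i)))))
          (atMost-fibres (Product.≡-dec Fin._≟_ Fin._≟_) {P = Endpoints} {Q = λ _ → State × State} (λ { (p , q , _) → p , q })
            (λ {(p , q , _)} _ → p , q)
            (atMost-Fin (λ { (p , q) _ → combine p q }) (λ { {p , q} {p′ , q′} _ _ eq → let p≡ , q≡ = Fin.combine-injective p q p′ q′ eq in cong₂ _,_ p≡ q≡ }))
            (λ { (p , q) _ → atMost-weaken (≤-reflexive (*-identityʳ _)) (λ r → r)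
                 (atMost-fibres _≟ᵗ_ {Q = RunsOn A p q x} (proj₂ ∘ proj₂) (λ { (r , refl) → r }) (all-runs d x (level≤ p))
                   (λ τ _ → atMost-one λ { ((_ , refl) , refl) ((_ , refl) , refl) → refl })) })
            (map (describe ∘ Inverse.from da) (allFin m))
            (Unique.map⁺ (λ eq → from-injective (describe-injective eq)) (Unique.allFin⁺ m))
            (All.map⁺ (All.tabulate⁺ {f = λ i → i} (λ i → describe-run (Inverse.from da i)))))
          where
          Endpoints : State × State × Trace → Set
          Endpoints (p , q , τ) = RunsOn A p q x τ
          describe : SuccessfulPathLabelled A x → State × State × Trace
          describe ((p , q , _ , _ , π) , _) = p , q , trace π
          describe-run : ∀ s → Endpoints (describe s)
          describe-run ((_ , _ , _ , _ , π) , eq) = trace-run π , trans (word-trace π) eq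
          from-injective : ∀ {i j} → Inverse.from da i ≡ Inverse.from da j → i ≡ j
          from-injective {i} {j} eq = trans (sym (Inverse.strictlyInverseˡ da i)) (trans (cong (Inverse.to da) eq) (Inverse.strictlyInverseˡ da j))
          describe-injective : ∀ {s s′} → describe s ≡ describe s′ → s ≡ s′
          describe-injective {(p , q , p∈ , q∈ , π) , w} {(p′ , q′ , p∈′ , q∈′ , π′) , w′} eq
            with refl , eq′ ← Product.,-injective eq
            with refl , eq″ ← Product.,-injective eq′
            with refl ← trace-injective {π = π} {π′} eq″
            with refl ← w | refl ← w′
            with refl ← []=-irrelevant p∈ p∈′ | refl ← []=-irrelevant q∈ q∈′ = refl

      upper-bound : PolynomiallyAmbiguous A → ∃[ h ] AmbiguityBoundedBy A h × degree h ≡ d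
      upper-bound (_ , finite) = geometric (C * 2 ^ d) d , bounded , degree-geometric (C * 2 ^ d) d {{m*n≢0 C (2 ^ d) {{_}} {{m^n≢0 2 d}}}}
        where
        -- The successor keeps the leading coefficient nonzero, so that the polynomial has degree
        -- exactly `d` even if the count is 0.
        C = suc (∣Q∣ * ∣Q∣ * constant d)
        bounded : AmbiguityBoundedBy A (geometric (C * 2 ^ d) d)
        -- The hypothesis supplies the value of da(A,x); the new bound on it is decidable and may
        -- therefore be proved with reachability assumed decidable.
        bounded x = let m , da , _ = finite x in m , da , decidable-stable (_ ≤? _) λ m≰ →
          ¬¬-Fin ∣Q∣ (λ p → ¬¬-Fin ∣Q∣ (λ q → ¬¬-excluded-middle)) λ reach? → m≰ (begin
            m                                                  ≤⟨ Classical.successful reach? x da ⟩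
            ∣Q∣ * ∣Q∣ * (constant d * suc (length x) ^ d)      ≡⟨ *-assoc (∣Q∣ * ∣Q∣) (constant d) _ ⟨
            ∣Q∣ * ∣Q∣ * constant d * suc (length x) ^ d        ≤⟨ *-monoˡ-≤ (suc (length x) ^ d) (n≤1+n (∣Q∣ * ∣Q∣ * constant d)) ⟩
            C * suc (length x) ^ d                             ≤⟨ geometric-bound C d (length x) ⟩
            eval (geometric (C * 2 ^ d) d) (length x)          ∎)
          where open ≤-Reasoning

  levels⇒dpa : ∀ A → Trim A → ε-CycleFree A → PolynomiallyAmbiguous A → ∀ {d} → Runs.Levels A d → Dpa A d
  levels⇒dpa A trim ε-free poly levels =
      UpperBound.upper-bound A levels (unambiguous A trim ε-free poly) poly
    , LowerBound.d≤degree A trim ε-free levels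

-- From arrays to flags and levels

module Correspondence where

  open import Defs using (Automaton; encodeLabel)
  open LoopLogic using (Holds; holds-index; holds-find)
  open DepthFirstSearch using (module Graph)
  open ReadProgram using (Triple; entries; Numbering; Numbered; bounded₀; injective)
  open ProductProgram using (Tables; module Emission)
  open LevelsProgram using (module Relaxation)
  open Traces using (module Runs)
  open import Data.Fin using (Fin; toℕ)
  import Data.Fin.Properties as Fin
  open import Data.List using (List; []; _∷_; _++_; length; map)
  open import Data.List.Membership.Propositional using (_∈_)
  open import Data.List.Membership.Propositional.Properties using (∈-map⁺; ∈-map⁻)
  open import Data.List.Relation.Unary.All as All using (All)
  open import Data.List.Relation.Unary.Any using (here; there)
  open import Data.Maybe using (just; nothing)
  open import Data.Nat
  open import Data.Nat.DivMod using (_%_; [m+kn]%n≡m%n; m<n⇒m%n≡m)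
  open import Data.Nat.Properties
  open import Data.Nat.Tactic.RingSolver using (solve-∀)
  open import Data.Product using (∃-syntax; ∃₂; _×_; _,_; proj₁; proj₂)
  open import Data.Sum using (_⊎_; inj₁; inj₂)
  open import Function using (_∘_)
  open import Relation.Binary.Construct.Closure.ReflexiveTransitive using (ε; _◅_; _◅◅_)
  open import Relation.Binary.PropositionalEquality
  open import Relation.Nullary using (¬_; contradiction)

  positional : ∀ N {a b c d} → a < N → c < N → a + N * b ≡ c + N * d → a ≡ c × b ≡ d
  positional N@(suc _) {a} {b} {c} {d} a<N c<N eq = a≡c , *-cancelˡ-≡ b d N (+-cancelˡ-≡ a _ _ (trans eq (cong (_+ N * d) (sym a≡c))))
    where
    remainder : ∀ {x} y → x < N → (x + N * y) % N ≡ x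
    remainder {x} y x<N = trans (cong (λ z → (x + z) % N) (*-comm N y)) (trans ([m+kn]%n≡m%n x y N) (m<n⇒m%n≡m x<N))
    a≡c : a ≡ c
    a≡c = trans (sym (remainder b a<N)) (trans (cong (_% N) eq) (remainder d c<N))

  module _ (A : Automaton) where
    open Automaton A
    open Runs A

    raw : Transition → Triple
    raw (p , l , q) = toℕ p , encodeLabel A l , toℕ q

    record Model : Set where
      field
        tables : Tables
        N M L  : ℕ
        u v    : ℕ → ℕ
        vis    : ℕ → ℕ
        before : List Triple
        edges  : List (ℕ × ℕ)
      open Tables tables public
      open Emission tables M public using (Labels; Letters; stepEdge; resetEdge; Emits; code)
      open Relaxation tables vis M public using (Flagged; Arc; plain; special; Walk; []; _∷_; Realised; _⇒*_)
      open Graph.DepthFirst u v L public using (_⟶_; _⟶*_)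
      field
        table     : Holds (λ i → src i , lab i , dst i) (entries before)
        M≡        : M ≡ length (entries before)
        before⊆   : ∀ {x} → x ∈ before → x ∈ map raw E
        ⊆before   : ∀ {x} → x ∈ map raw E → x ∈ before
        numbers   : Numbering t (pred N)
        numbered  : All (Numbered t) (entries before)
        0<N       : 0 < N
        t₂≡       : ∀ {i} → i < M → t₂ (src i) ≡ N * t (src i)
        t₃≡       : ∀ {i} → i < M → t₃ (src i) ≡ N * (N * t (src i))
        edge-list : Holds (λ e → u e , v e) edges
        L≡        : L ≡ length edges
        sound     : All Emits edges
        all-steps : ∀ {i j k} → i < M → j < M → k < M → Labels i j k → stepEdge i j k ∈ edges
        resets    : ∀ {i k} → i < M → k < M → Letters i k → resetEdge i k ∈ edges
        same⇒back : ∀ {e} → e < L → vis (u e) ≡ vis (v e) → v e ⟶* u e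
        back⇒same : ∀ {e} → e < L → v e ⟶* u e → vis (u e) ≡ vis (v e)

    module Correct (model : Model) where
      open Model model

      entry-cases : ∀ {x} es → x ∈ entries es →
        x ∈ es ⊎ ∃[ p ] x ≡ (p , 0 , p) × (∃₂ λ a q → (p , a , q) ∈ es ⊎ (q , a , p) ∈ es)
      entry-cases (_ ∷ es) (here refl)                 = inj₂ (_ , refl , _ , _ , inj₂ (here refl))
      entry-cases (_ ∷ es) (there (here refl))         = inj₂ (_ , refl , _ , _ , inj₁ (here refl))
      entry-cases (_ ∷ es) (there (there (here refl))) = inj₁ (here refl)
      entry-cases (_ ∷ es) (there (there (there x∈))) with entry-cases es x∈
      ... | inj₁ x∈′ = inj₁ (there x∈′)
      ... | inj₂ (p , eq , a , q , inj₁ e∈) = inj₂ (p , eq , a , q , inj₁ (there e∈))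
      ... | inj₂ (p , eq , a , q , inj₂ e∈) = inj₂ (p , eq , a , q , inj₂ (there e∈))

      entry-step : ∀ {p a q} es → (p , a , q) ∈ es →
        (p , a , q) ∈ entries es × (p , 0 , p) ∈ entries es × (q , 0 , q) ∈ entries es
      entry-step (_ ∷ es) (here refl) = there (there (here refl)) , there (here refl) , here refl
      entry-step (_ ∷ es) (there e∈)  = let x , y , z = entry-step es e∈ in
        there (there (there x)) , there (there (there y)) , there (there (there z))

      find : ∀ {p a q} → (p , a , q) ∈ entries before → ∃[ i ] i < M × src i ≡ p × lab i ≡ a × dst i ≡ q
      find x∈ with i , i<l , refl ← holds-find (entries before) table x∈ = i , ≤-trans i<l (≤-reflexive (sym M≡)) , refl , refl , refl

      at-index : ∀ {i} → i < M → (src i , lab i , dst i) ∈ entries before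
      at-index {i} i<M = holds-index (entries before) table i (≤-trans i<M (≤-reflexive M≡))

      -- The label 0 stands for any silent run, so that ε-transitions and the added loops, which are
      -- empty runs, are treated alike.
      Step : ℕ → State → State → Set
      Step n P Q = (n ≡ 0 × P ─[ [] ]→ Q) ⊎ ∃[ a ] n ≡ suc (toℕ a) × (P , just a , Q) ∈ E

      raw-step : ∀ {x} → x ∈ map raw E → ∃₂ λ P Q → proj₁ x ≡ toℕ P × proj₂ (proj₂ x) ≡ toℕ Q × Step (proj₁ (proj₂ x)) P Q
      raw-step x∈ with ∈-map⁻ raw x∈
      ... | (P , nothing , Q) , e∈ , refl = P , Q , refl , refl , inj₁ (refl , _ , e∈ ∷ [] , refl)
      ... | (P , just a , Q)  , e∈ , refl = P , Q , refl , refl , inj₂ (a , refl , e∈)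

      meaning : ∀ {i} → i < M → ∃₂ λ P Q → src i ≡ toℕ P × dst i ≡ toℕ Q × Step (lab i) P Q
      meaning i<M with entry-cases before (at-index i<M)
      ... | inj₁ x∈ = raw-step (before⊆ x∈)
      ... | inj₂ (p , eq , a , q , inj₁ e∈) with raw-step (before⊆ e∈)
      ...   | P , _ , refl , _ = P , P , cong proj₁ eq , cong (proj₂ ∘ proj₂) eq , inj₁ (cong (proj₁ ∘ proj₂) eq , stay)
      meaning i<M | inj₂ (p , eq , a , q , inj₂ e∈) with raw-step (before⊆ e∈)
      ...   | _ , P , _ , refl , _ = P , P , cong proj₁ eq , cong (proj₂ ∘ proj₂) eq , inj₁ (cong (proj₁ ∘ proj₂) eq , stay)

      -- Says that the state is an end point of some transition, through the loop that the table
      -- then contains. Only such states have a nonzero number, and only for them are codes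
      -- injective.
      Known : ℕ → Set
      Known p = ∃[ i ] i < M × src i ≡ p × lab i ≡ 0 × dst i ≡ p

      entry-of : ∀ {P l Q} → (P , l , Q) ∈ E → (∃[ i ] i < M × src i ≡ toℕ P × lab i ≡ encodeLabel A l × dst i ≡ toℕ Q)
        × Known (toℕ P) × Known (toℕ Q)
      entry-of e∈ = let x , y , z = entry-step before (⊆before (∈-map⁺ raw e∈)) in find x , find y , find z

      known-ends : ∀ {i} → i < M → Known (src i) × Known (dst i)
      known-ends {i} i<M with entry-cases before (at-index i<M)
      ... | inj₁ x∈ = let _ , y , z = entry-step before x∈ in find y , find z
      ... | inj₂ (p , eq , _) rewrite cong proj₁ eq | cong (proj₂ ∘ proj₂) eq =
        let k = find (subst (_∈ entries before) eq (at-index i<M)) in k , k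

      t<N : ∀ p → t p < N
      t<N p = ≤-trans (s≤s (bounded₀ numbers p)) (≤-reflexive (suc-pred N {{>-nonZero 0<N}}))

      t-injective : ∀ {p q} → Known p → t p ≡ t q → p ≡ q
      t-injective (i , i<M , refl , _) eq = injective numbers eq (proj₁ (All.lookup numbered (at-index i<M)))

      code-split : ∀ {a b c} → Known a → Known b → Known c → code a b c ≡ t a + N * (t b + N * t c)
      code-split {a} {b} {c} _ (j , j<M , refl , _) (k , k<M , refl , _) =
        trans (cong₂ (λ x y → t a + x + y) (t₂≡ j<M) (t₃≡ k<M)) (lemma (t a) (t (src j)) (t (src k)) N)
        where
        lemma : ∀ a b c n → a + n * b + n * (n * c) ≡ a + n * (b + n * c)
        lemma = solve-∀

      code-injective : ∀ {a b c a′ b′ c′} → Known a → Known b → Known c → Known a′ → Known b′ → Known c′ →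
        code a b c ≡ code a′ b′ c′ → a ≡ a′ × b ≡ b′ × c ≡ c′
      code-injective {a} {b} {c} {a′} {b′} {c′} ka kb kc ka′ kb′ kc′ eq =
        let ta , rest = positional N (t<N a) (t<N a′) (trans (sym (code-split ka kb kc)) (trans eq (code-split ka′ kb′ kc′)))
            tb , tc = positional N (t<N b) (t<N b′) rest
        in t-injective ka ta , t-injective kb tb , t-injective kc tc

      word-step : ∀ {n P Q n′ P′ Q′} → Step n P Q → Step n′ P′ Q′ → n ≡ n′ → ∃[ x ] P ─[ x ]→ Q × P′ ─[ x ]→ Q′
      word-step (inj₁ (refl , π)) (inj₁ (_ , π′)) _    = [] , π , π′
      word-step (inj₁ (refl , _)) (inj₂ (_ , refl , _)) ()
      word-step (inj₂ (_ , refl , _)) (inj₁ (refl , _)) ()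
      word-step (inj₂ (a , refl , e)) (inj₂ (a′ , eq , e′)) n≡ with refl ← Fin.toℕ-injective (suc-injective (trans n≡ eq)) =
        a ∷ [] , (_ , e ∷ [] , refl) , (_ , e′ ∷ [] , refl)

      words-step : ∀ {n P Q n′ P′ Q′ n″ P″ Q″} → Step n P Q → Step n′ P′ Q′ → Step n″ P″ Q″ → n ≡ n′ → n′ ≡ n″ →
        ∃[ x ] P ─[ x ]→ Q × P′ ─[ x ]→ Q′ × P″ ─[ x ]→ Q″
      words-step (inj₁ (refl , π)) (inj₁ (_ , π′)) (inj₁ (_ , π″)) _ _ = [] , π , π′ , π″
      words-step (inj₂ (a , refl , e)) (inj₂ (a′ , eq′ , e′)) (inj₂ (a″ , eq″ , e″)) n≡ n′≡
        with refl ← Fin.toℕ-injective (suc-injective (trans n≡ eq′))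
        with refl ← Fin.toℕ-injective (suc-injective (trans (trans n≡ n′≡) eq″)) =
        a ∷ [] , (_ , e ∷ [] , refl) , (_ , e′ ∷ [] , refl) , (_ , e″ ∷ [] , refl)
      words-step (inj₁ (refl , _)) (inj₂ (_ , refl , _)) _ () _
      words-step (inj₁ (refl , _)) (inj₁ (refl , _)) (inj₂ (_ , refl , _)) _ ()
      words-step (inj₂ (_ , refl , _)) (inj₁ (refl , _)) _ () _
      words-step (inj₂ (_ , refl , _)) (inj₂ (_ , refl , _)) (inj₁ (refl , _)) _ ()

      -- The second component follows its own path up to the first reset edge, and
      -- from there on a copy of the path of the third one.
      record Tracked (a b c : State) (n : ℕ) : Set where
        field
          {a′ b′ c′} : State
          known-a : Known (toℕ a′)
          known-b : Known (toℕ b′)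
          known-c : Known (toℕ c′)
          target  : n ≡ code (toℕ a′) (toℕ b′) (toℕ c′)
          {label} : Word
          path-a  : a ─[ label ]→ a′
          path-c  : c ─[ label ]→ c′
          path-b  : b ─[ label ]→ b′ ⊎ b ─[ label ]→ c′

      edge-emits : ∀ {e} → e < L → Emits (u e , v e)
      edge-emits {e} e<L = All.lookup sound (holds-index edges edge-list e (≤-trans e<L (≤-reflexive L≡)))

      track : ∀ {a b c m n} → m ≡ code (toℕ a) (toℕ b) (toℕ c) → Known (toℕ a) → Known (toℕ b) → Known (toℕ c) →
        m ⟶* n → Tracked a b c n
      track m≡ ka kb kc ε = record
        { known-a = ka ; known-b = kb ; known-c = kc ; target = m≡ ; path-a = stay ; path-c = stay ; path-b = inj₁ stay }
      track {a} {b} {c} {n = n} m≡ ka kb kc ((e , e<L , refl , refl) ◅ path) with edge-emits e<L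
      ... | inj₁ (i , j , k , i<M , j<M , k<M , (l₁ , l₂) , eq)
        with Pa , Qa , sa , da , step-a ← meaning i<M
        with Pb , Qb , sb , db , step-b ← meaning j<M
        with Pc , Qc , sc , dc , step-c ← meaning k<M
        with a≡ , b≡ , c≡ ← code-injective ka kb kc (proj₁ (known-ends i<M)) (proj₁ (known-ends j<M)) (proj₁ (known-ends k<M))
                              (trans (sym m≡) (cong proj₁ eq))
        with refl ← Fin.toℕ-injective (trans a≡ sa) | refl ← Fin.toℕ-injective (trans b≡ sb) | refl ← Fin.toℕ-injective (trans c≡ sc)
        with x , πa , πb , πc ← words-step step-a step-b step-c l₁ l₂ =
        extend (track (trans (cong proj₂ eq) (cong₃ da db dc))
                 (subst Known da (proj₂ (known-ends i<M))) (subst Known db (proj₂ (known-ends j<M))) (subst Known dc (proj₂ (known-ends k<M))) path)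
        where
        cong₃ : ∀ {a a′ b b′ c c′} → a ≡ a′ → b ≡ b′ → c ≡ c′ → code a b c ≡ code a′ b′ c′
        cong₃ refl refl refl = refl
        extend : Tracked Qa Qb Qc n → Tracked Pa Pb Pc n
        extend tr = record { known-a = known-a ; known-b = known-b ; known-c = known-c ; target = target ; path-a = πa ▸ path-a ; path-c = πc ▸ path-c
                           ; path-b = second path-b }
          where
          open Tracked tr
          second : Qb ─[ label ]→ b′ ⊎ Qb ─[ label ]→ c′ → Pb ─[ x ++ label ]→ b′ ⊎ Pb ─[ x ++ label ]→ c′
          second (inj₁ π) = inj₁ (πb ▸ π)
          second (inj₂ π) = inj₂ (πb ▸ π)
      ... | inj₂ (i , k , i<M , k<M , (l₁ , _) , eq)
        with Pa , Qa , sa , da , step-a ← meaning i<M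
        with Pc , Qc , sc , dc , step-c ← meaning k<M
        with a≡ , b≡ , c≡ ← code-injective ka kb kc (proj₁ (known-ends i<M)) (proj₁ (known-ends k<M)) (proj₁ (known-ends k<M))
                              (trans (sym m≡) (cong proj₁ eq))
        with refl ← Fin.toℕ-injective (trans a≡ sa) | refl ← Fin.toℕ-injective (trans b≡ sc) | refl ← Fin.toℕ-injective (trans c≡ sc)
        with x , πa , πc ← word-step step-a step-c l₁ =
        extend (track (trans (cong proj₂ eq) (cong₂ (λ a c → code a a c) da dc))
                 (subst Known da (proj₂ (known-ends i<M))) (subst Known da (proj₂ (known-ends i<M))) (subst Known dc (proj₂ (known-ends k<M))) path)
        where
        extend : Tracked Qa Qa Qc n → Tracked Pa Pc Pc n
        extend tr = record { known-a = known-a ; known-b = known-b ; known-c = known-c ; target = target ; path-a = πa ▸ path-a ; path-c = πc ▸ path-c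
                           ; path-b = inj₂ (πc ▸ path-c) }
          where open Tracked tr

      edge-index : ∀ {x y} → (x , y) ∈ edges → ∃[ e ] e < L × u e ≡ x × v e ≡ y
      edge-index x∈ with e , e<l , eq ← holds-find edges edge-list x∈ =
        e , ≤-trans e<l (≤-reflexive (sym L≡)) , cong proj₁ eq , cong proj₂ eq

      -- Equal component numbers at the ends of the reset edge give a way back from (P′, P′, Q′) to
      -- (P, Q, Q); its three tracked components are the loop at P, the crossing and the loop at Q.
      flagged⇒flag : ∀ {i j P Q} → i < M → j < M → Flagged i j → src i ≡ toℕ P → src j ≡ toℕ Q → Flag P Q
      flagged⇒flag {i} {j} {P} {Q} i<M j<M (l≡ , l≢0 , same , src≢) i≡P j≡Q
        with edge-index (resets i<M j<M (l≡ , l≢0)) | meaning i<M | meaning j<M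
      ... | e , e<L , u≡ , v≡ | P₁ , P′ , sP , dP , inj₁ (l≡0 , _) | _ = contradiction l≡0 l≢0
      ... | e , e<L , u≡ , v≡ | _ | Q₁ , Q′ , sQ , dQ , inj₁ (l≡0 , _) = contradiction (trans l≡ l≡0) l≢0
      ... | e , e<L , u≡ , v≡ | P₁ , P′ , sP , dP , inj₂ (a , la , e₁) | Q₁ , Q′ , sQ , dQ , inj₂ (a′ , la′ , e₃)
        with refl ← Fin.toℕ-injective (trans (sym i≡P) sP) | refl ← Fin.toℕ-injective (trans (sym j≡Q) sQ)
        with refl ← Fin.toℕ-injective (suc-injective (trans (sym la) (trans l≡ la′)))
        = conclude (track (trans v≡ (cong₂ (λ a c → code a a c) dP dQ)) kP′ kP′ kQ′ (same⇒back e<L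
            (trans (cong vis u≡) (trans same (cong vis (sym v≡))))))
        where
        kP′ : Known (toℕ P′)
        kP′ = subst Known dP (proj₂ (known-ends i<M))
        kQ′ : Known (toℕ Q′)
        kQ′ = subst Known dQ (proj₂ (known-ends j<M))
        conclude : Tracked P′ P′ Q′ (u e) → Flag P Q
        conclude tr
          with x , y , z ← code-injective (proj₁ (known-ends i<M)) (proj₁ (known-ends j<M)) (proj₁ (known-ends j<M))
                 (Tracked.known-a tr) (Tracked.known-b tr) (Tracked.known-c tr) (trans (sym u≡) (Tracked.target tr))
          with refl ← Fin.toℕ-injective (trans (sym i≡P) x) | refl ← Fin.toℕ-injective (trans (sym j≡Q) y)
             | refl ← Fin.toℕ-injective (trans (sym j≡Q) z) = record
          { distinct = λ { refl → src≢ (trans i≡P (sym j≡Q)) }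
          ; p-step = e₁ ; q-step = e₃
          ; p-loop = Tracked.path-a tr ; cross = merge (Tracked.path-b tr) ; q-loop = Tracked.path-c tr }
          where
          -- In the final triple the second and third components are both Q, so the crossing ends in
          -- Q whether or not it met a reset.
          merge : ∀ {X : Set} → X ⊎ X → X
          merge (inj₁ x) = x
          merge (inj₂ x) = x

      product-step : ∀ {i j k} → i < M → j < M → k < M → Labels i j k →
        code (src i) (src j) (src k) ⟶* code (dst i) (dst j) (dst k)
      product-step i<M j<M k<M labels with e , e<L , u≡ , v≡ ← edge-index (all-steps i<M j<M k<M labels) =
        (e , e<L , u≡ , v≡) ◅ ε

      KnownS : State → Set
      KnownS p = Known (toℕ p)

      known-run : ∀ {p τ q} → Run p τ q → KnownS p → KnownS q
      known-run []      kp = kp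
      known-run (e ∷ π) kp = known-run π (proj₂ (proj₂ (entry-of e)))

      ⟦_,_,_⟧ : State → State → State → ℕ
      ⟦ a , b , c ⟧ = code (toℕ a) (toℕ b) (toℕ c)

      cong-code : ∀ {a a′ b b′ c c′} → a ≡ a′ → b ≡ b′ → c ≡ c′ → code a b c ≡ code a′ b′ c′
      cong-code refl refl refl = refl

      -- While one component takes an ε-transition, the other two wait on their added loops, which
      -- `KnownS` provides.
      move₁ : ∀ {a τ a′ b c} → Run a τ a′ → word τ ≡ [] → KnownS b → KnownS c → ⟦ a , b , c ⟧ ⟶* ⟦ a′ , b , c ⟧
      move₁ [] _ kb kc = ε
      move₁ (_∷_ {l = nothing} e π) w kb@(j , j<M , sj , lj , dj) kc@(k , k<M , sk , lk , dk)
        with i , i<M , si , li , di ← proj₁ (entry-of e) =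
        subst₂ _⟶*_ (cong-code si sj sk) (cong-code di dj dk)
          (product-step i<M j<M k<M (trans li (sym lj) , trans lj (sym lk))) ◅◅ move₁ π w kb kc

      move₂ : ∀ {a b τ b′ c} → Run b τ b′ → word τ ≡ [] → KnownS a → KnownS c → ⟦ a , b , c ⟧ ⟶* ⟦ a , b′ , c ⟧
      move₂ [] _ ka kc = ε
      move₂ (_∷_ {l = nothing} e π) w ka@(i , i<M , si , li , di) kc@(k , k<M , sk , lk , dk)
        with j , j<M , sj , lj , dj ← proj₁ (entry-of e) =
        subst₂ _⟶*_ (cong-code si sj sk) (cong-code di dj dk)
          (product-step i<M j<M k<M (trans li (sym lj) , trans lj (sym lk))) ◅◅ move₂ π w ka kc

      move₃ : ∀ {a b c τ c′} → Run c τ c′ → word τ ≡ [] → KnownS a → KnownS b → ⟦ a , b , c ⟧ ⟶* ⟦ a , b , c′ ⟧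
      move₃ [] _ ka kb = ε
      move₃ (_∷_ {l = nothing} e π) w ka@(i , i<M , si , li , di) kb@(j , j<M , sj , lj , dj)
        with k , k<M , sk , lk , dk ← proj₁ (entry-of e) =
        subst₂ _⟶*_ (cong-code si sj sk) (cong-code di dj dk)
          (product-step i<M j<M k<M (trans li (sym lj) , trans lj (sym lk))) ◅◅ move₃ π w ka kb

      silent-moves : ∀ {a a′ b b′ c c′} → KnownS a → KnownS b → KnownS c → a ─[ [] ]→ a′ → b ─[ [] ]→ b′ → c ─[ [] ]→ c′ →
        ⟦ a , b , c ⟧ ⟶* ⟦ a′ , b′ , c′ ⟧
      silent-moves ka kb kc (_ , πa , wa) (_ , πb , wb) (_ , πc , wc) =
        move₁ πa wa kb kc ◅◅ move₂ πb wb (known-run πa ka) kc ◅◅ move₃ πc wc (known-run πa ka) (known-run πb kb)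

      -- The silent parts before each letter are run one component at a time, the letters in all
      -- three at once.
      synchronise : ∀ w {a a′ b b′ c c′} → KnownS a → KnownS b → KnownS c → a ─[ w ]→ a′ → b ─[ w ]→ b′ → c ─[ w ]→ c′ →
        ⟦ a , b , c ⟧ ⟶* ⟦ a′ , b′ , c′ ⟧
      synchronise []      ka kb kc πa πb πc = silent-moves ka kb kc πa πb πc
      synchronise (x ∷ w) ka kb kc πa πb πc
        with a₁ , a₂ , εa , ea , ρa ← first-letter πa
        with b₁ , b₂ , εb , eb , ρb ← first-letter πb
        with c₁ , c₂ , εc , ec , ρc ← first-letter πc
        with (i , i<M , si , li , di) , _ , ka₂ ← entry-of ea
        with (j , j<M , sj , lj , dj) , _ , kb₂ ← entry-of eb
        with (k , k<M , sk , lk , dk) , _ , kc₂ ← entry-of ec =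
        silent-moves ka kb kc εa εb εc
          ◅◅ subst₂ _⟶*_ (cong-code si sj sk) (cong-code di dj dk)
               (product-step i<M j<M k<M (trans li (sym lj) , trans lj (sym lk)))
          ◅◅ synchronise w ka₂ kb₂ kc₂ ρa ρb ρc

      -- The three paths of a flag read one word, so `synchronise` leads from the target of the
      -- reset edge back to its source and puts both in one component.
      flag⇒flagged : ∀ {P Q} → Flag P Q → ∃₂ λ i j → i < M × j < M × src i ≡ toℕ P × src j ≡ toℕ Q × Flagged i j
      flag⇒flagged {P} {Q} f
        with (i , i<M , si , li , di) , _ , kP′ ← entry-of (Flag.p-step f)
        with (j , j<M , sj , lj , dj) , _ , kQ′ ← entry-of (Flag.q-step f)
        with l≢0 ← (λ l≡0 → contradiction (trans (sym li) l≡0) λ ())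
        with e , e<L , u≡ , v≡ ← edge-index (resets i<M j<M (trans li (sym lj) , l≢0))
        = i , j , i<M , j<M , si , sj , trans li (sym lj) , l≢0
        , subst₂ (λ x y → vis x ≡ vis y) u≡ v≡ (back⇒same e<L
            (subst₂ _⟶*_ (sym (trans v≡ (cong-code di di dj))) (sym (trans u≡ (cong-code si sj sj)))
              (synchronise (Flag.suffix f) kP′ kP′ kQ′ (Flag.p-loop f) (Flag.cross f) (Flag.q-loop f))))
        , λ s≡ → Flag.distinct f (Fin.toℕ-injective (trans (sym si) (trans s≡ sj)))

      flag-reach : ∀ {P Q} → Flag P Q → Reach P Q
      flag-reach f = let _ , π , _ = Flag.cross f in _ , Flag.p-step f ∷ π

      arc-reach : ∀ {w x y P} → Arc w x y → x ≡ toℕ P → ∃[ Q ] y ≡ toℕ Q × Reach P Q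
      arc-reach (plain i<M) x≡ with P₁ , Q , s≡ , d≡ , step ← meaning i<M with refl ← Fin.toℕ-injective (trans (sym x≡) s≡) = Q , d≡ , go step
        where
        go : ∀ {n P} → Step n P Q → Reach P Q
        go (inj₁ (_ , π))     = reach π
        go (inj₂ (_ , _ , e)) = _ , e ∷ []
      arc-reach (special i<M j<M fl) x≡ with Q , _ , s≡ , _ ← meaning j<M = Q , s≡ , flag-reach (flagged⇒flag i<M j<M fl x≡ s≡)

      arcs-reach : ∀ {x y P} → x ⇒* y → x ≡ toℕ P → ∃[ Q ] y ≡ toℕ Q × Reach P Q
      arcs-reach ε x≡ = _ , x≡ , reach-refl
      arcs-reach ((_ , arc) ◅ arcs) x≡ with Q , y≡ , P⇝Q ← arc-reach arc x≡ with R , z≡ , Q⇝R ← arcs-reach arcs y≡ =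
        R , z≡ , reach-trans P⇝Q Q⇝R

      module _ (irreversible : ∀ {P Q} → Flag P Q → ¬ Reach Q P) where

        acyclic : ∀ {i j} → i < M → j < M → Flagged i j → ¬ src j ⇒* src i
        acyclic i<M j<M fl arcs with P , _ , sP , _ ← meaning i<M with Q , _ , sQ , _ ← meaning j<M
          with P₁ , eq , Q⇝P ← arcs-reach arcs sQ with refl ← Fin.toℕ-injective (trans (sym sP) eq) =
          irreversible (flagged⇒flag i<M j<M fl sP sQ) Q⇝P

        distinct : ∀ {i j} → i < M → j < M → t (src i) ≡ t (src j) → src i ≡ src j
        distinct i<M j<M eq = t-injective (proj₁ (known-ends i<M)) eq

        chain-run : ∀ {k p τ q} → Run p τ q → Chain k q → Chain k p
        chain-run []      c = c
        chain-run (e ∷ π) c = move e (chain-run π c)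

        walk-chain : ∀ {n k x P} → Walk n k x → x ≡ toℕ P → Chain k P
        walk-chain [] x≡ = stop
        walk-chain (plain i<M ∷ w) x≡ with P₁ , Q , s≡ , d≡ , step ← meaning i<M with refl ← Fin.toℕ-injective (trans (sym x≡) s≡) =
          go step (walk-chain w d≡)
          where
          go : ∀ {n k P} → Step n P Q → Chain k Q → Chain k P
          go (inj₁ (_ , _ , π , _)) c = chain-run π c
          go (inj₂ (_ , _ , e))     c = move e c
        walk-chain (special i<M j<M fl ∷ w) x≡ with Q , _ , s≡ , _ ← meaning j<M =
          flag (flagged⇒flag i<M j<M fl x≡ s≡) (walk-chain w s≡)

        levels : ∀ {R : ℕ → ℕ} {d} → (∀ x → Realised (R x) x) → (∀ {w x y} → Arc w x y → w + R y ≤ R x) →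
          (∀ i → i < M → R (src i) ≤ d) → d ≡ 0 ⊎ (∃[ i ] i < M × R (src i) ≡ d) → Levels d
        levels {R} {d} realised fixpoint above attained = record
          { level      = R ∘ toℕ
          ; level-step = λ e → let (i , i<M , si , _ , di) , _ = entry-of e in
                           subst₂ (λ x y → R x ≤ R y) di si (fixpoint (plain i<M))
          ; level-flag = λ f → let i , j , i<M , j<M , si , sj , fl = flag⇒flagged f in
                           subst₂ (λ x y → R x < R y) sj si (fixpoint (special i<M j<M fl))
          ; chain      = λ s → walk-chain (proj₂ (realised (toℕ s))) refl
          ; level≤     = λ s → bound (proj₂ (realised (toℕ s))) refl
          ; attained   = attained′ attained
          }
          where
          bound : ∀ {n k x} → Walk n k x → k ≡ R x → R x ≤ d
          -- This case covers states without transitions, which are no source in the table: only the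
          -- empty walk starts there, so their level is 0.
          bound []                  eq = ≤-trans (≤-reflexive (sym eq)) z≤n
          bound (plain i<M ∷ _)       eq = above _ i<M
          bound (special i<M _ _ ∷ _) eq = above _ i<M
          attained′ : d ≡ 0 ⊎ (∃[ i ] i < M × R (src i) ≡ d) → d ≡ 0 ⊎ (∃[ s ] R (toℕ s) ≡ d)
          attained′ (inj₁ d≡0) = inj₁ d≡0
          attained′ (inj₂ (i , i<M , eq)) with P , _ , sP , _ ← meaning i<M = inj₂ (P , trans (cong R (sym sP)) eq)

-- Cubic bounds by computation

module Asymptotics where

  open import Data.Nat
  open import Data.Nat.Properties
  open import Data.Nat.Tactic.RingSolver using (solve-∀)
  open import Relation.Binary.PropositionalEquality

  infixl 6 _⊞_
  infixl 7 _⊠_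
  -- Cost bounds are made into syntax so that the order of growth is computed: `order` is a number
  -- that evaluates to 3 for the whole program.
  data Expression : Set where
    con     : ℕ → Expression
    var     : Expression
    _⊞_ _⊠_ : Expression → Expression → Expression

  value : Expression → ℕ → ℕ
  value (con k) m = k
  value var     m = m
  value (p ⊞ q) m = value p m + value q m
  value (p ⊠ q) m = value p m * value q m

  order : Expression → ℕ
  order (con k) = 0
  order var     = 1
  order (p ⊞ q) = order p ⊔ order q
  order (p ⊠ q) = order p + order q

  factor : Expression → ℕ
  factor (con k) = k
  factor var     = 1
  factor (p ⊞ q) = factor p + factor q
  factor (p ⊠ q) = factor p * factor q

  value-mono : ∀ p {m n} → m ≤ n → value p m ≤ value p n
  value-mono (con k) m≤n = ≤-refl
  value-mono var     m≤n = m≤n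
  value-mono (p ⊞ q) m≤n = +-mono-≤ (value-mono p m≤n) (value-mono q m≤n)
  value-mono (p ⊠ q) m≤n = *-mono-≤ (value-mono p m≤n) (value-mono q m≤n)

  value≤ : ∀ p m → value p m ≤ factor p * suc m ^ order p
  value≤ (con k) m = ≤-reflexive (sym (*-identityʳ k))
  value≤ var     m = ≤-trans (n≤1+n m) (≤-reflexive (sym (trans (*-identityˡ (suc m ^ 1)) (*-identityʳ (suc m)))))
  value≤ (p ⊞ q) m = begin
    value p m + value q m                                      ≤⟨ +-mono-≤ (value≤ p m) (value≤ q m) ⟩
    factor p * suc m ^ order p + factor q * suc m ^ order q    ≤⟨ +-mono-≤ (*-monoʳ-≤ (factor p) (^-monoʳ-≤ (suc m) (m≤m⊔n (order p) (order q))))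
                                                                          (*-monoʳ-≤ (factor q) (^-monoʳ-≤ (suc m) (m≤n⊔m (order p) (order q)))) ⟩
    factor p * suc m ^ (order p ⊔ order q) + factor q * suc m ^ (order p ⊔ order q)
      ≡⟨ *-distribʳ-+ (suc m ^ (order p ⊔ order q)) (factor p) (factor q) ⟨
    (factor p + factor q) * suc m ^ (order p ⊔ order q)        ∎
    where open ≤-Reasoning
  value≤ (p ⊠ q) m = begin
    value p m * value q m                                        ≤⟨ *-mono-≤ (value≤ p m) (value≤ q m) ⟩
    (factor p * suc m ^ order p) * (factor q * suc m ^ order q)  ≡⟨ lemma (factor p) (suc m ^ order p) (factor q) (suc m ^ order q) ⟩
    factor p * factor q * (suc m ^ order p * suc m ^ order q)    ≡⟨ cong (factor p * factor q *_) (^-distribˡ-+-* (suc m) (order p) (order q)) ⟨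
    factor p * factor q * suc m ^ (order p + order q)            ∎
    where
    open ≤-Reasoning
    lemma : ∀ a b c d → (a * b) * (c * d) ≡ a * c * (b * d)
    lemma = solve-∀

  cube≤ : ∀ m → suc m ^ 3 ≤ 8 * (1 + m ^ 3)
  cube≤ zero      = s≤s z≤n
  cube≤ m@(suc k) = begin
    suc m ^ 3                                   ≤⟨ ^-monoˡ-≤ 3 {suc m} {m + m} (+-monoˡ-≤ m {1} {m} (s≤s z≤n)) ⟩
    (m + m) ^ 3                                 ≡⟨ lemma m ⟩
    8 * m ^ 3                                   ≤⟨ *-monoʳ-≤ 8 (n≤1+n (m ^ 3)) ⟩
    8 * (1 + m ^ 3)                             ∎
    where
    open ≤-Reasoning
    lemma : ∀ m → (m + m) * ((m + m) * ((m + m) * 1)) ≡ 8 * (m * (m * (m * 1)))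
    lemma = solve-∀

  cubic : ∀ p → order p ≡ 3 → ∀ m → value p m ≤ factor p * 8 * (1 + m ^ 3)
  cubic p order≡3 m = begin
    value p m                          ≤⟨ value≤ p m ⟩
    factor p * suc m ^ order p         ≡⟨ cong (λ k → factor p * suc m ^ k) order≡3 ⟩
    factor p * suc m ^ 3               ≤⟨ *-monoʳ-≤ (factor p) (cube≤ m) ⟩
    factor p * (8 * (1 + m ^ 3))       ≡⟨ *-assoc (factor p) 8 _ ⟨
    factor p * 8 * (1 + m ^ 3)         ∎
    where open ≤-Reasoning

-- The whole program and its cost

module Algorithm where

  open import Defs hiding (eval)
  open LoopLanguage hiding (At; at; steps; first)
  open LoopLogic
  open SearchProgram using (val; _:=_; scalar; searchAll; #out; #m; #N; #count; #i; #L; #SRC; #LAB; #DST; #T; #T₂; #T₃; #U; #V; #DEG; #VIS; #R)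
  open ComponentsProgram
  open ReadProgram
  open NumberingProgram
  open ProductProgram
  open LevelsProgram
  open Correspondence
  open Asymptotics
  open Traces using (module Runs)
  open import Data.Bool using (T)
  open import Data.Empty using (⊥-elim)
  open import Data.List using (List; []; _∷_; _++_; length; map; concatMap; _ʳ++_; reverse)
  open import Data.List.Membership.Propositional using (_∈_)
  open import Data.List.Properties using (length-map; length-ʳ++; ʳ++-defn; ++-identityʳ)
  open import Data.List.Relation.Unary.All using (All)
  open import Data.List.Relation.Unary.Any.Properties using (reverse⁺; reverse⁻)
  open import Data.Nat
  open import Data.Nat.Properties
  open import Data.Product using (_×_; _,_)
  open import Data.Unit using (tt)
  open import Relation.Binary.PropositionalEquality
  open import Relation.Nullary using (¬_)

  emitAll relaxAll maxAll : Cmd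
  emitAll  = #i := lit 0 ∙ loop (val #count) outerBody
  relaxAll = loop (val #N) relaxRound
  maxAll   = #i := lit 0 ∙ loop (val #count) maxBody

  dpaProgram : Cmd
  dpaProgram = readAll ∙ scaleAll ∙ emitAll ∙ scc ∙ relaxAll ∙ maxAll

  dpaProgram-def : dpaProgram ≡ readAll ∙ scaleAll ∙ emitAll ∙ scc ∙ relaxAll ∙ maxAll
  dpaProgram-def = refl

  record Clean (N : ℕ) (s : Env) : Set where
    field
      N≡   : scalar s #N ≡ N
      R0   : ∀ w → arrays s #R w ≡ 0
      out0 : scalar s #out ≡ 0

  clean-frame : ∀ {N} c → T (keeps c #N) → T (keeps c #R) → T (keeps c #out) → ∀ s → Clean N s → Clean N (eval c s)
  clean-frame c k₁ k₂ k₃ s cl = record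
    { N≡ = trans (cong (λ f → f 0) (frame c #N k₁ s)) N≡
    ; R0 = λ w → trans (cong (λ f → f w) (frame c #R k₂ s)) (R0 w)
    ; out0 = trans (cong (λ f → f 0) (frame c #out k₃ s)) out0 }
    where open Clean cl

  -- These repeat the cost bounds of the stages term by term, with the number M of table entries and
  -- the base N as arguments, so that the bounds proved and the values of these expressions agree by
  -- evaluation.
  maxE relaxE emitE scaleE : Expression → Expression → Expression
  maxE M _   = con 11 ⊞ (con 13 ⊞ M ⊠ con (cost maxBody (initial []) + 3))
  relaxE M N = con 13 ⊞ N ⊠ (con 11 ⊞ (con 13 ⊞ M ⊠ (con 11 ⊞ ((con 13 ⊞ M ⊠ con (bodyCost + 3)) ⊞ con 22) ⊞ con 3)) ⊞ con 3)
    where bodyCost = cost relaxStep (initial []) + (sizeExp flagged + (6 + cost relaxFlag (initial [])) + 22)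
  emitE M _  = con 11 ⊞ (con 13 ⊞ M ⊠ (con 11 ⊞ ((con 13 ⊞ M ⊠ (con 11 ⊞ ((con 13 ⊞ M ⊠ con (emitCost + 3)) ⊞ con 22) ⊞ con 3)) ⊞ con 22) ⊞ con 3))
    where emitCost = sizeExp sameLabels + (6 + cost emitStep (initial [])) + ((sizeExp sameLetter + (6 + cost emitReset (initial []))) + 22)
  scaleE M N = con 44 ⊞ (con 13 ⊞ M ⊠ (con 60 ⊞ ((con 13 ⊞ N ⊠ con 34) ⊞ ((con 13 ⊞ N ⊠ con 34) ⊞ con 100)) ⊞ con 3))

  emitAll-def : emitAll ≡ #i := lit 0 ∙ loop (val #count) outerBody
  emitAll-def = refl

  relaxAll-def : relaxAll ≡ loop (val #N) relaxRound
  relaxAll-def = refl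

  maxAll-def : maxAll ≡ #i := lit 0 ∙ loop (val #count) maxBody
  maxAll-def = refl

  scc-def : scc ≡ initRoots ∙ searchAll ∙ swapEdges ∙ searchAll
  scc-def = refl

  scaleAll-def : scaleAll ≡ (#N := val #m ⊕ val #m ⊕ lit 1 ∙ #i := lit 0)
                            ∙ loop (val #count) (scaleStart ∙ loop (val #N) mul₁ ∙ loop (val #N) mul₂ ∙ scaleStore)
  scaleAll-def = refl

  named : ∀ {c d : Cmd} (P : Env → Set) {b} s → c ≡ d → P (eval d s) × cost d s ≤ b → P (eval c s) × cost c s ≤ b
  named P s refl x = x

  sccPoly : Expression → Expression
  sccPoly L = (con 44 ⊞ L ⊠ con rootsCost) ⊞ (searchPoly L L ⊞ ((con 24 ⊞ L ⊠ con swapCost) ⊞ searchPoly L (con 5 ⊠ L)))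
    where
    open SearchCorrectness using (linkCost; loadCost; pushCost)
    searchPoly : Expression → Expression → Expression
    searchPoly L r = con 24 ⊞ L ⊠ con linkCost
      ⊞ (con 100 ⊞ r ⊠ con loadCost ⊞ (con 57 ⊞ ((r ⊞ r ⊞ r ⊞ L ⊞ L) ⊠ con 433 ⊞ con pushCost ⊠ L)))

  maxB relaxB emitB : ℕ → ℕ → ℕ
  maxB M N = value (maxE (con M) (con N)) 0
  relaxB M N = value (relaxE (con M) (con N)) 0
  emitB M N = value (emitE (con M) (con N)) 0

  -- At most two edges are emitted for each of the M³ triples of table entries.
  sccB : ℕ → ℕ
  sccB M = value (sccPoly var) (2 * (M * (M * M)))

  scaleB : ℕ → ℕ → ℕ
  scaleB M N = value (scaleE (con M) (con N)) 0

  restB : ℕ → ℕ → ℕ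
  restB M N = emitB M N + (sccB M + (relaxB M N + maxB M N))

  readB : ℕ → ℕ
  readB n = 46 + n * (cost readBody (initial []) + 3)

  total : ℕ → ℕ
  total n = readB n + (scaleB (3 * n) (suc (n + n)) + restB (3 * n) (suc (n + n)))

  afterRead-cong : ∀ {M M′ n n′} → M ≡ M′ → n ≡ n′ →
    scaleB M (suc (n + n)) + restB M (suc (n + n)) ≡ scaleB M′ (suc (n′ + n′)) + restB M′ (suc (n′ + n′))
  afterRead-cong refl refl = refl

  totalE : Expression
  totalE = (con 46 ⊞ var ⊠ con (cost readBody (initial []) + 3))
         ⊞ (scaleE M N ⊞ (emitE M N ⊞ (sccPoly (con 2 ⊠ (M ⊠ (M ⊠ M))) ⊞ (relaxE M N ⊞ maxE M N))))
    where
    -- A transition gives three table entries, itself and a loop at either end, and two state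
    -- numbers; N is one more than the largest number.
    M = con 3 ⊠ var
    N = con 1 ⊞ (var ⊞ var)

  total≡ : ∀ n → total n ≡ value totalE n
  total≡ n = refl

  module Stages (A : Automaton) (irreversible : ∀ {P Q} → Runs.Flag A P Q → ¬ Runs.Reach A Q P) where
    open Automaton A using (E)

    Goal : Env → Set
    Goal s = Runs.Levels A (scalar s #out)

    record Facts : Set where
      field
        tables   : Tables
        N M      : ℕ
        before   : List Triple
      open Tables tables public
      field
        table    : Holds (λ i → src i , lab i , dst i) (entries before)
        M≡       : M ≡ length (entries before)
        before⊆  : ∀ {x} → x ∈ before → x ∈ map (raw A) E
        ⊆before  : ∀ {x} → x ∈ map (raw A) E → x ∈ before
        numbers  : Numbering t (pred N)
        numbered : All (Numbered t) (entries before)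
        0<N      : 0 < N
        t₂≡      : ∀ {i} → i < M → t₂ (src i) ≡ N * t (src i)
        t₃≡      : ∀ {i} → i < M → t₃ (src i) ≡ N * (N * t (src i))

    max-stage : ∀ s (model : Model A) → let open Model model in
      Relaxation.Rounds tables vis M N s → scalar s #out ≡ 0 →
      Goal (eval maxAll s) × cost maxAll s ≤ maxB M N
    max-stage s model rounds out0 = named Goal s maxAll-def
      (let mx , bound = max-correct s (Rounds.static rounds) out0 in conclude mx , bound)
      where
      open Model model
      open Relaxation tables vis M using (module Rounds; Maximum; module Maximum; max-correct; module Shortening)
      open Correct A model
      open Shortening {N} (λ {i} _ → t<N (src i)) (distinct irreversible) (acyclic irreversible)
      conclude : ∀ {s′} → Maximum (arrays s #R) M s′ → Goal s′
      conclude mx = levels irreversible (Rounds.sound rounds) (fixpoint rounds) (Maximum.above mx) (Maximum.attained mx)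

    relax-stage : ∀ s (model : Model A) → let open Model model in
      Relaxation.Static tables vis M s → Clean N s →
      Goal (eval (relaxAll ∙ maxAll) s) × cost (relaxAll ∙ maxAll) s ≤ relaxB M N + maxB M N
    relax-stage s model st cl =
      let rounds , bound₁ = named (Relaxation.Rounds tables vis M N) {b = relaxB M N} s relaxAll-def
            (Relaxation.rounds-correct tables vis M s st (Clean.N≡ cl) (Clean.R0 cl))
          goal , bound₂ = max-stage (eval relaxAll s) model rounds (trans (cong (λ f → f 0) (frame relaxAll #out tt s)) (Clean.out0 cl))
      in eval-∙ Goal relaxAll maxAll s goal , cost-∙ relaxAll maxAll s bound₁ bound₂
      where open Model model

    after-scc : ∀ s s′ (facts : Facts) → let open Facts facts in
      (product : Emission.Product tables M s) →
      Components s′ (arrays s #U) (arrays s #V) (length (Emission.Product.edges product)) →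
      Emission.Static tables M s′ → Clean N s′ →
      Goal (eval (relaxAll ∙ maxAll) s′) × cost (relaxAll ∙ maxAll) s′ ≤ relaxB M N + maxB M N
    after-scc s s′ facts product found st cl = relax-stage s′ model
      (record { SRC≡ = SRC≡ ; LAB≡ = LAB≡ ; DST≡ = DST≡ ; T≡ = T≡ ; T₂≡ = T₂≡ ; T₃≡ = T₃≡ ; VIS≡ = λ _ → refl ; M≡ = count≡M }) cl
      where
      open Facts facts
      open Emission tables M using (module Product; module Edges; module Static)
      open Product product
      open Static st renaming (M≡ to count≡M)
      model : Model A
      model = record
        { tables = tables ; N = N ; M = M ; L = length edges ; u = arrays s #U ; v = arrays s #V ; vis = arrays s′ #VIS
        ; before = before ; edges = edges ; table = table ; M≡ = M≡ ; before⊆ = before⊆ ; ⊆before = ⊆before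
        ; numbers = numbers ; numbered = numbered ; 0<N = 0<N ; t₂≡ = t₂≡ ; t₃≡ = t₃≡
        ; edge-list = Edges.held stored ; L≡ = refl ; sound = sound ; all-steps = steps ; resets = resets
        ; same⇒back = Components.same⇒back found ; back⇒same = Components.back⇒same found }

    scc-stage : ∀ s (facts : Facts) → let open Facts facts in
      Emission.Product tables M s → Clean N s → (∀ w → arrays s #DEG w ≡ 0) → (∀ w → arrays s #VIS w ≡ 0) →
      Goal (eval (scc ∙ relaxAll ∙ maxAll) s) × cost (scc ∙ relaxAll ∙ maxAll) s ≤ sccB M + (relaxB M N + maxB M N)
    scc-stage s facts product cl deg0 vis0 =
      let found , bound₁ = named (λ s′ → Components s′ (arrays s #U) (arrays s #V) (length edges)) {b = value (sccPoly var) (length edges)} s scc-def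
            (scc-correct s refl refl (Edges.L≡ stored) deg0 vis0)
          goal , bound₂ = after-scc s (eval scc s) facts product found
            (static-frame scc tt tt tt tt tt tt tt s static) (clean-frame scc tt tt tt s cl)
      in eval-∙ Goal scc (relaxAll ∙ maxAll) s goal
       , cost-∙ scc (relaxAll ∙ maxAll) s (≤-trans bound₁ (value-mono (sccPoly var) {length edges} {2 * (M * (M * M))} size)) bound₂
      where
      open Facts facts
      open Emission tables M using (module Product; module Edges; static-frame)
      open Product product

    emit-stage : ∀ s (facts : Facts) → let open Facts facts in
      Emission.Static tables M s → scalar s #L ≡ 0 → Clean N s → (∀ w → arrays s #DEG w ≡ 0) → (∀ w → arrays s #VIS w ≡ 0) →
      Goal (eval (emitAll ∙ scc ∙ relaxAll ∙ maxAll) s)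
      × cost (emitAll ∙ scc ∙ relaxAll ∙ maxAll) s ≤ emitB M N + (sccB M + (relaxB M N + maxB M N))
    emit-stage s facts st L≡0 cl deg0 vis0 =
      let product , bound₁ = named (Emission.Product tables M) {b = emitB M N} s emitAll-def (Emission.emit-correct tables M s st L≡0)
          goal , bound₂ = scc-stage (eval emitAll s) facts product (clean-frame emitAll tt tt tt s cl)
            (λ w → trans (cong (λ f → f w) (frame emitAll #DEG tt s)) (deg0 w))
            (λ w → trans (cong (λ f → f w) (frame emitAll #VIS tt s)) (vis0 w))
      in eval-∙ Goal emitAll (scc ∙ relaxAll ∙ maxAll) s goal , cost-∙ emitAll (scc ∙ relaxAll ∙ maxAll) s bound₁ bound₂
      where open Facts facts

    -- Provided by the initially zero memory. The searches and the relaxation start from zeroed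
    -- arrays, and no earlier stage writes to these.
    record Fresh (s : Env) : Set where
      field
        L0   : scalar s #L ≡ 0
        out0 : scalar s #out ≡ 0
        deg0 : ∀ w → arrays s #DEG w ≡ 0
        vis0 : ∀ w → arrays s #VIS w ≡ 0
        R0   : ∀ w → arrays s #R w ≡ 0

    fresh-frame : ∀ c → T (keeps c #L) → T (keeps c #out) → T (keeps c #DEG) → T (keeps c #VIS) → T (keeps c #R) → ∀ s → Fresh s → Fresh (eval c s)
    fresh-frame c k₁ k₂ k₃ k₄ k₅ s fr = record
      { L0 = trans (cong (λ f → f 0) (frame c #L k₁ s)) L0 ; out0 = trans (cong (λ f → f 0) (frame c #out k₂ s)) out0
      ; deg0 = λ w → trans (cong (λ f → f w) (frame c #DEG k₃ s)) (deg0 w) ; vis0 = λ w → trans (cong (λ f → f w) (frame c #VIS k₄ s)) (vis0 w)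
      ; R0 = λ w → trans (cong (λ f → f w) (frame c #R k₅ s)) (R0 w) }
      where open Fresh fr

    Covers : List Triple → Set
    Covers before = (∀ {x} → x ∈ before → x ∈ map (raw A) E) × (∀ {x} → x ∈ map (raw A) E → x ∈ before)

    after-scale : ∀ s s′ {before} → Table before s → Covers before →
      let n = length before ; M = length (entries before) ; N = suc (n + n) in
      ScaleInv (arrays s #SRC) (arrays s #T) N M s′ → arrays s′ #LAB ≡ arrays s #LAB → arrays s′ #DST ≡ arrays s #DST →
      scalar s′ #count ≡ M → Fresh s′ →
      Goal (eval (emitAll ∙ scc ∙ relaxAll ∙ maxAll) s′) × cost (emitAll ∙ scc ∙ relaxAll ∙ maxAll) s′ ≤ restB M N
    after-scale s s′ {before} (tabulated (listed held _) num) (⊆E , E⊆) scaled lab-same dst-same count≡ fresh = emit-stage s′ facts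
      (record { SRC≡ = ScaleInv.SRC≡ scaled ; LAB≡ = lab-same ; DST≡ = dst-same ; T≡ = ScaleInv.T≡ scaled ; T₂≡ = refl ; T₃≡ = refl ; M≡ = count≡ })
      L0 (record { N≡ = ScaleInv.N≡ scaled ; R0 = R0 ; out0 = out0 }) deg0 vis0
      where
      open Fresh fresh
      facts : Facts
      facts = record
        { tables = record { src = arrays s #SRC ; lab = arrays s #LAB ; dst = arrays s #DST ; t = arrays s #T ; t₂ = arrays s′ #T₂ ; t₃ = arrays s′ #T₃ }
        ; N = suc (length before + length before) ; M = length (entries before) ; before = before
        ; table = held ; M≡ = refl ; before⊆ = ⊆E ; ⊆before = E⊆
        ; numbers = subst (Numbering (arrays s #T)) (Numbers.slot≡ num) (Numbers.numbers num)
        ; numbered = Numbers.numbered num ; 0<N = s≤s z≤n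
        ; t₂≡ = λ {i} i<M → ScaleInv.twice scaled i i<M ; t₃≡ = λ {i} i<M → ScaleInv.thrice scaled i i<M }

    scale-stage : ∀ s {before} → Table before s → Covers before → scalar s #m ≡ length before → Fresh s →
      let n = length before ; M = length (entries before) ; N = suc (n + n) in
      Goal (eval (scaleAll ∙ emitAll ∙ scc ∙ relaxAll ∙ maxAll) s)
      × cost (scaleAll ∙ emitAll ∙ scc ∙ relaxAll ∙ maxAll) s ≤ scaleB M N + restB M N
    scale-stage s {before} table covers m≡ fresh =
      let n = length before
          M = length (entries before)
          N = suc (n + n)
          scaled , bound₁ = named (ScaleInv (arrays s #SRC) (arrays s #T) N M) {b = scaleB M N} s scaleAll-def
            (scale-correct (arrays s #SRC) (arrays s #T) N s refl refl (trans (cong (λ k → k + k + 1) m≡) (+-comm (n + n) 1))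
              (Listed.count≡ (Table.entered table)))
          goal , bound₂ = after-scale s (eval scaleAll s) table covers scaled (frame scaleAll #LAB tt s) (frame scaleAll #DST tt s)
            (trans (cong (λ f → f 0) (frame scaleAll #count tt s)) (Listed.count≡ (Table.entered table)))
            (fresh-frame scaleAll tt tt tt tt tt s fresh)
      in eval-∙ Goal scaleAll (emitAll ∙ scc ∙ relaxAll ∙ maxAll) s goal
       , cost-∙ scaleAll (emitAll ∙ scc ∙ relaxAll ∙ maxAll) s bound₁ bound₂

    length-entries : ∀ es → length (entries es) ≡ 3 * length es
    length-entries []       = refl
    length-entries (_ ∷ es) = trans (cong (3 +_) (length-entries es)) (sym (*-suc 3 (length es)))

    digits-raw : ∀ ts → concatMap digits (map (raw A) ts) ≡ concatMap (encodeTransition A) ts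
    digits-raw []       = refl
    digits-raw (t ∷ ts) = cong (encodeTransition A t ++_) (digits-raw ts)

    subsets : List ℕ
    subsets = encodeSubset A (Automaton.I A) ++ encodeSubset A (Automaton.F A)

    triples : List Triple
    triples = map (raw A) E

    encode≡ : encode A ≡ Automaton.∣Σ∣ A ∷ Automaton.∣Q∣ A ∷ length triples ∷ concatMap digits triples ++ subsets
    encode≡ = cong₂ (λ n ds → Automaton.∣Σ∣ A ∷ Automaton.∣Q∣ A ∷ n ∷ ds ++ subsets)
      (sym (length-map (raw A) E)) (sym (digits-raw E))

    after-read : ∀ s → ReadInv triples subsets (length triples) s → scalar s #m ≡ length triples → Fresh s →
      Goal (eval (scaleAll ∙ emitAll ∙ scc ∙ relaxAll ∙ maxAll) s)
      × cost (scaleAll ∙ emitAll ∙ scc ∙ relaxAll ∙ maxAll) s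
        ≤ scaleB (3 * ∣ A ∣E) (suc (∣ A ∣E + ∣ A ∣E)) + restB (3 * ∣ A ∣E) (suc (∣ A ∣E + ∣ A ∣E))
    after-read s inv m≡ fresh =
      let goal , bound = scale-stage s entered covers (trans m≡ (sym position)) fresh in
      goal , ≤-trans bound (≤-reflexive (afterRead-cong (trans (length-entries before) (cong (3 *_) n≡)) n≡))
      where
      open ReadInv inv
      n≡ : length before ≡ ∣ A ∣E
      n≡ = trans position (length-map (raw A) E)
      finished : todo ≡ []
      finished with todo | split
      ... | []    | _  = refl
      ... | x ∷ r | eq = ⊥-elim (<-irrefl (trans position (trans (cong length eq) (length-ʳ++ before))) (m<m+n (length before) (s≤s z≤n)))
      reversed : triples ≡ reverse before
      reversed = trans split (trans (cong (before ʳ++_) finished) (trans (ʳ++-defn before) (++-identityʳ (reverse before))))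
      covers : Covers before
      covers = (λ x∈ → subst (_ ∈_) (sym reversed) (reverse⁺ x∈)) , (λ x∈ → reverse⁻ (subst (_ ∈_) reversed x∈))

    compose-read : ∀ s {b} → ReadInv triples subsets (length triples) (eval readAll s) → cost readAll s ≤ b →
      scalar (eval readAll s) #m ≡ length triples → Fresh s →
      Goal (eval (readAll ∙ scaleAll ∙ emitAll ∙ scc ∙ relaxAll ∙ maxAll) s)
      × cost (readAll ∙ scaleAll ∙ emitAll ∙ scc ∙ relaxAll ∙ maxAll) s
        ≤ b + (scaleB (3 * ∣ A ∣E) (suc (∣ A ∣E + ∣ A ∣E)) + restB (3 * ∣ A ∣E) (suc (∣ A ∣E + ∣ A ∣E)))
    compose-read s inv bound₁ m≡ fresh =
      let goal , bound₂ = after-read (eval readAll s) inv m≡ (fresh-frame readAll tt tt tt tt tt s fresh)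
      in eval-∙ Goal readAll (scaleAll ∙ emitAll ∙ scc ∙ relaxAll ∙ maxAll) s goal
       , cost-∙ readAll (scaleAll ∙ emitAll ∙ scc ∙ relaxAll ∙ maxAll) s bound₁ bound₂

    read-stage : ∀ a b →
      let s = initial (a ∷ b ∷ length triples ∷ concatMap digits triples ++ subsets) in
      Goal (eval (readAll ∙ scaleAll ∙ emitAll ∙ scc ∙ relaxAll ∙ maxAll) s)
      × cost (readAll ∙ scaleAll ∙ emitAll ∙ scc ∙ relaxAll ∙ maxAll) s ≤ total ∣ A ∣E
    read-stage a b =
      let inv , bound = read-correct triples subsets a b
      in compose-read (initial (a ∷ b ∷ length triples ∷ concatMap digits triples ++ subsets)) inv (≤-trans bound (≤-reflexive (cong readB (length-map (raw A) E)))) (number-read triples subsets a b)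
           (record { L0 = refl ; out0 = refl ; deg0 = λ _ → refl ; vis0 = λ _ → refl ; R0 = λ _ → refl })

    dpa-computed : Goal (eval dpaProgram (initial (encode A))) × cost dpaProgram (initial (encode A)) ≤ total ∣ A ∣E
    dpa-computed = subst (λ inp → Goal (eval dpaProgram (initial inp)) × cost dpaProgram (initial inp) ≤ total ∣ A ∣E) (sym encode≡)
      (named Goal (initial (Automaton.∣Σ∣ A ∷ Automaton.∣Q∣ A ∷ length triples ∷ concatMap digits triples ++ subsets)) dpaProgram-def (read-stage (Automaton.∣Σ∣ A) (Automaton.∣Q∣ A)))

-- The cubic-time algorithm for the degree

open import Data.Bool using (T)
open import Data.Nat using (_+_; _*_; _^_; _≤_)
open import Data.Nat.Properties using (≤-trans; ≤-reflexive)
open import Data.Product using (∃-syntax; _×_; _,_)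
open import Data.Unit using (tt)
open import Defs
open LoopLanguage using (program; program-computes; initial; cost; bounded)
open SearchProgram using (scalar; #out)
open Traces using (module Runs)
open Algorithm
open Asymptotics
open LowerBounds using (flag-irreversible)
open UpperBounds using (levels⇒dpa)
open import Relation.Binary.PropositionalEquality using (_≡_; refl)

-- Joins levels, compilation and growth for an arbitrary command, so that the concrete program
-- enters only through two conditions settled by evaluation and through its correctness.
solves : ∀ c e → T (bounded c) → order e ≡ 3 →
  (∀ A → Trim A → ε-CycleFree A → PolynomiallyAmbiguous A →
     Runs.Levels A (scalar (LoopLanguage.eval c (initial (encode A))) #out) × cost c (initial (encode A)) ≤ value e ∣ A ∣E) →
  ∃[ P ] ∃[ c ] ∀ (A : Automaton) →
    Trim A → ε-CycleFree A → PolynomiallyAmbiguous A →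
    ∃[ d ] ∃[ t ] Dpa A d × Computes P (encode A) d t × t ≤ c * (1 + ∣ A ∣E ^ 3)
solves c e ok order≡3 correct = program c , factor e * 8 , λ A trim ε-free poly →
  let levels , bound = correct A trim ε-free poly
  in scalar (LoopLanguage.eval c (initial (encode A))) #out , cost c (initial (encode A))
   , levels⇒dpa A trim ε-free poly levels
   , program-computes c (encode A) ok
   , ≤-trans bound (cubic e order≡3 ∣ A ∣E)

theorem6 : ∃[ P ] ∃[ c ] ∀ (A : Automaton) →
    Trim A → ε-CycleFree A → PolynomiallyAmbiguous A →
    ∃[ d ] ∃[ t ] Dpa A d × Computes P (encode A) d t × t ≤ c * (1 + ∣ A ∣E ^ 3)
theorem6 = solves dpaProgram totalE tt refl λ A trim ε-free poly →
  let levels , bound = Stages.dpa-computed A (flag-irreversible A trim ε-free poly)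
  in levels , ≤-trans bound (≤-reflexive (total≡ ∣ A ∣E))
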